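{- As power series (Laurent series where negative powers appear) in $q$, $|q|<1$: (1) \begin{align*} &\sum_{n\ge0}N^{0}(0,4;2n+1)q^n=q^5g(-q^8;q^{16})-q\frac{J_{8}^8J_{32}^2}{J_{4}^4J_{16}^5}+\frac{1}{2}\left(\frac{J_{2}^8J_{8}^2}{J_{1}^4J_{4}^5}+\frac{J_{4}^3}{J_{2}^2} \right),\\ &\sum_{n\ge0}N^{0}(0,4;4n+1)q^n=\frac{J_{2}^4J_{8}^5}{J_{1}^4J_{4}^2J_{16}^2},\qquad \sum_{n\ge0}N^{0}(0,4;4n+3)q^n=q^2g(-q^4;q^8)-\frac{J_{4}^8J_{16}^2}{J_{2}^4J_{8}^5}+2\frac{J_{4}^6}{J_{1}^2J_{2}^3},\\ &\sum_{n\ge0}N^{0}(0,4;8n+1)q^n=\frac{J_{2}^{12}J_{4}}{J_{1}^{10}J_{8}^2},\qquad \sum_{n\ge0}N^{0}(0,4;8n+3)q^n=qg(-q^2;q^4)+2\frac{J_{2}^6J_{4}^5}{J_{1}^8J_{8}^2}-\frac{J_{2}^8J_{8}^2}{J_{1}^4J_{4}^5},\\ &\sum_{n\ge0}N^{0}(0,4;8n+5)q^n=4\frac{J_{4}^9}{J_{1}^6J_{8}^2},\qquad \sum_{n\ge0}N^{0}(0,4;8n+7)q^n=4\frac{J_{2}^8J_{8}^2}{J_{1}^8J_{4}}. \end{align*} (2) \begin{align*} &\sum_{n\ge0}N^{0}(1,4;2n)q^n=-\frac{1}{2}+\frac{1}{2}g(-1;q^4)+\frac{1}{4}\frac{J_{2}^6J_{4}}{J_{1}^4J_{8}^2},\qquad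 \sum_{n\ge0}N^{0}(1,4;4n)q^n=-\frac{1}{2}+\frac{1}{2}g(-1;q^2)+\frac{1}{4}\frac{J_{2}^{15}}{J_{1}^8J_{4}^6},\\ &\sum_{n\ge0}N^{0}(1,4;4n+2)q^n=\frac{J_{2}^3J_{4}^2}{J_{1}^4},\qquad \sum_{n\ge0}N^{0}(1,4;8n)q^n=-\frac{1}{2}+\frac{1}{2}g(-1;q)+\frac{1}{4}\frac{J_{2}^{22}}{J_{1}^{13}J_{4}^8}+4q\frac{J_{4}^8}{J_{1}^5J_{2}^2},\\ &\sum_{n\ge0}N^{0}(1,4;8n+2)q^n=\frac{J_{2}^{16}}{J_{1}^{11}J_{4}^4},\qquad \sum_{n\ge0}N^{0}(1,4;8n+4)q^n=2\frac{J_{2}^{10}}{J_{1}^9},\qquad \sum_{n\ge0}N^{0}(1,4;8n+6)q^n=4\frac{J_{2}^4J_{4}^4}{J_{1}^7}. \end{align*} (3) \begin{align*} &\sum_{n\ge0}N^{0}(2,4;2n+1)q^n=-q^{ -1}+q^{ -1}g(-1;q^{16})+\frac{1}{2}q^{ -1}\frac{J_{8}^{6}J_{16}}{J_{4}^4J_{32}^2}-\frac{1}{2}\frac{J_{4}^3}{J_{2}^2}+\frac{1}{2}\frac{J_{2}^8J_{8}^2}{J_{1}^4J_{4}^5},\\ &\sum_{n\ge0}N^{0}(2,4;4n+1)q^n=2q\frac{J_{2}^4J_{16}^2}{J_{1}^4J_{8}},\qquad \sum_{n\ge0}N^{0}(2,4;4n+3)q^n=-q^{ -1}+q^{ -1}g(-1;q^8)+\frac{1}{2}q^{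 -1}\frac{J_{4}^6J_{8}}{J_{2}^4J_{16}^2}+2\frac{J_{4}^6}{J_{1}^2J_{2}^3},\\ &\sum_{n\ge0}N^{0}(2,4;8n+1)q^n=8q\frac{J_{2}^2J_{4}^3J_{8}^2}{J_{1}^6},\qquad \sum_{n\ge0}N^{0}(2,4;8n+3)q^n=2\frac{J_{2}^6J_{4}^5}{J_{1}^8J_{8}^2},\qquad \sum_{n\ge0}N^{0}(2,4;8n+5)q^n=2\frac{J_{2}^{14}J_{8}^2}{J_{1}^{10}J_{4}^5},\\ &\sum_{n\ge0}N^{0}(2,4;8n+7)q^n=-q^{ -1}+q^{ -1}g(-1;q^4)+\frac{1}{2}q^{ -1}\frac{J_{2}^6J_4}{J_{1}^4J_{8}^2} +4\frac{J_{2}^8J_{8}^2}{J_{1}^8J_{4}}. \end{align*}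
   Context: For $|q|<1$: $(a;q)_n=\prod_{k=0}^{n-1}(1-aq^k)$, $(a;q)_\infty=\prod_{k\ge0}(1-aq^k)$, $J_m=(q^m;q^m)_\infty$, and for $x$ not an integer power of $q$, \[g(x;q)=x^{ -1}\Big(-1+\sum_{n=0}^{\infty}\frac{q^{n^2}}{(x;q)_{n+1}(q/x;q)_{n}}\Big)\] (expressions such as $g(-q^8;q^{16})$ mean this function with $x=-q^8$ and $q$ replaced by $q^{16}$). An odd Durfee symbol of a positive integer $n$ consists of a nonnegative integer $D$ together with two (possibly empty) non-increasing sequences of odd positive integers $a_1\ge\cdots\ge a_s$ (top row) and $b_1\ge\cdots\ge b_t$ (bottom row), all entries at most $2D+1$, with $n=\sum a_i+\sum b_j+2D^2+2D+1$; its odd rank is $s-t$. $N^{0}(a,M;n)$ is the number of odd Durfee symbols of $n$ with odd rank congruent to $a$ modulo $M$, and $N^0(a,M;0)=0$. -}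

module Defs where

open import Data.Nat as ℕ using (ℕ; zero; suc; _∸_; _≤ᵇ_; _≡ᵇ_)
open import Data.Integer as ℤ using (ℤ; +_; -[1+_])
open import Data.Integer.DivMod using (_%ℕ_)
open import Data.Rational as ℚ using (ℚ; 0ℚ; 1ℚ; NonZero)
open import Data.Rational.Properties using (_≟_)
open import Data.List as L using (List; []; _∷_; _++_; length; upTo; concat; concatMap; filter; replicate)
open import Data.Bool using (Bool; true; false; if_then_else_)
open import Data.Product using (_×_; _,_; proj₁; proj₂)
open import Relation.Nullary using (yes; no)
open import Relation.Binary.PropositionalEquality using (_≡_; _≢_)
open import Relation.Unary using (Decidable)

-- all non-increasing lists of odd positive integers, each at most 2i+1,
-- with sum s (the multiplicity of the part 2i+1 is chosen first)
oddPartitions : (i s : ℕ) → List (List ℕ)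
oddPartitions zero    s = replicate s 1 ∷ []
oddPartitions (suc i) s =
  concatMap (λ m → L.map (λ r → replicate m p ++ r) (oddPartitions i (s ∸ m ℕ.* p)))
            (filter (λ m → m ℕ.* p ℕ.≤? s) (upTo (suc s)))
  where p = 2 ℕ.+ 2 ℕ.* suc i ∸ 1

-- an odd Durfee symbol: (D , top row , bottom row)
OddDurfee : Set
OddDurfee = ℕ × List ℕ × List ℕ

-- weight of the Durfee square part: 2D²+2D+1
core : ℕ → ℕ
core D = 2 ℕ.* D ℕ.* D ℕ.+ 2 ℕ.* D ℕ.+ 1

oddDurfeeSymbols : ℕ → List OddDurfee
oddDurfeeSymbols n =
  concatMap (λ D → concatMap (λ r₁ →
      concatMap (λ top → L.map (λ bot → D , top , bot)
                                (oddPartitions D ((n ∸ core D) ∸ r₁)))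
                (oddPartitions D r₁))
    (upTo (suc (n ∸ core D))))
  (filter (λ D → core D ℕ.≤? n) (upTo (suc n)))

oddRank : OddDurfee → ℤ
oddRank (_ , top , bot) = + length top ℤ.- + length bot

N⁰ : (a : ℤ) (M : ℕ) .{{_ : ℕ.NonZero M}} → ℕ → ℕ
N⁰ a M n = length (filter (λ σ → (oddRank σ %ℕ M) ℕ.≟ (a %ℕ M)) (oddDurfeeSymbols n))

Series : Set
Series = ℕ → ℚ

sumTo : ℕ → (ℕ → ℚ) → ℚ
sumTo zero    f = f 0
sumTo (suc n) f = sumTo n f ℚ.+ f (suc n)

cst : ℚ → Series
cst c zero    = c
cst c (suc _) = 0ℚ

mono : ℚ → ℕ → Series
mono c j n = if n ≡ᵇ j then c else 0ℚ

infixl 6 _⊕_ _⊖_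
infixl 7 _⊛_ _·_
infixr 8 _^^_

_⊕_ _⊖_ _⊛_ : Series → Series → Series
(f ⊕ g) n = f n ℚ.+ g n
(f ⊖ g) n = f n ℚ.- g n
(f ⊛ g) n = sumTo n (λ i → f i ℚ.* g (n ∸ i))

_·_ : ℚ → Series → Series
(c · f) n = c ℚ.* f n

_^^_ : Series → ℕ → Series
f ^^ zero  = cst 1ℚ
f ^^ suc e = f ⊛ (f ^^ e)

-- multiplicative inverse (defined for series with nonzero constant term;
-- junk value 0 otherwise)
private
  nth : List ℚ → ℕ → ℚ
  nth []       _       = 0ℚ
  nth (x ∷ _)  zero    = x
  nth (_ ∷ xs) (suc k) = nth xs k

  invCoeffs : Series → ℚ → ℕ → List ℚ
  invCoeffs f c zero    = c ∷ []
  invCoeffs f c (suc k) =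
    let bs = invCoeffs f c k in
    bs ++ (ℚ.- (c ℚ.* sumTo k (λ i → f (suc i) ℚ.* nth bs (k ∸ i))) ∷ [])

inv : Series → Series
inv f n with f 0 ≟ 0ℚ
... | yes _  = 0ℚ
... | no f≢0 = nth (invCoeffs f (ℚ.1/_ (f 0) {{ℚ.≢-nonZero f≢0}}) n) n

-- Infinite sum Σ_{n≥0} F n, for families with F n ≡ 0 (mod q^(n+1))
-- beyond the constant term, i.e. q-adic convergence: coefficient N only
-- involves the terms n ≤ N.  (Requirement: F n has valuation ≥ n.)
sumInf : (ℕ → Series) → Series
sumInf F N = sumTo N (λ n → F n N)

prodFin : (ℕ → Series) → ℕ → Series
prodFin F zero    = cst 1ℚ
prodFin F (suc n) = prodFin F n ⊛ F n

-- Infinite product Π_{k≥0} F k, for families with F k ≡ 1 (mod q^(k+1))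
prodInf : (ℕ → Series) → Series
prodInf F N = prodFin F (suc N) N

poch : Series → Series → ℕ → Series
poch a Q n = prodFin (λ k → cst 1ℚ ⊖ a ⊛ Q ^^ k) n

pochInf : Series → Series → Series
pochInf a Q = prodInf (λ k → cst 1ℚ ⊖ a ⊛ Q ^^ k)

J : ℕ → Series
J m = pochInf (mono 1ℚ m) (mono 1ℚ m)

-- Laurent series q^(-shift) · ser
record Laurent : Set where
  constructor laurent
  field
    shift : ℕ
    ser   : Series
open Laurent public

coeff : Laurent → ℤ → ℚ
coeff (laurent d f) k with k ℤ.+ + d
... | + n      = f n
... | -[1+ _ ] = 0ℚ

infix 4 _≈_
_≈_ : Laurent → Laurent → Set
F ≈ G = ∀ k → coeff F k ≡ coeff G k

⟦_⟧ : Series → Laurent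
⟦ f ⟧ = laurent 0 f

infixl 6 _+ᴸ_ _-ᴸ_
infixl 7 _*ᴸ_ _•_

_+ᴸ_ _-ᴸ_ _*ᴸ_ : Laurent → Laurent → Laurent
laurent d f +ᴸ laurent e g = laurent (d ℕ.+ e) (mono 1ℚ e ⊛ f ⊕ mono 1ℚ d ⊛ g)
laurent d f -ᴸ laurent e g = laurent (d ℕ.+ e) (mono 1ℚ e ⊛ f ⊖ mono 1ℚ d ⊛ g)
laurent d f *ᴸ laurent e g = laurent (d ℕ.+ e) (f ⊛ g)

_•_ : ℚ → Laurent → Laurent
c • laurent d f = laurent d (c · f)

qpow : ℤ → Laurent
qpow (+ n)      = laurent 0 (mono 1ℚ n)
qpow -[1+ n ]   = laurent (suc n) (cst 1ℚ)

-- g(x;Q) with x = c·q^j (c ≠ 0) and Q = q^m, j < m or j = 0 (so that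
-- Q/x = c⁻¹ q^(m-j) is a power series):
--   g(x;Q) = x⁻¹ ( -1 + Σ_{n≥0} Q^(n²) / ((x;Q)_{n+1} (Q/x;Q)_n) )

g : (c : ℚ) .{{_ : NonZero c}} (j m : ℕ) → Laurent
g c j m = laurent j ((ℚ.1/ c) · (ℚ.- 1ℚ · cst 1ℚ ⊕ sumInf term))
  where
    x Q Q/x : Series
    x   = mono c j
    Q   = mono 1ℚ m
    Q/x = mono (ℚ.1/ c) (m ∸ j)
    term : ℕ → Series
    term n = Q ^^ (n ℕ.* n) ⊛ inv (poch x Q (suc n) ⊛ poch Q/x Q n)

GF : ℤ → ℕ → ℕ → Laurent
GF a r s = ⟦ (λ n → + N⁰ a 4 (r ℕ.* n ℕ.+ s) ℚ./ 1) ⟧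

ηq : List (ℕ × ℕ) → List (ℕ × ℕ) → Laurent
ηq num den = ⟦ prod num ⊛ inv (prod den) ⟧
  where
    prod : List (ℕ × ℕ) → Series
    prod []             = cst 1ℚ
    prod ((m , e) ∷ xs) = J m ^^ e ⊛ prod xs

rat : ℤ → ℕ → ℚ
rat n zero    = 0ℚ
rat n (suc d) = n ℚ./ suc d

-1ℚ : ℚ
-1ℚ = ℚ.- 1ℚ

-- Let Ω_X = Σ q^(2n(n+1)) / Π_{k ≤ n} (1 - X q^(2k+1) + q^(4k+2)).  Sorting the rows of a symbol by their lengths
-- modulo 4 gives Σ N⁰(0) + N⁰(2) = q (Ω_2 + Ω_{-2}) / 2, Σ N⁰(0) - N⁰(2) = q Ω_0 and Σ N⁰(1) = q (Ω_2 - Ω_{-2}) / 4.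
--
-- Partial fractions in X, summed with the Durfee rectangle identity, turn Ω_X (and likewise the third order mock theta
-- function f, which is g(-1 ; q) up to a constant) into Lambert series, from which the even and odd parts can be read off:
-- Ω_2 + Ω_{-2} = 2 M₊(q²), Ω_0 = M₋(q²), q (Ω_2 - Ω_{-2}) = 4 H(q²).  The partial fraction expansion with two families
-- of poles, ∓q^(4r+2) and ±q^(2s+1), or -q^(4r) and q^(2s+1), becomes in the limit an identity between a theta quotient
-- and a sum of two Lambert series of this kind.  It reads M₊ + q Ω_{-2}(q²) = J₂⁸J₈²/(J₁⁴J₄⁵), M₋ + q Ω_2(q²) = J₄³/J₂²
-- and H + f(q⁴)/4 = J₂⁶J₄/(4 J₁⁴J₈²).
--
-- Since g(-q ; q²) = Ω_{-2}, these relations, iterated, give the first line of each part; the other lines follow by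
-- dissecting eta quotients with φ(±q) = φ(q⁴) ± 2 q ψ(q⁸).
module Submission where

open import Algebra.Bundles using (CommutativeRing)
import Algebra.Solver.Ring as RingSolver
open import Algebra.Solver.Ring.AlmostCommutativeRing using (fromCommutativeRing; _-Raw-AlmostCommutative⟶_)
open import Algebra.Structures using (IsCommutativeRing)
open import Data.Bool using (if_then_else_)
open import Data.Empty using (⊥; ⊥-elim)
open import Data.Integer as ℤ using (ℤ; +_; -[1+_])
open import Data.Integer.DivMod using (_%ℕ_)
import Data.Integer.Properties as ℤₚ
open import Data.List as List using (List; []; _∷_; _++_)
open import Data.List.Membership.Propositional using (_∈_)
open import Data.List.Membership.Propositional.Properties using (∈-map⁻)
import Data.List.Properties as Listₚ
import Data.List.Relation.Unary.All as All
open import Data.List.Relation.Unary.AllPairs using (_∷_)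
open import Data.List.Relation.Unary.Any using (here; there)
open import Data.List.Relation.Unary.Unique.Propositional using (Unique)
import Data.List.Relation.Unary.Unique.Propositional.Properties as Uniqueₚ
open import Data.Maybe using (Maybe; just; nothing)
open import Data.Nat as ℕ using (ℕ; zero; suc; _+_; _*_; _∸_; _≤_; _<_; z≤n; s≤s)
open import Data.Nat.Divisibility using (∣1⇒≡1)
open import Data.Nat.Properties as ℕₚ using (≤-refl; ≤-trans; ≤-reflexive; m≤m+n; m≤n+m; +-mono-≤)
open import Data.Nat.Tactic.RingSolver using (solve-∀)
open import Data.Product using (∃; _×_; _,_; proj₁; proj₂)
open import Data.Rational as ℚ using (ℚ; 0ℚ; 1ℚ; mkℚ; _/_; -_)
import Data.Rational.Properties as ℚₚ
open import Data.Rational.Solver using (module +-*-Solver)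
open import Data.Sum using (_⊎_; inj₁; inj₂)
open import Defs
open import Relation.Binary.PropositionalEquality as ≡ using (_≡_; _≢_; cong; cong₂; subst)
import Relation.Binary.Reasoning.Setoid as SetoidReasoning
open import Relation.Nullary using (¬_; yes; no; Dec)
open import Relation.Nullary.Decidable using (⌊_⌋)

-- The ring of power series

-- A factor 1 - X u + u² is linear in X, with a simple pole at u + 1/u. For u = ε q^a the factor of
-- v = ε δ q^b takes the value (1 - δ q^(b-a)) (1 - δ q^(a+b)) at that pole. As b - a may be
-- negative, the reciprocals are expanded from the start as power series in the direction that
-- converges, and an expansion in partial fractions is an identity between series, built up from two
-- poles. At X = 2 every factor is a square, which makes the product over both families a theta
-- quotient. Infinite identities are reached modulo q^n from finite truncations.
--
-- The moduli 8 and 16 in g come from feeding the relations into each other. The generating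
-- functions are q G₀(q²), H(q²) and q G₂(q²) with 2 G₀ = M₊ + M₋ and 2 G₂ = M₊ - M₋. In `G₀` the
-- half sum of `Ω two` and `Ω (~ two)` at q² is M₊(q⁴), and the relation for `M₊`, used again,
-- leaves `Ω (~ two)` at q⁸. In `G₂` half their difference, multiplied by q², is 2 H(q⁴), which
-- leaves f(q¹⁶); only one power of q is at hand, hence the q⁻¹ in front of g.

tail : Series → Series
tail f n = f (suc n)

sumTo-cong : ∀ n {f g : Series} → (∀ i → i ≤ n → f i ≡ g i) → sumTo n f ≡ sumTo n g
sumTo-cong zero    h = h 0 z≤n
sumTo-cong (suc n) h = cong₂ ℚ._+_ (sumTo-cong n λ i i≤n → h i (ℕₚ.m≤n⇒m≤1+n i≤n)) (h (suc n) ≤-refl)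

sumTo-head : ∀ n f → sumTo (suc n) f ≡ f 0 ℚ.+ sumTo n (tail f)
sumTo-head zero    f = ≡.refl
sumTo-head (suc n) f = ≡.trans (cong (ℚ._+ f (suc (suc n))) (sumTo-head n f)) (ℚₚ.+-assoc (f 0) _ _)

sumTo-reverse : ∀ n f → sumTo n f ≡ sumTo n (λ i → f (n ∸ i))
sumTo-reverse zero    f = ≡.refl
sumTo-reverse (suc n) f = ≡.trans (ℚₚ.+-comm (sumTo n f) (f (suc n)))
  (≡.trans (cong (f (suc n) ℚ.+_) (sumTo-reverse n f)) (≡.sym (sumTo-head n λ i → f (suc n ∸ i))))

sumTo-+ : ∀ n f g → sumTo n (f ⊕ g) ≡ sumTo n f ℚ.+ sumTo n g
sumTo-+ zero    f g = ≡.refl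
sumTo-+ (suc n) f g = ≡.trans (cong (ℚ._+ (f ⊕ g) (suc n)) (sumTo-+ n f g))
  (+-*-Solver.solve 4 (λ a b c d → (a :+ b) :+ (c :+ d) := (a :+ c) :+ (b :+ d)) ≡.refl
    (sumTo n f) (sumTo n g) (f (suc n)) (g (suc n)))
  where open +-*-Solver

sumTo-· : ∀ n c f → sumTo n (c · f) ≡ c ℚ.* sumTo n f
sumTo-· zero    c f = ≡.refl
sumTo-· (suc n) c f = ≡.trans (cong (ℚ._+ (c · f) (suc n)) (sumTo-· n c f))
  (≡.sym (ℚₚ.*-distribˡ-+ c (sumTo n f) (f (suc n))))

sumTo-0 : ∀ n {f : Series} → (∀ i → i ≤ n → f i ≡ 0ℚ) → sumTo n f ≡ 0ℚ
sumTo-0 zero    h = h 0 z≤n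
sumTo-0 (suc n) h = cong₂ ℚ._+_ (sumTo-0 n λ i i≤n → h i (ℕₚ.m≤n⇒m≤1+n i≤n)) (h (suc n) ≤-refl)

⊛-head : ∀ f g n → (f ⊛ g) (suc n) ≡ f 0 ℚ.* g (suc n) ℚ.+ (tail f ⊛ g) n
⊛-head f g n = sumTo-head n (λ i → f i ℚ.* g (suc n ∸ i))

⊛-cong : ∀ n {f f′ g g′ : Series} → (∀ i → i ≤ n → f i ≡ f′ i) → (∀ i → i ≤ n → g i ≡ g′ i) → (f ⊛ g) n ≡ (f′ ⊛ g′) n
⊛-cong n p r = sumTo-cong n λ i i≤n → cong₂ ℚ._*_ (p i i≤n) (r (n ∸ i) (ℕₚ.m∸n≤m n i))

⊛-comm : ∀ f g n → (f ⊛ g) n ≡ (g ⊛ f) n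
⊛-comm f g n = ≡.trans (sumTo-reverse n _) (sumTo-cong n λ i i≤n →
  ≡.trans (ℚₚ.*-comm (f (n ∸ i)) (g (n ∸ (n ∸ i)))) (cong (λ j → g j ℚ.* f (n ∸ i)) (ℕₚ.m∸[m∸n]≡n i≤n)))

⊛-distribʳ : ∀ h f g n → ((f ⊕ g) ⊛ h) n ≡ ((f ⊛ h) ⊕ (g ⊛ h)) n
⊛-distribʳ h f g n = ≡.trans (sumTo-cong n λ i _ → ℚₚ.*-distribʳ-+ (h (n ∸ i)) (f i) (g i))
  (sumTo-+ n (λ i → f i ℚ.* h (n ∸ i)) (λ i → g i ℚ.* h (n ∸ i)))

·-⊛ : ∀ c f g n → ((c · f) ⊛ g) n ≡ c ℚ.* (f ⊛ g) n
·-⊛ c f g n = ≡.trans (sumTo-cong n λ i _ → ℚₚ.*-assoc c (f i) (g (n ∸ i))) (sumTo-· n c (λ i → f i ℚ.* g (n ∸ i)))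

-- Induction on the index, for all three series at once: the tail of `f ⊛ g` is
-- `f 0 · tail g ⊕ tail f ⊛ g`, so peeling off the constant term of `f` leaves the same law for
-- `tail f`.
⊛-assoc : ∀ n f g h → ((f ⊛ g) ⊛ h) n ≡ (f ⊛ (g ⊛ h)) n
⊛-assoc zero    f g h = ℚₚ.*-assoc (f 0) (g 0) (h 0)
⊛-assoc (suc n) f g h = begin
  ((f ⊛ g) ⊛ h) (suc n)
    ≡⟨ ⊛-head (f ⊛ g) h n ⟩
  f 0 ℚ.* g 0 ℚ.* h (suc n) ℚ.+ (tail (f ⊛ g) ⊛ h) n
    ≡⟨ cong₂ ℚ._+_ (ℚₚ.*-assoc (f 0) (g 0) (h (suc n))) (⊛-cong n {g = h} (λ i _ → ⊛-head f g i) (λ _ _ → ≡.refl)) ⟩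
  f 0 ℚ.* (g 0 ℚ.* h (suc n)) ℚ.+ (((f 0 · tail g) ⊕ (tail f ⊛ g)) ⊛ h) n
    ≡⟨ cong (f 0 ℚ.* (g 0 ℚ.* h (suc n)) ℚ.+_) (⊛-distribʳ h (f 0 · tail g) (tail f ⊛ g) n) ⟩
  f 0 ℚ.* (g 0 ℚ.* h (suc n)) ℚ.+ (((f 0 · tail g) ⊛ h) n ℚ.+ ((tail f ⊛ g) ⊛ h) n)
    ≡⟨ cong₂ (λ x y → f 0 ℚ.* (g 0 ℚ.* h (suc n)) ℚ.+ (x ℚ.+ y)) (·-⊛ (f 0) (tail g) h n) (⊛-assoc n (tail f) g h) ⟩
  f 0 ℚ.* (g 0 ℚ.* h (suc n)) ℚ.+ (f 0 ℚ.* (tail g ⊛ h) n ℚ.+ (tail f ⊛ (g ⊛ h)) n)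
    ≡⟨ +-*-Solver.solve 4 (λ a b c d → a :* b :+ (a :* c :+ d) := a :* (b :+ c) :+ d) ≡.refl
         (f 0) (g 0 ℚ.* h (suc n)) ((tail g ⊛ h) n) ((tail f ⊛ (g ⊛ h)) n) ⟩
  f 0 ℚ.* (g 0 ℚ.* h (suc n) ℚ.+ (tail g ⊛ h) n) ℚ.+ (tail f ⊛ (g ⊛ h)) n
    ≡⟨ cong (λ x → f 0 ℚ.* x ℚ.+ (tail f ⊛ (g ⊛ h)) n) (⊛-head g h n) ⟨
  f 0 ℚ.* (g ⊛ h) (suc n) ℚ.+ (tail f ⊛ (g ⊛ h)) n
    ≡⟨ ⊛-head f (g ⊛ h) n ⟨
  (f ⊛ (g ⊛ h)) (suc n) ∎
  where open ≡.≡-Reasoning ; open +-*-Solver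

cst-⊛ : ∀ c f n → (cst c ⊛ f) n ≡ c ℚ.* f n
cst-⊛ c f zero    = ≡.refl
cst-⊛ c f (suc n) = ≡.trans (⊛-head (cst c) f n) (≡.trans
  (cong (c ℚ.* f (suc n) ℚ.+_) (sumTo-0 n λ i _ → ℚₚ.*-zeroˡ (f (n ∸ i)))) (ℚₚ.+-identityʳ _))

infix 4 _≋_
-- A record, so that unification recovers both series from the type of a proof; the bare function
-- type would expose only their coefficients.
record _≋_ (f g : Series) : Set where
  constructor pw
  field at : ∀ n → f n ≡ g n
open _≋_ public

infixl 6 _⊞_ _⊟_
infixl 7 _∙_
infix  8 ~_
-- Opaque copies of the operations: terms keep the shape in which they are written, so that implicit
-- arguments and the normal forms of the ring solver are found without unfolding convolutions.
opaque
  _⊞_ _∙_ : Series → Series → Series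
  _⊞_ = _⊕_
  _∙_ = _⊛_

  ~_ : Series → Series
  (~ f) n = ℚ.- f n

  K : ℚ → Series
  K = cst

  q^ : ℕ → Series
  q^ = mono 1ℚ

  infix 9 _⁻¹
  _⁻¹ : Series → Series
  _⁻¹ = inv

_⊟_ : Series → Series → Series
f ⊟ g = f ⊞ ~ g

𝟘 𝟙 : Series
𝟘 = K 0ℚ
𝟙 = K 1ℚ

cst-0 : ∀ n → cst 0ℚ n ≡ 0ℚ
cst-0 zero    = ≡.refl
cst-0 (suc _) = ≡.refl

opaque
  unfolding _⊞_
  isSeriesRing : IsCommutativeRing _≋_ _⊞_ _∙_ ~_ 𝟘 𝟙
  isSeriesRing = record
      { isRing = record
        { +-isAbelianGroup = record
          { isGroup = record
            { isMonoid = record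
              { isSemigroup = record
                { isMagma = record
                  { isEquivalence = record
                    { refl = pw λ _ → ≡.refl
                    ; sym = λ p → pw λ n → ≡.sym (at p n)
                    ; trans = λ p r → pw λ n → ≡.trans (at p n) (at r n) }
                  ; ∙-cong = λ p r → pw λ n → cong₂ ℚ._+_ (at p n) (at r n) }
                ; assoc = λ f g h → pw λ n → ℚₚ.+-assoc (f n) (g n) (h n) }
              ; identity = (λ f → pw λ n → ≡.trans (cong (ℚ._+ f n) (cst-0 n)) (ℚₚ.+-identityˡ (f n)))
                         , (λ f → pw λ n → ≡.trans (cong (f n ℚ.+_) (cst-0 n)) (ℚₚ.+-identityʳ (f n))) }
            ; inverse = (λ f → pw λ n → ≡.trans (ℚₚ.+-inverseˡ (f n)) (≡.sym (cst-0 n)))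
                      , (λ f → pw λ n → ≡.trans (ℚₚ.+-inverseʳ (f n)) (≡.sym (cst-0 n)))
            ; ⁻¹-cong = λ p → pw λ n → cong ℚ.-_ (at p n) }
          ; comm = λ f g → pw λ n → ℚₚ.+-comm (f n) (g n) }
        ; *-cong = λ p r → pw λ n → ⊛-cong n (λ i _ → at p i) (λ i _ → at r i)
        ; *-assoc = λ f g h → pw λ n → ⊛-assoc n f g h
        ; *-identity = (λ f → pw λ n → ≡.trans (cst-⊛ 1ℚ f n) (ℚₚ.*-identityˡ (f n)))
                     , (λ f → pw λ n → ≡.trans (⊛-comm f (cst 1ℚ) n) (≡.trans (cst-⊛ 1ℚ f n) (ℚₚ.*-identityˡ (f n))))
        ; distrib = (λ h f g → pw λ n → ≡.trans (⊛-comm h (f ⊕ g) n) (≡.trans (⊛-distribʳ h f g n)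
                       (cong₂ ℚ._+_ (⊛-comm f h n) (⊛-comm g h n))))
                  , (λ h f g → pw λ n → ⊛-distribʳ h f g n) }
      ; *-comm = λ f g → pw λ n → ⊛-comm f g n }

seriesRing : CommutativeRing _ _
seriesRing = record { isCommutativeRing = isSeriesRing }

open CommutativeRing seriesRing using (setoid)
  renaming (refl to ≋-refl; sym to ≋-sym; trans to ≋-trans; reflexive to ≋-reflexive; +-cong to ⊞-cong; *-cong to ∙-cong; -‿cong to ~-cong) public
open CommutativeRing seriesRing using ()
  renaming (*-identityˡ to ∙-identityˡ; *-identityʳ to ∙-identityʳ; *-comm to ∙-comm; *-assoc to ∙-assoc; +-comm to ⊞-comm; +-assoc to ⊞-assoc; zeroʳ to ∙-zeroʳ; +-identityˡ to ⊞-identityˡ; +-identityʳ to ⊞-identityʳ; -‿inverseʳ to ⊞-inverseʳ) public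

module ≋R = SetoidReasoning setoid

-- Integer constants and the ring solver

ℤtoℚ : ℤ → ℚ
ℤtoℚ i = mkℚ i 0 (λ {(_ , d∣1) → ∣1⇒≡1 d∣1})

ℤtoℚ-/ : ∀ i → i / 1 ≡ ℤtoℚ i
ℤtoℚ-/ i = ℚₚ.↥p/↧p≡p (ℤtoℚ i)

ℤtoℚ-+ : ∀ i j → ℤtoℚ (i ℤ.+ j) ≡ ℤtoℚ i ℚ.+ ℤtoℚ j
ℤtoℚ-+ i j = ≡.trans (≡.sym (ℤtoℚ-/ (i ℤ.+ j))) (cong (_/ 1) (≡.sym (cong₂ ℤ._+_ (ℤₚ.*-identityʳ i) (ℤₚ.*-identityʳ j))))

ℤtoℚ-* : ∀ i j → ℤtoℚ (i ℤ.* j) ≡ ℤtoℚ i ℚ.* ℤtoℚ j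
ℤtoℚ-* i j = ≡.sym (ℤtoℚ-/ (i ℤ.* j))

ℤtoℚ-neg : ∀ i → ℤtoℚ (ℤ.- i) ≡ ℚ.- ℤtoℚ i
ℤtoℚ-neg (+ zero)  = ≡.refl
ℤtoℚ-neg (+ suc n) = ≡.refl
ℤtoℚ-neg -[1+ n ]  = ≡.refl

opaque
  unfolding _⊞_
  K-+ : ∀ a b → K (a ℚ.+ b) ≋ K a ⊞ K b
  K-+ a b = pw λ { zero → ≡.refl ; (suc _) → ≡.refl }

  K-* : ∀ a b → K (a ℚ.* b) ≋ K a ∙ K b
  K-* a b = pw λ { zero → ≡.refl ; (suc n) → ≡.sym (≡.trans (cst-⊛ a (cst b) (suc n)) (ℚₚ.*-zeroʳ a)) }

  K-neg : ∀ a → K (ℚ.- a) ≋ ~ K a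
  K-neg a = pw λ { zero → ≡.refl ; (suc _) → ≡.refl }

K-cong : ∀ {a b} → a ≡ b → K a ≋ K b
K-cong p = ≋-reflexive (cong K p)

# : ℤ → Series
# i = K (ℤtoℚ i)

#-morphism : ℤ.+-*-rawRing -Raw-AlmostCommutative⟶ fromCommutativeRing seriesRing
#-morphism = record
  { ⟦_⟧ = #
  ; +-homo = λ i j → ≋-trans (K-cong (ℤtoℚ-+ i j)) (K-+ (ℤtoℚ i) (ℤtoℚ j))
  ; *-homo = λ i j → ≋-trans (K-cong (ℤtoℚ-* i j)) (K-* (ℤtoℚ i) (ℤtoℚ j))
  ; -‿homo = λ i → ≋-trans (K-cong (ℤtoℚ-neg i)) (K-neg (ℤtoℚ i))
  ; 0-homo = ≋-refl
  ; 1-homo = ≋-refl }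

#-weaklyDec : ∀ i j → Maybe (# i ≋ # j)
#-weaklyDec i j with i ℤ.≟ j
... | yes p = just (≋-reflexive (cong # p))
... | no _  = nothing

open RingSolver ℤ.+-*-rawRing (fromCommutativeRing seriesRing) #-morphism #-weaklyDec
  using (Polynomial; solve; _:=_; _:+_; _:*_; _:-_; con) renaming (:-_ to ⊝_) public

infix 10 ′_
′_ : ∀ {n} → ℕ → Polynomial n
′ k = con (+ k)

-- The list of coefficients inside inv is private.  Abstracting the concatenation and
-- the index in the unfolded inverse recovers lookup in that list.
mutual
  lookupWith : Series → ℚ → ℕ → (List ℚ → List ℚ → List ℚ) → ℕ → ℚ
  lookupWith f c k app j = _

  inv-suc : ∀ f (f≢0 : f 0 ≢ 0ℚ) k → inv f (suc k) ≡ lookupWith f (ℚ.1/_ (f 0) {{ℚ.≢-nonZero f≢0}}) k _++_ (suc k)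
  inv-suc f f≢0 k with f 0 ℚₚ.≟ 0ℚ
  ... | yes p = ⊥-elim (f≢0 p)
  ... | no f≢0′ with ℚ.1/_ (f 0) {{ℚ.≢-nonZero f≢0′}} | (_++_ {A = ℚ}) | suc k
  ... | c | app | j = ≡.refl

private
  -- A constant `app` turns the recovered lookup into plain indexing of an arbitrary list.
  nth : List ℚ → ℕ → ℚ
  nth l = lookupWith (cst 0ℚ) 0ℚ 0 (λ _ _ → l)

  -- The same device again: comparison with `lookupWith` determines the list of coefficients
  -- computed so far and the one-element list appended to it.
  mutual
    coeffs new : Series → ℚ → ℕ → List ℚ
    coeffs f c k = _
    new f c k = _

    lookupWith-nth : ∀ f c k app j → lookupWith f c k app j ≡ nth (app (coeffs f c k) (new f c k)) j
    lookupWith-nth f c k app j = ≡.refl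

module _ (f : Series) (c : ℚ) where
  private
    -- `next k` is the entry appended after stage k; `β k` below is the last entry of the list of
    -- stage k.
    next : ℕ → ℚ
    next k = lookupWith f c k (λ _ b → b) 0

    β : ℕ → ℚ
    β k = lookupWith f c k (λ a _ → a) k

    -- The list of stage k has k + 1 entries, so the index points into `ys`. Reassociating the
    -- concatenation turns stage `suc k` into stage k with a longer remainder.
    nth-++ʳ : ∀ k ys j → lookupWith f c k (λ a _ → a ++ ys) (suc k + j) ≡ nth ys j
    nth-++ʳ zero    ys j = ≡.refl
    nth-++ʳ (suc k) ys j = begin
      lookupWith f c (suc k) (λ a _ → a ++ ys) (suc (suc k + j))  ≡⟨ cong (λ l → nth l (suc (suc k + j))) (Listₚ.++-assoc (coeffs f c k) (next k ∷ []) ys) ⟩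
      lookupWith f c k (λ a _ → a ++ next k ∷ ys) (suc (suc k + j)) ≡⟨ cong (λ i → lookupWith f c k (λ a _ → a ++ next k ∷ ys) (suc i)) (ℕₚ.+-suc k j) ⟨
      lookupWith f c k (λ a _ → a ++ next k ∷ ys) (suc k + suc j) ≡⟨ nth-++ʳ k (next k ∷ ys) (suc j) ⟩
      nth ys j ∎
      where open ≡.≡-Reasoning

    nth-last : ∀ k ys → lookupWith f c k (λ a _ → a ++ ys) (suc k) ≡ nth ys 0
    nth-last k ys = ≡.trans (cong (λ i → lookupWith f c k (λ a _ → a ++ ys) (suc i)) (≡.sym (ℕₚ.+-identityʳ k))) (nth-++ʳ k ys 0)

    nth-++ˡ : ∀ k ys j → j ≤ k → lookupWith f c k (λ a _ → a ++ ys) j ≡ lookupWith f c k (λ a _ → a) j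
    nth-++ˡ zero    ys zero z≤n = ≡.refl
    nth-++ˡ (suc k) ys j j≤1+k with ℕₚ.m≤n⇒m<n∨m≡n j≤1+k
    ... | inj₁ (s≤s j≤k) = ≡.trans (cong (λ l → nth l j) (Listₚ.++-assoc (coeffs f c k) (next k ∷ []) ys))
                             (≡.trans (nth-++ˡ k (next k ∷ ys) j j≤k) (≡.sym (nth-++ˡ k (next k ∷ []) j j≤k)))
    ... | inj₂ ≡.refl = ≡.trans (cong (λ l → nth l j) (Listₚ.++-assoc (coeffs f c k) (next k ∷ []) ys))
                             (≡.trans (nth-last k (next k ∷ ys)) (≡.sym (nth-last k (next k ∷ []))))

    -- Later stages only append, so an entry never changes. This makes the lists one sequence, to
    -- which the recursion for reciprocals applies.
    β-stable : ∀ k j → j ≤ k → lookupWith f c k (λ a _ → a) j ≡ β j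
    β-stable zero    zero z≤n = ≡.refl
    β-stable (suc k) j j≤1+k with ℕₚ.m≤n⇒m<n∨m≡n j≤1+k
    ... | inj₁ (s≤s j≤k) = ≡.trans (nth-++ˡ k (next k ∷ []) j j≤k) (β-stable k j j≤k)
    ... | inj₂ ≡.refl = ≡.refl

  lookupWith-rec : ∀ k → lookupWith f c k _++_ (suc k) ≡ ℚ.- (c ℚ.* sumTo k (λ i → f (suc i) ℚ.* lookupWith f c (k ∸ i) (λ a _ → a) (k ∸ i)))
  lookupWith-rec k = ≡.trans (nth-last k (next k ∷ [])) (cong (λ x → ℚ.- (c ℚ.* x))
    (sumTo-cong k λ i _ → cong (f (suc i) ℚ.*_) (β-stable k (k ∸ i) (ℕₚ.m∸n≤m k i))))

inv-zero : ∀ f (f≢0 : f 0 ≢ 0ℚ) → inv f 0 ≡ ℚ.1/_ (f 0) {{ℚ.≢-nonZero f≢0}}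
inv-zero f f≢0 with f 0 ℚₚ.≟ 0ℚ
... | yes p = ⊥-elim (f≢0 p)
... | no _  = ≡.refl

inv-diagonal : ∀ f (f≢0 : f 0 ≢ 0ℚ) k → inv f k ≡ lookupWith f (ℚ.1/_ (f 0) {{ℚ.≢-nonZero f≢0}}) k (λ a _ → a) k
inv-diagonal f f≢0 zero    = inv-zero f f≢0
inv-diagonal f f≢0 (suc k) = inv-suc f f≢0 k

inv-rec : ∀ f (f≢0 : f 0 ≢ 0ℚ) k → inv f (suc k) ≡ ℚ.- (ℚ.1/_ (f 0) {{ℚ.≢-nonZero f≢0}} ℚ.* (tail f ⊛ inv f) k)
inv-rec f f≢0 k = ≡.trans (inv-suc f f≢0 k) (≡.trans (lookupWith-rec f c k)
  (cong (λ x → ℚ.- (c ℚ.* x)) (sumTo-cong k λ i _ → cong (f (suc i) ℚ.*_) (≡.sym (inv-diagonal f f≢0 (k ∸ i))))))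
  where c = ℚ.1/_ (f 0) {{ℚ.≢-nonZero f≢0}}

⊛-inv : ∀ f → f 0 ≢ 0ℚ → ∀ n → (f ⊛ inv f) n ≡ cst 1ℚ n
⊛-inv f f≢0 zero    = ≡.trans (cong (f 0 ℚ.*_) (inv-zero f f≢0)) (ℚₚ.*-inverseʳ (f 0) {{ℚ.≢-nonZero f≢0}})
⊛-inv f f≢0 (suc k) = begin
  (f ⊛ inv f) (suc k)                      ≡⟨ ⊛-head f (inv f) k ⟩
  f 0 ℚ.* inv f (suc k) ℚ.+ x              ≡⟨ cong (λ y → f 0 ℚ.* y ℚ.+ x) (inv-rec f f≢0 k) ⟩
  f 0 ℚ.* (ℚ.- (c ℚ.* x)) ℚ.+ x            ≡⟨ +-*-Solver.solve 3 (λ a c x → a :*′ (:-′ (c :*′ x)) :+′ x :=′ (:-′ (a :*′ c)) :*′ x :+′ x) ≡.refl (f 0) c x ⟩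
  (ℚ.- (f 0 ℚ.* c)) ℚ.* x ℚ.+ x            ≡⟨ cong (λ y → (ℚ.- y) ℚ.* x ℚ.+ x) (ℚₚ.*-inverseʳ (f 0) {{ℚ.≢-nonZero f≢0}}) ⟩
  (ℚ.- 1ℚ) ℚ.* x ℚ.+ x                     ≡⟨ +-*-Solver.solve 1 (λ x → (:-′ con′ 1ℚ) :*′ x :+′ x :=′ con′ 0ℚ) ≡.refl x ⟩
  0ℚ ∎
  where
    open ≡.≡-Reasoning
    open +-*-Solver using () renaming (_:=_ to _:=′_; _:+_ to _:+′_; _:*_ to _:*′_; :-_ to :-′_; con to con′)
    c = ℚ.1/_ (f 0) {{ℚ.≢-nonZero f≢0}}
    x = (tail f ⊛ inv f) k

-- Units and cancellable series

record Unit (f : Series) : Set where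
  constructor unit
  field const≢0 : f 0 ≢ 0ℚ
open Unit public

opaque
  unfolding _⊞_
  ∙-inverse : ∀ {f} → Unit f → f ∙ f ⁻¹ ≋ 𝟙
  ∙-inverse {f} u = pw (⊛-inv f (const≢0 u))

  Unit-∙ : ∀ {f g} → Unit f → Unit g → Unit (f ∙ g)
  Unit-∙ {f} {g} u v = unit λ p → const≢0 v (begin
    g 0                         ≡⟨ ℚₚ.*-identityˡ (g 0) ⟨
    1ℚ ℚ.* g 0                  ≡⟨ cong (ℚ._* g 0) (ℚₚ.*-inverseˡ (f 0) {{f≢0}}) ⟨
    f⁻¹ ℚ.* f 0 ℚ.* g 0         ≡⟨ ℚₚ.*-assoc f⁻¹ (f 0) (g 0) ⟩
    f⁻¹ ℚ.* (f 0 ℚ.* g 0)       ≡⟨ cong (f⁻¹ ℚ.*_) p ⟩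
    f⁻¹ ℚ.* 0ℚ                  ≡⟨ ℚₚ.*-zeroʳ f⁻¹ ⟩
    0ℚ                          ∎)
    where
      open ≡.≡-Reasoning
      f≢0 : ℚ.NonZero (f 0)
      f≢0 = ℚ.≢-nonZero (const≢0 u)
      f⁻¹ : ℚ
      f⁻¹ = ℚ.1/_ (f 0) {{f≢0}}

  Unit-K : ∀ {a} → a ≢ 0ℚ → Unit (K a)
  Unit-K a≢0 = unit a≢0

  Unit-⊞ : ∀ f g → g 0 ≡ 0ℚ → Unit f → Unit (f ⊞ g)
  Unit-⊞ f g g₀ u = unit λ p → const≢0 u (≡.trans (≡.sym (≡.trans (cong (f 0 ℚ.+_) g₀) (ℚₚ.+-identityʳ (f 0)))) p)

Unit-≋ : ∀ {f g} → f ≋ g → Unit f → Unit g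
Unit-≋ p u = unit λ z → const≢0 u (≡.trans (at p 0) z)

Unit-𝟙 : Unit 𝟙
Unit-𝟙 = Unit-K λ ()

open ≋R

-- The constant terms of the two factors multiply to 1.
unit-factor : ∀ {f g} → f ∙ g ≋ 𝟙 → Unit f
unit-factor {f} {g} p = unit λ z → 1≢0 (≡.trans (≡.sym (one p)) (zro z))
  where
    opaque
      unfolding _⊞_
      one : f ∙ g ≋ 𝟙 → f 0 ℚ.* g 0 ≡ 1ℚ
      one p = at p 0
      zro : f 0 ≡ 0ℚ → f 0 ℚ.* g 0 ≡ 0ℚ
      zro z = ≡.trans (cong (ℚ._* g 0) z) (ℚₚ.*-zeroˡ (g 0))
    1≢0 : 1ℚ ≢ 0ℚ
    1≢0 ()

-- Partial fractions divide by determinants of nodes. These are powers of q times units: not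
-- invertible as power series, but cancellable.
Regular : Series → Set
Regular f = ∀ {g h} → f ∙ g ≋ f ∙ h → g ≋ h

unit-regular : ∀ {f} → Unit f → Regular f
unit-regular {f} u {g} {h} p = begin
  g                 ≈⟨ solve 1 (λ g → g := ′ 1 :* g) ≋-refl g ⟩
  𝟙 ∙ g             ≈⟨ ∙-cong (∙-inverse u) ≋-refl ⟨
  f ∙ f ⁻¹ ∙ g      ≈⟨ solve 3 (λ f i g → f :* i :* g := i :* (f :* g)) ≋-refl f (f ⁻¹) g ⟩
  f ⁻¹ ∙ (f ∙ g)    ≈⟨ ∙-cong ≋-refl p ⟩
  f ⁻¹ ∙ (f ∙ h)    ≈⟨ solve 3 (λ f i g → f :* i :* g := i :* (f :* g)) ≋-refl f (f ⁻¹) h ⟨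
  f ∙ f ⁻¹ ∙ h      ≈⟨ ∙-cong (∙-inverse u) ≋-refl ⟩
  𝟙 ∙ h             ≈⟨ solve 1 (λ g → g := ′ 1 :* g) ≋-refl h ⟨
  h                 ∎

∙-regular : ∀ {f g} → Regular f → Regular g → Regular (f ∙ g)
∙-regular {f} {g} rf rg p = rg (rf (≋-trans (≋-sym (∙-assoc f g _)) (≋-trans p (∙-assoc f g _))))

regular-≋ : ∀ {f g} → f ≋ g → Regular f → Regular g
regular-≋ p r e = r (≋-trans (∙-cong p ≋-refl) (≋-trans e (≋-sym (∙-cong p ≋-refl))))

⁻¹-unique : ∀ {f g} → f ∙ g ≋ 𝟙 → f ⁻¹ ≋ g
⁻¹-unique p = unit-regular (unit-factor p) (≋-trans (∙-inverse (unit-factor p)) (≋-sym p))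

⁻¹-∙ : ∀ {f g} → Unit f → Unit g → (f ∙ g) ⁻¹ ≋ f ⁻¹ ∙ g ⁻¹
⁻¹-∙ {f} {g} u v = ⁻¹-unique (begin
  f ∙ g ∙ (f ⁻¹ ∙ g ⁻¹)     ≈⟨ solve 4 (λ f g i j → f :* g :* (i :* j) := f :* i :* (g :* j)) ≋-refl f g (f ⁻¹) (g ⁻¹) ⟩
  f ∙ f ⁻¹ ∙ (g ∙ g ⁻¹)     ≈⟨ ∙-cong (∙-inverse u) (∙-inverse v) ⟩
  𝟙 ∙ 𝟙                     ≈⟨ ∙-identityˡ 𝟙 ⟩
  𝟙                         ∎)

⁻¹-cong : ∀ {f g} → Unit f → f ≋ g → f ⁻¹ ≋ g ⁻¹
⁻¹-cong u p = ⁻¹-unique (≋-trans (∙-cong p ≋-refl) (∙-inverse (Unit-≋ p u)))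

Unit-⁻¹ : ∀ {f} → Unit f → Unit (f ⁻¹)
Unit-⁻¹ {f} u = unit-factor (≋-trans (∙-comm (f ⁻¹) f) (∙-inverse u))

-- Powers of q and congruences modulo them

opaque
  unfolding _⊞_
  q^-at : ∀ j f n → (q^ j ∙ f) (j + n) ≡ f n
  q^-at zero    f n = ≡.trans (⊛-cong n {mono 1ℚ 0} {cst 1ℚ} {f} {f} (λ { zero _ → ≡.refl ; (suc i) _ → ≡.refl }) (λ _ _ → ≡.refl))
                      (≡.trans (cst-⊛ 1ℚ f n) (ℚₚ.*-identityˡ (f n)))
  q^-at (suc j) f n = ≡.trans (⊛-head (mono 1ℚ (suc j)) f (j + n))
    (≡.trans (cong₂ ℚ._+_ (ℚₚ.*-zeroˡ (f (suc (j + n)))) (q^-at j f n)) (ℚₚ.+-identityˡ (f n)))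

  q^-low : ∀ j f n → n < j → (q^ j ∙ f) n ≡ 0ℚ
  q^-low (suc j) f zero    _         = ℚₚ.*-zeroˡ (f 0)
  q^-low (suc j) f (suc n) (s≤s n<j) = ≡.trans (⊛-head (mono 1ℚ (suc j)) f n)
    (cong₂ ℚ._+_ (ℚₚ.*-zeroˡ (f (suc n))) (q^-low j f n n<j))

  q^-zero : q^ 0 ≋ 𝟙
  q^-zero = pw λ { zero → ≡.refl ; (suc _) → ≡.refl }

  q^-const : ∀ j → q^ (suc j) 0 ≡ 0ℚ
  q^-const j = ≡.refl

by-cases : ∀ j {f g : Series} → (∀ n → n < j → f n ≡ g n) → (∀ n → f (j + n) ≡ g (j + n)) → f ≋ g
by-cases j {f} {g} lo hi = pw λ n → aux n (n ℕ.<? j)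
  where
    aux : ∀ n → Dec (n < j) → f n ≡ g n
    aux n (yes n<j) = lo n n<j
    aux n (no n≮j)  = subst (λ i → f i ≡ g i) (ℕₚ.m+[n∸m]≡n (ℕₚ.≮⇒≥ n≮j)) (hi (n ∸ j))

q^-regular : ∀ j → Regular (q^ j)
q^-regular j {g} {h} p = pw λ n → ≡.trans (≡.sym (q^-at j g n)) (≡.trans (at p (j + n)) (q^-at j h n))

dropq : ℕ → Series → Series
dropq j f n = f (j + n)

q^-+ : ∀ i j → q^ (i + j) ≋ q^ i ∙ q^ j
q^-+ i j = by-cases i
  (λ n n<i → ≡.trans (≡.trans (at (≋-sym (∙-identityʳ (q^ (i + j)))) n) (q^-low (i + j) 𝟙 n (≤-trans n<i (m≤m+n i j)))) (≡.sym (q^-low i (q^ j) n n<i)))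
  (λ n → ≡.trans (aux i n) (≡.sym (q^-at i (q^ j) n)))
  where
    opaque
      unfolding _⊞_
      aux : ∀ i n → q^ (i + j) (i + n) ≡ q^ j n
      aux zero    n = ≡.refl
      aux (suc i) n = aux i n

infix 4 _≈[_]_
-- With the quotient as a witness, compatibility with the ring operations is a polynomial identity;
-- `≈-at` and `≈-intro` translate to and from agreement of the first n coefficients.
record _≈[_]_ (f : Series) (n : ℕ) (g : Series) : Set where
  constructor modq
  field
    quotient : Series
    equation : f ≋ g ⊞ q^ n ∙ quotient
open _≈[_]_ public

opaque
  unfolding _⊞_
  ≈-at : ∀ {f g n} → f ≈[ n ] g → ∀ i → i < n → f i ≡ g i
  ≈-at {f} {g} {n} (modq h e) i i<n = ≡.trans (at e i) (≡.trans (cong (g i ℚ.+_) (q^-low n h i i<n)) (ℚₚ.+-identityʳ (g i)))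

  ≈-intro : ∀ {f g} n → (∀ i → i < n → f i ≡ g i) → f ≈[ n ] g
  ≈-intro {f} {g} n p = modq (dropq n (f ⊟ g)) (by-cases n
    (λ i i<n → ≡.trans (p i i<n) (≡.sym (≡.trans (cong (g i ℚ.+_) (q^-low n (dropq n (f ⊟ g)) i i<n)) (ℚₚ.+-identityʳ (g i)))))
    (λ i → ≡.trans (+-*-Solver.solve 2 (λ a b → a :=′ b :+′ (a :+′ (:-′ b))) ≡.refl (f (n + i)) (g (n + i)))
             (cong (g (n + i) ℚ.+_) (≡.sym (q^-at n (dropq n (f ⊟ g)) i)))))
    where open +-*-Solver using () renaming (_:=_ to _:=′_; _:+_ to _:+′_; :-_ to :-′_)

≈-all : ∀ {f g} → (∀ n → f ≈[ n ] g) → f ≋ g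
≈-all p = pw λ n → ≈-at (p (suc n)) n ≤-refl

≋⇒≈ : ∀ {f g n} → f ≋ g → f ≈[ n ] g
≋⇒≈ {f} {g} {n} p = modq 𝟘 (≋-trans p (solve 2 (λ g q → g := g :+ q :* ′ 0) ≋-refl g (q^ n)))

≈-refl : ∀ {f n} → f ≈[ n ] f
≈-refl = ≋⇒≈ ≋-refl

≈-sym : ∀ {f g n} → f ≈[ n ] g → g ≈[ n ] f
≈-sym {f} {g} {n} (modq h e) = modq (~ h) (≋-trans (solve 3 (λ g q h → g := g :+ q :* h :+ q :* (⊝ h)) ≋-refl g (q^ n) h) (⊞-cong (≋-sym e) ≋-refl))

≈-trans : ∀ {f g h n} → f ≈[ n ] g → g ≈[ n ] h → f ≈[ n ] h
≈-trans {f} {g} {h} {n} (modq a e) (modq b e′) = modq (b ⊞ a) (≋-trans e (≋-trans (⊞-cong e′ ≋-refl)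
  (solve 4 (λ h q b a → h :+ q :* b :+ q :* a := h :+ q :* (b :+ a)) ≋-refl h (q^ n) b a)))

≈-⊞ : ∀ {f f′ g g′ n} → f ≈[ n ] f′ → g ≈[ n ] g′ → f ⊞ g ≈[ n ] f′ ⊞ g′
≈-⊞ {f′ = f′} {g′ = g′} {n} (modq a e) (modq b e′) = modq (a ⊞ b) (≋-trans (⊞-cong e e′)
  (solve 5 (λ f g q a b → f :+ q :* a :+ (g :+ q :* b) := f :+ g :+ q :* (a :+ b)) ≋-refl f′ g′ (q^ n) a b))

≈-∙ : ∀ {f f′ g g′ n} → f ≈[ n ] f′ → g ≈[ n ] g′ → f ∙ g ≈[ n ] f′ ∙ g′
≈-∙ {f′ = f′} {g′ = g′} {n} (modq a e) (modq b e′) = modq (f′ ∙ b ⊞ a ∙ g′ ⊞ q^ n ∙ a ∙ b) (≋-trans (∙-cong e e′)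
  (solve 5 (λ f g q a b → (f :+ q :* a) :* (g :+ q :* b) := f :* g :+ q :* (f :* b :+ a :* g :+ q :* a :* b)) ≋-refl f′ g′ (q^ n) a b))

≈-~ : ∀ {f g n} → f ≈[ n ] g → ~ f ≈[ n ] ~ g
≈-~ {g = g} {n} (modq a e) = modq (~ a) (≋-trans (~-cong e) (solve 3 (λ g q a → ⊝ (g :+ q :* a) := ⊝ g :+ q :* (⊝ a)) ≋-refl g (q^ n) a))

-- f⁻¹ = f⁻¹ g g⁻¹ is congruent to f⁻¹ f g⁻¹ = g⁻¹.
≈-⁻¹ : ∀ {f g n} → Unit f → Unit g → f ≈[ n ] g → f ⁻¹ ≈[ n ] g ⁻¹
≈-⁻¹ {f} {g} {n} u v p = ≈-trans (≋⇒≈ (≋-trans (solve 1 (λ i → i := i :* ′ 1) ≋-refl (f ⁻¹)) (∙-cong ≋-refl (≋-sym (∙-inverse v)))))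
  (≈-trans (≈-∙ ≈-refl (≈-∙ (≈-sym p) ≈-refl))
  (≋⇒≈ (≋-trans (solve 3 (λ f i j → i :* (f :* j) := f :* i :* j) ≋-refl f (f ⁻¹) (g ⁻¹)) (≋-trans (∙-cong (∙-inverse u) ≋-refl) (∙-identityˡ (g ⁻¹))))))

≈-weaken : ∀ {f g m n} → m ≤ n → f ≈[ n ] g → f ≈[ m ] g
≈-weaken {f} {g} {m} {n} m≤n p = ≈-intro m λ i i<m → ≈-at p i (≤-trans i<m m≤n)

-- The factor q^w gains w places of precision; the limits of sums below rest on this gain.
q^-≈ : ∀ {f g n} w → f ≈[ n ] g → q^ w ∙ f ≈[ w + n ] q^ w ∙ g
q^-≈ {f} {g} {n} w (modq a e) = modq a (≋-trans (∙-cong ≋-refl e) (≋-trans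
  (solve 4 (λ w g q a → w :* (g :+ q :* a) := w :* g :+ w :* q :* a) ≋-refl (q^ w) g (q^ n) a)
  (⊞-cong ≋-refl (∙-cong (≋-sym (q^-+ w n)) ≋-refl))))

q^-small : ∀ {n} w f → n ≤ w → q^ w ∙ f ≈[ n ] 𝟘
q^-small w f n≤w = ≈-weaken n≤w (modq f (≋-sym (⊞-identityˡ _)))

q^-cong : ∀ {i j} → i ≡ j → q^ i ≋ q^ j
q^-cong p = ≋-reflexive (cong q^ p)

-- Finite and infinite sums and products

Σ< Π< : ℕ → (ℕ → Series) → Series
Σ< zero    F = 𝟘
Σ< (suc n) F = Σ< n F ⊞ F n
Π< zero    F = 𝟙
Π< (suc n) F = Π< n F ∙ F n

Σ-≈ : ∀ {m} n {F G} → (∀ i → i < n → F i ≈[ m ] G i) → Σ< n F ≈[ m ] Σ< n G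
Σ-≈ zero    p = ≈-refl
Σ-≈ (suc n) p = ≈-⊞ (Σ-≈ n λ i i<n → p i (ℕₚ.m≤n⇒m≤1+n i<n)) (p n ≤-refl)

Π-≈ : ∀ {m} n {F G} → (∀ i → i < n → F i ≈[ m ] G i) → Π< n F ≈[ m ] Π< n G
Π-≈ zero    p = ≈-refl
Π-≈ (suc n) p = ≈-∙ (Π-≈ n λ i i<n → p i (ℕₚ.m≤n⇒m≤1+n i<n)) (p n ≤-refl)

Σ-cong : ∀ n {F G} → (∀ i → i < n → F i ≋ G i) → Σ< n F ≋ Σ< n G
Σ-cong n p = ≈-all λ _ → Σ-≈ n λ i i<n → ≋⇒≈ (p i i<n)

Π-cong : ∀ n {F G} → (∀ i → i < n → F i ≋ G i) → Π< n F ≋ Π< n G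
Π-cong n p = ≈-all λ _ → Π-≈ n λ i i<n → ≋⇒≈ (p i i<n)

Σ-∙ : ∀ n c F → c ∙ Σ< n F ≋ Σ< n (λ i → c ∙ F i)
Σ-∙ zero    c F = ∙-zeroʳ c
Σ-∙ (suc n) c F = ≋-trans (solve 3 (λ c s f → c :* (s :+ f) := c :* s :+ c :* f) ≋-refl c (Σ< n F) (F n)) (⊞-cong (Σ-∙ n c F) ≋-refl)

Σ-⊞ : ∀ n F G → Σ< n (λ i → F i ⊞ G i) ≋ Σ< n F ⊞ Σ< n G
Σ-⊞ zero    F G = ≋-sym (⊞-identityˡ 𝟘)
Σ-⊞ (suc n) F G = ≋-trans (⊞-cong (Σ-⊞ n F G) ≋-refl)
  (solve 4 (λ a b c d → a :+ b :+ (c :+ d) := a :+ c :+ (b :+ d)) ≋-refl (Σ< n F) (Σ< n G) (F n) (G n))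

Π-∙ : ∀ n F G → Π< n (λ i → F i ∙ G i) ≋ Π< n F ∙ Π< n G
Π-∙ zero    F G = ≋-sym (∙-identityˡ 𝟙)
Π-∙ (suc n) F G = ≋-trans (∙-cong (Π-∙ n F G) ≋-refl)
  (solve 4 (λ a b c d → a :* b :* (c :* d) := a :* c :* (b :* d)) ≋-refl (Π< n F) (Π< n G) (F n) (G n))

Σ-split : ∀ m n F → Σ< (m + n) F ≋ Σ< m F ⊞ Σ< n (λ i → F (m + i))
Σ-split m zero    F = ≋-trans (≋-reflexive (cong (λ k → Σ< k F) (ℕₚ.+-identityʳ m))) (≋-sym (⊞-identityʳ _))
Σ-split m (suc n) F = ≋-trans (≋-reflexive (cong (λ k → Σ< k F) (ℕₚ.+-suc m n)))
  (≋-trans (⊞-cong (Σ-split m n F) ≋-refl) (⊞-assoc _ _ _))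

Π-split : ∀ m n F → Π< (m + n) F ≋ Π< m F ∙ Π< n (λ i → F (m + i))
Π-split m zero    F = ≋-trans (≋-reflexive (cong (λ k → Π< k F) (ℕₚ.+-identityʳ m))) (≋-sym (∙-identityʳ _))
Π-split m (suc n) F = ≋-trans (≋-reflexive (cong (λ k → Π< k F) (ℕₚ.+-suc m n)))
  (≋-trans (∙-cong (Π-split m n F) ≋-refl) (∙-assoc _ _ _))

Σ-head : ∀ n F → Σ< (suc n) F ≋ F 0 ⊞ Σ< n (λ i → F (suc i))
Σ-head n F = ≋-trans (Σ-split 1 n F) (⊞-cong (⊞-identityˡ (F 0)) ≋-refl)

Π-head : ∀ n F → Π< (suc n) F ≋ F 0 ∙ Π< n (λ i → F (suc i))
Π-head n F = ≋-trans (Π-split 1 n F) (∙-cong (∙-identityˡ (F 0)) ≋-refl)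

Π-reverse : ∀ n F → Π< n F ≋ Π< n (λ i → F (n ∸ suc i))
Π-reverse zero    F = ≋-refl
Π-reverse (suc n) F = ≋-trans (∙-comm (Π< n F) (F n)) (≋-trans (∙-cong ≋-refl (Π-reverse n F))
  (≋-sym (Π-head n λ i → F (n ∸ i))))

Σ-reverse : ∀ n F → Σ< n F ≋ Σ< n (λ i → F (n ∸ suc i))
Σ-reverse zero    F = ≋-refl
Σ-reverse (suc n) F = ≋-trans (⊞-comm (Σ< n F) (F n)) (≋-trans (⊞-cong ≋-refl (Σ-reverse n F))
  (≋-sym (Σ-head n λ i → F (n ∸ i))))

Π-Unit′ : ∀ n {F} → (∀ i → i < n → Unit (F i)) → Unit (Π< n F)
Π-Unit′ zero    u = Unit-𝟙
Π-Unit′ (suc n) u = Unit-∙ (Π-Unit′ n λ i i<n → u i (ℕₚ.m≤n⇒m≤1+n i<n)) (u n ≤-refl)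

Π-⁻¹′ : ∀ n {F} → (∀ i → i < n → Unit (F i)) → Π< n (λ i → F i ⁻¹) ≋ (Π< n F) ⁻¹
Π-⁻¹′ zero    u = ≋-sym (⁻¹-unique (∙-identityˡ 𝟙))
Π-⁻¹′ (suc n) u = ≋-trans (∙-cong (Π-⁻¹′ n λ i i<n → u i (ℕₚ.m≤n⇒m≤1+n i<n)) ≋-refl)
  (≋-sym (⁻¹-∙ (Π-Unit′ n λ i i<n → u i (ℕₚ.m≤n⇒m≤1+n i<n)) (u n ≤-refl)))

Π-Unit : ∀ n {F} → (∀ i → Unit (F i)) → Unit (Π< n F)
Π-Unit n u = Π-Unit′ n λ i _ → u i

Π-⁻¹ : ∀ n {F} → (∀ i → Unit (F i)) → Π< n (λ i → F i ⁻¹) ≋ (Π< n F) ⁻¹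
Π-⁻¹ n u = Π-⁻¹′ n λ i _ → u i

-- Substitutes n = j + k and sums over k first: after an expansion in partial fractions j is the
-- pole, which has to become the outer index.
Σ-triangle : ∀ M (F : ℕ → ℕ → Series) → Σ< M (λ n → Σ< (suc n) (F n)) ≋ Σ< M (λ j → Σ< (M ∸ j) (λ k → F (j + k) j))
Σ-triangle zero    F = ≋-refl
Σ-triangle (suc M) F = begin
  Σ< M (λ n → Σ< (suc n) (F n)) ⊞ (Σ< M (F M) ⊞ F M M)
    ≈⟨ ⊞-cong (Σ-triangle M F) ≋-refl ⟩
  Σ< M (λ j → Σ< (M ∸ j) (λ k → F (j + k) j)) ⊞ (Σ< M (F M) ⊞ F M M)
    ≈⟨ ⊞-assoc _ _ _ ⟨
  Σ< M (λ j → Σ< (M ∸ j) (λ k → F (j + k) j)) ⊞ Σ< M (F M) ⊞ F M M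
    ≈⟨ ⊞-cong (Σ-⊞ M _ _) ≋-refl ⟨
  Σ< M (λ j → Σ< (M ∸ j) (λ k → F (j + k) j) ⊞ F M j) ⊞ F M M
    ≈⟨ ⊞-cong (Σ-cong M (λ j j<M → ≋-reflexive (inner j (ℕₚ.<⇒≤ j<M)))) (≋-sym (≋-trans (≋-reflexive last) (⊞-identityˡ (F M M)))) ⟩
  Σ< M (λ j → Σ< (suc M ∸ j) (λ k → F (j + k) j)) ⊞ Σ< (suc M ∸ M) (λ k → F (M + k) M) ∎
  where
    inner : ∀ j → j ≤ M → Σ< (M ∸ j) (λ k → F (j + k) j) ⊞ F M j ≡ Σ< (suc M ∸ j) (λ k → F (j + k) j)
    inner j j≤M = ≡.trans (cong (λ i → Σ< (M ∸ j) (λ k → F (j + k) j) ⊞ F i j) (≡.sym (ℕₚ.m+[n∸m]≡n j≤M)))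
                  (cong (λ i → Σ< i (λ k → F (j + k) j)) (≡.sym (ℕₚ.+-∸-assoc 1 j≤M)))
    last : Σ< (suc M ∸ M) (λ k → F (M + k) M) ≡ 𝟘 ⊞ F M M
    last = ≡.trans (cong (λ i → Σ< i (λ k → F (M + k) M)) (ℕₚ.m+n∸n≡m 1 M)) (cong (λ i → 𝟘 ⊞ F i M) (ℕₚ.+-identityʳ M))

Σ-diagonal : ∀ M (F : ℕ → ℕ → Series) → Σ< M (λ n → Σ< (suc n) (F n)) ≋ Σ< M (λ d → Σ< (M ∸ d) (λ k → F (d + k) k))
Σ-diagonal M F = ≋-trans (Σ-cong M λ n _ → Σ-reverse (suc n) (F n)) (≋-trans (Σ-triangle M (λ n j → F n (n ∸ j)))
  (Σ-cong M λ d _ → Σ-cong (M ∸ d) λ k _ → ≋-reflexive (cong (F (d + k)) (ℕₚ.m+n∸m≡n d k))))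

-- A family is summable if its k-th term vanishes modulo q^(k-1); accordingly the
-- N-th coefficient of its sum involves the terms with index at most N + 1.
record Small (F : ℕ → Series) : Set where
  constructor small
  field vanish : ∀ k → F (suc k) ≈[ k ] 𝟘
open Small public

∑ : (ℕ → Series) → Series
∑ F N = Σ< (2 + N) F N

record Near1 (F : ℕ → Series) : Set where
  constructor near1
  field approx : ∀ k → F k ≈[ k ] 𝟙
open Near1 public

∏ : (ℕ → Series) → Series
∏ F N = Π< (suc N) F N

Σ-tail : ∀ {F n} m → Small F → Σ< (m + suc n) F ≈[ n ] Σ< (suc n) F
Σ-tail zero        s = ≈-refl
Σ-tail {F} {n} (suc m) s = ≈-trans (≈-⊞ (Σ-tail m s) (≈-trans (≋⇒≈ (≋-reflexive (cong F (ℕₚ.+-suc m n)))) (≈-weaken (m≤n+m n m) (vanish s (m + n)))))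
  (≋⇒≈ (⊞-identityʳ _))

∑-limit : ∀ {F n} M → n < M → Small F → ∑ F ≈[ n ] Σ< M F
∑-limit {F} {n} M n<M s = ≈-intro n λ i i<n → ≡.trans
  (≡.sym (≈-at (Σ-tail {F} {suc i} (M ∸ (2 + i)) s) i ≤-refl))
  (cong (λ k → Σ< k F i) (ℕₚ.m∸n+n≡m (≤-trans (s≤s i<n) n<M)))

-- For each n one partial sum with more than n terms is enough to compare with. Rules for infinite
-- sums are inherited from finite sums in this way.
∑-unique : ∀ {F g} → Small F → (∀ n → ∃ λ M → n < M × g ≈[ n ] Σ< M F) → g ≋ ∑ F
∑-unique s h = ≈-all λ n → let (M , n<M , p) = h n in ≈-trans p (≈-sym (∑-limit M n<M s))

∑-cong : ∀ {F G} → (∀ k → F k ≋ G k) → ∑ F ≋ ∑ G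
∑-cong {F} {G} p = pw λ N → at (Σ-cong (2 + N) {F} {G} λ i _ → p i) N

Small-∙ : ∀ {F} c → Small F → Small (λ k → c ∙ F k)
Small-∙ c s = small λ k → ≈-trans (≈-∙ ≈-refl (vanish s k)) (≋⇒≈ (∙-zeroʳ c))

Small-⊞ : ∀ {F G} → Small F → Small G → Small (λ k → F k ⊞ G k)
Small-⊞ s t = small λ k → ≈-trans (≈-⊞ (vanish s k) (vanish t k)) (≋⇒≈ (⊞-identityˡ 𝟘))

Small-q^ : ∀ (e : ℕ → ℕ) (F : ℕ → Series) → (∀ k → k ≤ e (suc k)) → Small (λ k → q^ (e k) ∙ F k)
Small-q^ e F le = small λ k → q^-small (e (suc k)) (F (suc k)) (le k)

Small-≋ : ∀ {F G} → (∀ k → F k ≋ G k) → Small F → Small G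
Small-≋ p s = small λ k → ≈-trans (≋⇒≈ (≋-sym (p (suc k)))) (vanish s k)

∑-∙ : ∀ {F} c → Small F → c ∙ ∑ F ≋ ∑ (λ k → c ∙ F k)
∑-∙ {F} c s = ∑-unique (Small-∙ c s) λ n → suc n , ≤-refl , ≈-trans (≈-∙ ≈-refl (∑-limit (suc n) ≤-refl s)) (≋⇒≈ (Σ-∙ (suc n) c F))

opaque
  unfolding _⊞_
  ∑-⊞ : ∀ F G → ∑ (λ k → F k ⊞ G k) ≋ ∑ F ⊞ ∑ G
  ∑-⊞ F G = pw λ N → at (Σ-⊞ (2 + N) F G) N

∑-head : ∀ {F} → Small F → ∑ F ≋ F 0 ⊞ ∑ (λ k → F (suc k))
∑-head {F} s = ≈-all λ n → ≈-trans (∑-limit (2 + n) (s≤s (ℕₚ.n≤1+n n)) s)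
  (≈-trans (≋⇒≈ (Σ-head (suc n) F)) (≈-⊞ ≈-refl (≈-sym (∑-limit (suc n) ≤-refl (small λ k → ≈-weaken (ℕₚ.n≤1+n k) (vanish s (suc k)))))))

Π-tail : ∀ {F n} m → Near1 F → Π< (m + n) F ≈[ n ] Π< n F
Π-tail zero    s = ≈-refl
Π-tail {F} {n} (suc m) s = ≈-trans (≈-∙ (Π-tail m s) (≈-weaken (m≤n+m n m) (approx s (m + n)))) (≋⇒≈ (∙-identityʳ _))

∏-limit : ∀ {F n} M → n ≤ M → Near1 F → ∏ F ≈[ n ] Π< M F
∏-limit {F} {n} M n≤M s = ≈-intro n λ i i<n → ≡.trans
  (≡.sym (≈-at (Π-tail {F} {suc i} (M ∸ suc i) s) i ≤-refl))
  (cong (λ k → Π< k F i) (ℕₚ.m∸n+n≡m (≤-trans i<n n≤M)))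

∏-cong : ∀ {F G} → (∀ k → F k ≋ G k) → ∏ F ≋ ∏ G
∏-cong {F} {G} p = pw λ N → at (Π-cong (suc N) {F} {G} λ i _ → p i) N

∏-Unit : ∀ {F} → (∀ k → Unit (F k)) → Unit (∏ F)
∏-Unit u = unit (const≢0 (Π-Unit 1 u))

∏-∙ : ∀ {F G} → Near1 F → Near1 G → ∏ (λ k → F k ∙ G k) ≋ ∏ F ∙ ∏ G
∏-∙ {F} {G} s t = ≈-all λ n → ≈-trans
  (∏-limit n ≤-refl (near1 λ k → ≈-trans (≈-∙ (approx s k) (approx t k)) (≋⇒≈ (∙-identityˡ 𝟙))))
  (≈-trans (≋⇒≈ (Π-∙ n F G)) (≈-sym (≈-∙ (∏-limit n ≤-refl s) (∏-limit n ≤-refl t))))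

-- Partial fractions

module _ {P : Set} where
  ΣL ΠL : List P → (P → Series) → Series
  ΣL []      F = 𝟘
  ΣL (p ∷ l) F = F p ⊞ ΣL l F
  ΠL []      F = 𝟙
  ΠL (p ∷ l) F = F p ∙ ΠL l F

  ΣL-cong : ∀ l {F G} → (∀ p → p ∈ l → F p ≋ G p) → ΣL l F ≋ ΣL l G
  ΣL-cong []      h = ≋-refl
  ΣL-cong (p ∷ l) h = ⊞-cong (h p (here ≡.refl)) (ΣL-cong l λ i i∈l → h i (there i∈l))

  ΣL-∙ : ∀ l c F → c ∙ ΣL l F ≋ ΣL l (λ i → c ∙ F i)
  ΣL-∙ []      c F = ∙-zeroʳ c
  ΣL-∙ (p ∷ l) c F = ≋-trans (solve 3 (λ c s f → c :* (f :+ s) := c :* f :+ c :* s) ≋-refl c (ΣL l F) (F p)) (⊞-cong ≋-refl (ΣL-∙ l c F))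

  ΣL-⊞ : ∀ l F G → ΣL l (λ i → F i ⊞ G i) ≋ ΣL l F ⊞ ΣL l G
  ΣL-⊞ []      F G = ≋-sym (⊞-identityˡ 𝟘)
  ΣL-⊞ (p ∷ l) F G = ≋-trans (⊞-cong ≋-refl (ΣL-⊞ l F G))
    (solve 4 (λ a b c d → a :+ b :+ (c :+ d) := a :+ c :+ (b :+ d)) ≋-refl (F p) (G p) (ΣL l F) (ΣL l G))

  ΣL-++ : ∀ l m F → ΣL (l ++ m) F ≋ ΣL l F ⊞ ΣL m F
  ΣL-++ []      m F = ≋-sym (⊞-identityˡ _)
  ΣL-++ (p ∷ l) m F = ≋-trans (⊞-cong ≋-refl (ΣL-++ l m F)) (≋-sym (⊞-assoc _ _ _))

  ΠL-++ : ∀ l m F → ΠL (l ++ m) F ≋ ΠL l F ∙ ΠL m F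
  ΠL-++ []      m F = ≋-sym (∙-identityˡ _)
  ΠL-++ (p ∷ l) m F = ≋-trans (∙-cong ≋-refl (ΠL-++ l m F)) (≋-sym (∙-assoc _ _ _))

  ΣL-downFrom : ∀ (h : ℕ → P) n F → ΣL (List.map h (List.downFrom n)) F ≋ Σ< n (λ i → F (h i))
  ΣL-downFrom h zero    F = ≋-refl
  ΣL-downFrom h (suc n) F = ≋-trans (⊞-cong ≋-refl (ΣL-downFrom h n F)) (⊞-comm _ _)

  ΠL-downFrom : ∀ (h : ℕ → P) n F → ΠL (List.map h (List.downFrom n)) F ≋ Π< n (λ i → F (h i))
  ΠL-downFrom h zero    F = ≋-refl
  ΠL-downFrom h (suc n) F = ≋-trans (∙-cong ≋-refl (ΠL-downFrom h n F)) (∙-comm _ _)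

  module _ (c : P → P → Series) (c-refl : ∀ p → c p p ≋ 𝟙) where
    -- The partial fraction of a product of two simple poles: `x p` plays the role of the reciprocal
    -- of a factor linear in X, and `c i p` is its value at the pole of `x i`.
    TwoPole : (P → Series) → P → P → Set
    TwoPole x p i = x p ∙ x i ≋ x i ∙ c i p ⊞ x p ∙ c p i

    -- Induction on the poles: multiply the expansion over the rest by `x p` and split each
    -- `x p ∙ x i`. The coefficient that collects at `x p` is the expansion over the rest evaluated
    -- at the pole p, that is, the induction hypothesis for `c p` in place of `x`; hence the
    -- statement for every `x` with the two-pole property. The convention `c p p ≋ 𝟙` drops the
    -- factor of the pole itself.
    lagrange : (∀ r p i → r ≢ p → r ≢ i → p ≢ i → TwoPole (c r) p i) →
      ∀ p l → Unique (p ∷ l) → ∀ x → (∀ r i → r ≢ i → r ∈ p ∷ l → i ∈ p ∷ l → TwoPole x r i) →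
      ΠL (p ∷ l) x ≋ ΣL (p ∷ l) (λ i → x i ∙ ΠL (p ∷ l) (c i))
    lagrange tp p []       u x tx = ≋-trans (solve 1 (λ x → x :* ′ 1 := x :* (′ 1 :* ′ 1) :+ ′ 0) ≋-refl (x p))
      (⊞-cong (∙-cong ≋-refl (∙-cong (≋-sym (c-refl p)) ≋-refl)) ≋-refl)
    lagrange tp p (p′ ∷ l′) (p∉l ∷ u) x tx = begin
      x p ∙ ΠL l x
        ≈⟨ ∙-cong ≋-refl (lagrange tp p′ l′ u x λ r i r≢i r∈l i∈l → tx r i r≢i (there r∈l) (there i∈l)) ⟩
      x p ∙ ΣL l (λ i → x i ∙ ΠL l (c i))
        ≈⟨ ΣL-∙ l (x p) _ ⟩
      ΣL l (λ i → x p ∙ (x i ∙ ΠL l (c i)))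
        ≈⟨ ΣL-cong l (λ i i∈l → ≋-trans (≋-sym (∙-assoc _ _ _)) (≋-trans
             (∙-cong (tx p i (All.lookup p∉l i∈l) (here ≡.refl) (there i∈l)) ≋-refl)
             (solve 5 (λ xp xi a b w → (xi :* a :+ xp :* b) :* w := xi :* (a :* w) :+ xp :* (b :* w)) ≋-refl (x p) (x i) (c i p) (c p i) (ΠL l (c i))))) ⟩
      ΣL l (λ i → x i ∙ (c i p ∙ ΠL l (c i)) ⊞ x p ∙ (c p i ∙ ΠL l (c i)))
        ≈⟨ ΣL-⊞ l _ _ ⟩
      ΣL l (λ i → x i ∙ (c i p ∙ ΠL l (c i))) ⊞ ΣL l (λ i → x p ∙ (c p i ∙ ΠL l (c i)))
        ≈⟨ ⊞-comm _ _ ⟩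
      ΣL l (λ i → x p ∙ (c p i ∙ ΠL l (c i))) ⊞ ΣL l (λ i → x i ∙ (c i p ∙ ΠL l (c i)))
        ≈⟨ ⊞-cong (≋-trans (≋-sym (ΣL-∙ l (x p) _)) (∙-cong ≋-refl (≋-trans (≋-sym residues) (≋-trans (≋-sym (∙-identityˡ _)) (∙-cong (≋-sym (c-refl p)) ≋-refl))))) ≋-refl ⟩
      x p ∙ (c p p ∙ ΠL l (c p)) ⊞ ΣL l (λ i → x i ∙ (c i p ∙ ΠL l (c i))) ∎
      where
        l = p′ ∷ l′
        residues : ΠL l (c p) ≋ ΣL l (λ i → c p i ∙ ΠL l (c i))
        residues = lagrange tp p′ l′ u (c p) λ r i r≢i r∈l i∈l → tp p r i (All.lookup p∉l r∈l) (All.lookup p∉l i∈l) r≢i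

module _ (c : ℕ ⊎ ℕ → ℕ ⊎ ℕ → Series) (c-refl : ∀ p → c p p ≋ 𝟙)
         (tp : ∀ r p i → r ≢ p → r ≢ i → p ≢ i → TwoPole c c-refl (c r) p i) where

  private
    nodes : ℕ → ℕ → List (ℕ ⊎ ℕ)
    nodes n m = List.map inj₁ (List.downFrom n) ++ List.map inj₂ (List.downFrom m)

    nodes-unique : ∀ n m → Unique (nodes n m)
    nodes-unique n m = Uniqueₚ.++⁺ (Uniqueₚ.map⁺ (λ { ≡.refl → ≡.refl }) (Uniqueₚ.downFrom⁺ n)) (Uniqueₚ.map⁺ (λ { ≡.refl → ≡.refl }) (Uniqueₚ.downFrom⁺ m))
      λ (p , r) → disjoint (∈-map⁻ inj₁ p) (∈-map⁻ inj₂ r)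
      where
        disjoint : ∀ {v : ℕ ⊎ ℕ} {l l′ : List ℕ} → (∃ λ i → i ∈ l × v ≡ inj₁ i) → (∃ λ j → j ∈ l′ × v ≡ inj₂ j) → ⊥
        disjoint (_ , _ , ≡.refl) (_ , _ , ())

    Π-nodes : ∀ n m F → ΠL (nodes n m) F ≋ Π< n (λ i → F (inj₁ i)) ∙ Π< m (λ j → F (inj₂ j))
    Π-nodes n m F = ≋-trans (ΠL-++ (List.map inj₁ (List.downFrom n)) _ F) (∙-cong (ΠL-downFrom inj₁ n F) (ΠL-downFrom inj₂ m F))

  partialFractions : ∀ n m x → (∀ p i → p ≢ i → TwoPole c c-refl x p i) →
    Π< (suc n) (λ i → x (inj₁ i)) ∙ Π< m (λ j → x (inj₂ j)) ≋
    Σ< (suc n) (λ i → x (inj₁ i) ∙ (Π< (suc n) (λ k → c (inj₁ i) (inj₁ k)) ∙ Π< m (λ k → c (inj₁ i) (inj₂ k)))) ⊞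
    Σ< m (λ j → x (inj₂ j) ∙ (Π< (suc n) (λ k → c (inj₂ j) (inj₁ k)) ∙ Π< m (λ k → c (inj₂ j) (inj₂ k))))
  partialFractions n m x tx = begin
    Π< (suc n) (λ i → x (inj₁ i)) ∙ Π< m (λ j → x (inj₂ j))
      ≈⟨ Π-nodes (suc n) m x ⟨
    ΠL (nodes (suc n) m) x
      ≈⟨ lagrange c c-refl tp (inj₁ n) _ (nodes-unique (suc n) m) x (λ r i r≢i _ _ → tx r i r≢i) ⟩
    ΣL (nodes (suc n) m) (λ i → x i ∙ ΠL (nodes (suc n) m) (c i))
      ≈⟨ ΣL-++ (List.map inj₁ (List.downFrom (suc n))) _ _ ⟩
    _
      ≈⟨ ⊞-cong (≋-trans (ΣL-downFrom inj₁ (suc n) _) (Σ-cong (suc n) λ i _ → ∙-cong ≋-refl (Π-nodes (suc n) m (c (inj₁ i)))))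
                (≋-trans (ΣL-downFrom inj₂ m _) (Σ-cong m λ i _ → ∙-cong ≋-refl (Π-nodes (suc n) m (c (inj₂ i))))) ⟩
    _ ∎

-- A point (t , T) stands for the value T / t.  A node u has value u + 1/u, and the
-- point (1 , X) evaluates 1 / (1 - X u + u²).
Point : Set
Point = Series × Series

det : Point → Point → Series
det (t , T) (t′ , T′) = t ∙ T′ ⊟ t′ ∙ T

-- Any three vectors in the plane satisfy k det(p,i) + p det(i,k) + i det(k,p) = 0. This is its
-- first coordinate, multiplied by t_k, after the denominators have been cleared and cancelled.
twoPole : ∀ (k p i : Point) {kp ki ip pi} → Regular (det k p) → Regular (det k i) → Regular (det p i) →
  det k p ∙ kp ≋ proj₁ k → det k i ∙ ki ≋ proj₁ k → det i p ∙ ip ≋ proj₁ i → det p i ∙ pi ≋ proj₁ p →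
  kp ∙ ki ≋ ki ∙ ip ⊞ kp ∙ pi
twoPole k@(tk , Tk) p@(tp , Tp) i@(ti , Ti) {kp} {ki} {ip} {pi} rkp rki rpi ekp eki eip epi =
  ∙-regular rkp (∙-regular rki rpi) (begin
    det k p ∙ (det k i ∙ det p i) ∙ (kp ∙ ki)
      ≈⟨ solve 5 (λ a b c x y → a :* (b :* c) :* (x :* y) := a :* x :* (b :* y) :* c) ≋-refl (det k p) (det k i) (det p i) kp ki ⟩
    det k p ∙ kp ∙ (det k i ∙ ki) ∙ det p i
      ≈⟨ ∙-cong (∙-cong ekp eki) ≋-refl ⟩
    tk ∙ tk ∙ det p i
      ≈⟨ solve 6 (λ tk Tk tp Tp ti Ti → tk :* tk :* (tp :* Ti :- ti :* Tp) :=
           tk :* (⊝ ti) :* (tk :* Tp :- tp :* Tk) :+ tk :* tp :* (tk :* Ti :- ti :* Tk)) ≋-refl tk Tk tp Tp ti Ti ⟩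
    tk ∙ (~ ti) ∙ det k p ⊞ tk ∙ tp ∙ det k i
      ≈⟨ ⊞-cong (∙-cong (∙-cong eki (~-cong eip)) ≋-refl) (∙-cong (∙-cong ekp epi) ≋-refl) ⟨
    det k i ∙ ki ∙ (~ (det i p ∙ ip)) ∙ det k p ⊞ det k p ∙ kp ∙ (det p i ∙ pi) ∙ det k i
      ≈⟨ ⊞-cong (∙-cong (∙-cong ≋-refl (solve 5 (λ tp Tp ti Ti w → ⊝ ((ti :* Tp :- tp :* Ti) :* w) := (tp :* Ti :- ti :* Tp) :* w) ≋-refl tp Tp ti Ti ip)) ≋-refl) ≋-refl ⟩
    det k i ∙ ki ∙ (det p i ∙ ip) ∙ det k p ⊞ det k p ∙ kp ∙ (det p i ∙ pi) ∙ det k i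
      ≈⟨ solve 7 (λ a b c x y z w → b :* y :* (c :* z) :* a :+ a :* x :* (c :* w) :* b := a :* (b :* c) :* (y :* z :+ x :* w)) ≋-refl
           (det k p) (det k i) (det p i) kp ki ip pi ⟩
    det k p ∙ (det k i ∙ det p i) ∙ (ki ∙ ip ⊞ kp ∙ pi) ∎)

-- Nodes in arithmetic progression

-- The triangular numbers 0 + 1 + ... + (n - 1).
T : ℕ → ℕ
T zero    = 0
T (suc n) = T n + n

pow : Series → ℕ → Series
pow σ n = Π< n (λ _ → σ)

fac : Series → ℕ → Series
fac δ d = 𝟙 ⊟ δ ∙ q^ d

fac-cong : ∀ {δ d d′} → d ≡ d′ → fac δ d ≋ fac δ d′
fac-cong {δ} p = ≋-reflexive (cong (fac δ) p)

private
  opaque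
    unfolding _⊞_
    const-0 : ∀ δ d → (~ (δ ∙ q^ (suc d))) 0 ≡ 0ℚ
    const-0 δ d = cong ℚ.-_ (≡.trans (cong (δ 0 ℚ.*_) (q^-const d)) (ℚₚ.*-zeroʳ (δ 0)))

Unit-fac : ∀ {δ d} → 0 < d → Unit (fac δ d)
Unit-fac {δ} {suc d} _ = Unit-⊞ 𝟙 (~ (δ ∙ q^ (suc d))) (const-0 δ d) Unit-𝟙

fac-minus : ∀ d → fac (~ 𝟙) d ≋ 𝟙 ⊞ q^ d
fac-minus d = solve 1 (λ x → ′ 1 :- (⊝ ′ 1) :* x := ′ 1 :+ x) ≋-refl (q^ d)

Unit-fac-minus-zero : Unit (fac (~ 𝟙) 0)
Unit-fac-minus-zero = Unit-≋ (≋-sym (≋-trans (fac-minus 0) (≋-trans (⊞-cong ≋-refl q^-zero) (solve 0 (′ 1 :+ ′ 1 := ′ 2) ≋-refl)))) (Unit-K λ ())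

-- The shifted factorial (δ q^x ; q^m)_n.
P : Series → ℕ → ℕ → ℕ → Series
P δ x m n = Π< n (λ k → fac δ (x + m * k))

Unit-P : ∀ δ x m n → 0 < x → Unit (P δ x m n)
Unit-P δ x m n 0<x = Π-Unit n λ k → Unit-fac (≤-trans 0<x (m≤m+n x (m * k)))

P-split : ∀ δ x m j n → P δ x m j ∙ P δ (x + m * j) m n ≋ P δ x m (j + n)
P-split δ x m j n = ≋-sym (≋-trans (Π-split j n _) (∙-cong ≋-refl (Π-cong n λ k _ → fac-cong (shuffle x m j k))))
  where
    shuffle : ∀ x m j k → x + m * (j + k) ≡ x + m * j + m * k
    shuffle = solve-∀

-- The power series 1 / (1 - δ q^(b - a)); for b < a it is - δ⁻¹ q^(a - b) / (1 - δ⁻¹ q^(a - b)).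
gap : Series → ℕ → ℕ → Series
gap δ zero    b       = fac δ b ⁻¹
gap δ (suc a) zero    = ~ δ ∙ q^ (suc a) ∙ fac δ (suc a) ⁻¹
gap δ (suc a) (suc b) = gap δ a b

gap-up : ∀ δ a d → gap δ a (a + d) ≡ fac δ d ⁻¹
gap-up δ zero    d = ≡.refl
gap-up δ (suc a) d = gap-up δ a d

gap-down : ∀ δ b d → gap δ (b + suc d) b ≡ ~ δ ∙ q^ (suc d) ∙ fac δ (suc d) ⁻¹
gap-down δ zero    d = ≡.refl
gap-down δ (suc b) d = gap-down δ b d

-- For u = ε q^a and v = ε δ q^b this is u divided by the determinant of the two nodes, the value at
-- the pole of u of the reciprocal factor of v.
cf : Series → ℕ → ℕ → Series
cf δ a b = gap δ a b ∙ fac δ (a + b) ⁻¹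

data Gap : ℕ → ℕ → Set where
  up   : ∀ a d → Gap a (a + d)
  down : ∀ b d → Gap (b + suc d) b

gap? : ∀ a b → Gap a b
gap? a b with a ℕ.≤? b
... | yes a≤b = subst (Gap a) (ℕₚ.m+[n∸m]≡n a≤b) (up a (b ∸ a))
... | no a≰b = subst (λ i → Gap i b) eq (down b (a ∸ suc b))
  where
    eq : b + suc (a ∸ suc b) ≡ a
    eq = ≡.trans (ℕₚ.+-suc b _) (ℕₚ.m+[n∸m]≡n (ℕₚ.≰⇒> a≰b))

-- Either condition makes q^a - δ q^b a power of q times a unit.
Apart : Series → ℕ → ℕ → Set
Apart δ a b = Unit (fac δ 0) ⊎ a ≢ b

-- A node u = ε q^a is the point (u , 1 + u²).
node : Series → ℕ → Point
node ε a = ε ∙ q^ a , 𝟙 ⊞ q^ a ∙ q^ a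

module _ {δ : Series} (δ² : δ ∙ δ ≋ 𝟙) where
  private
    unit-up : ∀ a d → Apart δ a (a + d) → Unit (fac δ d)
    unit-up a zero    (inj₁ u) = u
    unit-up a zero    (inj₂ p) = ⊥-elim (p (≡.sym (ℕₚ.+-identityʳ a)))
    unit-up a (suc d) _        = Unit-fac (s≤s z≤n)

  unit-sum : ∀ a b → Apart δ a b → Unit (fac δ (a + b))
  unit-sum zero    zero    (inj₁ u) = u
  unit-sum zero    zero    (inj₂ p) = ⊥-elim (p ≡.refl)
  unit-sum zero    (suc b) _        = Unit-fac (s≤s z≤n)
  unit-sum (suc a) b       _        = Unit-fac (s≤s z≤n)

  private
    diff-up : ∀ a d → q^ a ⊟ δ ∙ q^ (a + d) ≋ q^ a ∙ fac δ d
    diff-up a d = ≋-trans (⊞-cong ≋-refl (~-cong (∙-cong ≋-refl (q^-+ a d))))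
      (solve 3 (λ x δ y → x :- δ :* (x :* y) := x :* (′ 1 :- δ :* y)) ≋-refl (q^ a) δ (q^ d))

    diff-down : ∀ b d → q^ (b + d) ⊟ δ ∙ q^ b ≋ q^ b ∙ (~ δ) ∙ fac δ d
    diff-down b d = begin
      q^ (b + d) ⊟ δ ∙ q^ b         ≈⟨ ⊞-cong (q^-+ b d) ≋-refl ⟩
      q^ b ∙ q^ d ⊟ δ ∙ q^ b        ≈⟨ solve 3 (λ x δ y → x :* y :- δ :* x := x :* (′ 1 :* y :- δ)) ≋-refl (q^ b) δ (q^ d) ⟩
      q^ b ∙ (𝟙 ∙ q^ d ⊟ δ)         ≈⟨ ∙-cong ≋-refl (⊞-cong (∙-cong δ² ≋-refl) ≋-refl) ⟨
      q^ b ∙ (δ ∙ δ ∙ q^ d ⊟ δ)     ≈⟨ solve 3 (λ x δ y → x :* (δ :* δ :* y :- δ) := x :* (⊝ δ) :* (′ 1 :- δ :* y)) ≋-refl (q^ b) δ (q^ d) ⟩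
      q^ b ∙ (~ δ) ∙ fac δ d        ∎

    Unit-~δ : Unit (~ δ)
    Unit-~δ = unit-factor {~ δ} {~ δ} (≋-trans (solve 1 (λ δ → (⊝ δ) :* (⊝ δ) := δ :* δ) ≋-refl δ) δ²)

  diff-regular : ∀ a b → Apart δ a b → Regular (q^ a ⊟ δ ∙ q^ b)
  diff-regular a b ap with gap? a b
  ... | up _ d   = regular-≋ (≋-sym (diff-up a d)) (∙-regular (q^-regular a) (unit-regular (unit-up a d ap)))
  ... | down _ d = regular-≋ (≋-sym (diff-down b (suc d)))
                     (∙-regular (∙-regular (q^-regular b) (unit-regular Unit-~δ)) (unit-regular (Unit-fac (s≤s z≤n))))

  diff-gap : ∀ a b → Apart δ a b → (q^ a ⊟ δ ∙ q^ b) ∙ gap δ a b ≋ q^ a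
  diff-gap a b ap with gap? a b
  ... | up _ d   = begin
    (q^ a ⊟ δ ∙ q^ (a + d)) ∙ gap δ a (a + d)   ≈⟨ ∙-cong (diff-up a d) (≋-reflexive (gap-up δ a d)) ⟩
    q^ a ∙ fac δ d ∙ fac δ d ⁻¹                 ≈⟨ ∙-assoc _ _ _ ⟩
    q^ a ∙ (fac δ d ∙ fac δ d ⁻¹)               ≈⟨ ∙-cong ≋-refl (∙-inverse (unit-up a d ap)) ⟩
    q^ a ∙ 𝟙                                    ≈⟨ ∙-identityʳ _ ⟩
    q^ a                                        ∎
  ... | down _ d = begin
    (q^ (b + suc d) ⊟ δ ∙ q^ b) ∙ gap δ (b + suc d) b
      ≈⟨ ∙-cong (diff-down b (suc d)) (≋-reflexive (gap-down δ b d)) ⟩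
    q^ b ∙ (~ δ) ∙ fac δ (suc d) ∙ (~ δ ∙ q^ (suc d) ∙ fac δ (suc d) ⁻¹)
      ≈⟨ solve 5 (λ x δ y f i → x :* (⊝ δ) :* f :* (⊝ δ :* y :* i) := x :* y :* (δ :* δ) :* (f :* i)) ≋-refl (q^ b) δ (q^ (suc d)) (fac δ (suc d)) (fac δ (suc d) ⁻¹) ⟩
    q^ b ∙ q^ (suc d) ∙ (δ ∙ δ) ∙ (fac δ (suc d) ∙ fac δ (suc d) ⁻¹)
      ≈⟨ ∙-cong (∙-cong (≋-sym (q^-+ b (suc d))) δ²) (∙-inverse (Unit-fac (s≤s z≤n))) ⟩
    q^ (b + suc d) ∙ 𝟙 ∙ 𝟙
      ≈⟨ solve 1 (λ x → x :* ′ 1 :* ′ 1 := x) ≋-refl _ ⟩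
    q^ (b + suc d) ∎

  module _ {ε ε′ : Series} (ε² : ε ∙ ε ≋ 𝟙) (εδ : ε ∙ δ ≋ ε′) where
    -- u (1 + v²) - v (1 + u²) = (u - v) (1 - u v), where the signs square to 1.
    det-node : ∀ a b → det (node ε a) (node ε′ b) ≋ ε ∙ (q^ a ⊟ δ ∙ q^ b) ∙ fac δ (a + b)
    det-node a b = begin
      ε ∙ q^ a ∙ (𝟙 ⊞ q^ b ∙ q^ b) ⊟ ε′ ∙ q^ b ∙ (𝟙 ⊞ q^ a ∙ q^ a)
        ≈⟨ ⊞-cong ≋-refl (~-cong (∙-cong (∙-cong (≋-sym εδ) ≋-refl) ≋-refl)) ⟩
      ε ∙ q^ a ∙ (𝟙 ⊞ q^ b ∙ q^ b) ⊟ ε ∙ δ ∙ q^ b ∙ (𝟙 ⊞ q^ a ∙ q^ a)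
        ≈⟨ solve 4 (λ ε δ a b → ε :* a :* (′ 1 :+ b :* b) :- ε :* δ :* b :* (′ 1 :+ a :* a) :=
                     ε :* a :* (′ 1 :+ ′ 1 :* b :* b) :- ε :* δ :* b :* (′ 1 :+ a :* a)) ≋-refl ε δ (q^ a) (q^ b) ⟩
      ε ∙ q^ a ∙ (𝟙 ⊞ 𝟙 ∙ q^ b ∙ q^ b) ⊟ ε ∙ δ ∙ q^ b ∙ (𝟙 ⊞ q^ a ∙ q^ a)
        ≈⟨ ⊞-cong (∙-cong ≋-refl (⊞-cong ≋-refl (∙-cong (∙-cong (≋-sym δ²) ≋-refl) ≋-refl))) ≋-refl ⟩
      ε ∙ q^ a ∙ (𝟙 ⊞ δ ∙ δ ∙ q^ b ∙ q^ b) ⊟ ε ∙ δ ∙ q^ b ∙ (𝟙 ⊞ q^ a ∙ q^ a)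
        ≈⟨ solve 4 (λ ε δ a b → ε :* a :* (′ 1 :+ δ :* δ :* b :* b) :- ε :* δ :* b :* (′ 1 :+ a :* a) :=
                     ε :* (a :- δ :* b) :* (′ 1 :- δ :* (a :* b))) ≋-refl ε δ (q^ a) (q^ b) ⟩
      ε ∙ (q^ a ⊟ δ ∙ q^ b) ∙ (𝟙 ⊟ δ ∙ (q^ a ∙ q^ b))
        ≈⟨ ∙-cong ≋-refl (⊞-cong ≋-refl (~-cong (∙-cong ≋-refl (≋-sym (q^-+ a b))))) ⟩
      ε ∙ (q^ a ⊟ δ ∙ q^ b) ∙ fac δ (a + b) ∎

    det-regular : ∀ a b → Apart δ a b → Regular (det (node ε a) (node ε′ b))
    det-regular a b ap = regular-≋ (≋-sym (det-node a b))
      (∙-regular (∙-regular (unit-regular (unit-factor ε²)) (diff-regular a b ap)) (unit-regular (unit-sum a b ap)))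

    det-cf : ∀ a b → Apart δ a b → det (node ε a) (node ε′ b) ∙ cf δ a b ≋ proj₁ (node ε a)
    det-cf a b ap = begin
      det (node ε a) (node ε′ b) ∙ cf δ a b
        ≈⟨ ∙-cong (det-node a b) ≋-refl ⟩
      ε ∙ (q^ a ⊟ δ ∙ q^ b) ∙ fac δ (a + b) ∙ (gap δ a b ∙ fac δ (a + b) ⁻¹)
        ≈⟨ solve 5 (λ ε d f g i → ε :* d :* f :* (g :* i) := ε :* (d :* g) :* (f :* i)) ≋-refl ε (q^ a ⊟ δ ∙ q^ b) (fac δ (a + b)) (gap δ a b) (fac δ (a + b) ⁻¹) ⟩
      ε ∙ ((q^ a ⊟ δ ∙ q^ b) ∙ gap δ a b) ∙ (fac δ (a + b) ∙ fac δ (a + b) ⁻¹)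
        ≈⟨ ∙-cong (∙-cong ≋-refl (diff-gap a b ap)) (∙-inverse (unit-sum a b ap)) ⟩
      ε ∙ q^ a ∙ 𝟙
        ≈⟨ ∙-identityʳ _ ⟩
      ε ∙ q^ a ∎

-- Read downwards from a, the ℓ nodes below it lie at distances x, x + m, x + 2m, ..., and each
-- distance d contributes - δ q^d / (1 - δ q^d). The equation `b + m * ℓ ≡ a + y` places the next
-- node at distance y above a.
gap-below : ∀ δ a b m x y ℓ → 0 < x → x + y ≡ m → b + m * ℓ ≡ a + y →
  Π< ℓ (λ r → gap δ a (b + m * r)) ≋ pow (~ δ) ℓ ∙ q^ (x * ℓ + m * T ℓ) ∙ P δ x m ℓ ⁻¹
gap-below δ a b m x y ℓ 0<x x+y bℓ = begin
  Π< ℓ (λ r → gap δ a (b + m * r))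
    ≈⟨ Π-reverse ℓ _ ⟩
  Π< ℓ (λ k → gap δ a (b + m * (ℓ ∸ suc k)))
    ≈⟨ Π-cong ℓ (λ k k<ℓ → ≋-reflexive (down′ k (ℓ ∸ suc k) (≡.trans (ℕₚ.+-comm _ (suc k)) (ℕₚ.m+[n∸m]≡n k<ℓ)))) ⟩
  Π< ℓ (λ k → ~ δ ∙ q^ (x + m * k) ∙ fac δ (x + m * k) ⁻¹)
    ≈⟨ ≋-trans (Π-∙ ℓ _ _) (∙-cong (Π-∙ ℓ _ _) (Π-⁻¹ ℓ λ k → Unit-fac (≤-trans 0<x (m≤m+n x (m * k))))) ⟩
  pow (~ δ) ℓ ∙ Π< ℓ (λ k → q^ (x + m * k)) ∙ P δ x m ℓ ⁻¹
    ≈⟨ ∙-cong (∙-cong ≋-refl (monomials ℓ)) ≋-refl ⟩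
  pow (~ δ) ℓ ∙ q^ (x * ℓ + m * T ℓ) ∙ P δ x m ℓ ⁻¹ ∎
  where
    monomials : ∀ ℓ → Π< ℓ (λ k → q^ (x + m * k)) ≋ q^ (x * ℓ + m * T ℓ)
    monomials zero    = ≋-sym (≋-trans (q^-cong (≡.cong₂ _+_ (ℕₚ.*-zeroʳ x) (ℕₚ.*-zeroʳ m))) q^-zero)
    monomials (suc ℓ) = ≋-trans (∙-cong (monomials ℓ) ≋-refl) (≋-trans (≋-sym (q^-+ _ _)) (q^-cong (shuffle x m ℓ (T ℓ))))
      where
        shuffle : ∀ x m ℓ t → x * ℓ + m * t + (x + m * ℓ) ≡ x * suc ℓ + m * (t + ℓ)
        shuffle = solve-∀
    shuffle₁ : ∀ b m r x k → b + m * r + (x + m * k) ≡ b + (m * r + m * k) + x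
    shuffle₁ = solve-∀
    shuffle₂ : ∀ b x y r k → b + ((x + y) * r + (x + y) * k) + x + y ≡ b + (x + y) * (r + suc k)
    shuffle₂ = solve-∀
    below : ∀ r k → r + suc k ≡ ℓ → b + m * r + (x + m * k) ≡ a
    below r k p = ℕₚ.+-cancelʳ-≡ y _ _ (≡.trans (cong (_+ y) (shuffle₁ b m r x k))
      (≡.trans (subst (λ m → b + (m * r + m * k) + x + y ≡ b + m * (r + suc k)) x+y (shuffle₂ b x y r k)) (≡.trans (cong (λ i → b + m * i) p) bℓ)))
    down″ : ∀ a′ b′ d → 0 < d → b′ + d ≡ a′ → gap δ a′ b′ ≡ ~ δ ∙ q^ d ∙ fac δ d ⁻¹
    down″ a′ b′ (suc d) _ ≡.refl = gap-down δ b′ d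
    down′ : ∀ k r → r + suc k ≡ ℓ → gap δ a (b + m * r) ≡ ~ δ ∙ q^ (x + m * k) ∙ fac δ (x + m * k) ⁻¹
    down′ k r p = down″ a (b + m * r) (x + m * k) (≤-trans 0<x (m≤m+n x (m * k))) (below r k p)

gap-above : ∀ δ a m y n (b : ℕ → ℕ) → 0 < y → (∀ k → b k ≡ a + (y + m * k)) →
  Π< n (λ k → gap δ a (b k)) ≋ P δ y m n ⁻¹
gap-above δ a m y n b 0<y bk = ≋-trans (Π-cong n λ k _ → ≋-reflexive (≡.trans (cong (gap δ a) (bk k)) (gap-up δ a (y + m * k))))
  (Π-⁻¹ n λ k → Unit-fac (≤-trans 0<y (m≤m+n y (m * k))))

cf-product : ∀ δ a b m x y z ℓ M → 0 < x → 0 < y → 0 < z → x + y ≡ m → b + m * ℓ ≡ a + y → a + b ≡ z →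
  Π< (ℓ + M) (λ r → cf δ a (b + m * r)) ≋
  pow (~ δ) ℓ ∙ q^ (x * ℓ + m * T ℓ) ∙ P δ y m M ⁻¹ ∙ (P δ x m ℓ ∙ P δ z m (ℓ + M)) ⁻¹
cf-product δ a b m x y z ℓ M 0<x 0<y 0<z x+y bℓ ab = begin
  Π< (ℓ + M) (λ r → cf δ a (b + m * r))
    ≈⟨ Π-∙ (ℓ + M) _ _ ⟩
  Π< (ℓ + M) (λ r → gap δ a (b + m * r)) ∙ Π< (ℓ + M) (λ r → fac δ (a + (b + m * r)) ⁻¹)
    ≈⟨ ∙-cong (≋-trans (Π-split ℓ M _) (∙-cong (gap-below δ a b m x y ℓ 0<x x+y bℓ) (gap-above δ a m y M _ 0<y λ k → ≡.trans (shuffle₁ b m ℓ k) (≡.trans (cong (_+ m * k) bℓ) (ℕₚ.+-assoc a y (m * k))))))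
        (≋-trans (Π-cong (ℓ + M) λ r _ → ≋-reflexive (cong (λ i → fac δ i ⁻¹) (≡.trans (≡.sym (ℕₚ.+-assoc a b (m * r))) (cong (_+ m * r) ab))))
                 (Π-⁻¹ (ℓ + M) λ k → Unit-fac (≤-trans 0<z (m≤m+n z (m * k))))) ⟩
  pow (~ δ) ℓ ∙ q^ (x * ℓ + m * T ℓ) ∙ P δ x m ℓ ⁻¹ ∙ P δ y m M ⁻¹ ∙ P δ z m (ℓ + M) ⁻¹
    ≈⟨ solve 5 (λ a b c d e → a :* b :* c :* d :* e := a :* b :* d :* (c :* e)) ≋-refl (pow (~ δ) ℓ) (q^ (x * ℓ + m * T ℓ)) (P δ x m ℓ ⁻¹) (P δ y m M ⁻¹) (P δ z m (ℓ + M) ⁻¹) ⟩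
  pow (~ δ) ℓ ∙ q^ (x * ℓ + m * T ℓ) ∙ P δ y m M ⁻¹ ∙ (P δ x m ℓ ⁻¹ ∙ P δ z m (ℓ + M) ⁻¹)
    ≈⟨ ∙-cong ≋-refl (≋-sym (⁻¹-∙ (Unit-P δ x m ℓ 0<x) (Unit-P δ z m (ℓ + M) 0<z))) ⟩
  pow (~ δ) ℓ ∙ q^ (x * ℓ + m * T ℓ) ∙ P δ y m M ⁻¹ ∙ (P δ x m ℓ ∙ P δ z m (ℓ + M)) ⁻¹ ∎
  where
    shuffle₁ : ∀ b m ℓ k → b + m * (ℓ + k) ≡ b + m * ℓ + m * k
    shuffle₁ = solve-∀

-- Residues within one family. Since 2a = m b, two exponents add up to m (b + i + j). `κ i` is the
-- quotient of the factorial of length 2i + b by the factors that actually occur for j < i.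
module Own (a m b : ℕ) (0<m : 0 < m) (2a : a + a ≡ m * b) (κ : ℕ → Series)
  (κ-spec : ∀ i → κ i ∙ (P 𝟙 m m i ∙ Π< i (λ j → fac 𝟙 (m * (b + i + j)))) ≋ P 𝟙 m m (i + i + b)) where

  at-index : ℕ → ℕ
  at-index i = a + m * i

  own : ℕ → ℕ → Series
  own i j with i ℕ.≟ j
  ... | yes _ = 𝟙
  ... | no _  = cf 𝟙 (at-index i) (at-index j)

  own-refl : ∀ i → own i i ≋ 𝟙
  own-refl i with i ℕ.≟ i
  ... | yes _ = ≋-refl
  ... | no p  = ⊥-elim (p ≡.refl)

  own-≢ : ∀ {i j} → i ≢ j → own i j ≡ cf 𝟙 (at-index i) (at-index j)
  own-≢ {i} {j} i≢j with i ℕ.≟ j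
  ... | yes p = ⊥-elim (i≢j p)
  ... | no _  = ≡.refl

  at-index-injective : ∀ {i j} → i ≢ j → at-index i ≢ at-index j
  at-index-injective i≢j p = i≢j (ℕₚ.*-cancelˡ-≡ _ _ m {{ℕ.>-nonZero 0<m}} (ℕₚ.+-cancelˡ-≡ a _ _ p))

  private
    sum : ∀ i j → at-index i + at-index j ≡ m * (b + i + j)
    sum i j = ≡.trans (shuffle a m i j) (≡.trans (cong (_+ (m * i + m * j)) 2a) (shuffle′ m b i j))
      where
        shuffle : ∀ a m i j → a + m * i + (a + m * j) ≡ a + a + (m * i + m * j)
        shuffle = solve-∀
        shuffle′ : ∀ m b i j → m * b + (m * i + m * j) ≡ m * (b + i + j)
        shuffle′ = solve-∀

    Unit-sum : ∀ i j → 0 < b + i + j → Unit (fac 𝟙 (m * (b + i + j)))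
    Unit-sum i j 0<s = Unit-fac (ℕₚ.*-mono-≤ 0<m 0<s)

  -- With Q = q^m, the differences give (Q)_i from the nodes below and (Q)_M from those above. The
  -- sums form a run without the term j = i; `κ i` closes it, together with (Q)_i, up to length 2i +
  -- b + M. The i nodes below also supply the sign and the power of q.
  own-product : ∀ i M → Π< (i + suc M) (own i) ≋
    pow (~ 𝟙) i ∙ q^ (m * T (suc i)) ∙ κ i ∙ (P 𝟙 m m M ∙ P 𝟙 m m (i + i + b + M)) ⁻¹
  own-product i M = begin
    Π< (i + suc M) (own i)
      ≈⟨ ≋-trans (Π-split i (suc M) (own i)) (∙-cong ≋-refl (Π-head M _)) ⟩
    Π< i (own i) ∙ (own i (i + 0) ∙ Π< M (λ k → own i (i + suc k)))
      ≈⟨ ∙-cong lower (∙-cong (≋-trans (≋-reflexive (cong (own i) (ℕₚ.+-identityʳ i))) (own-refl i)) upper) ⟩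
    S ∙ q^ (m * i + m * T i) ∙ A ⁻¹ ∙ B ⁻¹ ∙ (𝟙 ∙ (C ⁻¹ ∙ D ⁻¹))
      ≈⟨ solve 6 (λ s w a b c d → s :* w :* a :* b :* (′ 1 :* (c :* d)) := s :* w :* (a :* b) :* (c :* d)) ≋-refl S (q^ (m * i + m * T i)) (A ⁻¹) (B ⁻¹) (C ⁻¹) (D ⁻¹) ⟩
    S ∙ q^ (m * i + m * T i) ∙ (A ⁻¹ ∙ B ⁻¹) ∙ (C ⁻¹ ∙ D ⁻¹)
      ≈⟨ ∙-cong (∙-cong (∙-cong ≋-refl (q^-cong (expo m i (T i)))) κ-eq) ≋-refl ⟩
    S ∙ q^ (m * T (suc i)) ∙ (κ i ∙ E ⁻¹) ∙ (C ⁻¹ ∙ D ⁻¹)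
      ≈⟨ solve 6 (λ s w k e c d → s :* w :* (k :* e) :* (c :* d) := s :* w :* k :* (c :* (e :* d))) ≋-refl S (q^ (m * T (suc i))) (κ i) (E ⁻¹) (C ⁻¹) (D ⁻¹) ⟩
    S ∙ q^ (m * T (suc i)) ∙ κ i ∙ (C ⁻¹ ∙ (E ⁻¹ ∙ D ⁻¹))
      ≈⟨ ∙-cong ≋-refl (≋-trans (∙-cong ≋-refl (≋-trans (≋-sym (⁻¹-∙ UE UD)) (⁻¹-cong (Unit-∙ UE UD) ED))) (≋-sym (⁻¹-∙ (Unit-P 𝟙 m m M 0<m) (Unit-P 𝟙 m m (i + i + b + M) 0<m)))) ⟩
    S ∙ q^ (m * T (suc i)) ∙ κ i ∙ (C ∙ P 𝟙 m m (i + i + b + M)) ⁻¹ ∎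
    where
      S = pow (~ 𝟙) i
      A = P 𝟙 m m i
      B = Π< i (λ j → fac 𝟙 (m * (b + i + j)))
      C = P 𝟙 m m M
      D = Π< M (λ k → fac 𝟙 (m * (b + i + (i + suc k))))
      E = P 𝟙 m m (i + i + b)
      expo : ∀ m i t → m * i + m * t ≡ m * (t + i)
      expo = solve-∀
      UE : Unit E
      UE = Unit-P 𝟙 m m (i + i + b) 0<m
      UD : Unit D
      UD = Π-Unit M λ k → Unit-sum i (i + suc k) (≤-trans (s≤s z≤n) (≤-trans (≤-reflexive (≡.sym (ℕₚ.+-suc i k))) (m≤n+m (i + suc k) (b + i))))
      ED : E ∙ D ≋ P 𝟙 m m (i + i + b + M)
      ED = ≋-trans (∙-cong ≋-refl (Π-cong M λ k _ → fac-cong (shuffle m b i k))) (P-split 𝟙 m m (i + i + b) M)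
        where
          shuffle : ∀ m b i k → m * (b + i + (i + suc k)) ≡ m + m * (i + i + b) + m * k
          shuffle = solve-∀
      UA : Unit A
      UA = Unit-P 𝟙 m m i 0<m
      κ-eq : A ⁻¹ ∙ B ⁻¹ ≋ κ i ∙ E ⁻¹
      κ-eq = begin
        A ⁻¹ ∙ B ⁻¹                             ≈⟨ solve 1 (λ x → x := x :* ′ 1) ≋-refl (A ⁻¹ ∙ B ⁻¹) ⟩
        A ⁻¹ ∙ B ⁻¹ ∙ 𝟙                         ≈⟨ ∙-cong ≋-refl (≋-trans (≋-sym (∙-inverse UE)) (∙-cong (≋-sym (κ-spec i)) ≋-refl)) ⟩
        A ⁻¹ ∙ B ⁻¹ ∙ (κ i ∙ (A ∙ B) ∙ E ⁻¹)    ≈⟨ solve 6 (λ a b a′ b′ k e → a′ :* b′ :* (k :* (a :* b) :* e) := k :* e :* (a :* a′) :* (b :* b′)) ≋-refl A B (A ⁻¹) (B ⁻¹) (κ i) (E ⁻¹) ⟩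
        κ i ∙ E ⁻¹ ∙ (A ∙ A ⁻¹) ∙ (B ∙ B ⁻¹)    ≈⟨ ∙-cong (∙-cong ≋-refl (∙-inverse UA)) (∙-inverse UB) ⟩
        κ i ∙ E ⁻¹ ∙ 𝟙 ∙ 𝟙                      ≈⟨ solve 1 (λ x → x :* ′ 1 :* ′ 1 := x) ≋-refl (κ i ∙ E ⁻¹) ⟩
        κ i ∙ E ⁻¹ ∎
        where
          UB : Unit B
          UB = unit-factor {B} {A ∙ κ i ∙ E ⁻¹} (≋-trans (solve 4 (λ b a k e → b :* (a :* k :* e) := k :* (a :* b) :* e) ≋-refl B A (κ i) (E ⁻¹))
                 (≋-trans (∙-cong (κ-spec i) ≋-refl) (∙-inverse UE)))
      lower : Π< i (own i) ≋ S ∙ q^ (m * i + m * T i) ∙ A ⁻¹ ∙ B ⁻¹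
      lower = ≋-trans (Π-cong i λ j j<i → ≋-reflexive (own-≢ (λ p → ℕₚ.<⇒≢ j<i (≡.sym p))))
        (≋-trans (Π-∙ i _ _) (∙-cong (gap-below 𝟙 (at-index i) a m m 0 i 0<m (ℕₚ.+-identityʳ m) (≡.sym (ℕₚ.+-identityʳ (at-index i)))) B-eq))
        where
          B-eq : Π< i (λ j → fac 𝟙 (at-index i + at-index j) ⁻¹) ≋ B ⁻¹
          B-eq = ≋-trans (Π-cong i λ j _ → ≋-reflexive (cong (λ e → fac 𝟙 e ⁻¹) (sum i j))) (inverse i ≤-refl)
            where
              inverse : ∀ n → n ≤ i → Π< n (λ j → fac 𝟙 (m * (b + i + j)) ⁻¹) ≋ Π< n (λ j → fac 𝟙 (m * (b + i + j))) ⁻¹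
              inverse n n≤i = Π-⁻¹′ n λ j j<n → Unit-sum i j (≤-trans (≤-trans (s≤s z≤n) (≤-trans j<n n≤i)) (≤-trans (m≤n+m i b) (m≤m+n (b + i) j)))
      upper : Π< M (λ k → own i (i + suc k)) ≋ C ⁻¹ ∙ D ⁻¹
      upper = ≋-trans (Π-cong M λ k _ → ≋-reflexive (own-≢ λ p → ℕₚ.m≢1+m+n i (≡.trans p (ℕₚ.+-suc i k))))
        (≋-trans (Π-∙ M _ _) (∙-cong (gap-above 𝟙 (at-index i) m m M _ 0<m λ k → shuffle a m i k)
          (≋-trans (Π-cong M λ k _ → ≋-reflexive (cong (λ e → fac 𝟙 e ⁻¹) (sum i (i + suc k)))) (Π-⁻¹ M λ k → Unit-sum i (i + suc k) (≤-trans (s≤s z≤n) (≤-trans (≤-reflexive (≡.sym (ℕₚ.+-suc i k))) (m≤n+m (i + suc k) (b + i))))))))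
        where
          shuffle : ∀ a m i k → a + m * (i + suc k) ≡ a + m * i + (m + m * k)
          shuffle = solve-∀

-- Expansion over two families of nodes, and limits of products

denom : Series → Series → ℕ → Series
denom X ε a = det (𝟙 , X) (node ε a)

-- Two nodes of one family are compared with sign 1 and are apart because their exponents differ.
-- Nodes of different families are compared with sign δ and are apart whatever their exponents,
-- because 1 - δ is a unit.
module TwoFamilies
  (ε₁ ε₂ δ : Series) (ε₁² : ε₁ ∙ ε₁ ≋ 𝟙) (ε₂² : ε₂ ∙ ε₂ ≋ 𝟙) (δ² : δ ∙ δ ≋ 𝟙) (ε₁δ : ε₁ ∙ δ ≋ ε₂) (ε₂δ : ε₂ ∙ δ ≋ ε₁) (Uδ : Unit (fac δ 0))
  (e₁ e₂ : ℕ → ℕ) (inj-e₁ : ∀ {i j} → i ≢ j → e₁ i ≢ e₁ j) (inj-e₂ : ∀ {i j} → i ≢ j → e₂ i ≢ e₂ j)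
  (o₁ o₂ : ℕ → ℕ → Series) (o₁-refl : ∀ i → o₁ i i ≋ 𝟙) (o₂-refl : ∀ i → o₂ i i ≋ 𝟙)
  (o₁-≢ : ∀ {i j} → i ≢ j → o₁ i j ≡ cf 𝟙 (e₁ i) (e₁ j)) (o₂-≢ : ∀ {i j} → i ≢ j → o₂ i j ≡ cf 𝟙 (e₂ i) (e₂ j))
  (X : Series) (U₁ : ∀ i → Unit (denom X ε₁ (e₁ i))) (U₂ : ∀ i → Unit (denom X ε₂ (e₂ i))) where

  private
    pt : ℕ ⊎ ℕ → Point
    pt (inj₁ i) = node ε₁ (e₁ i)
    pt (inj₂ i) = node ε₂ (e₂ i)

    c : ℕ ⊎ ℕ → ℕ ⊎ ℕ → Series
    c (inj₁ i) (inj₁ j) = o₁ i j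
    c (inj₁ i) (inj₂ j) = cf δ (e₁ i) (e₂ j)
    c (inj₂ i) (inj₁ j) = cf δ (e₂ i) (e₁ j)
    c (inj₂ i) (inj₂ j) = o₂ i j

    c-refl : ∀ p → c p p ≋ 𝟙
    c-refl (inj₁ i) = o₁-refl i
    c-refl (inj₂ i) = o₂-refl i

    𝟙² : 𝟙 ∙ 𝟙 ≋ 𝟙
    𝟙² = ∙-identityˡ 𝟙

    regular : ∀ p r → p ≢ r → Regular (det (pt p) (pt r))
    regular (inj₁ i) (inj₁ j) p≢r = det-regular 𝟙² ε₁² (∙-identityʳ ε₁) (e₁ i) (e₁ j) (inj₂ (inj-e₁ λ { ≡.refl → p≢r ≡.refl }))
    regular (inj₁ i) (inj₂ j) p≢r = det-regular δ² ε₁² ε₁δ (e₁ i) (e₂ j) (inj₁ Uδ)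
    regular (inj₂ i) (inj₁ j) p≢r = det-regular δ² ε₂² ε₂δ (e₂ i) (e₁ j) (inj₁ Uδ)
    regular (inj₂ i) (inj₂ j) p≢r = det-regular 𝟙² ε₂² (∙-identityʳ ε₂) (e₂ i) (e₂ j) (inj₂ (inj-e₂ λ { ≡.refl → p≢r ≡.refl }))

    c-spec : ∀ p r → p ≢ r → det (pt p) (pt r) ∙ c p r ≋ proj₁ (pt p)
    c-spec (inj₁ i) (inj₁ j) p≢r = ≋-trans (∙-cong ≋-refl (≋-reflexive (o₁-≢ λ { ≡.refl → p≢r ≡.refl })))
      (det-cf 𝟙² ε₁² (∙-identityʳ ε₁) (e₁ i) (e₁ j) (inj₂ (inj-e₁ λ { ≡.refl → p≢r ≡.refl })))
    c-spec (inj₁ i) (inj₂ j) p≢r = det-cf δ² ε₁² ε₁δ (e₁ i) (e₂ j) (inj₁ Uδ)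
    c-spec (inj₂ i) (inj₁ j) p≢r = det-cf δ² ε₂² ε₂δ (e₂ i) (e₁ j) (inj₁ Uδ)
    c-spec (inj₂ i) (inj₂ j) p≢r = ≋-trans (∙-cong ≋-refl (≋-reflexive (o₂-≢ λ { ≡.refl → p≢r ≡.refl })))
      (det-cf 𝟙² ε₂² (∙-identityʳ ε₂) (e₂ i) (e₂ j) (inj₂ (inj-e₂ λ { ≡.refl → p≢r ≡.refl })))

    U : ∀ p → Unit (det (𝟙 , X) (pt p))
    U (inj₁ i) = U₁ i
    U (inj₂ i) = U₂ i

    ≢-sym : ∀ {p r : ℕ ⊎ ℕ} → p ≢ r → r ≢ p
    ≢-sym p≢r e = p≢r (≡.sym e)

    x : ℕ ⊎ ℕ → Series
    x p = det (𝟙 , X) (pt p) ⁻¹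

  expand : ∀ n m →
    Π< (suc n) (λ i → denom X ε₁ (e₁ i) ⁻¹) ∙ Π< m (λ j → denom X ε₂ (e₂ j) ⁻¹) ≋
    Σ< (suc n) (λ i → denom X ε₁ (e₁ i) ⁻¹ ∙ (Π< (suc n) (o₁ i) ∙ Π< m (λ k → cf δ (e₁ i) (e₂ k)))) ⊞
    Σ< m (λ j → denom X ε₂ (e₂ j) ⁻¹ ∙ (Π< (suc n) (λ k → cf δ (e₂ j) (e₁ k)) ∙ Π< m (o₂ j)))
  expand n m = partialFractions c c-refl
    (λ r p i r≢p r≢i p≢i → twoPole (pt r) (pt p) (pt i) (regular r p r≢p) (regular r i r≢i) (regular p i p≢i)
       (c-spec r p r≢p) (c-spec r i r≢i) (c-spec i p (≢-sym p≢i)) (c-spec p i p≢i))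
    n m x
    λ p i p≢i → twoPole (𝟙 , X) (pt p) (pt i) (unit-regular (U p)) (unit-regular (U i)) (regular p i p≢i)
       (∙-inverse (U p)) (∙-inverse (U i)) (c-spec i p (≢-sym p≢i)) (c-spec p i p≢i)

-- Infinite products and the Durfee rectangle identity

P∞ : Series → ℕ → ℕ → Series
P∞ δ x m = ∏ (λ k → fac δ (x + m * k))

fac-near : ∀ δ {d n} → n ≤ d → fac δ d ≈[ n ] 𝟙
fac-near δ {d} n≤d = ≈-weaken n≤d (modq (~ δ) (solve 2 (λ δ x → ′ 1 :- δ :* x := ′ 1 :+ x :* (⊝ δ)) ≋-refl δ (q^ d)))

near-fac : ∀ δ x {m} → 0 < m → Near1 (λ k → fac δ (x + m * k))
near-fac δ x {m} 0<m = near1 λ k → fac-near δ (≤-trans (ℕₚ.m≤n*m k m {{ℕ.>-nonZero 0<m}}) (m≤n+m (m * k) x))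

P∞-limit : ∀ δ x m {n} M → 0 < m → n ≤ M → P∞ δ x m ≈[ n ] P δ x m M
P∞-limit δ x m M 0<m n≤M = ∏-limit M n≤M (near-fac δ x 0<m)

Unit-P∞ : ∀ δ x m → 0 < x → Unit (P∞ δ x m)
Unit-P∞ δ x m 0<x = ∏-Unit λ k → Unit-fac (≤-trans 0<x (m≤m+n x (m * k)))

P⁻¹-limit : ∀ δ x m {n} M → 0 < x → 0 < m → n ≤ M → P δ x m M ⁻¹ ≈[ n ] P∞ δ x m ⁻¹
P⁻¹-limit δ x m M 0<x 0<m n≤M = ≈-⁻¹ (Unit-P δ x m M 0<x) (Unit-P∞ δ x m 0<x) (≈-sym (P∞-limit δ x m M 0<m n≤M))

Σ-~ : ∀ n G → Σ< n (λ k → ~ G k) ≋ ~ Σ< n G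
Σ-~ zero    G = solve 0 (′ 0 := ⊝ ′ 0) ≋-refl
Σ-~ (suc n) G = ≋-trans (⊞-cong (Σ-~ n G) ≋-refl) (solve 2 (λ a b → ⊝ a :- b := ⊝ (a :+ b)) ≋-refl (Σ< n G) (G n))

opaque
  unfolding _⊞_
  ∑-~ : ∀ G → ∑ (λ k → ~ G k) ≋ ~ ∑ G
  ∑-~ G = pw λ N → at (Σ-~ (2 + N) G) N

∑-⊟ : ∀ F G → ∑ (λ k → F k ⊟ G k) ≋ ∑ F ⊟ ∑ G
∑-⊟ F G = ≋-trans (∑-⊞ F (λ k → ~ G k)) (⊞-cong ≋-refl (∑-~ G))

module Rectangle (m : ℕ) (0<m : 0 < m) where
  Q! : ℕ → Series
  Q! n = P 𝟙 m m n

  i : ℕ → Series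
  i n = (Q! n) ⁻¹

  Ui : ∀ n → Unit (Q! n)
  Ui n = Unit-P 𝟙 m m n 0<m

  Q^ : ℕ → Series
  Q^ n = q^ (m * n)

  Q^-+ : ∀ a b c → c ≡ a + b → Q^ c ≋ Q^ a ∙ Q^ b
  Q^-+ a b _ ≡.refl = ≋-trans (q^-cong (ℕₚ.*-distribˡ-+ m a b)) (q^-+ (m * a) (m * b))

  i-suc : ∀ n → i n ≋ (𝟙 ⊟ Q^ (suc n)) ∙ i (suc n)
  i-suc n = begin
    i n                                   ≈⟨ ∙-identityʳ (i n) ⟨
    i n ∙ 𝟙                               ≈⟨ ∙-cong ≋-refl (∙-inverse (Ui (suc n))) ⟨
    i n ∙ ((Q! n) ∙ f ∙ i (suc n))        ≈⟨ solve 4 (λ i p f j → i :* (p :* f :* j) := p :* i :* (f :* j)) ≋-refl (i n) (Q! n) f (i (suc n)) ⟩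
    (Q! n) ∙ i n ∙ (f ∙ i (suc n))        ≈⟨ ∙-cong (∙-inverse (Ui n)) ≋-refl ⟩
    𝟙 ∙ (f ∙ i (suc n))                   ≈⟨ ∙-identityˡ _ ⟩
    f ∙ i (suc n)                         ≈⟨ ∙-cong (⊞-cong ≋-refl (~-cong (≋-trans (∙-identityˡ _) (q^-cong (≡.sym (ℕₚ.*-suc m n)))))) ≋-refl ⟩
    (𝟙 ⊟ Q^ (suc n)) ∙ i (suc n)          ∎
    where f = fac 𝟙 (m + m * n)

  rect : ℕ → ℕ → Series
  rect d k = Q^ (k * (k + d)) ∙ (i k ∙ i (k + d))

  private
    quad : ∀ d k → k ≤ m * (suc k * (suc k + d))
    quad d k = ≤-trans (≤-trans (ℕₚ.n≤1+n k) (ℕₚ.m≤m*n (suc k) (suc k + d))) (ℕₚ.m≤n*m _ m {{ℕ.>-nonZero 0<m}})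

    S : ℕ → Series
    S d = ∑ (rect d)

    rect-small : ∀ d → Small (rect d)
    rect-small d = Small-q^ (λ k → m * (k * (k + d))) _ (quad d)

    -- The two halves of `rect d k ⊟ rect (suc d) k` over a common denominator. `A` vanishes at k =
    -- 0, so that its sum can be shifted by one against `B`.
    A B : ℕ → ℕ → Series
    A d k = Q^ (k * (k + d)) ∙ ((𝟙 ⊟ Q^ k) ∙ (i k ∙ i (k + suc d)))
    B d k = Q^ (k * (k + d)) ∙ (Q^ (k + suc d) ∙ (i k ∙ i (k + suc d)))

    difference : ∀ d k → rect d k ⊟ rect (suc d) k ≋ A d k ⊟ B d k
    difference d k = begin
      Q^ (k * (k + d)) ∙ (i k ∙ i (k + d)) ⊟ Q^ (k * (k + suc d)) ∙ (i k ∙ i (k + suc d))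
        ≈⟨ ⊞-cong (∙-cong ≋-refl (∙-cong ≋-refl (≋-trans (i-suc (k + d)) (≋-reflexive (cong (λ n → (𝟙 ⊟ Q^ n) ∙ i n) (≡.sym (ℕₚ.+-suc k d)))))))
                  (~-cong (∙-cong (Q^-+ (k * (k + d)) k _ (shuffle k d)) ≋-refl)) ⟩
      Q^ (k * (k + d)) ∙ (i k ∙ ((𝟙 ⊟ Q^ (k + suc d)) ∙ i (k + suc d))) ⊟ Q^ (k * (k + d)) ∙ Q^ k ∙ (i k ∙ i (k + suc d))
        ≈⟨ solve 5 (λ w x y i j → w :* (i :* ((′ 1 :- y) :* j)) :- w :* x :* (i :* j) := w :* ((′ 1 :- x) :* (i :* j)) :- w :* (y :* (i :* j))) ≋-refl
             (Q^ (k * (k + d))) (Q^ k) (Q^ (k + suc d)) (i k) (i (k + suc d)) ⟩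
      A d k ⊟ B d k ∎
      where
        shuffle : ∀ k d → k * (k + suc d) ≡ k * (k + d) + k
        shuffle = solve-∀

    shifted : ∀ d k → A d (suc k) ⊟ B d k ≋ ~ Q^ (suc d) ∙ (A (suc d) k ⊟ B (suc d) k)
    shifted d k = begin
      A d (suc k) ⊟ B d k
        ≈⟨ ⊞-cong (∙-cong (≋-trans (Q^-+ (k * (k + d) + (k + suc d)) k _ (shuffle₁ k d)) (∙-cong (Q^-+ (k * (k + d)) (k + suc d) _ ≡.refl) ≋-refl)) (≋-trans
               (solve 3 (λ f i j → f :* (i :* j) := f :* i :* j) ≋-refl (𝟙 ⊟ Q^ (suc k)) (i (suc k)) (i (suc k + suc d)))
               (∙-cong (≋-sym (i-suc k)) (≋-reflexive (cong i (≡.sym (ℕₚ.+-suc k (suc d))))))))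
             (~-cong (∙-cong ≋-refl (∙-cong ≋-refl (∙-cong ≋-refl (≋-trans (i-suc (k + suc d)) (≋-reflexive (cong (λ n → (𝟙 ⊟ Q^ n) ∙ i n) (≡.sym (ℕₚ.+-suc k (suc d)))))))))) ⟩
      W ∙ Y ∙ Z ∙ (I ∙ I′) ⊟ W ∙ (Y ∙ (I ∙ ((𝟙 ⊟ V) ∙ I′)))
        ≈⟨ solve 6 (λ w y z i j v → w :* y :* z :* (i :* j) :- w :* (y :* (i :* ((′ 1 :- v) :* j))) :=
                      ⊝ (w :* y) :* ((′ 1 :- z) :* (i :* j) :- v :* (i :* j))) ≋-refl W Y Z I I′ V ⟩
      ~ (W ∙ Y) ∙ ((𝟙 ⊟ Z) ∙ (I ∙ I′) ⊟ V ∙ (I ∙ I′))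
        ≈⟨ ∙-cong (~-cong (≋-trans (≋-sym (Q^-+ (k * (k + d)) (k + suc d) _ ≡.refl)) (Q^-+ (suc d) (k * (k + suc d)) _ (shuffle₂ k d)))) ≋-refl ⟩
      ~ (Q^ (suc d) ∙ R) ∙ ((𝟙 ⊟ Z) ∙ (I ∙ I′) ⊟ V ∙ (I ∙ I′))
        ≈⟨ solve 6 (λ s r z i j v → ⊝ (s :* r) :* ((′ 1 :- z) :* (i :* j) :- v :* (i :* j)) := ⊝ s :* (r :* ((′ 1 :- z) :* (i :* j)) :- r :* (v :* (i :* j)))) ≋-refl (Q^ (suc d)) R Z I I′ V ⟩
      ~ Q^ (suc d) ∙ (A (suc d) k ⊟ B (suc d) k) ∎
      where
        W = Q^ (k * (k + d))
        Y = Q^ (k + suc d)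
        Z = Q^ k
        I = i k
        I′ = i (k + suc (suc d))
        V = Q^ (k + suc (suc d))
        R = Q^ (k * (k + suc d))
        shuffle₁ : ∀ k d → suc k * (suc k + d) ≡ k * (k + d) + (k + suc d) + k
        shuffle₁ = solve-∀
        shuffle₂ : ∀ k d → k * (k + d) + (k + suc d) ≡ suc d + k * (k + suc d)
        shuffle₂ = solve-∀

    A-small : ∀ d → Small (A d)
    A-small d = Small-q^ (λ k → m * (k * (k + d))) _ (quad d)

    A-zero : ∀ d → A d 0 ≋ 𝟘
    A-zero d = ≋-trans (∙-cong ≋-refl (∙-cong (≋-trans (⊞-cong ≋-refl (~-cong (≋-trans (q^-cong (ℕₚ.*-zeroʳ m)) q^-zero))) (⊞-inverseʳ 𝟙)) ≋-refl))
      (solve 2 (λ w v → w :* (′ 0 :* v) := ′ 0) ≋-refl _ _)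

    -- Each difference of neighbouring sums is - Q^(d+1) times the next one. Iterated, this makes it
    -- divisible by every power of q, hence zero, and the sum does not depend on d.
    step : ∀ d → S d ⊟ S (suc d) ≋ ~ Q^ (suc d) ∙ (S (suc d) ⊟ S (suc (suc d)))
    step d = begin
      S d ⊟ S (suc d)                                       ≈⟨ ∑-⊟ (rect d) (rect (suc d)) ⟨
      ∑ (λ k → rect d k ⊟ rect (suc d) k)                   ≈⟨ ∑-cong (difference d) ⟩
      ∑ (λ k → A d k ⊟ B d k)                               ≈⟨ ∑-⊟ (A d) (B d) ⟩
      ∑ (A d) ⊟ ∑ (B d)                                     ≈⟨ ⊞-cong (≋-trans (∑-head (A-small d)) (≋-trans (⊞-cong (A-zero d) ≋-refl) (⊞-identityˡ _))) ≋-refl ⟩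
      ∑ (λ k → A d (suc k)) ⊟ ∑ (B d)                       ≈⟨ ∑-⊟ (λ k → A d (suc k)) (B d) ⟨
      ∑ (λ k → A d (suc k) ⊟ B d k)                         ≈⟨ ∑-cong (λ k → ≋-trans (shifted d k) (∙-cong ≋-refl (≋-sym (difference (suc d) k)))) ⟩
      ∑ (λ k → ~ Q^ (suc d) ∙ (rect (suc d) k ⊟ rect (suc (suc d)) k))
        ≈⟨ ∑-∙ (~ Q^ (suc d)) (Small-⊞ (rect-small (suc d)) (Small-≋ (λ k → solve 1 (λ x → (⊝ ′ 1) :* x := ⊝ x) ≋-refl _) (Small-∙ (~ 𝟙) (rect-small (suc (suc d)))))) ⟨
      ~ Q^ (suc d) ∙ ∑ (λ k → rect (suc d) k ⊟ rect (suc (suc d)) k)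
        ≈⟨ ∙-cong ≋-refl (∑-⊟ (rect (suc d)) (rect (suc (suc d)))) ⟩
      ~ Q^ (suc d) ∙ (S (suc d) ⊟ S (suc (suc d)))          ∎

    D-vanish : ∀ n d → S d ⊟ S (suc d) ≈[ n ] 𝟘
    D-vanish zero    d = ≈-intro 0 λ _ ()
    D-vanish (suc n) d = ≈-trans (≋⇒≈ (≋-trans (step d) (solve 2 (λ x y → ⊝ x :* y := x :* (⊝ y)) ≋-refl (Q^ (suc d)) (S (suc d) ⊟ S (suc (suc d))))))
      (≈-weaken (ℕₚ.+-monoˡ-≤ n {1} (ℕₚ.*-mono-≤ 0<m (s≤s z≤n)))
      (≈-trans (q^-≈ (m * suc d) (≈-~ (D-vanish n (suc d)))) (≋⇒≈ (solve 1 (λ x → x :* (⊝ ′ 0) := ′ 0) ≋-refl (Q^ (suc d))))))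

    S-suc : ∀ d → S d ≋ S (suc d)
    S-suc d = ≋-trans (solve 2 (λ a b → a := a :- b :+ b) ≋-refl (S d) (S (suc d)))
      (≋-trans (⊞-cong (≈-all λ n → D-vanish n d) ≋-refl) (⊞-identityˡ _))

    S-far : ∀ d n → S d ≋ S (n + d)
    S-far d zero    = ≋-refl
    S-far d (suc n) = ≋-trans (S-far d n) (S-suc (n + d))

    -- For large d only the term k = 0 is visible: 1/(Q)_d, which agrees with 1/(Q)_∞ modulo q^n.
    S-start : ∀ n d → n ≤ d → S d ≈[ n ] P∞ 𝟙 m m ⁻¹
    S-start n d n≤d = ≈-trans (≋⇒≈ (∑-head (rect-small d))) (≈-trans (≈-⊞ first rest) (≋⇒≈ (⊞-identityʳ _)))
      where
        first : rect d 0 ≈[ n ] P∞ 𝟙 m m ⁻¹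
        first = ≈-trans (≋⇒≈ (≋-trans (∙-cong (≋-trans (q^-cong (ℕₚ.*-zeroʳ m)) q^-zero) (∙-cong (⁻¹-unique (∙-identityˡ 𝟙)) ≋-refl))
                  (solve 1 (λ x → ′ 1 :* (′ 1 :* x) := x) ≋-refl (i d)))) (P⁻¹-limit 𝟙 m m d 0<m 0<m n≤d)
        big : ∀ k → n ≤ m * (suc k * (suc k + d))
        big k = ≤-trans n≤d (≤-trans (≤-trans (m≤n+m d (suc k)) (ℕₚ.m≤n*m (suc k + d) (suc k))) (ℕₚ.m≤n*m _ m {{ℕ.>-nonZero 0<m}}))
        rest : ∑ (λ k → rect d (suc k)) ≈[ n ] 𝟘
        rest = ≈-trans (∑-limit (suc n) ≤-refl (Small-q^ (λ k → m * (suc k * (suc k + d))) _ λ k → ≤-trans (ℕₚ.n≤1+n k) (quad d (suc k))))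
          (≈-trans (Σ-≈ (suc n) λ k _ → q^-small _ _ (big k)) (≋⇒≈ (zeros (suc n))))
          where
            zeros : ∀ n → Σ< n (λ _ → 𝟘) ≋ 𝟘
            zeros zero    = ≋-refl
            zeros (suc n) = ≋-trans (⊞-identityʳ _) (zeros n)

  -- Both sides count partitions: cut off the largest k × (k + d) rectangle.
  rectangle : ∀ d → ∑ (rect d) ≋ P∞ 𝟙 m m ⁻¹
  rectangle d = ≈-all λ n → ≈-trans (≋⇒≈ (S-far d n)) (S-start n (n + d) (m≤m+n n d))

  rectangle-limit : ∀ d n → Σ< (suc n) (rect d) ≈[ n ] P∞ 𝟙 m m ⁻¹
  rectangle-limit d n = ≈-trans (≈-sym (∑-limit (suc n) ≤-refl (rect-small d))) (≋⇒≈ (rectangle d))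

-- A limit under the summation sign: `Z i` is close to `C` only modulo q^(k-i), and the weight q^(w
-- i) with w i at least i makes up for the loss.
limit-Σ : ∀ (w : ℕ → ℕ) (g : ℕ → Series) C → (∀ i → i ≤ w i) → ∀ k N → k < N → (F Z : ℕ → Series) →
  (∀ i → i < N → F i ≋ q^ (w i) ∙ (g i ∙ Z i)) → (∀ i → i < N → Z i ≈[ k ∸ i ] C) →
  Σ< N F ≈[ k ] C ∙ ∑ (λ i → q^ (w i) ∙ g i)
limit-Σ w g C w≥ k N k<N F Z F≋ Z≈ = ≈-trans (Σ-≈ N term) (≈-trans (≋⇒≈ (≋-sym (Σ-∙ N C _))) (≈-∙ ≈-refl (≈-sym (∑-limit N k<N sm))))
  where
    sm : Small (λ i → q^ (w i) ∙ g i)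
    sm = Small-q^ w g λ i → ≤-trans (ℕₚ.n≤1+n i) (w≥ (suc i))
    enough : ∀ i → k ≤ w i + (k ∸ i)
    enough i = ≤-trans (ℕₚ.m≤n+m∸n k i) (ℕₚ.+-monoˡ-≤ (k ∸ i) (w≥ i))
    term : ∀ i → i < N → F i ≈[ k ] C ∙ (q^ (w i) ∙ g i)
    term i i<N = ≈-trans (≋⇒≈ (F≋ i i<N)) (≈-trans (≈-weaken (enough i) (q^-≈ (w i) (≈-∙ ≈-refl (Z≈ i i<N))))
      (≋⇒≈ (solve 3 (λ c q g → q :* (g :* c) := c :* (q :* g)) ≋-refl C (q^ (w i)) (g i))))

-- 1 - ε X q^a + q^(2a) is `fac` with the series ε X - q^a in the place of a sign.
Unit-denom : ∀ X ε {a} → 0 < a → Unit (denom X ε a)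
Unit-denom X ε {a} 0<a = Unit-≋ (solve 3 (λ q ε X → ′ 1 :- (ε :* X :- q) :* q := ′ 1 :* (′ 1 :+ q :* q) :- ε :* q :* X) ≋-refl (q^ a) ε X)
  (Unit-fac {ε ∙ X ⊟ q^ a} 0<a)

κ-odd : ℕ → ℕ → Series
κ-odd m i = fac 𝟙 (m + m * (i + i))

κ-odd-spec : ∀ m i → κ-odd m i ∙ (P 𝟙 m m i ∙ Π< i (λ j → fac 𝟙 (m * (1 + i + j)))) ≋ P 𝟙 m m (i + i + 1)
κ-odd-spec m i = ≋-trans (∙-cong ≋-refl (≋-trans (∙-cong ≋-refl (Π-cong i λ j _ → fac-cong (shuffle m i j))) (P-split 𝟙 m m i i)))
  (≋-trans (∙-comm _ _) (≋-reflexive (cong (P 𝟙 m m) (≡.sym (ℕₚ.+-comm (i + i) 1)))))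
  where
    shuffle : ∀ m i j → m * (1 + i + j) ≡ m + m * i + m * j
    shuffle = solve-∀

κ-zero : ℕ → ℕ → Series
κ-zero m zero    = 𝟙
κ-zero m (suc i) = 𝟙 ⊞ q^ (m * suc i)

-- The run of sums starts at i itself, so 1 - Q^i occurs twice, Q = q^m. Multiplication by 1 + Q^i
-- turns the second copy into the missing last factor 1 - Q^(2i).
κ-zero-spec : ∀ m i → κ-zero m i ∙ (P 𝟙 m m i ∙ Π< i (λ j → fac 𝟙 (m * (0 + i + j)))) ≋ P 𝟙 m m (i + i + 0)
κ-zero-spec m zero    = solve 0 (′ 1 :* (′ 1 :* ′ 1) := ′ 1) ≋-refl
κ-zero-spec m (suc i) = begin
  (𝟙 ⊞ Y) ∙ (P 𝟙 m m (suc i) ∙ Π< (suc i) (λ j → fac 𝟙 (m * (suc i + j))))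
    ≈⟨ ∙-cong ≋-refl (∙-cong ≋-refl (≋-trans (Π-head i _) (∙-cong (fac-cong (cong (m *_) (ℕₚ.+-identityʳ (suc i)))) (Π-cong i λ j _ → fac-cong (shuffle₁ m i j))))) ⟩
  (𝟙 ⊞ Y) ∙ (P 𝟙 m m (suc i) ∙ (fac 𝟙 (m * suc i) ∙ P 𝟙 (m + m * suc i) m i))
    ≈⟨ solve 3 (λ y p r → (′ 1 :+ y) :* (p :* ((′ 1 :- ′ 1 :* y) :* r)) := p :* r :* (′ 1 :- ′ 1 :* (y :* y))) ≋-refl Y (P 𝟙 m m (suc i)) (P 𝟙 (m + m * suc i) m i) ⟩
  P 𝟙 m m (suc i) ∙ P 𝟙 (m + m * suc i) m i ∙ (𝟙 ⊟ 𝟙 ∙ (Y ∙ Y))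
    ≈⟨ ∙-cong (P-split 𝟙 m m (suc i) i) (⊞-cong ≋-refl (~-cong (∙-cong ≋-refl (≋-trans (≋-sym (q^-+ _ _)) (q^-cong (shuffle₂ m i)))))) ⟩
  P 𝟙 m m (suc (suc i + i))
    ≈⟨ ≋-reflexive (cong (P 𝟙 m m) (shuffle₃ i)) ⟩
  P 𝟙 m m (suc i + suc i + 0) ∎
  where
    Y = q^ (m * suc i)
    shuffle₁ : ∀ m i j → m * (suc i + suc j) ≡ m + m * suc i + m * j
    shuffle₁ = solve-∀
    shuffle₂ : ∀ m i → m * suc i + m * suc i ≡ m + m * (suc i + i)
    shuffle₂ = solve-∀
    shuffle₃ : ∀ i → suc (suc i + i) ≡ suc i + suc i + 0
    shuffle₃ = solve-∀

minus² : ~ 𝟙 ∙ ~ 𝟙 ≋ 𝟙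
minus² = solve 0 ((⊝ ′ 1) :* (⊝ ′ 1) := ′ 1) ≋-refl

𝟙² : 𝟙 ∙ 𝟙 ≋ 𝟙
𝟙² = ∙-identityˡ 𝟙

module OddFamily = Own 1 2 1 (s≤s z≤n) ≡.refl (κ-odd 2) (κ-odd-spec 2)

-- From Eulerian series to Lambert series

-- Up to normalisation, the partial fractions exhibit the finite products of `x` as one half of a
-- Bailey pair, the other half being (-1)^j q^(m T(j+1)) κ_j x_j. The rectangle identity then acts
-- as the limiting case of Bailey's lemma.
module Transform (a m b : ℕ) (0<m : 0 < m) (2a : a + a ≡ m * b) (κ : ℕ → Series)
  (κ-spec : ∀ i → κ i ∙ (P 𝟙 m m i ∙ Π< i (λ j → fac 𝟙 (m * (b + i + j)))) ≋ P 𝟙 m m (i + i + b))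
  (X : Series) (UX : ∀ i → Unit (denom X 𝟙 (a + m * i))) where

  open Own a m b 0<m 2a κ κ-spec
  open Rectangle m 0<m using (rect; rectangle-limit)

  private
    module TF = TwoFamilies 𝟙 (~ 𝟙) (~ 𝟙) 𝟙² minus² minus² (∙-identityˡ (~ 𝟙)) minus² Unit-fac-minus-zero
      at-index OddFamily.at-index at-index-injective OddFamily.at-index-injective own OddFamily.own own-refl OddFamily.own-refl own-≢ OddFamily.own-≢
      X UX (λ i → Unit-denom X (~ 𝟙) (s≤s z≤n))

    x : ℕ → Series
    x i = denom X 𝟙 (a + m * i) ⁻¹

    one-family : ∀ n → Π< (suc n) x ≋ Σ< (suc n) (λ i → x i ∙ Π< (suc n) (own i))
    -- The two-family expansion with the second family cut off at zero nodes.
    one-family n = ≋-trans (≋-sym (∙-identityʳ _)) (≋-trans (TF.expand n 0) (≋-trans (⊞-identityʳ _)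
      (Σ-cong (suc n) λ i _ → ∙-cong ≋-refl (∙-identityʳ _))))

    w : ℕ → ℕ
    w j = m * (T (suc j) + j * (j + b))

  eulerian : ℕ → Series
  eulerian n = q^ (m * (n * (n + b))) ∙ Π< (suc n) x

  lambert : ℕ → Series
  lambert j = q^ (w j) ∙ (pow (~ 𝟙) j ∙ κ j ∙ x j)

  private
    F : ℕ → ℕ → Series
    F n j = q^ (m * (n * (n + b))) ∙ (x j ∙ Π< (suc n) (own j))

    -- (j + l)(j + l + b) = j (j + b) + l (l + 2j + b), so for a fixed pole j the sum over l is a
    -- rectangle sum with side difference 2j + b.
    F-eq : ∀ j l → F (j + l) j ≋ q^ (w j) ∙ (pow (~ 𝟙) j ∙ κ j ∙ x j ∙ rect (j + j + b) l)
    F-eq j l = begin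
      q^ (m * ((j + l) * (j + l + b))) ∙ (x j ∙ Π< (suc (j + l)) (own j))
        ≈⟨ ∙-cong (≋-trans (q^-cong (shuffle m j l b)) (q^-+ _ _)) (∙-cong ≋-refl (≋-trans (≋-reflexive (cong (λ i → Π< i (own j)) (≡.sym (ℕₚ.+-suc j l)))) (own-product j l))) ⟩
      Y ∙ Z ∙ (x j ∙ (S ∙ V ∙ κ j ∙ (P 𝟙 m m l ∙ P 𝟙 m m (j + j + b + l)) ⁻¹))
        ≈⟨ ∙-cong ≋-refl (∙-cong ≋-refl (∙-cong ≋-refl (≋-trans (⁻¹-∙ (Unit-P 𝟙 m m l 0<m) (Unit-P 𝟙 m m (j + j + b + l) 0<m)) (∙-cong ≋-refl (≋-reflexive (cong (λ i → P 𝟙 m m i ⁻¹) (ℕₚ.+-comm (j + j + b) l))))))) ⟩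
      Y ∙ Z ∙ (x j ∙ (S ∙ V ∙ κ j ∙ I))
        ≈⟨ solve 7 (λ y z x s v k i → y :* z :* (x :* (s :* v :* k :* i)) := v :* y :* (s :* k :* x :* (z :* i))) ≋-refl Y Z (x j) S V (κ j) I ⟩
      V ∙ Y ∙ (S ∙ κ j ∙ x j ∙ (Z ∙ I))
        ≈⟨ ∙-cong (≋-trans (≋-sym (q^-+ _ _)) (q^-cong (≡.sym (ℕₚ.*-distribˡ-+ m (T (suc j)) (j * (j + b)))))) ≋-refl ⟩
      q^ (w j) ∙ (pow (~ 𝟙) j ∙ κ j ∙ x j ∙ rect (j + j + b) l) ∎
      where
        Y = q^ (m * (j * (j + b)))
        Z = q^ (m * (l * (l + (j + j + b))))
        S = pow (~ 𝟙) j
        V = q^ (m * T (suc j))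
        I = P 𝟙 m m l ⁻¹ ∙ P 𝟙 m m (l + (j + j + b)) ⁻¹
        shuffle : ∀ m j l b → m * ((j + l) * (j + l + b)) ≡ m * (j * (j + b)) + m * (l * (l + (j + j + b)))
        shuffle = solve-∀

  T-suc≥ : ∀ j → j ≤ T (suc j)
  T-suc≥ j = m≤n+m j (T j)

  lambert-small : Small lambert
  lambert-small = Small-q^ w _ λ k → ≤-trans (≤-trans (ℕₚ.n≤1+n k) (≤-trans (T-suc≥ (suc k)) (m≤m+n _ _))) (ℕₚ.m≤n*m _ m {{ℕ.>-nonZero 0<m}})

  private
    eulerian-partial : ∀ n → Σ< (suc n) eulerian ≈[ n ] P∞ 𝟙 m m ⁻¹ ∙ ∑ lambert
    eulerian-partial n = ≈-trans (≋⇒≈ (begin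
      Σ< M eulerian
        ≈⟨ Σ-cong M (λ k _ → ≋-trans (∙-cong ≋-refl (one-family k)) (Σ-∙ (suc k) _ _)) ⟩
      Σ< M (λ k → Σ< (suc k) (F k))
        ≈⟨ Σ-triangle M F ⟩
      Σ< M (λ j → Σ< (M ∸ j) (λ l → F (j + l) j)) ∎))
      (limit-Σ w (λ j → pow (~ 𝟙) j ∙ κ j ∙ x j) (P∞ 𝟙 m m ⁻¹)
        (λ i → ≤-trans (≤-trans (T-suc≥ i) (m≤m+n _ _)) (ℕₚ.m≤n*m _ m {{ℕ.>-nonZero 0<m}})) n M ≤-refl _ (λ j → Σ< (M ∸ j) (rect (j + j + b)))
        (λ j _ → ≋-trans (Σ-cong (M ∸ j) λ l _ → ≋-trans (F-eq j l) (≋-sym (∙-assoc _ _ _)))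
                   (≋-trans (≋-sym (Σ-∙ (M ∸ j) _ _)) (∙-assoc _ _ _)))
        λ j j<M → ≈-trans (≋⇒≈ (≋-reflexive (cong (λ i → Σ< i (rect (j + j + b))) (ℕₚ.+-∸-assoc 1 (ℕₚ.≤-pred j<M))))) (rectangle-limit (j + j + b) (n ∸ j)))
      where M = suc n

  eulerian-small : Small eulerian
  eulerian-small = Small-q^ (λ n → m * (n * (n + b))) _ λ k → ≤-trans (≤-trans (ℕₚ.n≤1+n k) (≤-trans (ℕₚ.m≤m*n (suc k) (suc k)) (ℕₚ.*-monoʳ-≤ (suc k) (m≤m+n (suc k) b)))) (ℕₚ.m≤n*m _ m {{ℕ.>-nonZero 0<m}})

  transform : ∑ eulerian ≋ P∞ 𝟙 m m ⁻¹ ∙ ∑ lambert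
  transform = ≈-all λ n → ≈-trans (∑-limit (suc n) ≤-refl eulerian-small) (eulerian-partial n)

-- Two families with opposite signs

pow-𝟙 : ∀ n → pow (~ ~ 𝟙) n ≋ 𝟙
pow-𝟙 zero    = ≋-refl
pow-𝟙 (suc n) = ≋-trans (∙-cong (pow-𝟙 n) (solve 0 (⊝ (⊝ ′ 1) := ′ 1) ≋-refl)) (∙-identityˡ 𝟙)

P⁺ : ℕ → ℕ → ℕ → Series
P⁺ = P (~ 𝟙)

P⁺∞ : ℕ → ℕ → Series
P⁺∞ = P∞ (~ 𝟙)

two : Series
two = 𝟙 ⊞ 𝟙

denom-two : ∀ {ε} a → ε ∙ ε ≋ 𝟙 → denom two ε a ≋ fac ε a ∙ fac ε a
denom-two {ε} a ε² = begin
  𝟙 ∙ (𝟙 ⊞ Y ∙ Y) ⊟ ε ∙ Y ∙ (𝟙 ⊞ 𝟙)        ≈⟨ solve 2 (λ ε y → ′ 1 :* (′ 1 :+ y :* y) :- ε :* y :* (′ 1 :+ ′ 1) := ′ 1 :+ ′ 1 :* (y :* y) :- ε :* y :* (′ 1 :+ ′ 1)) ≋-refl ε Y ⟩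
  𝟙 ⊞ 𝟙 ∙ (Y ∙ Y) ⊟ ε ∙ Y ∙ (𝟙 ⊞ 𝟙)        ≈⟨ ⊞-cong (⊞-cong ≋-refl (∙-cong (≋-sym ε²) ≋-refl)) ≋-refl ⟩
  𝟙 ⊞ ε ∙ ε ∙ (Y ∙ Y) ⊟ ε ∙ Y ∙ (𝟙 ⊞ 𝟙)    ≈⟨ solve 2 (λ ε y → ′ 1 :+ ε :* ε :* (y :* y) :- ε :* y :* (′ 1 :+ ′ 1) := (′ 1 :- ε :* y) :* (′ 1 :- ε :* y)) ≋-refl ε Y ⟩
  fac ε a ∙ fac ε a                          ∎
  where Y = q^ a

-- `ℓ r` is half of the even exponent a₁ + 4r, hence the number of odd exponents below it. `v` and
-- `h` record the power of q and the factor that the first family contributes to the residue at an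
-- odd node; `Z` is the part with a limit.
module Cross
  (a₁ b₁ : ℕ) (2a₁ : a₁ + a₁ ≡ 4 * b₁) (κ₁ : ℕ → Series)
  (κ₁-spec : ∀ i → κ₁ i ∙ (P 𝟙 4 4 i ∙ Π< i (λ j → fac 𝟙 (4 * (b₁ + i + j)))) ≋ P 𝟙 4 4 (i + i + b₁))
  (ε₁ ε₂ : Series) (ε₁² : ε₁ ∙ ε₁ ≋ 𝟙) (ε₂² : ε₂ ∙ ε₂ ≋ 𝟙) (ε₁₂ : ε₁ ∙ ~ 𝟙 ≋ ε₂) (ε₂₁ : ε₂ ∙ ~ 𝟙 ≋ ε₁)
  (Uf₁ : ∀ i → Unit (fac ε₁ (a₁ + 4 * i)))
  (ℓ : ℕ → ℕ) (ℓ-spec : ∀ r → a₁ + 4 * r ≡ ℓ r + ℓ r) (ℓ≤ : ∀ r → ℓ r ≤ suc (r + r))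
  (v : ℕ → ℕ) (h : ℕ → Series)
  (cross₂ : ∀ k s → s < suc k + suc k → ∃ λ Z → (Π< (suc k) (λ r → cf (~ 𝟙) (1 + 2 * s) (a₁ + 4 * r)) ≋ q^ (v s) ∙ (h s ∙ Z))
                                              × Z ≈[ k ∸ s ] P⁺∞ 1 4 ⁻¹ ∙ P⁺∞ 3 4 ⁻¹)
  where

  private
    module A = Own a₁ 4 b₁ (s≤s z≤n) 2a₁ κ₁ κ₁-spec

    U₁ : ∀ i → Unit (denom two ε₁ (a₁ + 4 * i))
    U₁ i = Unit-≋ (≋-sym (denom-two _ ε₁²)) (Unit-∙ (Uf₁ i) (Uf₁ i))

    U₂ : ∀ i → Unit (denom two ε₂ (1 + 2 * i))
    U₂ i = Unit-denom two ε₂ (s≤s z≤n)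

    module TF = TwoFamilies ε₁ ε₂ (~ 𝟙) ε₁² ε₂² minus² ε₁₂ ε₂₁ Unit-fac-minus-zero
      A.at-index OddFamily.at-index A.at-index-injective OddFamily.at-index-injective A.own OddFamily.own A.own-refl OddFamily.own-refl A.own-≢ OddFamily.own-≢
      two U₁ U₂

    w₁ w₂ : ℕ → ℕ
    w₁ r = 4 * T (suc r) + (1 * ℓ r + 2 * T (ℓ r))
    w₂ s = 2 * T (suc s) + v s

    g₁ g₂ : ℕ → Series
    g₁ r = pow (~ 𝟙) r ∙ κ₁ r ∙ denom two ε₁ (a₁ + 4 * r) ⁻¹
    g₂ s = pow (~ 𝟙) s ∙ κ-odd 2 s ∙ h s ∙ denom two ε₂ (1 + 2 * s) ⁻¹

    C₁ C₂ : Series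
    C₁ = P∞ 𝟙 4 4 ⁻¹ ∙ P∞ 𝟙 4 4 ⁻¹ ∙ (P⁺∞ 1 2 ⁻¹ ∙ P⁺∞ 1 2 ⁻¹)
    C₂ = P∞ 𝟙 2 2 ⁻¹ ∙ P∞ 𝟙 2 2 ⁻¹ ∙ (P⁺∞ 1 4 ⁻¹ ∙ P⁺∞ 3 4 ⁻¹)

    0< : ∀ {n} → 0 < suc n
    0< = s≤s z≤n

    split : ∀ {k r} → r < suc k → suc k ≡ r + suc (k ∸ r)
    split {k} {r} (s≤s r≤k) = ≡.sym (≡.trans (ℕₚ.+-suc r (k ∸ r)) (cong suc (ℕₚ.m+[n∸m]≡n r≤k)))

    -- The distances down to the odd nodes are 1, 3, ..., 2 ℓ r - 1, and the sums of exponents begin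
    -- at 1 + 2 ℓ r, exactly where these end. The two runs join into one factorial.
    cross₁ : ∀ r M → Π< (ℓ r + M) (λ s → cf (~ 𝟙) (a₁ + 4 * r) (1 + 2 * s)) ≋
      q^ (1 * ℓ r + 2 * T (ℓ r)) ∙ (P⁺ 1 2 M ⁻¹ ∙ P⁺ 1 2 (ℓ r + (ℓ r + M)) ⁻¹)
    cross₁ r M = begin
      Π< (ℓ r + M) (λ s → cf (~ 𝟙) (a₁ + 4 * r) (1 + 2 * s))
        ≈⟨ cf-product (~ 𝟙) (a₁ + 4 * r) 1 2 1 1 (1 + 2 * ℓ r) (ℓ r) M 0< 0< 0< ≡.refl (≡.trans (shuffle (ℓ r)) (≡.sym (cong (_+ 1) (ℓ-spec r)))) (≡.trans (cong (_+ 1) (ℓ-spec r)) (≡.sym (shuffle (ℓ r)))) ⟩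
      pow (~ ~ 𝟙) (ℓ r) ∙ q^ (1 * ℓ r + 2 * T (ℓ r)) ∙ P⁺ 1 2 M ⁻¹ ∙ (P⁺ 1 2 (ℓ r) ∙ P⁺ (1 + 2 * ℓ r) 2 (ℓ r + M)) ⁻¹
        ≈⟨ ∙-cong (∙-cong (≋-trans (∙-cong (pow-𝟙 (ℓ r)) ≋-refl) (∙-identityˡ _)) ≋-refl)
                  (⁻¹-cong (Unit-∙ (Unit-P (~ 𝟙) 1 2 (ℓ r) 0<) (Unit-P (~ 𝟙) (1 + 2 * ℓ r) 2 (ℓ r + M) 0<)) (P-split (~ 𝟙) 1 2 (ℓ r) (ℓ r + M))) ⟩
      q^ (1 * ℓ r + 2 * T (ℓ r)) ∙ P⁺ 1 2 M ⁻¹ ∙ P⁺ 1 2 (ℓ r + (ℓ r + M)) ⁻¹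
        ≈⟨ ∙-assoc _ _ _ ⟩
      q^ (1 * ℓ r + 2 * T (ℓ r)) ∙ (P⁺ 1 2 M ⁻¹ ∙ P⁺ 1 2 (ℓ r + (ℓ r + M)) ⁻¹) ∎
      where
        shuffle : ∀ n → 1 + 2 * n ≡ n + n + 1
        shuffle = solve-∀

    Z₁ : ℕ → ℕ → Series
    Z₁ k r = P 𝟙 4 4 (k ∸ r) ⁻¹ ∙ P 𝟙 4 4 (r + r + b₁ + (k ∸ r)) ⁻¹ ∙ (P⁺ 1 2 (suc k + suc k ∸ ℓ r) ⁻¹ ∙ P⁺ 1 2 (ℓ r + (ℓ r + (suc k + suc k ∸ ℓ r))) ⁻¹)

    ℓ-fits : ∀ {k r} → r < suc k → ℓ r ≤ suc k + suc k
    ℓ-fits {k} {r} (s≤s r≤k) = ≤-trans (ℓ≤ r) (≤-trans (s≤s (+-mono-≤ r≤k r≤k)) (s≤s (ℕₚ.+-monoʳ-≤ k (ℕₚ.n≤1+n k))))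

    term₁ : ∀ k r → r < suc k → denom two ε₁ (a₁ + 4 * r) ⁻¹ ∙ (Π< (suc k) (A.own r) ∙ Π< (suc k + suc k) (λ s → cf (~ 𝟙) (a₁ + 4 * r) (1 + 2 * s))) ≋
      q^ (w₁ r) ∙ (g₁ r ∙ Z₁ k r)
    term₁ k r r<k = begin
      x ∙ (Π< (suc k) (A.own r) ∙ Π< (suc k + suc k) (λ s → cf (~ 𝟙) (a₁ + 4 * r) (1 + 2 * s)))
        ≈⟨ ∙-cong ≋-refl (∙-cong (≋-trans (≋-reflexive (cong (λ n → Π< n (A.own r)) (split r<k))) (A.own-product r (k ∸ r)))
             (≋-trans (≋-reflexive (cong (λ n → Π< n (λ s → cf (~ 𝟙) (a₁ + 4 * r) (1 + 2 * s))) (≡.sym (ℕₚ.m+[n∸m]≡n (ℓ-fits r<k))))) (cross₁ r (suc k + suc k ∸ ℓ r)))) ⟩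
      x ∙ (S ∙ q^ (4 * T (suc r)) ∙ κ₁ r ∙ (P 𝟙 4 4 (k ∸ r) ∙ P 𝟙 4 4 (r + r + b₁ + (k ∸ r))) ⁻¹ ∙ (q^ (1 * ℓ r + 2 * T (ℓ r)) ∙ R))
        ≈⟨ ∙-cong ≋-refl (∙-cong (∙-cong ≋-refl (⁻¹-∙ (Unit-P 𝟙 4 4 (k ∸ r) 0<) (Unit-P 𝟙 4 4 (r + r + b₁ + (k ∸ r)) 0<))) ≋-refl) ⟩
      x ∙ (S ∙ q^ (4 * T (suc r)) ∙ κ₁ r ∙ I ∙ (q^ (1 * ℓ r + 2 * T (ℓ r)) ∙ R))
        ≈⟨ solve 7 (λ x s q k i p r → x :* (s :* q :* k :* i :* (p :* r)) := q :* p :* (s :* k :* x :* (i :* r))) ≋-refl x S (q^ (4 * T (suc r))) (κ₁ r) I (q^ (1 * ℓ r + 2 * T (ℓ r))) R ⟩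
      q^ (4 * T (suc r)) ∙ q^ (1 * ℓ r + 2 * T (ℓ r)) ∙ (g₁ r ∙ Z₁ k r)
        ≈⟨ ∙-cong (≋-sym (q^-+ _ _)) ≋-refl ⟩
      q^ (w₁ r) ∙ (g₁ r ∙ Z₁ k r) ∎
      where
        x = denom two ε₁ (a₁ + 4 * r) ⁻¹
        S = pow (~ 𝟙) r
        I = P 𝟙 4 4 (k ∸ r) ⁻¹ ∙ P 𝟙 4 4 (r + r + b₁ + (k ∸ r)) ⁻¹
        R = P⁺ 1 2 (suc k + suc k ∸ ℓ r) ⁻¹ ∙ P⁺ 1 2 (ℓ r + (ℓ r + (suc k + suc k ∸ ℓ r))) ⁻¹

    room : ∀ k r → r < suc k → k ∸ r ≤ suc k + suc k ∸ ℓ r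
    room k r (s≤s r≤k) = ℕₚ.m+n≤o⇒m≤o∸n (k ∸ r) (≤-trans (ℕₚ.+-monoʳ-≤ (k ∸ r) (ℓ≤ r))
      (≤-trans (≤-reflexive (≡.trans (shuffle (k ∸ r) r) (cong (λ i → suc (i + r)) (ℕₚ.m∸n+n≡m r≤k)))) (s≤s (ℕₚ.+-monoʳ-≤ k (ℕₚ.m≤n⇒m≤1+n r≤k)))))
      where
        shuffle : ∀ d r → d + suc (r + r) ≡ suc (d + r + r)
        shuffle = solve-∀

    Z₁-limit : ∀ k r → r < suc k → Z₁ k r ≈[ k ∸ r ] C₁
    Z₁-limit k r r<k = ≈-∙ (≈-∙ (P⁻¹-limit 𝟙 4 4 (k ∸ r) 0< 0< ≤-refl) (P⁻¹-limit 𝟙 4 4 (r + r + b₁ + (k ∸ r)) 0< 0< (m≤n+m _ _)))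
      (≈-∙ (P⁻¹-limit (~ 𝟙) 1 2 (suc k + suc k ∸ ℓ r) 0< 0< (room k r r<k))
           (P⁻¹-limit (~ 𝟙) 1 2 (ℓ r + (ℓ r + (suc k + suc k ∸ ℓ r))) 0< 0< (≤-trans (room k r r<k) (≤-trans (m≤n+m _ (ℓ r)) (m≤n+m _ (ℓ r))))))

    Z₂′ : ∀ k s → Dec (s < suc k + suc k) → Series
    -- `cross₂` gives nothing outside its range; the limit itself serves as default, so that the
    -- congruence to `C₂` holds for every s.
    Z₂′ k s (no _)  = C₂
    Z₂′ k s (yes p) = P 𝟙 2 2 (suc k + k ∸ s) ⁻¹ ∙ P 𝟙 2 2 (s + s + 1 + (suc k + k ∸ s)) ⁻¹ ∙ proj₁ (cross₂ k s p)

    Z₂ : ℕ → ℕ → Series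
    Z₂ k s = Z₂′ k s (s ℕ.<? suc k + suc k)

    term₂ : ∀ k s (d : Dec (s < suc k + suc k)) → s < suc k + suc k → denom two ε₂ (1 + 2 * s) ⁻¹ ∙ (Π< (suc k) (λ r → cf (~ 𝟙) (1 + 2 * s) (a₁ + 4 * r)) ∙ Π< (suc k + suc k) (OddFamily.own s)) ≋
      q^ (w₂ s) ∙ (g₂ s ∙ Z₂′ k s d)
    term₂ k s (no p)  s<k = ⊥-elim (p s<k)
    term₂ k s (yes p) s<k = begin
      x ∙ (Π< (suc k) (λ r → cf (~ 𝟙) (1 + 2 * s) (a₁ + 4 * r)) ∙ Π< (suc k + suc k) (OddFamily.own s))
        ≈⟨ ∙-cong ≋-refl (∙-cong (proj₁ (proj₂ (cross₂ k s p))) (≋-trans (≋-reflexive (cong (λ n → Π< n (OddFamily.own s)) (≡.trans (ℕₚ.+-suc (suc k) k) (split (≤-trans p (≤-reflexive (ℕₚ.+-suc (suc k) k))))))) (OddFamily.own-product s (suc k + k ∸ s)))) ⟩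
      x ∙ (q^ (v s) ∙ (h s ∙ Z) ∙ (S ∙ q^ (2 * T (suc s)) ∙ κ-odd 2 s ∙ (P 𝟙 2 2 (suc k + k ∸ s) ∙ P 𝟙 2 2 (s + s + 1 + (suc k + k ∸ s))) ⁻¹))
        ≈⟨ ∙-cong ≋-refl (∙-cong ≋-refl (∙-cong ≋-refl (⁻¹-∙ (Unit-P 𝟙 2 2 (suc k + k ∸ s) 0<) (Unit-P 𝟙 2 2 (s + s + 1 + (suc k + k ∸ s)) 0<)))) ⟩
      x ∙ (q^ (v s) ∙ (h s ∙ Z) ∙ (S ∙ q^ (2 * T (suc s)) ∙ κ-odd 2 s ∙ I))
        ≈⟨ solve 8 (λ x p h z s q k i → x :* (p :* (h :* z) :* (s :* q :* k :* i)) := q :* p :* (s :* k :* h :* x :* (i :* z))) ≋-refl x (q^ (v s)) (h s) Z S (q^ (2 * T (suc s))) (κ-odd 2 s) I ⟩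
      q^ (2 * T (suc s)) ∙ q^ (v s) ∙ (g₂ s ∙ (I ∙ Z))
        ≈⟨ ∙-cong (≋-sym (q^-+ _ _)) ≋-refl ⟩
      q^ (w₂ s) ∙ (g₂ s ∙ (I ∙ Z)) ∎
      where
        x = denom two ε₂ (1 + 2 * s) ⁻¹
        S = pow (~ 𝟙) s
        Z = proj₁ (cross₂ k s p)
        I = P 𝟙 2 2 (suc k + k ∸ s) ⁻¹ ∙ P 𝟙 2 2 (s + s + 1 + (suc k + k ∸ s)) ⁻¹

    Z₂-limit : ∀ k s (d : Dec (s < suc k + suc k)) → Z₂′ k s d ≈[ k ∸ s ] C₂
    Z₂-limit k s (no _)  = ≈-refl
    Z₂-limit k s (yes p) = ≈-∙ (≈-∙ (P⁻¹-limit 𝟙 2 2 (suc k + k ∸ s) 0< 0< le) (P⁻¹-limit 𝟙 2 2 (s + s + 1 + (suc k + k ∸ s)) 0< 0< (≤-trans le (m≤n+m _ _)))) (proj₂ (proj₂ (cross₂ k s p)))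
      where
        le : k ∸ s ≤ suc k + k ∸ s
        le = ℕₚ.∸-monoˡ-≤ s (m≤n+m k (suc k))

    product-limit : ∀ k N a m {ε} → ε ∙ ε ≋ 𝟙 → 0 < m → k ≤ N → (∀ i → Unit (fac ε (a + m * i))) →
      Π< N (λ i → denom two ε (a + m * i) ⁻¹) ≈[ k ] (P∞ ε a m ∙ P∞ ε a m) ⁻¹
    product-limit k N a m {ε} ε² 0<m k≤N u = ≈-trans (≋⇒≈ (≋-trans (Π-⁻¹ N λ i → Unit-≋ (≋-sym (denom-two _ ε²)) (Unit-∙ (u i) (u i)))
        (⁻¹-cong (Π-Unit N λ i → Unit-≋ (≋-sym (denom-two _ ε²)) (Unit-∙ (u i) (u i))) (≋-trans (Π-cong N λ i _ → denom-two _ ε²) (Π-∙ N _ _)))))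
      (≈-⁻¹ (Unit-∙ (Π-Unit N u) (Π-Unit N u)) (Unit-∙ (∏-Unit u) (∏-Unit u)) (≈-sym (≈-∙ (P∞-limit ε a m N 0<m k≤N) (P∞-limit ε a m N 0<m k≤N))))

    T-suc≥ : ∀ j c → j ≤ suc c * T (suc j)
    T-suc≥ j c = ≤-trans (m≤n+m j (T j)) (m≤m+n _ _)

  first second : ℕ → Series
  first r  = q^ (w₁ r) ∙ g₁ r
  second s = q^ (w₂ s) ∙ g₂ s

  -- The truncations keep k + 1 nodes in steps of 4 and 2k + 2 nodes in steps of 2, so both families
  -- reach about the same exponent and all residues converge together.
  crossing : (P∞ ε₁ a₁ 4 ∙ P∞ ε₁ a₁ 4) ⁻¹ ∙ (P∞ ε₂ 1 2 ∙ P∞ ε₂ 1 2) ⁻¹ ≋ C₁ ∙ ∑ first ⊞ C₂ ∙ ∑ second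
  crossing = ≈-all λ k → ≈-trans (≈-sym (≈-∙ (product-limit k (suc k) a₁ 4 ε₁² 0< (ℕₚ.n≤1+n k) Uf₁) (product-limit k (suc k + suc k) 1 2 ε₂² 0< (≤-trans (ℕₚ.n≤1+n k) (m≤m+n (suc k) (suc k))) λ i → Unit-fac 0<)))
    (≈-trans (≋⇒≈ (TF.expand k (suc k + suc k)))
    (≈-⊞ (limit-Σ w₁ g₁ C₁ (λ i → ≤-trans (T-suc≥ i 3) (m≤m+n _ _)) k (suc k) ≤-refl _ (Z₁ k) (term₁ k) (Z₁-limit k))
         (limit-Σ w₂ g₂ C₂ (λ i → ≤-trans (T-suc≥ i 1) (m≤m+n _ _)) k (suc k + suc k) (m≤m+n (suc k) (suc k)) _ (Z₂ k) (λ s → term₂ k s (s ℕ.<? suc k + suc k)) (λ s _ → Z₂-limit k s (s ℕ.<? suc k + suc k)))))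

-- Residue products across the two families

data Parity : ℕ → Set where
  even : ∀ σ → Parity (σ + σ)
  odd  : ∀ σ → Parity (suc (σ + σ))

parity : ∀ n → Parity n
parity zero = even 0
parity (suc n) with parity n
... | even σ = odd σ
... | odd σ  = subst Parity (cong suc (ℕₚ.+-suc σ σ)) (even (suc σ))

half-≤ : ∀ σ k → σ + σ < suc k + suc k → σ ≤ k
half-≤ σ k p with σ ℕ.≤? k
... | yes le = le
... | no gt  = ⊥-elim (ℕₚ.<⇒≱ p (+-mono-≤ (ℕₚ.≰⇒> gt) (ℕₚ.≰⇒> gt)))

-- Both sides are σ (2σ + 1). Together with `T-odd` this merges the exponents found for even and for
-- odd s into one triangular number.
T-even : ∀ σ → 3 * σ + 4 * T σ ≡ T (suc (σ + σ))
T-even zero    = ≡.refl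
T-even (suc σ) = ≡.trans (shuffle₁ σ (T σ)) (≡.trans (cong (_+ (σ + σ + suc (σ + σ) + 2)) (T-even σ))
  (≡.trans (shuffle₂ σ (T (suc (σ + σ)))) (≡.sym (cong (λ n → T n + n) (cong suc (ℕₚ.+-suc σ σ))))))
  where
    shuffle₁ : ∀ σ t → 3 * suc σ + 4 * (t + σ) ≡ 3 * σ + 4 * t + (σ + σ + suc (σ + σ) + 2)
    shuffle₁ = solve-∀
    shuffle₂ : ∀ σ t → t + (σ + σ + suc (σ + σ) + 2) ≡ t + suc (σ + σ) + suc (suc (σ + σ))
    shuffle₂ = solve-∀

T-odd : ∀ σ → 1 * suc σ + 4 * T (suc σ) ≡ T (suc (suc (σ + σ)))
T-odd σ = ≡.trans (shuffle σ (T σ)) (cong (_+ suc (σ + σ)) (T-even σ))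
  where
    shuffle : ∀ σ t → 1 * suc σ + 4 * (t + σ) ≡ 3 * σ + 4 * t + suc (σ + σ)
    shuffle = solve-∀

private
  0<′ : ∀ {n} → 0 < suc n
  0<′ = s≤s z≤n

  cf-product⁺ : ∀ a b x y z ℓ M → 0 < x → 0 < y → 0 < z → x + y ≡ 4 → b + 4 * ℓ ≡ a + y → a + b ≡ z →
    Π< (ℓ + M) (λ r → cf (~ 𝟙) a (b + 4 * r)) ≋ q^ (x * ℓ + 4 * T ℓ) ∙ (P⁺ y 4 M ⁻¹ ∙ (P⁺ x 4 ℓ ∙ P⁺ z 4 (ℓ + M)) ⁻¹)
  cf-product⁺ a b x y z ℓ M 0<x 0<y 0<z xy bl ab = ≋-trans (cf-product (~ 𝟙) a b 4 x y z ℓ M 0<x 0<y 0<z xy bl ab)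
    (≋-trans (∙-cong (∙-cong (≋-trans (∙-cong (pow-𝟙 ℓ) ≋-refl) (∙-identityˡ _)) ≋-refl) ≋-refl) (∙-assoc _ _ _))

  -- The sums of exponents start one step after the last distance, so the two runs of factors merge
  -- without overlap.
  cross-regular : ∀ a b x y ℓ M → 0 < x → 0 < y → x + y ≡ 4 → b + 4 * ℓ ≡ a + y → a + b ≡ x + 4 * ℓ →
    Π< (ℓ + M) (λ r → cf (~ 𝟙) a (b + 4 * r)) ≋ q^ (x * ℓ + 4 * T ℓ) ∙ (𝟙 ∙ (P⁺ y 4 M ⁻¹ ∙ P⁺ x 4 (ℓ + (ℓ + M)) ⁻¹))
  cross-regular a b x y ℓ M 0<x 0<y xy bl ab = ≋-trans (cf-product⁺ a b x y (x + 4 * ℓ) ℓ M 0<x 0<y (≤-trans 0<x (m≤m+n x _)) xy bl ab)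
    (∙-cong ≋-refl (≋-trans (∙-cong ≋-refl (⁻¹-cong (Unit-∙ (Unit-P (~ 𝟙) x 4 ℓ 0<x) (Unit-P (~ 𝟙) (x + 4 * ℓ) 4 (ℓ + M) (≤-trans 0<x (m≤m+n x _)))) (P-split (~ 𝟙) x 4 ℓ (ℓ + M)))) (≋-sym (∙-identityˡ _))))

  -- With nodes at 4r the sums of exponents start at a, which is also the last distance. The factor
  -- 1 + q^a therefore occurs twice, and its extra copy is what becomes `h`.
  cross-shifted : ∀ a x y σ M → 0 < x → 0 < y → x + y ≡ 4 → a ≡ x + 4 * σ →
    Π< (suc σ + M) (λ r → cf (~ 𝟙) a (0 + 4 * r)) ≋ q^ (x * suc σ + 4 * T (suc σ)) ∙ (fac (~ 𝟙) a ⁻¹ ∙ (P⁺ y 4 M ⁻¹ ∙ P⁺ x 4 (σ + (suc σ + M)) ⁻¹))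
  cross-shifted a x y σ M 0<x 0<y xy ≡.refl = ≋-trans
    (cf-product⁺ a 0 x y a (suc σ) M 0<x 0<y 0<a xy
      (≡.trans (shuffle σ) (subst (λ m → m + 4 * σ ≡ x + 4 * σ + y) xy (shuffle′ x y (4 * σ)))) (ℕₚ.+-identityʳ a))
    (∙-cong ≋-refl (≋-trans (∙-cong ≋-refl (≋-trans (⁻¹-cong (Unit-∙ (Unit-P (~ 𝟙) x 4 (suc σ) 0<x) U) (≋-trans (solve 3 (λ p f r → p :* f :* r := f :* (p :* r)) ≋-refl (P⁺ x 4 σ) (fac (~ 𝟙) a) (P⁺ a 4 (suc σ + M))) (∙-cong ≋-refl (P-split (~ 𝟙) x 4 σ (suc σ + M)))))
      (⁻¹-∙ (Unit-fac 0<a) (Unit-P (~ 𝟙) x 4 (σ + (suc σ + M)) 0<x))))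
      (solve 3 (λ p f r → p :* (f :* r) := f :* (p :* r)) ≋-refl (P⁺ y 4 M ⁻¹) (fac (~ 𝟙) a ⁻¹) (P⁺ x 4 (σ + (suc σ + M)) ⁻¹))))
    where
      0<a : 0 < a
      0<a = ≤-trans 0<x (m≤m+n x _)
      U : Unit (P⁺ a 4 (suc σ + M))
      U = Unit-P (~ 𝟙) a 4 (suc σ + M) 0<a
      shuffle : ∀ σ → 0 + 4 * suc σ ≡ 4 + 4 * σ
      shuffle = solve-∀
      shuffle′ : ∀ x y t → x + y + t ≡ x + t + y
      shuffle′ = solve-∀

  CrossFor : (a₁ : ℕ) (v : ℕ → ℕ) (h : ℕ → Series) → ℕ → ℕ → Set
  CrossFor a₁ v h k s = ∃ λ Z → (Π< (suc k) (λ r → cf (~ 𝟙) (1 + 2 * s) (a₁ + 4 * r)) ≋ q^ (v s) ∙ (h s ∙ Z)) × Z ≈[ k ∸ s ] P⁺∞ 1 4 ⁻¹ ∙ P⁺∞ 3 4 ⁻¹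

  Z-limit : ∀ {n} x y M N → 0 < x → 0 < y → n ≤ M → n ≤ N → P⁺ x 4 M ⁻¹ ∙ P⁺ y 4 N ⁻¹ ≈[ n ] P⁺∞ x 4 ⁻¹ ∙ P⁺∞ y 4 ⁻¹
  Z-limit x y M N 0<x 0<y n≤M n≤N = ≈-∙ (P⁻¹-limit (~ 𝟙) x 4 M 0<x 0<′ n≤M) (P⁻¹-limit (~ 𝟙) y 4 N 0<y 0<′ n≤N)

  build : ∀ a₁ v h k s ℓ M e Z → ℓ + M ≡ suc k → e ≡ v s →
    Π< (ℓ + M) (λ r → cf (~ 𝟙) (1 + 2 * s) (a₁ + 4 * r)) ≋ q^ e ∙ (h s ∙ Z) → Z ≈[ k ∸ s ] P⁺∞ 1 4 ⁻¹ ∙ P⁺∞ 3 4 ⁻¹ → CrossFor a₁ v h k s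
  build a₁ v h k s ℓ M e Z p ≡.refl eq lim = Z , ≋-trans (≋-reflexive (cong (λ n → Π< n (λ r → cf (~ 𝟙) (1 + 2 * s) (a₁ + 4 * r))) (≡.sym p))) eq , lim

  le-even : ∀ k σ → k ∸ (σ + σ) ≤ suc k ∸ σ
  le-even k σ = ≤-trans (ℕₚ.∸-monoʳ-≤ k (m≤m+n σ σ)) (ℕₚ.∸-monoˡ-≤ σ (ℕₚ.n≤1+n k))

  le-odd : ∀ k σ → k ∸ suc (σ + σ) ≤ k ∸ σ
  le-odd k σ = ℕₚ.∸-monoʳ-≤ k (≤-trans (m≤m+n σ σ) (ℕₚ.n≤1+n _))

  deep : ∀ {n} a b M → n ≤ M → n ≤ a + (b + M)
  deep a b M p = ≤-trans p (≤-trans (m≤n+m M b) (m≤n+m (b + M) a))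

-- The parity of s fixes 1 + 2s modulo 4, and with it the distance to the next lower node: 3 for
-- even s and 1 for odd s. In `cross-zero` the two distances change places.
cross-odd : ∀ k s → s < suc k + suc k → CrossFor 2 (λ s → T (suc s)) (λ _ → 𝟙) k s
cross-odd k s s<k with parity s
... | even σ = build 2 (λ s → T (suc s)) (λ _ → 𝟙) k (σ + σ) σ M (3 * σ + 4 * T σ) _ (ℕₚ.m+[n∸m]≡n (ℕₚ.m≤n⇒m≤1+n (half-≤ σ k s<k))) (T-even σ)
    (cross-regular (1 + 2 * (σ + σ)) 2 3 1 σ M 0<′ 0<′ ≡.refl (e₁ σ) (e₂ σ))
    (Z-limit 1 3 M (σ + (σ + M)) 0<′ 0<′ (le-even k σ) (deep σ σ M (le-even k σ)))
  where
    M = suc k ∸ σ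
    e₁ : ∀ σ → 2 + 4 * σ ≡ 1 + 2 * (σ + σ) + 1
    e₁ = solve-∀
    e₂ : ∀ σ → 1 + 2 * (σ + σ) + 2 ≡ 3 + 4 * σ
    e₂ = solve-∀
... | odd σ = build 2 (λ s → T (suc s)) (λ _ → 𝟙) k (suc (σ + σ)) (suc σ) M (1 * suc σ + 4 * T (suc σ)) _ (cong suc (ℕₚ.m+[n∸m]≡n (half-≤ σ k (ℕₚ.<⇒≤ s<k)))) (T-odd σ)
    (cross-regular (1 + 2 * suc (σ + σ)) 2 1 3 (suc σ) M 0<′ 0<′ ≡.refl (e₁ σ) (e₂ σ))
    (≈-trans (Z-limit 3 1 M (suc σ + (suc σ + M)) 0<′ 0<′ (le-odd k σ) (deep (suc σ) (suc σ) M (le-odd k σ))) (≋⇒≈ (∙-comm _ _)))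
  where
    M = k ∸ σ
    e₁ : ∀ σ → 2 + 4 * suc σ ≡ 1 + 2 * suc (σ + σ) + 3
    e₁ = solve-∀
    e₂ : ∀ σ → 1 + 2 * suc (σ + σ) + 2 ≡ 1 + 4 * suc σ
    e₂ = solve-∀

cross-zero : ∀ k s → s < suc k + suc k → CrossFor 0 (λ s → T (suc (suc s))) (λ s → fac (~ 𝟙) (1 + 2 * s) ⁻¹) k s
cross-zero k s s<k with parity s
... | even σ = build 0 (λ s → T (suc (suc s))) (λ s → fac (~ 𝟙) (1 + 2 * s) ⁻¹) k (σ + σ) (suc σ) M (1 * suc σ + 4 * T (suc σ)) _ (cong suc (ℕₚ.m+[n∸m]≡n (half-≤ σ k s<k))) (T-odd σ)
    (cross-shifted (1 + 2 * (σ + σ)) 1 3 σ M 0<′ 0<′ ≡.refl (e₁ σ))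
    (≈-trans (Z-limit 3 1 M (σ + (suc σ + M)) 0<′ 0<′ le (deep σ (suc σ) M le)) (≋⇒≈ (∙-comm _ _)))
  where
    M = k ∸ σ
    le : k ∸ (σ + σ) ≤ M
    le = ℕₚ.∸-monoʳ-≤ k (m≤m+n σ σ)
    e₁ : ∀ σ → 1 + 2 * (σ + σ) ≡ 1 + 4 * σ
    e₁ = solve-∀
... | odd σ = build 0 (λ s → T (suc (suc s))) (λ s → fac (~ 𝟙) (1 + 2 * s) ⁻¹) k (suc (σ + σ)) (suc σ) M (3 * suc σ + 4 * T (suc σ)) _ (cong suc (ℕₚ.m+[n∸m]≡n (half-≤ σ k (ℕₚ.<⇒≤ s<k))))
      (≡.trans (T-even (suc σ)) (cong (λ n → T (suc (suc n))) (ℕₚ.+-suc σ σ)))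
    (cross-shifted (1 + 2 * suc (σ + σ)) 3 1 σ M 0<′ 0<′ ≡.refl (e₁ σ))
    (Z-limit 1 3 M (σ + (suc σ + M)) 0<′ 0<′ (le-odd k σ) (deep σ (suc σ) M (le-odd k σ)))
  where
    M = k ∸ σ
    e₁ : ∀ σ → 1 + 2 * suc (σ + σ) ≡ 3 + 4 * σ
    e₁ = solve-∀

double-odd : ∀ r → 2 + 4 * r ≡ suc (r + r) + suc (r + r)
double-odd = solve-∀

double-even : ∀ r → 0 + 4 * r ≡ r + r + (r + r)
double-even = solve-∀

Unit-fac-4 : ∀ i → Unit (fac (~ 𝟙) (0 + 4 * i))
Unit-fac-4 zero    = Unit-fac-minus-zero
Unit-fac-4 (suc i) = Unit-fac 0<′

module CrossOdd (d : Series) (d² : d ∙ d ≋ 𝟙) = Cross 2 1 ≡.refl (κ-odd 4) (κ-odd-spec 4) (~ d) d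
  (≋-trans (solve 1 (λ d → (⊝ d) :* (⊝ d) := d :* d) ≋-refl d) d²) d²
  (solve 1 (λ d → (⊝ d) :* (⊝ ′ 1) := d) ≋-refl d) (solve 1 (λ d → d :* (⊝ ′ 1) := ⊝ d) ≋-refl d)
  (λ i → Unit-fac 0<′) (λ r → suc (r + r)) double-odd (λ r → ≤-refl)
  (λ s → T (suc s)) (λ _ → 𝟙) cross-odd

module CrossZero = Cross 0 0 ≡.refl (κ-zero 4) (κ-zero-spec 4) (~ 𝟙) 𝟙 minus² 𝟙² minus² (∙-identityˡ (~ 𝟙))
  Unit-fac-4 (λ r → r + r) double-even (λ r → ℕₚ.n≤1+n (r + r))
  (λ s → T (suc (suc s))) (λ s → fac (~ 𝟙) (1 + 2 * s) ⁻¹) cross-zero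

-- The substitution q ↦ q²

dbl : Series → Series
dbl f zero          = f 0
dbl f (suc zero)    = 0ℚ
dbl f (suc (suc n)) = dbl (tail f) n

Even Odd : Series → Series
Even f n = f (2 * n)
Odd  f n = f (suc (2 * n))

private
  dbl-pointwise : ∀ n {f g : Series} → (∀ i → f i ≡ g i) → dbl f n ≡ dbl g n
  dbl-pointwise zero          p = p 0
  dbl-pointwise (suc zero)    p = ≡.refl
  dbl-pointwise (suc (suc n)) p = dbl-pointwise n λ i → p (suc i)

  dbl-⊕ : ∀ n f g → dbl (f ⊕ g) n ≡ dbl f n ℚ.+ dbl g n
  dbl-⊕ zero          f g = ≡.refl
  dbl-⊕ (suc zero)    f g = ≡.refl
  dbl-⊕ (suc (suc n)) f g = dbl-⊕ n (tail f) (tail g)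

  dbl-· : ∀ n c f → dbl (c · f) n ≡ c ℚ.* dbl f n
  dbl-· zero          c f = ≡.refl
  dbl-· (suc zero)    c f = ≡.sym (ℚₚ.*-zeroʳ c)
  dbl-· (suc (suc n)) c f = dbl-· n c (tail f)

  dbl-⊛ : ∀ n f g → dbl (f ⊛ g) n ≡ (dbl f ⊛ dbl g) n
  dbl-⊛ zero          f g = ≡.refl
  dbl-⊛ (suc zero)    f g = ≡.sym (cong₂ ℚ._+_ (ℚₚ.*-zeroʳ (f 0)) (ℚₚ.*-zeroˡ (g 0)))
  dbl-⊛ (suc (suc n)) f g = ≡.trans (dbl-pointwise n (⊛-head f g))
    (≡.trans (dbl-⊕ n (f 0 · tail g) (tail f ⊛ g)) (≡.trans (cong₂ ℚ._+_ (dbl-· n (f 0) (tail g)) (dbl-⊛ n (tail f) g))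
    (≡.sym (≡.trans (⊛-head (dbl f) (dbl g) (suc n)) (cong (f 0 ℚ.* dbl (tail g) n ℚ.+_)
      (≡.trans (⊛-head (tail (dbl f)) (dbl g) n) (≡.trans (cong (ℚ._+ (dbl (tail f) ⊛ dbl g) n) (ℚₚ.*-zeroˡ (dbl g (suc n)))) (ℚₚ.+-identityˡ _))))))))

dbl-cong : ∀ {f g} → f ≋ g → dbl f ≋ dbl g
dbl-cong p = pw λ n → dbl-pointwise n (at p)

opaque
  unfolding _⊞_
  dbl-⊞ : ∀ f g → dbl (f ⊞ g) ≋ dbl f ⊞ dbl g
  dbl-⊞ f g = pw λ n → dbl-⊕ n f g

  dbl-∙ : ∀ f g → dbl (f ∙ g) ≋ dbl f ∙ dbl g
  dbl-∙ f g = pw λ n → dbl-⊛ n f g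

  dbl-~ : ∀ f → dbl (~ f) ≋ ~ dbl f
  dbl-~ f = pw λ n → aux n f
    where
      aux : ∀ n f → dbl (~ f) n ≡ (~ dbl f) n
      aux zero          f = ≡.refl
      aux (suc zero)    f = ≡.refl
      aux (suc (suc n)) f = aux n (tail f)

  dbl-K : ∀ c → dbl (K c) ≋ K c
  dbl-K c = pw λ { zero → ≡.refl ; (suc zero) → ≡.refl ; (suc (suc n)) → zeros n }
    where
      zeros : ∀ n → dbl (λ _ → 0ℚ) n ≡ 0ℚ
      zeros zero          = ≡.refl
      zeros (suc zero)    = ≡.refl
      zeros (suc (suc n)) = zeros n

dbl-q^ : ∀ n → dbl (q^ n) ≋ q^ (2 * n)
dbl-q^ zero    = ≋-trans (dbl-cong q^-zero) (≋-trans (dbl-K 1ℚ) (≋-sym q^-zero))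
dbl-q^ (suc n) = ≋-trans (dbl-cong (q^-+ 1 n)) (≋-trans (dbl-∙ _ _) (≋-trans (∙-cong base (dbl-q^ n))
  (≋-trans (≋-sym (q^-+ 2 (2 * n))) (q^-cong (≡.sym (ℕₚ.*-suc 2 n))))))
  where
    opaque
      unfolding _⊞_
      zeros : ∀ n → dbl (λ i → mono 1ℚ 1 (suc (suc i))) n ≡ 0ℚ
      zeros zero          = ≡.refl
      zeros (suc zero)    = ≡.refl
      zeros (suc (suc n)) = zeros n
      base : dbl (q^ 1) ≋ q^ 2
      base = pw λ { zero → ≡.refl ; (suc zero) → ≡.refl ; (suc (suc zero)) → ≡.refl ; (suc (suc (suc zero))) → ≡.refl ; (suc (suc (suc (suc n)))) → zeros n }

dbl-𝟙 : dbl 𝟙 ≋ 𝟙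
dbl-𝟙 = dbl-K 1ℚ

dbl-⁻¹ : ∀ {f} → Unit f → dbl (f ⁻¹) ≋ dbl f ⁻¹
dbl-⁻¹ {f} u = ≋-sym (⁻¹-unique (≋-trans (≋-sym (dbl-∙ f (f ⁻¹))) (≋-trans (dbl-cong (∙-inverse u)) dbl-𝟙)))

dbl-Unit : ∀ {f} → Unit f → Unit (dbl f)
dbl-Unit u = unit (const≢0 u)

dbl-≈ : ∀ {f g n} → f ≈[ n ] g → dbl f ≈[ n ] dbl g
dbl-≈ {f} {g} {n} (modq h e) = ≈-weaken (m≤m+n n (1 * n)) (modq (dbl h) (≋-trans (dbl-cong e) (≋-trans (dbl-⊞ _ _) (⊞-cong ≋-refl (≋-trans (dbl-∙ _ _) (∙-cong (dbl-q^ n) ≋-refl))))))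

dbl-Σ : ∀ n F → dbl (Σ< n F) ≋ Σ< n (λ k → dbl (F k))
dbl-Σ zero    F = dbl-K 0ℚ
dbl-Σ (suc n) F = ≋-trans (dbl-⊞ _ _) (⊞-cong (dbl-Σ n F) ≋-refl)

dbl-Π : ∀ n F → dbl (Π< n F) ≋ Π< n (λ k → dbl (F k))
dbl-Π zero    F = dbl-𝟙
dbl-Π (suc n) F = ≋-trans (dbl-∙ _ _) (∙-cong (dbl-Π n F) ≋-refl)

dbl-Small : ∀ {F} → Small F → Small (λ k → dbl (F k))
dbl-Small s = small λ k → ≈-trans (dbl-≈ (vanish s k)) (≋⇒≈ (dbl-K 0ℚ))

dbl-∑ : ∀ {F} → Small F → dbl (∑ F) ≋ ∑ (λ k → dbl (F k))
dbl-∑ {F} s = ∑-unique (dbl-Small s) λ n → suc n , ≤-refl , ≈-trans (dbl-≈ (∑-limit (suc n) ≤-refl s)) (≋⇒≈ (dbl-Σ (suc n) F))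

dbl-∏ : ∀ {F} → Near1 F → dbl (∏ F) ≋ ∏ (λ k → dbl (F k))
dbl-∏ {F} s = ≈-all λ n → ≈-trans (dbl-≈ (∏-limit n ≤-refl s)) (≈-trans (≋⇒≈ (dbl-Π n F))
  (≈-sym (∏-limit n ≤-refl (near1 λ k → ≈-trans (dbl-≈ (approx s k)) (≋⇒≈ dbl-𝟙)))))

dbl-fac : ∀ {δ} d → dbl δ ≋ δ → dbl (fac δ d) ≋ fac δ (2 * d)
dbl-fac d p = ≋-trans (dbl-⊞ _ _) (⊞-cong dbl-𝟙 (≋-trans (dbl-~ _) (~-cong (≋-trans (dbl-∙ _ _) (∙-cong p (dbl-q^ d))))))

dbl-minus : dbl (~ 𝟙) ≋ ~ 𝟙
dbl-minus = ≋-trans (dbl-~ 𝟙) (~-cong dbl-𝟙)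

dbl-P∞ : ∀ {δ} x m → 0 < m → dbl δ ≋ δ → dbl (P∞ δ x m) ≋ P∞ δ (2 * x) (2 * m)
dbl-P∞ {δ} x m 0<m p = ≋-trans (dbl-∏ (near-fac δ x 0<m)) (∏-cong λ k → ≋-trans (dbl-fac (x + m * k) p) (fac-cong (shuffle x m k)))
  where
    shuffle : ∀ x m k → 2 * (x + m * k) ≡ 2 * x + 2 * m * k
    shuffle = solve-∀

dbl-denom : ∀ {X ε} a → dbl X ≋ X → dbl ε ≋ ε → dbl (denom X ε a) ≋ denom X ε (2 * a)
dbl-denom a pX pε = ≋-trans (dbl-⊞ _ _) (⊞-cong
  (≋-trans (dbl-∙ _ _) (∙-cong dbl-𝟙 (≋-trans (dbl-⊞ _ _) (⊞-cong dbl-𝟙 (≋-trans (dbl-∙ _ _) (∙-cong (dbl-q^ a) (dbl-q^ a)))))))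
  (≋-trans (dbl-~ _) (~-cong (≋-trans (dbl-∙ _ _) (∙-cong (≋-trans (dbl-∙ _ _) (∙-cong pε (dbl-q^ a))) pX)))))

dbl-pow : ∀ {σ} n → dbl σ ≋ σ → dbl (pow σ n) ≋ pow σ n
dbl-pow n p = ≋-trans (dbl-Π n _) (Π-cong n λ _ _ → p)

dbl-even : ∀ f n → dbl f (2 * n) ≡ f n
dbl-even f zero    = ≡.refl
dbl-even f (suc n) = ≡.trans (cong (dbl f) (ℕₚ.*-suc 2 n)) (dbl-even (tail f) n)

dbl-odd : ∀ f n → dbl f (suc (2 * n)) ≡ 0ℚ
dbl-odd f zero    = ≡.refl
dbl-odd f (suc n) = ≡.trans (cong (λ i → dbl f (suc i)) (ℕₚ.*-suc 2 n)) (dbl-odd (tail f) n)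

dbl-injective : ∀ {f g} → dbl f ≋ dbl g → f ≋ g
dbl-injective {f} {g} p = pw λ n → ≡.trans (≡.sym (dbl-even f n)) (≡.trans (at p (2 * n)) (dbl-even g n))

opaque
  unfolding _⊞_
  private
    shifted-even : ∀ f n → (q^ 1 ∙ dbl f) (2 * n) ≡ 0ℚ
    shifted-even f zero    = q^-low 1 (dbl f) 0 (s≤s z≤n)
    shifted-even f (suc n) = ≡.trans (cong (q^ 1 ∙ dbl f) (ℕₚ.*-suc 2 n)) (≡.trans (q^-at 1 (dbl f) (suc (2 * n))) (dbl-odd f n))

  even-part : ∀ {f} a b → f ≋ dbl a ⊞ q^ 1 ∙ dbl b → Even f ≋ a
  even-part a b p = pw λ n → ≡.trans (at p (2 * n)) (≡.trans (cong₂ ℚ._+_ (dbl-even a n) (shifted-even b n)) (ℚₚ.+-identityʳ (a n)))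

  odd-part : ∀ {f} a b → f ≋ dbl a ⊞ q^ 1 ∙ dbl b → Odd f ≋ b
  odd-part a b p = pw λ n → ≡.trans (at p (suc (2 * n))) (≡.trans (cong₂ ℚ._+_ (dbl-odd a n) (≡.trans (q^-at 1 (dbl b) (2 * n)) (dbl-even b n))) (ℚₚ.+-identityˡ (b n)))

-- Eta quotients

zpow : Series → ℤ → Series
zpow x (+ n)    = pow x n
zpow x -[1+ n ] = pow (x ⁻¹) (suc n)

pow-+ : ∀ x m n → pow x (m + n) ≋ pow x m ∙ pow x n
pow-+ x m n = Π-split m n (λ _ → x)

zpow-⊖ : ∀ {x} → Unit x → ∀ m n → zpow x (m ℤ.⊖ n) ≋ pow x m ∙ pow (x ⁻¹) n
zpow-⊖ u m       zero    = ≋-sym (∙-identityʳ _)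
zpow-⊖ u zero    (suc n) = ≋-sym (∙-identityˡ _)
zpow-⊖ {x} u (suc m) (suc n) = ≋-trans (≋-reflexive (cong (zpow x) (ℤₚ.[1+m]⊖[1+n]≡m⊖n m n))) (≋-trans (zpow-⊖ u m n)
  (≋-trans (solve 2 (λ a b → a :* b := a :* b :* ′ 1) ≋-refl (pow x m) (pow (x ⁻¹) n)) (≋-trans (∙-cong ≋-refl (≋-sym (∙-inverse u)))
  (solve 4 (λ a b c d → a :* b :* (c :* d) := a :* c :* (b :* d)) ≋-refl (pow x m) (pow (x ⁻¹) n) x (x ⁻¹)))))

zpow-+ : ∀ {x} → Unit x → ∀ i j → zpow x (i ℤ.+ j) ≋ zpow x i ∙ zpow x j
zpow-+ {x} u (+ m)    (+ n)    = pow-+ x m n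
zpow-+ u (+ m)    -[1+ n ] = zpow-⊖ u m (suc n)
zpow-+ u -[1+ m ] (+ n)    = ≋-trans (zpow-⊖ u n (suc m)) (∙-comm _ _)
zpow-+ {x} u -[1+ m ] -[1+ n ] = ≋-trans (≋-reflexive (cong (λ k → pow (x ⁻¹) (suc k)) (≡.sym (ℕₚ.+-suc m n)))) (pow-+ (x ⁻¹) (suc m) (suc n))

zpow-Unit : ∀ {x} → Unit x → ∀ i → Unit (zpow x i)
zpow-Unit u (+ n)    = Π-Unit n λ _ → u
zpow-Unit u -[1+ n ] = Π-Unit (suc n) λ _ → Unit-⁻¹ u

𝐉 : ℕ → Series
𝐉 m = P∞ 𝟙 m m

Unit-𝐉 : ∀ m → Unit (𝐉 (suc m))
Unit-𝐉 m = Unit-P∞ 𝟙 (suc m) (suc m) (s≤s z≤n)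

dbl-𝐉 : ∀ m → dbl (𝐉 (suc m)) ≋ 𝐉 (2 * suc m)
dbl-𝐉 m = dbl-P∞ (suc m) (suc m) (s≤s z≤n) dbl-𝟙

-- η (e₀ ∷ e₁ ∷ …) is the product of the powers (q^(2^k) ; q^(2^k))_∞ ^ e_k.
η : List ℤ → Series
η []       = 𝟙
η (e ∷ es) = zpow (𝐉 1) e ∙ dbl (η es)

η-Unit : ∀ es → Unit (η es)
η-Unit []       = Unit-𝟙
η-Unit (e ∷ es) = Unit-∙ (zpow-Unit (Unit-𝐉 0) e) (dbl-Unit (η-Unit es))

infixl 6 _⊹_
_⊹_ : List ℤ → List ℤ → List ℤ
[]       ⊹ fs       = fs
(e ∷ es) ⊹ []       = e ∷ es
(e ∷ es) ⊹ (f ∷ fs) = e ℤ.+ f ∷ es ⊹ fs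

η-∙ : ∀ es fs → η es ∙ η fs ≋ η (es ⊹ fs)
η-∙ []       fs       = ∙-identityˡ _
η-∙ (e ∷ es) []       = ∙-identityʳ _
η-∙ (e ∷ es) (f ∷ fs) = ≋-trans (solve 4 (λ a b c d → a :* b :* (c :* d) := a :* c :* (b :* d)) ≋-refl (zpow (𝐉 1) e) (dbl (η es)) (zpow (𝐉 1) f) (dbl (η fs)))
  (∙-cong (≋-sym (zpow-+ (Unit-𝐉 0) e f)) (≋-trans (≋-sym (dbl-∙ _ _)) (dbl-cong (η-∙ es fs))))

η-dbl : ∀ es → dbl (η es) ≋ η (+ 0 ∷ es)
η-dbl es = ≋-sym (∙-identityˡ _)

η-zeros : ∀ n → η (List.replicate n (+ 0)) ≋ 𝟙
η-zeros zero    = ≋-refl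
η-zeros (suc n) = ≋-trans (∙-identityˡ _) (≋-trans (dbl-cong (η-zeros n)) dbl-𝟙)

η-⁻¹ : ∀ es → η es ⁻¹ ≋ η (List.map ℤ.-_ es)
η-⁻¹ es = ⁻¹-unique (≋-trans (η-∙ es (List.map ℤ.-_ es)) (≋-trans (≋-reflexive (cong η (cancel es))) (η-zeros (List.length es))))
  where
    cancel : ∀ es → es ⊹ List.map ℤ.-_ es ≡ List.replicate (List.length es) (+ 0)
    cancel []       = ≡.refl
    cancel (e ∷ es) = cong₂ _∷_ (ℤₚ.+-inverseʳ e) (cancel es)

P∞-split : ∀ δ x m → 0 < m → P∞ δ x m ≋ P∞ δ x (2 * m) ∙ P∞ δ (x + m) (2 * m)
P∞-split δ x m 0<m = ≈-all λ n → ≈-trans (P∞-limit δ x m (n + n) 0<m (m≤m+n n n)) (≈-trans (≋⇒≈ (finite n))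
  (≈-sym (≈-∙ (P∞-limit δ x (2 * m) n 0<2m ≤-refl) (P∞-limit δ (x + m) (2 * m) n 0<2m ≤-refl))))
  where
    0<2m : 0 < 2 * m
    0<2m = ≤-trans 0<m (m≤m+n m _)
    shuffle₁ : ∀ x m n → x + m * (n + n) ≡ x + 2 * m * n
    shuffle₁ = solve-∀
    shuffle₂ : ∀ x m n → x + m * suc (n + n) ≡ x + m + 2 * m * n
    shuffle₂ = solve-∀
    finite : ∀ n → P δ x m (n + n) ≋ P δ x (2 * m) n ∙ P δ (x + m) (2 * m) n
    finite zero    = ≋-sym (∙-identityˡ 𝟙)
    finite (suc n) = ≋-trans (≋-reflexive (cong (P δ x m) (cong suc (ℕₚ.+-suc n n)))) (≋-trans
      (∙-cong (∙-cong (finite n) (fac-cong (shuffle₁ x m n))) (fac-cong (shuffle₂ x m n)))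
      (solve 4 (λ a b c d → a :* b :* c :* d := a :* c :* (b :* d)) ≋-refl (P δ x (2 * m) n) (P δ (x + m) (2 * m) n) (fac δ (x + 2 * m * n)) (fac δ (x + m + 2 * m * n))))

P∞-merge : ∀ x m → 0 < m → P∞ 𝟙 x m ∙ P⁺∞ x m ≋ P∞ 𝟙 (2 * x) (2 * m)
P∞-merge x m 0<m = ≋-trans (≋-sym (∏-∙ (near-fac 𝟙 x 0<m) (near-fac (~ 𝟙) x 0<m))) (∏-cong λ k → begin
  fac 𝟙 (x + m * k) ∙ fac (~ 𝟙) (x + m * k)
    ≈⟨ solve 1 (λ y → (′ 1 :- ′ 1 :* y) :* (′ 1 :- (⊝ ′ 1) :* y) := ′ 1 :- ′ 1 :* (y :* y)) ≋-refl (q^ (x + m * k)) ⟩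
  𝟙 ⊟ 𝟙 ∙ (q^ (x + m * k) ∙ q^ (x + m * k))
    ≈⟨ ⊞-cong ≋-refl (~-cong (∙-cong ≋-refl (≋-trans (≋-sym (q^-+ _ _)) (q^-cong (shuffle x m k))))) ⟩
  fac 𝟙 (2 * x + 2 * m * k) ∎)
  where
    shuffle : ∀ x m k → x + m * k + (x + m * k) ≡ 2 * x + 2 * m * k
    shuffle = solve-∀

divide : ∀ {a b c} → Unit b → a ∙ b ≋ c → a ≋ c ∙ b ⁻¹
divide {a} {b} {c} u p = begin
  a                ≈⟨ solve 1 (λ a → a := a :* ′ 1) ≋-refl a ⟩
  a ∙ 𝟙            ≈⟨ ∙-cong ≋-refl (∙-inverse u) ⟨
  a ∙ (b ∙ b ⁻¹)   ≈⟨ ∙-assoc _ _ _ ⟨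
  a ∙ b ∙ b ⁻¹     ≈⟨ ∙-cong p ≋-refl ⟩
  c ∙ b ⁻¹         ∎

infix 4 _≐_
-- With the exponents as an index, an identity between eta quotients becomes an equality of integer
-- lists, which `≐-unique` checks by computation.
record _≐_ (f : Series) (es : List ℤ) : Set where
  constructor isη
  field eta : f ≋ η es
open _≐_ public

≐-trans : ∀ {f g es} → f ≋ g → g ≐ es → f ≐ es
≐-trans p (isη r) = isη (≋-trans p r)

≐-unique : ∀ {f g es} → f ≐ es → g ≐ es → f ≋ g
≐-unique (isη p) (isη r) = ≋-trans p (≋-sym r)

≐-η : ∀ es → η es ≐ es
≐-η es = isη ≋-refl

negate : List ℤ → List ℤ
negate es = List.map ℤ.-_ es

infixl 7 _⊗_
_⊗_ : ∀ {f g es fs} → f ≐ es → g ≐ fs → f ∙ g ≐ es ⊹ fs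
_⊗_ {es = es} {fs} (isη p) (isη r) = isη (≋-trans (∙-cong p r) (η-∙ es fs))

≐-⁻¹ : ∀ {f es} → f ≐ es → f ⁻¹ ≐ negate es
≐-⁻¹ {es = es} (isη p) = isη (≋-trans (⁻¹-cong (Unit-≋ (≋-sym p) (η-Unit es)) p) (η-⁻¹ es))

≐-divide : ∀ {a b c es fs} → b ≐ es → c ≐ fs → a ∙ b ≋ c → a ≐ fs ⊹ negate es
≐-divide {es = es} b≐@(isη p) c≐ r = ≐-trans (divide (Unit-≋ (≋-sym p) (η-Unit es)) r) (c≐ ⊗ ≐-⁻¹ b≐)

≐-dbl : ∀ {f es} → f ≐ es → dbl f ≐ + 0 ∷ es
≐-dbl {es = es} (isη p) = isη (≋-trans (dbl-cong p) (η-dbl es))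

-- Lists that differ by trailing zeros are different indices, and `⊹` does not trim; lengths are
-- adjusted here before a comparison.
≐-pad : ∀ {f es} n → f ≐ es → f ≐ es ++ List.replicate n (+ 0)
≐-pad {es = es} n (isη p) = isη (≋-trans p (pad es))
  where
    pad : ∀ es → η es ≋ η (es ++ List.replicate n (+ 0))
    pad []       = ≋-sym (η-zeros n)
    pad (e ∷ es) = ∙-cong ≋-refl (dbl-cong (pad es))

𝐉₁ : 𝐉 1 ≐ + 1 ∷ []
𝐉₁ = isη (≋-trans (solve 1 (λ x → x := ′ 1 :* x :* ′ 1) ≋-refl (𝐉 1)) (∙-cong ≋-refl (≋-sym dbl-𝟙)))

𝐉₂ : 𝐉 2 ≐ + 0 ∷ + 1 ∷ []
𝐉₂ = ≐-trans (≋-sym (dbl-𝐉 0)) (≐-dbl 𝐉₁)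

𝐉₄ : 𝐉 4 ≐ + 0 ∷ + 0 ∷ + 1 ∷ []
𝐉₄ = ≐-trans (≋-sym (dbl-𝐉 1)) (≐-dbl 𝐉₂)

𝐉₈ : 𝐉 8 ≐ + 0 ∷ + 0 ∷ + 0 ∷ + 1 ∷ []
𝐉₈ = ≐-trans (≋-sym (dbl-𝐉 3)) (≐-dbl 𝐉₄)

private
  0<₁ : ∀ {n} → 0 < suc n
  0<₁ = s≤s z≤n

odd⁻ : P∞ 𝟙 1 2 ≐ + 1 ∷ -[1+ 0 ] ∷ []
odd⁻ = ≐-divide 𝐉₂ 𝐉₁ (≋-sym (P∞-split 𝟙 1 1 0<₁))

odd⁻₂ : P∞ 𝟙 2 4 ≐ + 0 ∷ + 1 ∷ -[1+ 0 ] ∷ []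
odd⁻₂ = ≐-trans (≋-sym (dbl-P∞ 1 2 0<₁ dbl-𝟙)) (≐-dbl odd⁻)

odd⁺ : P⁺∞ 1 2 ≐ -[1+ 0 ] ∷ + 2 ∷ -[1+ 0 ] ∷ []
odd⁺ = ≐-divide odd⁻ odd⁻₂ (≋-trans (∙-comm _ _) (P∞-merge 1 2 0<₁))

odd⁺₂ : P⁺∞ 2 4 ≐ + 0 ∷ -[1+ 0 ] ∷ + 2 ∷ -[1+ 0 ] ∷ []
odd⁺₂ = ≐-trans (≋-sym (dbl-P∞ 1 2 0<₁ dbl-minus)) (≐-dbl odd⁺)

even⁺₄ : P⁺∞ 4 4 ≐ + 0 ∷ + 0 ∷ -[1+ 0 ] ∷ + 1 ∷ []
even⁺₄ = ≐-divide 𝐉₄ 𝐉₈ (≋-trans (∙-comm _ _) (P∞-merge 4 4 0<₁))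

P⁺∞-zero : ∀ m → 0 < m → P⁺∞ 0 m ≋ two ∙ P⁺∞ m m
P⁺∞-zero m 0<m = ≈-all λ n → ≈-trans (P∞-limit (~ 𝟙) 0 m (suc n) 0<m (ℕₚ.n≤1+n n)) (≈-trans (≋⇒≈ (≋-trans (Π-head n _) (∙-cong first (Π-cong n λ k _ → fac-cong (ℕₚ.*-suc m k)))))
  (≈-∙ ≈-refl (≈-sym (P∞-limit (~ 𝟙) m m n 0<m ≤-refl))))
  where
    first : fac (~ 𝟙) (0 + m * 0) ≋ two
    first = ≋-trans (fac-cong (ℕₚ.*-zeroʳ m)) (≋-trans (fac-minus 0) (⊞-cong ≋-refl q^-zero))

C₁-η : P∞ 𝟙 4 4 ⁻¹ ∙ P∞ 𝟙 4 4 ⁻¹ ∙ (P⁺∞ 1 2 ⁻¹ ∙ P⁺∞ 1 2 ⁻¹) ≐ + 2 ∷ -[1+ 3 ] ∷ + 0 ∷ []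
C₁-η = ≐-⁻¹ 𝐉₄ ⊗ ≐-⁻¹ 𝐉₄ ⊗ (≐-⁻¹ odd⁺ ⊗ ≐-⁻¹ odd⁺)

C₂-η : P∞ 𝟙 2 2 ⁻¹ ∙ P∞ 𝟙 2 2 ⁻¹ ∙ (P⁺∞ 1 4 ⁻¹ ∙ P⁺∞ 3 4 ⁻¹) ≐ + 1 ∷ -[1+ 3 ] ∷ + 1 ∷ []
C₂-η = ≐-⁻¹ 𝐉₂ ⊗ ≐-⁻¹ 𝐉₂ ⊗ ≐-trans (≋-trans (≋-sym (⁻¹-∙ U₁ U₃)) (⁻¹-cong (Unit-∙ U₁ U₃) (≋-sym (P∞-split (~ 𝟙) 1 2 0<₁)))) (≐-⁻¹ odd⁺)
  where
    U₁ : Unit (P⁺∞ 1 4)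
    U₁ = Unit-P∞ (~ 𝟙) 1 4 0<₁
    U₃ : Unit (P⁺∞ 3 4)
    U₃ = Unit-P∞ (~ 𝟙) 3 4 0<₁

-- Turns the constants in front of the two sums of a crossing into 1/J₄ and 1/J₁.
normaliser : Series
normaliser = η (-[1+ 1 ] ∷ + 4 ∷ -[1+ 0 ] ∷ [])

normaliser-η : normaliser ≐ -[1+ 1 ] ∷ + 4 ∷ -[1+ 0 ] ∷ []
normaliser-η = isη ≋-refl

normalise : ∀ {L A B C₁ C₂} → C₁ ≐ + 2 ∷ -[1+ 3 ] ∷ + 0 ∷ [] → C₂ ≐ + 1 ∷ -[1+ 3 ] ∷ + 1 ∷ [] →
  L ≋ C₁ ∙ A ⊞ C₂ ∙ B → 𝐉 1 ⁻¹ ∙ B ⊞ 𝐉 4 ⁻¹ ∙ A ≋ normaliser ∙ L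
normalise {L} {A} {B} {C₁} {C₂} p₁ p₂ p = begin
  𝐉 1 ⁻¹ ∙ B ⊞ 𝐉 4 ⁻¹ ∙ A
    ≈⟨ ⊞-cong (∙-cong (≐-unique (≐-pad 2 (≐-⁻¹ 𝐉₁)) (normaliser-η ⊗ p₂)) ≋-refl) (∙-cong (≐-unique (≐-⁻¹ 𝐉₄) (normaliser-η ⊗ p₁)) ≋-refl) ⟩
  normaliser ∙ C₂ ∙ B ⊞ normaliser ∙ C₁ ∙ A
    ≈⟨ solve 5 (λ w a b c d → w :* a :* b :+ w :* c :* d := w :* (c :* d :+ a :* b)) ≋-refl normaliser C₂ B C₁ A ⟩
  normaliser ∙ (C₁ ∙ A ⊞ C₂ ∙ B)
    ≈⟨ ∙-cong ≋-refl (≋-sym p) ⟩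
  normaliser ∙ L ∎

-- The crossings as relations between Ω and the third order function

T-square : ∀ n → 1 * n + 2 * T n ≡ n * n
T-square zero    = ≡.refl
T-square (suc n) = ≡.trans (shuffle₁ n (T n)) (≡.trans (cong (_+ (n + suc n)) (T-square n)) (shuffle₂ n))
  where
    shuffle₁ : ∀ n t → 1 * suc n + 2 * (t + n) ≡ 1 * n + 2 * t + (n + suc n)
    shuffle₁ = solve-∀
    shuffle₂ : ∀ n → n * n + (n + suc n) ≡ suc n * suc n
    shuffle₂ = solve-∀

T-double : ∀ n → 2 * T (suc n) ≡ n * (n + 1)
T-double n = ≡.trans (shuffle n (T n)) (≡.trans (cong (_+ n) (T-square n)) (shuffle′ n))
  where
    shuffle : ∀ n t → 2 * (t + n) ≡ 1 * n + 2 * t + n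
    shuffle = solve-∀
    shuffle′ : ∀ n → n * n + n ≡ n * (n + 1)
    shuffle′ = solve-∀

-- Ω X is Σ q^(2n(n+1)) / Π_{k ≤ n} (1 - X q^(2k+1) + q^(4k+2)).
module OmegaT (X : Series) = Transform 1 2 1 (s≤s z≤n) ≡.refl (κ-odd 2) (κ-odd-spec 2) X (λ i → Unit-denom X 𝟙 (s≤s z≤n))

Ω : Series → Series
Ω X = ∑ (OmegaT.eulerian X)

Unit-denom-minus : ∀ i → Unit (denom (~ two) 𝟙 (0 + 1 * i))
Unit-denom-minus zero    = Unit-≋ (≋-sym (≋-trans (⊞-cong (∙-cong ≋-refl (⊞-cong ≋-refl (∙-cong q^-zero q^-zero))) (~-cong (∙-cong (∙-cong ≋-refl q^-zero) ≋-refl)))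
  (solve 0 (′ 1 :* (′ 1 :+ ′ 1 :* ′ 1) :- ′ 1 :* ′ 1 :* (⊝ (′ 1 :+ ′ 1)) := ′ 4) ≋-refl))) (Unit-K λ ())
Unit-denom-minus (suc i) = Unit-denom (~ two) 𝟙 (s≤s z≤n)

-- For X = -2 the node q^0 contributes 1 + 2 + 1 = 4 to every denominator; this is the origin of the
-- factor one quarter.
module ThirdOrder = Transform 0 1 0 (s≤s z≤n) ≡.refl (κ-zero 1) (κ-zero-spec 1) (~ two) Unit-denom-minus

-- One quarter of the third order mock theta function f
𝔽 : Series
𝔽 = ∑ ThirdOrder.eulerian

denom-cong : ∀ {X Y} ε a → ε ∙ X ≋ Y → denom X ε a ≋ denom Y 𝟙 a
denom-cong {X} {Y} ε a p = ≋-trans (solve 3 (λ q ε X → ′ 1 :* (′ 1 :+ q :* q) :- ε :* q :* X := ′ 1 :* (′ 1 :+ q :* q) :- ′ 1 :* q :* (ε :* X)) ≋-refl (q^ a) ε X)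
  (⊞-cong ≋-refl (~-cong (∙-cong ≋-refl p)))

dbl-two : dbl two ≋ two
dbl-two = ≋-trans (dbl-⊞ _ _) (⊞-cong dbl-𝟙 dbl-𝟙)

dbl-minus-two : dbl (~ two) ≋ ~ two
dbl-minus-two = ≋-trans (dbl-~ two) (~-cong dbl-two)

module _ (d : Series) (d² : d ∙ d ≋ 𝟙) {X : Series} (dX : ~ d ∙ two ≋ X) (dbl-X : dbl X ≋ X) where
  open CrossOdd d d²

  private
    -- The residues at the nodes with exponents 2 + 4r again form the Lambert series of some Ω: its
    -- exponents 1 + 2r double to 2 + 4r, and the sign -d of the nodes is absorbed into X = -2d. The
    -- square (2r + 1)² in the exponent leaves one factor q.
    first-dbl : ∀ r → first r ≋ q^ 1 ∙ dbl (OmegaT.lambert X r)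
    first-dbl r = begin
      q^ (4 * T (suc r) + (1 * suc (r + r) + 2 * T (suc (r + r)))) ∙ (pow (~ 𝟙) r ∙ κ-odd 4 r ∙ denom two (~ d) (2 + 4 * r) ⁻¹)
        ≈⟨ ∙-cong (≋-trans (q^-cong (≡.trans (cong (λ e → 4 * T (suc r) + e) (T-square (suc (r + r)))) (shuffle (T (suc r)) r))) (q^-+ 1 _))
             (∙-cong (∙-cong (≋-sym (dbl-pow r dbl-minus)) (≋-sym (≋-trans (dbl-fac _ dbl-𝟙) (fac-cong (shuffle₁ r)))))
               (⁻¹-cong (Unit-denom two (~ d) 0<₁) (≋-trans (denom-cong (~ d) _ dX) (≋-trans (≋-reflexive (cong (denom X 𝟙) (shuffle₂ r))) (≋-sym (dbl-denom (1 + 2 * r) dbl-X dbl-𝟙)))))) ⟩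
      q^ 1 ∙ q^ (2 * (2 * (T (suc r) + r * (r + 1)))) ∙ (dbl (pow (~ 𝟙) r) ∙ dbl (κ-odd 2 r) ∙ dbl (denom X 𝟙 (1 + 2 * r)) ⁻¹)
        ≈⟨ ∙-cong (∙-cong ≋-refl (≋-sym (dbl-q^ _))) (≋-trans (∙-cong (≋-sym (dbl-∙ _ _)) (≋-sym (dbl-⁻¹ (Unit-denom X 𝟙 0<₁)))) (≋-sym (dbl-∙ _ _))) ⟩
      q^ 1 ∙ dbl (q^ (2 * (T (suc r) + r * (r + 1)))) ∙ dbl (pow (~ 𝟙) r ∙ κ-odd 2 r ∙ denom X 𝟙 (1 + 2 * r) ⁻¹)
        ≈⟨ ≋-trans (∙-assoc _ _ _) (∙-cong ≋-refl (≋-sym (dbl-∙ _ _))) ⟩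
      q^ 1 ∙ dbl (OmegaT.lambert X r) ∎
      where
        shuffle : ∀ t r → 4 * t + suc (r + r) * suc (r + r) ≡ 1 + 2 * (2 * (t + r * (r + 1)))
        shuffle = solve-∀
        shuffle₁ : ∀ r → 2 * (2 + 2 * (r + r)) ≡ 4 + 4 * (r + r)
        shuffle₁ = solve-∀
        shuffle₂ : ∀ r → 2 + 4 * r ≡ 2 * (1 + 2 * r)
        shuffle₂ = solve-∀

    ∑-first : 𝐉 4 ⁻¹ ∙ ∑ first ≋ q^ 1 ∙ dbl (Ω X)
    ∑-first = begin
      𝐉 4 ⁻¹ ∙ ∑ first                                     ≈⟨ ∙-cong (≋-trans (⁻¹-cong (Unit-𝐉 3) (≋-sym (dbl-𝐉 1))) (≋-sym (dbl-⁻¹ (Unit-𝐉 1)))) (∑-cong first-dbl) ⟩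
      dbl (𝐉 2 ⁻¹) ∙ ∑ (λ r → q^ 1 ∙ dbl (OmegaT.lambert X r)) ≈⟨ ∙-cong ≋-refl (≋-trans (≋-sym (∑-∙ (q^ 1) (dbl-Small (OmegaT.lambert-small X)))) (∙-cong ≋-refl (≋-sym (dbl-∑ (OmegaT.lambert-small X))))) ⟩
      dbl (𝐉 2 ⁻¹) ∙ (q^ 1 ∙ dbl (∑ (OmegaT.lambert X)))   ≈⟨ solve 3 (λ a b c → a :* (b :* c) := b :* (a :* c)) ≋-refl _ _ _ ⟩
      q^ 1 ∙ (dbl (𝐉 2 ⁻¹) ∙ dbl (∑ (OmegaT.lambert X)))   ≈⟨ ∙-cong ≋-refl (≋-trans (≋-sym (dbl-∙ _ _)) (dbl-cong (≋-sym (OmegaT.transform X)))) ⟩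
      q^ 1 ∙ dbl (Ω X)                                     ∎

  M : Series
  M = 𝐉 1 ⁻¹ ∙ ∑ second

  M-crossing : M ⊞ q^ 1 ∙ dbl (Ω X) ≋ normaliser ∙ ((P∞ (~ d) 2 4 ∙ P∞ (~ d) 2 4) ⁻¹ ∙ (P∞ d 1 2 ∙ P∞ d 1 2) ⁻¹)
  M-crossing = ≋-trans (⊞-cong ≋-refl (≋-sym ∑-first)) (normalise C₁-η C₂-η crossing)

minus-two : ~ 𝟙 ∙ two ≋ ~ two
minus-two = solve 0 ((⊝ ′ 1) :* (′ 1 :+ ′ 1) := ⊝ (′ 1 :+ ′ 1)) ≋-refl

plus-two : ~ ~ 𝟙 ∙ two ≋ two
plus-two = solve 0 ((⊝ (⊝ ′ 1)) :* (′ 1 :+ ′ 1) := ′ 1 :+ ′ 1) ≋-refl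

M₊ M₋ : Series
M₊ = M 𝟙 𝟙² minus-two dbl-minus-two
M₋ = M (~ 𝟙) minus² plus-two dbl-two

M₊-equation : M₊ ⊞ q^ 1 ∙ dbl (Ω (~ two)) ≐ -[1+ 3 ] ∷ + 8 ∷ -[1+ 4 ] ∷ + 2 ∷ []
M₊-equation = ≐-trans (M-crossing 𝟙 𝟙² minus-two dbl-minus-two) (normaliser-η ⊗ (≐-⁻¹ (odd⁺₂ ⊗ odd⁺₂) ⊗ ≐-⁻¹ (odd⁻ ⊗ odd⁻)))

M₋-equation : M₋ ⊞ q^ 1 ∙ dbl (Ω two) ≐ + 0 ∷ -[1+ 1 ] ∷ + 3 ∷ []
M₋-equation = ≐-trans (M-crossing (~ 𝟙) minus² plus-two dbl-two) (normaliser-η ⊗ (≐-⁻¹ (odd⁻₂′ ⊗ odd⁻₂′) ⊗ ≐-⁻¹ (odd⁺ ⊗ odd⁺)))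
  where
    odd⁻₂′ : P∞ (~ ~ 𝟙) 2 4 ≐ + 0 ∷ + 1 ∷ -[1+ 0 ] ∷ []
    odd⁻₂′ = ≐-trans (∏-cong λ k → solve 1 (λ q → ′ 1 :- (⊝ (⊝ ′ 1)) :* q := ′ 1 :- ′ 1 :* q) ≋-refl (q^ (2 + 4 * k))) odd⁻₂

H : Series
H = 𝐉 1 ⁻¹ ∙ ∑ CrossZero.second

quarter : ℚ
quarter = + 1 / 4

private
  0<₂ : ∀ {n} → 0 < suc n
  0<₂ = s≤s z≤n

  dbl-κ-zero : ∀ m r → dbl (κ-zero m r) ≋ κ-zero (2 * m) r
  dbl-κ-zero m zero    = dbl-𝟙
  dbl-κ-zero m (suc r) = ≋-trans (dbl-⊞ _ _) (⊞-cong dbl-𝟙 (≋-trans (dbl-q^ _) (q^-cong (≡.sym (ℕₚ.*-assoc 2 m (suc r))))))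

  first-dbl₄ : ∀ r → CrossZero.first r ≋ dbl (dbl (ThirdOrder.lambert r))
  first-dbl₄ r = ≋-sym (begin
    dbl (dbl (q^ (1 * (T (suc r) + r * (r + 0))) ∙ (pow (~ 𝟙) r ∙ κ-zero 1 r ∙ denom (~ two) 𝟙 (0 + 1 * r) ⁻¹)))
      ≈⟨ ≋-trans (dbl-cong (≋-trans (dbl-∙ _ _) (∙-cong (dbl-q^ _) (≋-trans (dbl-∙ _ _) (∙-cong (≋-trans (dbl-∙ _ _) (∙-cong (dbl-pow r dbl-minus) (dbl-κ-zero 1 r))) (dbl-⁻¹ (Unit-denom-minus r)))))))
           (≋-trans (dbl-∙ _ _) (∙-cong (dbl-q^ _) (≋-trans (dbl-∙ _ _) (∙-cong (≋-trans (dbl-∙ _ _) (∙-cong (dbl-pow r dbl-minus) (dbl-κ-zero 2 r))) (dbl-⁻¹ (dbl-Unit (Unit-denom-minus r))))))) ⟩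
    q^ (2 * (2 * (1 * (T (suc r) + r * (r + 0))))) ∙ (pow (~ 𝟙) r ∙ κ-zero 4 r ∙ dbl (dbl (denom (~ two) 𝟙 (0 + 1 * r))) ⁻¹)
      ≈⟨ ∙-cong (q^-cong (≡.trans (shuffle (T (suc r)) r) (cong (λ e → 4 * T (suc r) + e) (≡.sym (T-square (r + r))))))
           (∙-cong ≋-refl (⁻¹-cong (dbl-Unit (dbl-Unit (Unit-denom-minus r)))
             (≋-trans (dbl-cong (dbl-denom _ dbl-minus-two dbl-𝟙)) (≋-trans (dbl-denom _ dbl-minus-two dbl-𝟙) (≋-trans (≋-reflexive (cong (denom (~ two) 𝟙) (shuffle′ r)))
               (≋-sym (denom-cong (~ 𝟙) _ minus-two))))))) ⟩
    CrossZero.first r ∎)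
    where
      shuffle : ∀ t r → 2 * (2 * (1 * (t + r * (r + 0)))) ≡ 4 * t + (r + r) * (r + r)
      shuffle = solve-∀
      shuffle′ : ∀ r → 2 * (2 * (0 + 1 * r)) ≡ 0 + 4 * r
      shuffle′ = solve-∀

  ∑-first₄ : 𝐉 4 ⁻¹ ∙ ∑ CrossZero.first ≋ dbl (dbl 𝔽)
  ∑-first₄ = begin
    𝐉 4 ⁻¹ ∙ ∑ CrossZero.first
      ≈⟨ ∙-cong (≋-trans (⁻¹-cong (Unit-𝐉 3) (≋-trans (≋-sym (dbl-𝐉 1)) (dbl-cong (≋-sym (dbl-𝐉 0))))) (≋-sym (≋-trans (dbl-cong (dbl-⁻¹ (Unit-𝐉 0))) (dbl-⁻¹ (dbl-Unit (Unit-𝐉 0)))))) (∑-cong first-dbl₄) ⟩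
    dbl (dbl (𝐉 1 ⁻¹)) ∙ ∑ (λ r → dbl (dbl (ThirdOrder.lambert r)))
      ≈⟨ ∙-cong ≋-refl (≋-trans (≋-sym (dbl-∑ (dbl-Small ThirdOrder.lambert-small))) (dbl-cong (≋-sym (dbl-∑ ThirdOrder.lambert-small)))) ⟩
    dbl (dbl (𝐉 1 ⁻¹)) ∙ dbl (dbl (∑ ThirdOrder.lambert))
      ≈⟨ ≋-trans (≋-sym (dbl-∙ _ _)) (dbl-cong (≋-trans (≋-sym (dbl-∙ _ _)) (dbl-cong (≋-sym ThirdOrder.transform)))) ⟩
    dbl (dbl 𝔽) ∎

-- The first factor of (-1 ; q⁴)_∞ is 2, and the theta quotient contains the square of this product
-- in its denominator, whence the constant 1/4.
H-equation : H ⊞ dbl (dbl 𝔽) ≋ K quarter ∙ η (-[1+ 3 ] ∷ + 6 ∷ + 1 ∷ -[1+ 1 ] ∷ [])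
H-equation = begin
  H ⊞ dbl (dbl 𝔽)
    ≈⟨ ≋-trans (⊞-cong ≋-refl (≋-sym ∑-first₄)) (normalise C₁-η C₂-η CrossZero.crossing) ⟩
  normaliser ∙ ((P⁺∞ 0 4 ∙ P⁺∞ 0 4) ⁻¹ ∙ (P∞ 𝟙 1 2 ∙ P∞ 𝟙 1 2) ⁻¹)
    ≈⟨ ∙-cong ≋-refl (∙-cong zero-products ≋-refl) ⟩
  normaliser ∙ (K quarter ∙ (P⁺∞ 4 4 ∙ P⁺∞ 4 4) ⁻¹ ∙ (P∞ 𝟙 1 2 ∙ P∞ 𝟙 1 2) ⁻¹)
    ≈⟨ solve 4 (λ n k a b → n :* (k :* a :* b) := k :* (n :* (a :* b))) ≋-refl normaliser (K quarter) ((P⁺∞ 4 4 ∙ P⁺∞ 4 4) ⁻¹) ((P∞ 𝟙 1 2 ∙ P∞ 𝟙 1 2) ⁻¹) ⟩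
  K quarter ∙ (normaliser ∙ ((P⁺∞ 4 4 ∙ P⁺∞ 4 4) ⁻¹ ∙ (P∞ 𝟙 1 2 ∙ P∞ 𝟙 1 2) ⁻¹))
    ≈⟨ ∙-cong ≋-refl (eta (normaliser-η ⊗ (≐-⁻¹ (even⁺₄ ⊗ even⁺₄) ⊗ ≐-⁻¹ (odd⁻ ⊗ odd⁻)))) ⟩
  K quarter ∙ η (-[1+ 3 ] ∷ + 6 ∷ + 1 ∷ -[1+ 1 ] ∷ []) ∎
  where
    U : Unit (P⁺∞ 4 4 ∙ P⁺∞ 4 4)
    U = Unit-∙ (Unit-P∞ (~ 𝟙) 4 4 0<₂) (Unit-P∞ (~ 𝟙) 4 4 0<₂)
    four-quarters : two ∙ two ∙ K quarter ≋ 𝟙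
    four-quarters = ≋-trans (∙-cong (solve 0 ((′ 1 :+ ′ 1) :* (′ 1 :+ ′ 1) := ′ 4) ≋-refl) ≋-refl) (≋-sym (K-* (ℤtoℚ (+ 4)) quarter))
    zero-products : (P⁺∞ 0 4 ∙ P⁺∞ 0 4) ⁻¹ ≋ K quarter ∙ (P⁺∞ 4 4 ∙ P⁺∞ 4 4) ⁻¹
    zero-products = ⁻¹-unique (begin
      P⁺∞ 0 4 ∙ P⁺∞ 0 4 ∙ (K quarter ∙ (P⁺∞ 4 4 ∙ P⁺∞ 4 4) ⁻¹)
        ≈⟨ ∙-cong (∙-cong (P⁺∞-zero 4 0<₂) (P⁺∞-zero 4 0<₂)) ≋-refl ⟩
      two ∙ P⁺∞ 4 4 ∙ (two ∙ P⁺∞ 4 4) ∙ (K quarter ∙ (P⁺∞ 4 4 ∙ P⁺∞ 4 4) ⁻¹)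
        ≈⟨ solve 4 (λ t p k i → t :* p :* (t :* p) :* (k :* i) := t :* t :* k :* (p :* p :* i)) ≋-refl two (P⁺∞ 4 4) (K quarter) ((P⁺∞ 4 4 ∙ P⁺∞ 4 4) ⁻¹) ⟩
      two ∙ two ∙ K quarter ∙ (P⁺∞ 4 4 ∙ P⁺∞ 4 4 ∙ (P⁺∞ 4 4 ∙ P⁺∞ 4 4) ⁻¹)
        ≈⟨ ≋-trans (∙-cong four-quarters (∙-inverse U)) (∙-identityˡ 𝟙) ⟩
      𝟙 ∎)

-- Even and odd parts of Ω: termwise, with V = q^(2s+1), these are the partial fractions
-- (1 + V) / (1 - V) ± (1 - V) / (1 + V) and (1 - V²) / (1 + V²).
private
  module Term (s : ℕ) where
    V Y a b c S Q : Series
    V = q^ (1 + 2 * s)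
    Y = q^ (2 * (1 + 2 * s))
    a = fac 𝟙 (1 + 2 * s) ⁻¹
    b = fac (~ 𝟙) (1 + 2 * s) ⁻¹
    c = fac (~ 𝟙) (2 * (1 + 2 * s)) ⁻¹
    S = pow (~ 𝟙) s
    Q = q^ (2 * (T (suc s) + s * (s + 1)))

    V² : V ∙ V ≋ Y
    V² = ≋-trans (≋-sym (q^-+ _ _)) (q^-cong (double (1 + 2 * s)))
      where
        double : ∀ n → n + n ≡ 2 * n
        double = solve-∀

    a-inv : (𝟙 ⊟ 𝟙 ∙ V) ∙ a ≋ 𝟙
    a-inv = ∙-inverse (Unit-fac 0<₂)

    b-inv : (𝟙 ⊟ ~ 𝟙 ∙ V) ∙ b ≋ 𝟙
    b-inv = ∙-inverse (Unit-fac 0<₂)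

    c-inv : (𝟙 ⊟ ~ 𝟙 ∙ Y) ∙ c ≋ 𝟙
    c-inv = ∙-inverse (Unit-fac 0<₂)

    ab : fac 𝟙 (2 * (1 + 2 * s)) ⁻¹ ≋ a ∙ b
    ab = ⁻¹-unique (begin
      (𝟙 ⊟ 𝟙 ∙ Y) ∙ (a ∙ b)                            ≈⟨ ∙-cong (⊞-cong ≋-refl (~-cong (∙-cong ≋-refl (≋-sym V²)))) ≋-refl ⟩
      (𝟙 ⊟ 𝟙 ∙ (V ∙ V)) ∙ (a ∙ b)                      ≈⟨ solve 3 (λ v a b → (′ 1 :- ′ 1 :* (v :* v)) :* (a :* b) := (′ 1 :- ′ 1 :* v) :* a :* ((′ 1 :- (⊝ ′ 1) :* v) :* b)) ≋-refl V a b ⟩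
      (𝟙 ⊟ 𝟙 ∙ V) ∙ a ∙ ((𝟙 ⊟ ~ 𝟙 ∙ V) ∙ b)            ≈⟨ ≋-trans (∙-cong a-inv b-inv) (∙-identityˡ 𝟙) ⟩
      𝟙                                                ∎)

    κ₂ : κ-odd 2 s ≋ 𝟙 ⊟ Y
    κ₂ = ≋-trans (fac-cong (shuffle s)) (⊞-cong ≋-refl (~-cong (∙-identityˡ Y)))
      where
        shuffle : ∀ s → 2 + 2 * (s + s) ≡ 2 * (1 + 2 * s)
        shuffle = solve-∀

    dbl-κ₂ : dbl (κ-odd 2 s) ≋ 𝟙 ⊟ Y ∙ Y
    dbl-κ₂ = ≋-trans (dbl-cong κ₂) (≋-trans (dbl-⊞ _ _) (⊞-cong dbl-𝟙 (≋-trans (dbl-~ _) (~-cong (≋-trans (dbl-q^ _) (≋-trans (q^-cong (double (2 * (1 + 2 * s)))) (q^-+ _ _)))))))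
      where
        double : ∀ n → 2 * n ≡ n + n
        double = solve-∀

    denom-inverse : ∀ {ε} e → 0 < e → ε ∙ ε ≋ 𝟙 → denom two ε e ⁻¹ ≋ fac ε e ⁻¹ ∙ fac ε e ⁻¹
    denom-inverse e 0<e ε² = ≋-trans (⁻¹-cong (Unit-denom two _ 0<e) (denom-two e ε²)) (⁻¹-∙ (Unit-fac 0<e) (Unit-fac 0<e))

    lambert₊ : OmegaT.lambert two s ≋ Q ∙ (S ∙ (𝟙 ⊟ Y) ∙ (a ∙ a))
    lambert₊ = ∙-cong ≋-refl (∙-cong (∙-cong ≋-refl κ₂) (denom-inverse (1 + 2 * s) 0<₂ 𝟙²))

    lambert₋ : OmegaT.lambert (~ two) s ≋ Q ∙ (S ∙ (𝟙 ⊟ Y) ∙ (b ∙ b))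
    lambert₋ = ∙-cong ≋-refl (∙-cong (∙-cong ≋-refl κ₂) (≋-trans (⁻¹-cong (Unit-denom (~ two) 𝟙 0<₂)
      (≋-sym (denom-cong (~ 𝟙) _ minus-two))) (denom-inverse (1 + 2 * s) 0<₂ minus²)))

    lambert₀ : OmegaT.lambert 𝟘 s ≋ Q ∙ (S ∙ (𝟙 ⊟ Y) ∙ c)
    lambert₀ = ∙-cong ≋-refl (∙-cong (∙-cong ≋-refl κ₂) (⁻¹-cong (Unit-denom 𝟘 𝟙 0<₂) (≋-trans
      (solve 1 (λ v → ′ 1 :* (′ 1 :+ v :* v) :- ′ 1 :* v :* ′ 0 := ′ 1 :- (⊝ ′ 1) :* (v :* v)) ≋-refl V) (⊞-cong ≋-refl (~-cong (∙-cong ≋-refl V²))))))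

    dbl-second : ∀ {ε} e D → e ≡ T (suc s) + s * (s + 1) → dbl ε ≋ ε → ε ∙ ε ≋ 𝟙 →
      dbl (q^ e ∙ (S ∙ κ-odd 2 s ∙ D ∙ denom two ε (1 + 2 * s) ⁻¹)) ≋ Q ∙ (S ∙ (𝟙 ⊟ Y ∙ Y) ∙ dbl D ∙ (fac ε (2 * (1 + 2 * s)) ⁻¹ ∙ fac ε (2 * (1 + 2 * s)) ⁻¹))
    dbl-second {ε} e D p dε ε² = ≋-trans (dbl-∙ _ _) (∙-cong (≋-trans (dbl-q^ e) (q^-cong (cong (2 *_) p))) (≋-trans (dbl-∙ _ _) (∙-cong
      (≋-trans (dbl-∙ _ _) (∙-cong (≋-trans (dbl-∙ _ _) (∙-cong (dbl-pow s dbl-minus) dbl-κ₂)) ≋-refl))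
      (≋-trans (dbl-⁻¹ (Unit-denom two ε 0<₂)) (≋-trans (⁻¹-cong (dbl-Unit (Unit-denom two ε 0<₂)) (dbl-denom _ dbl-two dε)) (denom-inverse (2 * (1 + 2 * s)) 0<₂ ε²))))))

    exponent : 2 * T (suc s) + T (suc s) ≡ T (suc s) + s * (s + 1)
    exponent = ≡.trans (ℕₚ.+-comm (2 * T (suc s)) (T (suc s))) (cong (λ e → T (suc s) + e) (T-double s))

second₋-dbl : ∀ s → dbl (CrossOdd.second (~ 𝟙) minus² s) ≋ OmegaT.lambert 𝟘 s
second₋-dbl s = begin
  dbl (CrossOdd.second (~ 𝟙) minus² s)
    ≈⟨ dbl-second (2 * T (suc s) + T (suc s)) 𝟙 exponent dbl-minus minus² ⟩
  Q ∙ (S ∙ (𝟙 ⊟ Y ∙ Y) ∙ dbl 𝟙 ∙ (c ∙ c))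
    ≈⟨ ∙-cong ≋-refl (∙-cong (∙-cong ≋-refl dbl-𝟙) ≋-refl) ⟩
  Q ∙ (S ∙ (𝟙 ⊟ Y ∙ Y) ∙ 𝟙 ∙ (c ∙ c))
    ≈⟨ solve 4 (λ q s y c → q :* (s :* (′ 1 :- y :* y) :* ′ 1 :* (c :* c)) := q :* (s :* (′ 1 :- y) :* ((′ 1 :- (⊝ ′ 1) :* y) :* c :* c))) ≋-refl Q S Y c ⟩
  Q ∙ (S ∙ (𝟙 ⊟ Y) ∙ ((𝟙 ⊟ ~ 𝟙 ∙ Y) ∙ c ∙ c))
    ≈⟨ ∙-cong ≋-refl (∙-cong ≋-refl (≋-trans (∙-cong c-inv ≋-refl) (∙-identityˡ c))) ⟩
  Q ∙ (S ∙ (𝟙 ⊟ Y) ∙ c)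
    ≈⟨ lambert₀ ⟨
  OmegaT.lambert 𝟘 s ∎
  where open Term s

second₊-dbl : ∀ s → two ∙ dbl (CrossOdd.second 𝟙 𝟙² s) ≋ OmegaT.lambert two s ⊞ OmegaT.lambert (~ two) s
second₊-dbl s = begin
  two ∙ dbl (CrossOdd.second 𝟙 𝟙² s)
    ≈⟨ ∙-cong ≋-refl (≋-trans (dbl-second (2 * T (suc s) + T (suc s)) 𝟙 exponent dbl-𝟙 𝟙²) (∙-cong ≋-refl (∙-cong (∙-cong ≋-refl dbl-𝟙) (∙-cong ab ab)))) ⟩
  two ∙ (Q ∙ (S ∙ (𝟙 ⊟ Y ∙ Y) ∙ 𝟙 ∙ (a ∙ b ∙ (a ∙ b))))
    ≈⟨ solve 5 (λ q s y a b → (′ 1 :+ ′ 1) :* (q :* (s :* (′ 1 :- y :* y) :* ′ 1 :* (a :* b :* (a :* b)))) := q :* (s :* (′ 1 :- y) :* (a :* a :* (b :* b) :* (′ 2 :* (′ 1 :+ y))))) ≋-refl Q S Y a b ⟩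
  Q ∙ (S ∙ (𝟙 ⊟ Y) ∙ (a ∙ a ∙ (b ∙ b) ∙ (# (+ 2) ∙ (𝟙 ⊞ Y))))
    ≈⟨ ∙-cong ≋-refl (∙-cong ≋-refl (∙-cong ≋-refl (∙-cong ≋-refl (⊞-cong ≋-refl (≋-sym V²))))) ⟩
  Q ∙ (S ∙ (𝟙 ⊟ Y) ∙ (a ∙ a ∙ (b ∙ b) ∙ (# (+ 2) ∙ (𝟙 ⊞ V ∙ V))))
    -- 2 (1 + V²) = (1 + V)² + (1 - V)², where `a` and `b` are the reciprocals of 1 - V and 1 + V.
    ≈⟨ ∙-cong ≋-refl (∙-cong ≋-refl (solve 3 (λ v a b → a :* a :* (b :* b) :* (′ 2 :* (′ 1 :+ v :* v)) :=
         a :* a :* ((′ 1 :- (⊝ ′ 1) :* v) :* b :* ((′ 1 :- (⊝ ′ 1) :* v) :* b)) :+ b :* b :* ((′ 1 :- ′ 1 :* v) :* a :* ((′ 1 :- ′ 1 :* v) :* a))) ≋-refl V a b)) ⟩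
  Q ∙ (S ∙ (𝟙 ⊟ Y) ∙ (a ∙ a ∙ ((𝟙 ⊟ ~ 𝟙 ∙ V) ∙ b ∙ ((𝟙 ⊟ ~ 𝟙 ∙ V) ∙ b)) ⊞ b ∙ b ∙ ((𝟙 ⊟ 𝟙 ∙ V) ∙ a ∙ ((𝟙 ⊟ 𝟙 ∙ V) ∙ a))))
    ≈⟨ ∙-cong ≋-refl (∙-cong ≋-refl (⊞-cong (∙-cong ≋-refl (∙-cong b-inv b-inv)) (∙-cong ≋-refl (∙-cong a-inv a-inv)))) ⟩
  Q ∙ (S ∙ (𝟙 ⊟ Y) ∙ (a ∙ a ∙ (𝟙 ∙ 𝟙) ⊞ b ∙ b ∙ (𝟙 ∙ 𝟙)))
    ≈⟨ solve 5 (λ q s y a b → q :* (s :* (′ 1 :- y) :* (a :* a :* (′ 1 :* ′ 1) :+ b :* b :* (′ 1 :* ′ 1))) := q :* (s :* (′ 1 :- y) :* (a :* a)) :+ q :* (s :* (′ 1 :- y) :* (b :* b))) ≋-refl Q S Y a b ⟩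
  Q ∙ (S ∙ (𝟙 ⊟ Y) ∙ (a ∙ a)) ⊞ Q ∙ (S ∙ (𝟙 ⊟ Y) ∙ (b ∙ b))
    ≈⟨ ⊞-cong lambert₊ lambert₋ ⟨
  OmegaT.lambert two s ⊞ OmegaT.lambert (~ two) s ∎
  where open Term s

second₀-dbl : ∀ s → # (+ 4) ∙ dbl (CrossZero.second s) ≋ q^ 1 ∙ (OmegaT.lambert two s ⊟ OmegaT.lambert (~ two) s)
second₀-dbl s = begin
  # (+ 4) ∙ dbl (q^ (2 * T (suc s) + T (suc (suc s))) ∙ (S ∙ κ-odd 2 s ∙ b ∙ denom two 𝟙 (1 + 2 * s) ⁻¹))
    -- The exponent exceeds that of the odd crossing by s + 1, which doubles to q^(2s+2) = q V. This
    -- V is needed for 4 V = (1 + V)² - (1 - V)² below.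
    ≈⟨ ∙-cong ≋-refl (dbl-cong (≋-trans (∙-cong (≋-trans (q^-cong split) (q^-+ _ (suc s))) ≋-refl) (solve 3 (λ x y z → x :* y :* z := y :* (x :* z)) ≋-refl _ _ _))) ⟩
  # (+ 4) ∙ dbl (q^ (suc s) ∙ (q^ (2 * T (suc s) + T (suc s)) ∙ (S ∙ κ-odd 2 s ∙ b ∙ denom two 𝟙 (1 + 2 * s) ⁻¹)))
    ≈⟨ ∙-cong ≋-refl (≋-trans (dbl-∙ _ _) (∙-cong (≋-trans (dbl-q^ (suc s)) (≋-trans (q^-cong (ℕₚ.*-suc 2 s)) (q^-+ 1 (1 + 2 * s))))
         (≋-trans (dbl-second (2 * T (suc s) + T (suc s)) b exponent dbl-𝟙 𝟙²) (∙-cong ≋-refl (∙-cong (∙-cong ≋-refl dbl-b) (∙-cong ab ab)))))) ⟩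
  # (+ 4) ∙ (q^ 1 ∙ V ∙ (Q ∙ (S ∙ (𝟙 ⊟ Y ∙ Y) ∙ c ∙ (a ∙ b ∙ (a ∙ b)))))
    ≈⟨ solve 8 (λ z v q s y a b c → ′ 4 :* (z :* v :* (q :* (s :* (′ 1 :- y :* y) :* c :* (a :* b :* (a :* b))))) :=
         z :* (q :* (s :* (′ 1 :- y) :* (((′ 1 :- (⊝ ′ 1) :* y) :* c) :* (a :* b :* (a :* b) :* (′ 4 :* v)))))) ≋-refl (q^ 1) V Q S Y a b c ⟩
  q^ 1 ∙ (Q ∙ (S ∙ (𝟙 ⊟ Y) ∙ ((𝟙 ⊟ ~ 𝟙 ∙ Y) ∙ c ∙ (a ∙ b ∙ (a ∙ b) ∙ (# (+ 4) ∙ V)))))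
    ≈⟨ ∙-cong ≋-refl (∙-cong ≋-refl (∙-cong ≋-refl (∙-cong c-inv (solve 3 (λ v a b → a :* b :* (a :* b) :* (′ 4 :* v) :=
         a :* a :* ((′ 1 :- (⊝ ′ 1) :* v) :* b :* ((′ 1 :- (⊝ ′ 1) :* v) :* b)) :- b :* b :* ((′ 1 :- ′ 1 :* v) :* a :* ((′ 1 :- ′ 1 :* v) :* a))) ≋-refl V a b)))) ⟩
  q^ 1 ∙ (Q ∙ (S ∙ (𝟙 ⊟ Y) ∙ (𝟙 ∙ (a ∙ a ∙ ((𝟙 ⊟ ~ 𝟙 ∙ V) ∙ b ∙ ((𝟙 ⊟ ~ 𝟙 ∙ V) ∙ b)) ⊟ b ∙ b ∙ ((𝟙 ⊟ 𝟙 ∙ V) ∙ a ∙ ((𝟙 ⊟ 𝟙 ∙ V) ∙ a))))))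
    ≈⟨ ∙-cong ≋-refl (∙-cong ≋-refl (∙-cong ≋-refl (∙-cong ≋-refl (⊞-cong (∙-cong ≋-refl (∙-cong b-inv b-inv)) (~-cong (∙-cong ≋-refl (∙-cong a-inv a-inv))))))) ⟩
  q^ 1 ∙ (Q ∙ (S ∙ (𝟙 ⊟ Y) ∙ (𝟙 ∙ (a ∙ a ∙ (𝟙 ∙ 𝟙) ⊟ b ∙ b ∙ (𝟙 ∙ 𝟙)))))
    ≈⟨ solve 6 (λ z q s y a b → z :* (q :* (s :* (′ 1 :- y) :* (′ 1 :* (a :* a :* (′ 1 :* ′ 1) :- b :* b :* (′ 1 :* ′ 1))))) := z :* (q :* (s :* (′ 1 :- y) :* (a :* a)) :- q :* (s :* (′ 1 :- y) :* (b :* b)))) ≋-refl (q^ 1) Q S Y a b ⟩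
  q^ 1 ∙ (Q ∙ (S ∙ (𝟙 ⊟ Y) ∙ (a ∙ a)) ⊟ Q ∙ (S ∙ (𝟙 ⊟ Y) ∙ (b ∙ b)))
    ≈⟨ ∙-cong ≋-refl (⊞-cong lambert₊ (~-cong lambert₋)) ⟨
  q^ 1 ∙ (OmegaT.lambert two s ⊟ OmegaT.lambert (~ two) s) ∎
  where
    open Term s
    split : 2 * T (suc s) + T (suc (suc s)) ≡ 2 * T (suc s) + T (suc s) + suc s
    split = ≡.sym (ℕₚ.+-assoc (2 * T (suc s)) (T (suc s)) (suc s))
    dbl-b : dbl b ≋ c
    dbl-b = ≋-trans (dbl-⁻¹ (Unit-fac 0<₂)) (⁻¹-cong (dbl-Unit (Unit-fac 0<₂)) (dbl-fac (1 + 2 * s) dbl-minus))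

private
  dbl-J⁻¹ : dbl (𝐉 1 ⁻¹) ≋ 𝐉 2 ⁻¹
  dbl-J⁻¹ = ≋-trans (dbl-⁻¹ (Unit-𝐉 0)) (⁻¹-cong (dbl-Unit (Unit-𝐉 0)) (dbl-𝐉 0))

  second-small : ∀ (e : ℕ → ℕ) F → (∀ s → 2 * T (suc s) ≤ e s) → Small (λ s → q^ (e s) ∙ F s)
  second-small e F le = Small-q^ e F λ k → ≤-trans (≤-trans (≤-trans (ℕₚ.n≤1+n k) (m≤n+m (suc k) (T (suc k)))) (m≤m+n _ _)) (le (suc k))

  dbl-sum : ∀ {F} → Small F → dbl (𝐉 1 ⁻¹ ∙ ∑ F) ≋ 𝐉 2 ⁻¹ ∙ ∑ (λ s → dbl (F s))
  dbl-sum s = ≋-trans (dbl-∙ _ _) (∙-cong dbl-J⁻¹ (dbl-∑ s))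

dbl-M₋ : dbl M₋ ≋ Ω 𝟘
dbl-M₋ = ≋-trans (dbl-sum (second-small (λ s → 2 * T (suc s) + T (suc s)) _ λ s → m≤m+n _ _))
  (≋-trans (∙-cong ≋-refl (∑-cong second₋-dbl)) (≋-sym (OmegaT.transform 𝟘)))

dbl-M₊ : two ∙ dbl M₊ ≋ Ω two ⊞ Ω (~ two)
dbl-M₊ = begin
  two ∙ dbl M₊
    ≈⟨ ∙-cong ≋-refl (dbl-sum sm) ⟩
  two ∙ (𝐉 2 ⁻¹ ∙ ∑ (λ s → dbl (CrossOdd.second 𝟙 𝟙² s)))
    ≈⟨ ≋-trans (solve 3 (λ x y z → x :* (y :* z) := y :* (x :* z)) ≋-refl _ _ _) (∙-cong ≋-refl (∑-∙ two (dbl-Small sm))) ⟩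
  𝐉 2 ⁻¹ ∙ ∑ (λ s → two ∙ dbl (CrossOdd.second 𝟙 𝟙² s))
    ≈⟨ ∙-cong ≋-refl (≋-trans (∑-cong second₊-dbl) (∑-⊞ _ _)) ⟩
  𝐉 2 ⁻¹ ∙ (∑ (OmegaT.lambert two) ⊞ ∑ (OmegaT.lambert (~ two)))
    ≈⟨ solve 3 (λ x y z → x :* (y :+ z) := x :* y :+ x :* z) ≋-refl _ _ _ ⟩
  𝐉 2 ⁻¹ ∙ ∑ (OmegaT.lambert two) ⊞ 𝐉 2 ⁻¹ ∙ ∑ (OmegaT.lambert (~ two))
    ≈⟨ ⊞-cong (OmegaT.transform two) (OmegaT.transform (~ two)) ⟨
  Ω two ⊞ Ω (~ two) ∎
  where
    sm : Small (CrossOdd.second 𝟙 𝟙²)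
    sm = second-small (λ s → 2 * T (suc s) + T (suc s)) _ λ s → m≤m+n _ _

dbl-H : # (+ 4) ∙ dbl H ≋ q^ 1 ∙ (Ω two ⊟ Ω (~ two))
dbl-H = begin
  # (+ 4) ∙ dbl H
    ≈⟨ ∙-cong ≋-refl (dbl-sum sm) ⟩
  # (+ 4) ∙ (𝐉 2 ⁻¹ ∙ ∑ (λ s → dbl (CrossZero.second s)))
    ≈⟨ ≋-trans (solve 3 (λ x y z → x :* (y :* z) := y :* (x :* z)) ≋-refl _ _ _) (∙-cong ≋-refl (∑-∙ (# (+ 4)) (dbl-Small sm))) ⟩
  𝐉 2 ⁻¹ ∙ ∑ (λ s → # (+ 4) ∙ dbl (CrossZero.second s))
    ≈⟨ ∙-cong ≋-refl (≋-trans (∑-cong second₀-dbl) (≋-sym (∑-∙ (q^ 1) (Small-⊞ (OmegaT.lambert-small two) (Small-≋ (λ k → solve 1 (λ x → (⊝ ′ 1) :* x := ⊝ x) ≋-refl _) (Small-∙ (~ 𝟙) (OmegaT.lambert-small (~ two)))))))) ⟩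
  𝐉 2 ⁻¹ ∙ (q^ 1 ∙ ∑ (λ s → OmegaT.lambert two s ⊟ OmegaT.lambert (~ two) s))
    ≈⟨ ∙-cong ≋-refl (∙-cong ≋-refl (∑-⊟ _ _)) ⟩
  𝐉 2 ⁻¹ ∙ (q^ 1 ∙ (∑ (OmegaT.lambert two) ⊟ ∑ (OmegaT.lambert (~ two))))
    ≈⟨ solve 4 (λ x w y z → x :* (w :* (y :- z)) := w :* (x :* y :- x :* z)) ≋-refl _ _ _ _ ⟩
  q^ 1 ∙ (𝐉 2 ⁻¹ ∙ ∑ (OmegaT.lambert two) ⊟ 𝐉 2 ⁻¹ ∙ ∑ (OmegaT.lambert (~ two)))
    ≈⟨ ∙-cong ≋-refl (⊞-cong (OmegaT.transform two) (~-cong (OmegaT.transform (~ two)))) ⟨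
  q^ 1 ∙ (Ω two ⊟ Ω (~ two)) ∎
  where
    sm : Small CrossZero.second
    sm = second-small (λ s → 2 * T (suc s) + T (suc (suc s))) _ λ s → m≤m+n _ _

-- The Jacobi triple product and the dissection of theta functions

module Euler (m : ℕ) (0<m : 0 < m) (ρ : Series) where
  open Rectangle m 0<m using (Q!; Q^; i; i-suc)

  weight : ℕ → ℕ → ℕ
  weight a k = a * k + m * T k

  term : ℕ → ℕ → Series
  term a k = q^ (weight a k) ∙ (pow ρ k ∙ i k)

  private
    big : ∀ a k → k ≤ weight a (suc k)
    big a k = ≤-trans (≤-trans (m≤n+m k (T k)) (ℕₚ.m≤n*m (T k + k) m {{ℕ.>-nonZero 0<m}})) (m≤n+m _ (a * suc k))

  term-small : ∀ a → Small (term a)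
  term-small a = Small-q^ (weight a) _ (big a)

  private
    G : ℕ → Series
    G a = ∑ (term a)

    A : ℕ → ℕ → Series
    A a k = q^ (weight a k) ∙ (pow ρ k ∙ ((𝟙 ⊟ Q^ k) ∙ i k))

    A-small : ∀ a → Small (A a)
    A-small a = Small-q^ (weight a) _ (big a)

    difference : ∀ a k → term a k ⊟ term (a + m) k ≋ A a k
    difference a k = ≋-trans (⊞-cong ≋-refl (~-cong (∙-cong (≋-trans (q^-cong (shuffle a m k (T k))) (q^-+ _ _)) ≋-refl)))
      (solve 4 (λ w x p i → w :* (p :* i) :- w :* x :* (p :* i) := w :* (p :* ((′ 1 :- x) :* i))) ≋-refl (q^ (weight a k)) (Q^ k) (pow ρ k) (i k))
      where
        shuffle : ∀ a m k t → (a + m) * k + m * t ≡ a * k + m * t + m * k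
        shuffle = solve-∀

    A-suc : ∀ a k → A a (suc k) ≋ ρ ∙ q^ a ∙ term (a + m) k
    A-suc a k = ≋-trans (∙-cong (≋-trans (q^-cong (shuffle a m k (T k))) (q^-+ a _)) (∙-cong ≋-refl (≋-sym (i-suc k))))
      (solve 5 (λ x w p r i → x :* w :* (p :* r :* i) := r :* x :* (w :* (p :* i))) ≋-refl (q^ a) (q^ (weight (a + m) k)) (pow ρ k) ρ (i k))
      where
        shuffle : ∀ a m k t → a * suc k + m * (t + k) ≡ a + ((a + m) * k + m * t)
        shuffle = solve-∀

    A-zero : ∀ a → A a 0 ≋ 𝟘
    A-zero a = ≋-trans (∙-cong ≋-refl (∙-cong ≋-refl (∙-cong (≋-trans (⊞-cong ≋-refl (~-cong (≋-trans (q^-cong (ℕₚ.*-zeroʳ m)) q^-zero))) (⊞-inverseʳ 𝟙)) ≋-refl)))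
      (solve 3 (λ w v p → w :* (p :* (′ 0 :* v)) := ′ 0) ≋-refl _ _ _)

    functional : ∀ a → G a ≋ fac (~ ρ) a ∙ G (a + m)
    functional a = begin
      G a                                                    ≈⟨ solve 2 (λ x y → x := y :+ (x :- y)) ≋-refl (G a) (G (a + m)) ⟩
      G (a + m) ⊞ (G a ⊟ G (a + m))                          ≈⟨ ⊞-cong ≋-refl (≋-trans (≋-sym (∑-⊟ _ _)) (∑-cong (difference a))) ⟩
      G (a + m) ⊞ ∑ (A a)                                    ≈⟨ ⊞-cong ≋-refl (≋-trans (∑-head (A-small a)) (≋-trans (⊞-cong (A-zero a) (∑-cong (A-suc a))) (⊞-identityˡ _))) ⟩
      G (a + m) ⊞ ∑ (λ k → ρ ∙ q^ a ∙ term (a + m) k)        ≈⟨ ⊞-cong ≋-refl (∑-∙ (ρ ∙ q^ a) (term-small (a + m))) ⟨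
      G (a + m) ⊞ ρ ∙ q^ a ∙ G (a + m)                       ≈⟨ solve 3 (λ g r x → g :+ r :* x :* g := (′ 1 :- (⊝ r) :* x) :* g) ≋-refl (G (a + m)) ρ (q^ a) ⟩
      fac (~ ρ) a ∙ G (a + m)                                ∎

    iterate : ∀ a n → G a ≋ P (~ ρ) a m n ∙ G (a + m * n)
    iterate a zero    = ≋-trans (≋-reflexive (cong G (≡.sym (≡.trans (cong (λ e → a + e) (ℕₚ.*-zeroʳ m)) (ℕₚ.+-identityʳ a))))) (≋-sym (∙-identityˡ _))
    iterate a (suc n) = ≋-trans (iterate a n) (≋-trans (∙-cong ≋-refl (≋-trans (functional (a + m * n)) (∙-cong ≋-refl (≋-reflexive (cong G (shuffle a m n)))))) (≋-sym (∙-assoc _ _ _)))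
      where
        shuffle : ∀ a m n → a + m * n + m ≡ a + m * suc n
        shuffle = solve-∀

    G-start : ∀ n b → n ≤ b → G b ≈[ n ] 𝟙
    G-start n b n≤b = ≈-trans (∑-limit (suc n) ≤-refl (term-small b)) (≈-trans (≋⇒≈ (Σ-head n (term b)))
      (≈-trans (≈-⊞ (≋⇒≈ first) (≈-trans (Σ-≈ n λ k _ → q^-small (weight b (suc k)) _ (≤-trans n≤b (≤-trans (ℕₚ.m≤m*n b (suc k)) (m≤m+n _ _)))) (≋⇒≈ (zeros n)))) (≋⇒≈ (⊞-identityʳ 𝟙))))
      where
        zeros : ∀ n → Σ< n (λ _ → 𝟘) ≋ 𝟘
        zeros zero    = ≋-refl
        zeros (suc n) = ≋-trans (⊞-identityʳ _) (zeros n)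
        first : term b 0 ≋ 𝟙
        first = ≋-trans (∙-cong (≋-trans (q^-cong (cong₂ _+_ (ℕₚ.*-zeroʳ b) (ℕₚ.*-zeroʳ m))) q^-zero) (≋-trans (∙-identityˡ _) (⁻¹-unique (∙-identityˡ 𝟙)))) (∙-identityˡ 𝟙)

  -- Euler's expansion: both sides satisfy G(a) = (1 + ρ q^a) G(a + m), and G(a + m n) is 1 modulo
  -- q^n.
  euler : ∀ a → P∞ (~ ρ) a m ≋ ∑ (term a)
  euler a = ≈-all λ n → ≈-trans (P∞-limit (~ ρ) a m n 0<m ≤-refl) (≈-trans (≋⇒≈ (≋-sym (∙-identityʳ _)))
    (≈-trans (≈-∙ ≈-refl (≈-sym (G-start n (a + m * n) (≤-trans (ℕₚ.m≤n*m n m {{ℕ.>-nonZero 0<m}}) (m≤n+m _ a))))) (≋⇒≈ (≋-sym (iterate a n)))))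

Σ-square : ∀ M (F : ℕ → ℕ → Series) → Σ< M (λ k → Σ< M (F k)) ≋ Σ< M (λ k → Σ< (suc k) (F k)) ⊞ Σ< M (λ l → Σ< l (λ k → F k l))
Σ-square zero    F = ≋-sym (⊞-identityˡ 𝟘)
Σ-square (suc M) F = begin
  Σ< M (λ k → Σ< M (F k) ⊞ F k M) ⊞ Σ< (suc M) (F M)
    ≈⟨ ⊞-cong (≋-trans (Σ-⊞ M _ _) (⊞-cong (Σ-square M F) ≋-refl)) ≋-refl ⟩
  Σ< M (λ k → Σ< (suc k) (F k)) ⊞ Σ< M (λ l → Σ< l (λ k → F k l)) ⊞ Σ< M (λ k → F k M) ⊞ Σ< (suc M) (F M)
    ≈⟨ solve 4 (λ a b c d → a :+ b :+ c :+ d := a :+ d :+ (b :+ c)) ≋-refl _ _ _ _ ⟩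
  Σ< M (λ k → Σ< (suc k) (F k)) ⊞ Σ< (suc M) (F M) ⊞ (Σ< M (λ l → Σ< l (λ k → F k l)) ⊞ Σ< M (λ k → F k M)) ∎

pow-square : ∀ {ρ} → ρ ∙ ρ ≋ 𝟙 → ∀ l → pow ρ l ∙ pow ρ l ≋ 𝟙
pow-square         ρ² zero    = ∙-identityˡ 𝟙
pow-square {ρ = ρ} ρ² (suc l) = ≋-trans (solve 2 (λ p r → p :* r :* (p :* r) := p :* p :* (r :* r)) ≋-refl (pow ρ l) ρ)
  (≋-trans (∙-cong (pow-square ρ² l) ρ²) (∙-identityˡ 𝟙))

-- The two Euler expansions are multiplied and collected by the difference d of their indices.
-- Because a + b = m, the exponents on one diagonal complete to m l (l + d), so `rectangle` sums
-- each diagonal to the same constant; ρ² = 1 leaves the power of ρ depending on d alone.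
module TripleProduct (m a b : ℕ) (0<m : 0 < m) (a+b : a + b ≡ m) (0<a : 0 < a) (ρ : Series) (ρ² : ρ ∙ ρ ≋ 𝟙) where
  open Euler m 0<m ρ
  open Rectangle m 0<m using (rect; rectangle-limit; Q^; i)

  private
    F : ℕ → ℕ → Series
    F k l = term a k ∙ term b l

    T-+ : ∀ d l → T (d + l) ≡ T d + T l + d * l
    T-+ d zero    = ≡.trans (cong T (ℕₚ.+-identityʳ d)) (≡.sym (≡.trans (cong (λ e → T d + 0 + e) (ℕₚ.*-zeroʳ d)) (≡.trans (ℕₚ.+-identityʳ _) (ℕₚ.+-identityʳ _))))
    T-+ d (suc l) = ≡.trans (cong T (ℕₚ.+-suc d l)) (≡.trans (cong (_+ (d + l)) (T-+ d l)) (shuffle d l (T d) (T l)))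
      where
        shuffle : ∀ d l t u → t + u + d * l + (d + l) ≡ t + (u + l) + d * suc l
        shuffle = solve-∀

    exponent : ∀ a b d l → a + b ≡ m → weight a (d + l) + weight b l ≡ weight a d + m * (l * (l + d))
    exponent a b d l p = ≡.trans (cong (λ t → a * (d + l) + m * t + weight b l) (T-+ d l)) (≡.trans (shuffle₁ a b d l m (T d) (T l))
      (≡.trans (cong (λ e → a * d + m * T d + (e * l + (m * (d * l) + m * (2 * T l)))) p) (≡.trans (shuffle₂ (a * d + m * T d) m d l (T l)) (cong (λ e → a * d + m * T d + m * (e + d * l)) (T-square l) ⟨≡⟩ shuffle₃ (a * d + m * T d) m d l))))
      where
        _⟨≡⟩_ : ∀ {x y z : ℕ} → x ≡ y → y ≡ z → x ≡ z
        _⟨≡⟩_ = ≡.trans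
        shuffle₁ : ∀ a b d l m t u → a * (d + l) + m * (t + u + d * l) + (b * l + m * u) ≡ a * d + m * t + ((a + b) * l + (m * (d * l) + m * (2 * u)))
        shuffle₁ = solve-∀
        shuffle₂ : ∀ x m d l u → x + (m * l + (m * (d * l) + m * (2 * u))) ≡ x + m * (1 * l + 2 * u + d * l)
        shuffle₂ = solve-∀
        shuffle₃ : ∀ x m d l → x + m * (l * l + d * l) ≡ x + m * (l * (l + d))
        shuffle₃ = solve-∀

    product : ∀ a b d l → a + b ≡ m → term a (d + l) ∙ term b l ≋ q^ (weight a d) ∙ (pow ρ d ∙ rect d l)
    product a b d l p = begin
      q^ (weight a (d + l)) ∙ (pow ρ (d + l) ∙ i (d + l)) ∙ (q^ (weight b l) ∙ (pow ρ l ∙ i l))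
        ≈⟨ ∙-cong (∙-cong ≋-refl (∙-cong (pow-+ ρ d l) (≋-reflexive (cong i (ℕₚ.+-comm d l))))) ≋-refl ⟩
      q^ (weight a (d + l)) ∙ (pow ρ d ∙ pow ρ l ∙ i (l + d)) ∙ (q^ (weight b l) ∙ (pow ρ l ∙ i l))
        ≈⟨ solve 6 (λ x p r i y j → x :* (p :* r :* i) :* (y :* (r :* j)) := x :* y :* (p :* (r :* r) :* (j :* i))) ≋-refl (q^ (weight a (d + l))) (pow ρ d) (pow ρ l) (i (l + d)) (q^ (weight b l)) (i l) ⟩
      q^ (weight a (d + l)) ∙ q^ (weight b l) ∙ (pow ρ d ∙ (pow ρ l ∙ pow ρ l) ∙ (i l ∙ i (l + d)))
        ≈⟨ ∙-cong (≋-trans (≋-sym (q^-+ _ _)) (≋-trans (q^-cong (exponent a b d l p)) (q^-+ _ _))) (∙-cong (≋-trans (∙-cong ≋-refl (pow-square ρ² l)) (∙-identityʳ _)) ≋-refl) ⟩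
      q^ (weight a d) ∙ Q^ (l * (l + d)) ∙ (pow ρ d ∙ (i l ∙ i (l + d)))
        ≈⟨ solve 4 (λ x y p j → x :* y :* (p :* j) := x :* (p :* (y :* j))) ≋-refl _ _ _ _ ⟩
      q^ (weight a d) ∙ (pow ρ d ∙ rect d l) ∎

    lower : ∀ n → Σ< (suc (suc n)) (λ d → Σ< (suc (suc n) ∸ d) (λ l → F (d + l) l)) ≈[ n ] P∞ 𝟙 m m ⁻¹ ∙ ∑ (λ d → q^ (weight a d) ∙ pow ρ d)
    lower n = limit-Σ (weight a) (pow ρ) (P∞ 𝟙 m m ⁻¹) (λ d → ≤-trans (ℕₚ.m≤n*m d a {{ℕ.>-nonZero 0<a}}) (m≤m+n _ _)) n (suc (suc n)) (s≤s (ℕₚ.n≤1+n n)) _ (λ d → Σ< (suc (suc n) ∸ d) (rect d))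
      (λ d _ → ≋-trans (Σ-cong (suc (suc n) ∸ d) λ l _ → ≋-trans (product a b d l a+b) (≋-sym (∙-assoc _ _ _))) (≋-trans (≋-sym (Σ-∙ (suc (suc n) ∸ d) _ _)) (∙-assoc _ _ _)))
      λ d d<N → ≈-trans (≋⇒≈ (≋-reflexive (cong (λ j → Σ< j (rect d)) (ℕₚ.+-∸-assoc 1 (ℕₚ.≤-pred d<N))))) (≈-weaken (ℕₚ.∸-monoˡ-≤ d (ℕₚ.n≤1+n n)) (rectangle-limit d (suc n ∸ d)))

    upper : ∀ n → Σ< (suc n) (λ d → Σ< (suc n ∸ d) (λ k → F k (suc (d + k)))) ≈[ n ] P∞ 𝟙 m m ⁻¹ ∙ ∑ (λ d → q^ (weight b (suc d)) ∙ pow ρ (suc d))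
    upper n = limit-Σ (λ d → weight b (suc d)) (λ d → pow ρ (suc d)) (P∞ 𝟙 m m ⁻¹)
      (λ d → ≤-trans (≤-trans (m≤n+m d (T d)) (ℕₚ.m≤n*m (T d + d) m {{ℕ.>-nonZero 0<m}})) (m≤n+m _ (b * suc d))) n (suc n) ≤-refl _ (λ d → Σ< (suc n ∸ d) (rect (suc d)))
      (λ d _ → ≋-trans (Σ-cong (suc n ∸ d) λ k _ → ≋-trans (∙-comm _ _) (≋-trans (product b a (suc d) k (≡.trans (ℕₚ.+-comm b a) a+b)) (≋-sym (∙-assoc _ _ _)))) (≋-trans (≋-sym (Σ-∙ (suc n ∸ d) _ _)) (∙-assoc _ _ _)))
      λ d d<N → ≈-trans (≋⇒≈ (≋-reflexive (cong (λ j → Σ< j (rect (suc d))) (ℕₚ.+-∸-assoc 1 (ℕₚ.≤-pred d<N))))) (rectangle-limit (suc d) (n ∸ d))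

  tripleProduct : P∞ 𝟙 m m ∙ (P∞ (~ ρ) a m ∙ P∞ (~ ρ) b m) ≋ ∑ (λ d → q^ (weight a d) ∙ pow ρ d) ⊞ ∑ (λ d → q^ (weight b (suc d)) ∙ pow ρ (suc d))
  tripleProduct = begin
    P∞ 𝟙 m m ∙ (P∞ (~ ρ) a m ∙ P∞ (~ ρ) b m)    ≈⟨ ∙-cong ≋-refl expanded ⟩
    P∞ 𝟙 m m ∙ (I ∙ A ⊞ I ∙ B)                  ≈⟨ solve 4 (λ p i a b → p :* (i :* a :+ i :* b) := p :* i :* (a :+ b)) ≋-refl (P∞ 𝟙 m m) I A B ⟩
    P∞ 𝟙 m m ∙ I ∙ (A ⊞ B)                      ≈⟨ ≋-trans (∙-cong (∙-inverse (Unit-P∞ 𝟙 m m 0<m)) ≋-refl) (∙-identityˡ _) ⟩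
    A ⊞ B                                       ∎
    where
      I = P∞ 𝟙 m m ⁻¹
      A = ∑ (λ d → q^ (weight a d) ∙ pow ρ d)
      B = ∑ (λ d → q^ (weight b (suc d)) ∙ pow ρ (suc d))
      expanded : P∞ (~ ρ) a m ∙ P∞ (~ ρ) b m ≋ I ∙ A ⊞ I ∙ B
      expanded = ≈-all λ n → ≈-trans (≋⇒≈ (∙-cong (euler a) (euler b))) (≈-trans
        (≈-∙ (∑-limit (suc (suc n)) (s≤s (ℕₚ.n≤1+n n)) (term-small a)) (∑-limit (suc (suc n)) (s≤s (ℕₚ.n≤1+n n)) (term-small b)))
        (≈-trans (≋⇒≈ (square n)) (≈-⊞ (lower n) (upper n))))
        where
          square : ∀ n → Σ< (suc (suc n)) (term a) ∙ Σ< (suc (suc n)) (term b) ≋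
            Σ< (suc (suc n)) (λ d → Σ< (suc (suc n) ∸ d) (λ l → F (d + l) l)) ⊞ Σ< (suc n) (λ d → Σ< (suc n ∸ d) (λ k → F k (suc (d + k))))
          square n = ≋-trans (∙-comm _ _) (≋-trans (Σ-∙ N _ _) (≋-trans (Σ-cong N λ k _ → ≋-trans (∙-comm _ _) (Σ-∙ N (term a k) (term b)))
            (≋-trans (Σ-square N F) (⊞-cong (Σ-diagonal N F)
              (≋-trans (Σ-head (suc n) _) (≋-trans (⊞-identityˡ _) (Σ-diagonal (suc n) (λ l k → F k (suc l)))))))))
            where N = suc (suc n)

pow-of-𝟙 : ∀ n → pow 𝟙 n ≋ 𝟙
pow-of-𝟙 zero    = ≋-refl
pow-of-𝟙 (suc n) = ≋-trans (∙-identityʳ _) (pow-of-𝟙 n)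

Small-monomial : ∀ (e : ℕ → ℕ) → (∀ k → k ≤ e (suc k)) → Small (λ k → q^ (e k))
Small-monomial e le = Small-≋ (λ k → ∙-identityʳ (q^ (e k))) (Small-q^ e (λ _ → 𝟙) le)

∑-interleave : ∀ {G} → Small G → ∑ G ≋ ∑ (λ d → G (d + d)) ⊞ ∑ (λ d → G (suc (d + d)))
∑-interleave {G} s = ≈-all λ n → ≈-trans (∑-limit (suc n + suc n) (m≤m+n (suc n) (suc n)) s) (≈-trans (≋⇒≈ (finite (suc n)))
  (≈-sym (≈-⊞ (∑-limit (suc n) ≤-refl (small λ k → ≈-weaken (m≤m+n k (suc k)) (vanish s (k + suc k))))
              (∑-limit (suc n) ≤-refl (small λ k → ≈-weaken (≤-trans (ℕₚ.n≤1+n k) (m≤m+n (suc k) (suc k))) (vanish s (suc k + suc k)))))))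
  where
    finite : ∀ n → Σ< (n + n) G ≋ Σ< n (λ d → G (d + d)) ⊞ Σ< n (λ d → G (suc (d + d)))
    finite zero    = ≋-sym (⊞-identityˡ 𝟘)
    finite (suc n) = ≋-trans (≋-reflexive (cong (λ i → Σ< i G) (cong suc (ℕₚ.+-suc n n)))) (≋-trans (⊞-cong (⊞-cong (finite n) ≋-refl) ≋-refl)
      (solve 4 (λ a b c d → a :+ b :+ c :+ d := a :+ c :+ (b :+ d)) ≋-refl _ _ _ _))

module Theta (ρ : Series) (ρ² : ρ ∙ ρ ≋ 𝟙) where
  private
    module JTP = TripleProduct 2 1 1 (s≤s z≤n) ≡.refl (s≤s z≤n) ρ ρ²

  θ : Series
  θ = ∑ (λ d → q^ (d * d) ∙ pow ρ d)

  -- Ramanujan's φ(ρ q) as a product; `θ` is the half of its series with nonnegative index.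
  Φ : Series
  Φ = P∞ 𝟙 2 2 ∙ (P∞ (~ ρ) 1 2 ∙ P∞ (~ ρ) 1 2)

  square≥ : ∀ k → k ≤ suc k * suc k
  square≥ k = ≤-trans (ℕₚ.n≤1+n k) (ℕₚ.m≤m*n (suc k) (suc k))

  Φ-θ : Φ ≋ θ ⊞ θ ⊟ 𝟙
  Φ-θ = begin
    Φ                                                          ≈⟨ JTP.tripleProduct ⟩
    _                                                          ≈⟨ ⊞-cong (∑-cong λ d → ∙-cong (q^-cong (T-square d)) ≋-refl) (∑-cong λ d → ∙-cong (q^-cong (T-square (suc d))) ≋-refl) ⟩
    θ ⊞ rest                                                   ≈⟨ solve 2 (λ t r → t :+ r := t :+ (′ 1 :+ r) :- ′ 1) ≋-refl θ rest ⟩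
    θ ⊞ (𝟙 ⊞ rest) ⊟ 𝟙                                         ≈⟨ ⊞-cong (⊞-cong ≋-refl (≋-sym (≋-trans (∑-head (Small-q^ (λ d → d * d) (pow ρ) square≥)) (⊞-cong (≋-trans (∙-identityʳ _) q^-zero) ≋-refl)))) ≋-refl ⟩
    θ ⊞ θ ⊟ 𝟙                                                  ∎
    where rest = ∑ (λ d → q^ (suc d * suc d) ∙ pow ρ (suc d))

  θ-parity : θ ≋ ∑ (λ e → q^ (4 * (e * e))) ⊞ ρ ∙ q^ 1 ∙ ∑ (λ e → q^ (8 * T (suc e)))
  θ-parity = begin
    θ
      ≈⟨ ∑-interleave (Small-q^ (λ d → d * d) (pow ρ) square≥) ⟩
    ∑ (λ e → q^ ((e + e) * (e + e)) ∙ pow ρ (e + e)) ⊞ ∑ (λ e → q^ (suc (e + e) * suc (e + e)) ∙ pow ρ (suc (e + e)))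
      ≈⟨ ⊞-cong (∑-cong λ e → ≋-trans (∙-cong (q^-cong (shuffle e)) (even-power e)) (∙-identityʳ _))
                (∑-cong λ e → ≋-trans (∙-cong (≋-trans (q^-cong (≡.trans (shuffle′ e) (cong (λ x → 1 + 4 * x) (≡.sym (T-double e)) ⟨≡⟩ shuffle″ (T (suc e))))) (q^-+ 1 _)) (∙-cong (even-power e) ≋-refl))
                                       (solve 3 (λ x y r → x :* y :* (′ 1 :* r) := r :* x :* y) ≋-refl (q^ 1) _ ρ)) ⟩
    ∑ (λ e → q^ (4 * (e * e))) ⊞ ∑ (λ e → ρ ∙ q^ 1 ∙ q^ (8 * T (suc e)))
      ≈⟨ ⊞-cong ≋-refl (≋-sym (∑-∙ (ρ ∙ q^ 1) (Small-monomial (λ e → 8 * T (suc e)) λ k → ≤-trans (≤-trans (ℕₚ.n≤1+n k) (m≤n+m (suc k) (T (suc k)))) (m≤m+n _ _)))) ⟩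
    ∑ (λ e → q^ (4 * (e * e))) ⊞ ρ ∙ q^ 1 ∙ ∑ (λ e → q^ (8 * T (suc e))) ∎
    where
      _⟨≡⟩_ : ∀ {x y z : ℕ} → x ≡ y → y ≡ z → x ≡ z
      _⟨≡⟩_ = ≡.trans
      even-power : ∀ e → pow ρ (e + e) ≋ 𝟙
      even-power e = ≋-trans (pow-+ ρ e e) (pow-square ρ² e)
      shuffle : ∀ e → (e + e) * (e + e) ≡ 4 * (e * e)
      shuffle = solve-∀
      shuffle′ : ∀ e → suc (e + e) * suc (e + e) ≡ 1 + 4 * (e * (e + 1))
      shuffle′ = solve-∀
      shuffle″ : ∀ t → 1 + 4 * (2 * t) ≡ 1 + 8 * t
      shuffle″ = solve-∀

open Theta using (Φ)

-- Ramanujan's ψ(q), factored modulo 4 so that the triple product yields the triangular exponents d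
-- (2d + 1) and (d + 1)(2d + 1) on its two sides.
Ψ : Series
Ψ = P∞ 𝟙 4 4 ∙ (P⁺∞ 3 4 ∙ P⁺∞ 1 4)

Ψ-sum : Ψ ≋ ∑ (λ e → q^ (T (suc e)))
Ψ-sum = begin
  Ψ                                                                      ≈⟨ TripleProduct.tripleProduct 4 3 1 (s≤s z≤n) ≡.refl (s≤s z≤n) 𝟙 𝟙² ⟩
  _                                                                      ≈⟨ ⊞-cong (∑-cong λ d → ≋-trans (∙-cong (q^-cong (T-even d)) (pow-of-𝟙 d)) (∙-identityʳ _))
                                                                                   (∑-cong λ d → ≋-trans (∙-cong (q^-cong (T-odd d)) (pow-of-𝟙 (suc d))) (∙-identityʳ _)) ⟩
  ∑ (λ d → q^ (T (suc (d + d)))) ⊞ ∑ (λ d → q^ (T (suc (suc (d + d)))))  ≈⟨ ∑-interleave (Small-monomial (λ e → T (suc e)) λ k → ≤-trans (ℕₚ.n≤1+n k) (m≤n+m (suc k) (T (suc k)))) ⟨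
  ∑ (λ e → q^ (T (suc e)))                                               ∎

dbl²-θ : dbl (dbl (Theta.θ 𝟙 𝟙²)) ≋ ∑ (λ e → q^ (4 * (e * e)))
dbl²-θ = ≋-trans (dbl-cong (dbl-cong (∑-cong λ e → ≋-trans (∙-cong ≋-refl (pow-of-𝟙 e)) (∙-identityʳ _)))) (≋-trans (dbl-cong (dbl-∑ sm)) (≋-trans (dbl-∑ (dbl-Small sm))
  (∑-cong λ e → ≋-trans (dbl-cong (dbl-q^ _)) (≋-trans (dbl-q^ _) (q^-cong (≡.sym (ℕₚ.*-assoc 2 2 (e * e))))))))
  where
    sm : Small (λ e → q^ (e * e))
    sm = Small-monomial (λ e → e * e) (Theta.square≥ 𝟙 𝟙²)

dbl³-Ψ : dbl (dbl (dbl Ψ)) ≋ ∑ (λ e → q^ (8 * T (suc e)))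
dbl³-Ψ = ≋-trans (dbl-cong (dbl-cong (dbl-cong Ψ-sum))) (≋-trans (dbl-cong (dbl-cong (dbl-∑ sm))) (≋-trans (dbl-cong (dbl-∑ (dbl-Small sm))) (≋-trans (dbl-∑ (dbl-Small (dbl-Small sm)))
  (∑-cong λ e → ≋-trans (dbl-cong (≋-trans (dbl-cong (dbl-q^ _)) (dbl-q^ _))) (≋-trans (dbl-q^ _) (q^-cong (shuffle (T (suc e)))))))))
  where
    shuffle : ∀ t → 2 * (2 * (2 * t)) ≡ 8 * t
    shuffle = solve-∀
    sm : Small (λ e → q^ (T (suc e)))
    sm = Small-monomial (λ e → T (suc e)) λ k → ≤-trans (ℕₚ.n≤1+n k) (m≤n+m (suc k) (T (suc k)))

-- A square is 4e² or 1 + 8 T(e + 1). These are the exponents of φ(q⁴) and of q ψ(q⁸).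
Φ-dissection : ∀ ρ ρ² → Φ ρ ρ² ≋ dbl (dbl (Φ 𝟙 𝟙²)) ⊞ two ∙ ρ ∙ q^ 1 ∙ dbl (dbl (dbl Ψ))
Φ-dissection ρ ρ² = begin
  Φ ρ ρ²
    ≈⟨ ≋-trans (Theta.Φ-θ ρ ρ²) (⊞-cong (⊞-cong (Theta.θ-parity ρ ρ²) (Theta.θ-parity ρ ρ²)) ≋-refl) ⟩
  A ⊞ ρ ∙ q^ 1 ∙ B ⊞ (A ⊞ ρ ∙ q^ 1 ∙ B) ⊟ 𝟙
    ≈⟨ solve 4 (λ a r x b → a :+ r :* x :* b :+ (a :+ r :* x :* b) :- ′ 1 := a :+ a :- ′ 1 :+ (′ 1 :+ ′ 1) :* r :* x :* b) ≋-refl A ρ (q^ 1) B ⟩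
  A ⊞ A ⊟ 𝟙 ⊞ two ∙ ρ ∙ q^ 1 ∙ B
    ≈⟨ ⊞-cong (≋-sym (≋-trans (dbl-cong (dbl-cong (Theta.Φ-θ 𝟙 𝟙²))) doubled)) (∙-cong ≋-refl (≋-sym dbl³-Ψ)) ⟩
  dbl (dbl (Φ 𝟙 𝟙²)) ⊞ two ∙ ρ ∙ q^ 1 ∙ dbl (dbl (dbl Ψ)) ∎
  where
    A = ∑ (λ e → q^ (4 * (e * e)))
    B = ∑ (λ e → q^ (8 * T (suc e)))
    t = Theta.θ 𝟙 𝟙²
    doubled : dbl (dbl (t ⊞ t ⊟ 𝟙)) ≋ A ⊞ A ⊟ 𝟙
    doubled = ≋-trans (dbl-cong (≋-trans (dbl-⊞ _ _) (⊞-cong (dbl-⊞ t t) dbl-minus))) (≋-trans (dbl-⊞ _ _)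
      (⊞-cong (≋-trans (dbl-⊞ _ _) (⊞-cong dbl²-θ dbl²-θ)) dbl-minus))

Φ₊ Φ₋ : Series
Φ₊ = Φ 𝟙 𝟙²
Φ₋ = Φ (~ 𝟙) minus²

Φ₊-η : Φ₊ ≐ -[1+ 1 ] ∷ + 5 ∷ -[1+ 1 ] ∷ []
Φ₊-η = 𝐉₂ ⊗ (odd⁺ ⊗ odd⁺)

Φ₋-η : Φ₋ ≐ + 2 ∷ -[1+ 0 ] ∷ []
Φ₋-η = 𝐉₂ ⊗ (odd⁻′ ⊗ odd⁻′)
  where
    odd⁻′ : P∞ (~ ~ 𝟙) 1 2 ≐ + 1 ∷ -[1+ 0 ] ∷ []
    odd⁻′ = ≐-trans (∏-cong λ k → solve 1 (λ q → ′ 1 :- (⊝ (⊝ ′ 1)) :* q := ′ 1 :- ′ 1 :* q) ≋-refl (q^ (1 + 2 * k))) odd⁻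

Ψ-η : Ψ ≐ -[1+ 0 ] ∷ + 2 ∷ + 0 ∷ []
Ψ-η = 𝐉₄ ⊗ ≐-trans (≋-trans (∙-comm _ _) (≋-sym (P∞-split (~ 𝟙) 1 2 (s≤s z≤n)))) odd⁺

-- Dissections of eta quotients

half : Series
half = K (+ 1 / 2)

half-two : half ∙ two ≋ 𝟙
half-two = ≋-trans (∙-cong ≋-refl (solve 0 (′ 1 :+ ′ 1 := ′ 2) ≋-refl)) (≋-sym (K-* (+ 1 / 2) (ℤtoℚ (+ 2))))

private
  a b : Series
  a = dbl (dbl Φ₊)
  b = dbl (dbl (dbl Ψ))

  Φ₊-ab : Φ₊ ≋ a ⊞ two ∙ q^ 1 ∙ b
  Φ₊-ab = ≋-trans (Φ-dissection 𝟙 𝟙²) (solve 3 (λ a x b → a :+ (′ 1 :+ ′ 1) :* ′ 1 :* x :* b := a :+ (′ 1 :+ ′ 1) :* x :* b) ≋-refl a (q^ 1) b)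

  Φ₋-ab : Φ₋ ≋ a ⊟ two ∙ q^ 1 ∙ b
  Φ₋-ab = ≋-trans (Φ-dissection (~ 𝟙) minus²) (solve 3 (λ a x b → a :+ (′ 1 :+ ′ 1) :* (⊝ ′ 1) :* x :* b := a :- (′ 1 :+ ′ 1) :* x :* b) ≋-refl a (q^ 1) b)

Φ-sum : half ∙ (Φ₊ ⊞ Φ₋) ≋ dbl (dbl Φ₊)
Φ-sum = begin
  half ∙ (Φ₊ ⊞ Φ₋)                                       ≈⟨ ∙-cong ≋-refl (⊞-cong Φ₊-ab Φ₋-ab) ⟩
  half ∙ (a ⊞ two ∙ q^ 1 ∙ b ⊞ (a ⊟ two ∙ q^ 1 ∙ b))     ≈⟨ solve 4 (λ h a x b → h :* (a :+ (′ 1 :+ ′ 1) :* x :* b :+ (a :- (′ 1 :+ ′ 1) :* x :* b)) := h :* (′ 1 :+ ′ 1) :* a) ≋-refl half a (q^ 1) b ⟩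
  half ∙ two ∙ a                                         ≈⟨ ≋-trans (∙-cong half-two ≋-refl) (∙-identityˡ a) ⟩
  a                                                      ∎

Φ-difference : half ∙ (Φ₊ ⊟ Φ₋) ≋ two ∙ q^ 1 ∙ dbl (dbl (dbl Ψ))
Φ-difference = begin
  half ∙ (Φ₊ ⊟ Φ₋)                                       ≈⟨ ∙-cong ≋-refl (⊞-cong Φ₊-ab (~-cong Φ₋-ab)) ⟩
  half ∙ (a ⊞ two ∙ q^ 1 ∙ b ⊟ (a ⊟ two ∙ q^ 1 ∙ b))     ≈⟨ solve 4 (λ h a x b → h :* (a :+ (′ 1 :+ ′ 1) :* x :* b :- (a :- (′ 1 :+ ′ 1) :* x :* b)) := h :* (′ 1 :+ ′ 1) :* ((′ 1 :+ ′ 1) :* x :* b)) ≋-refl half a (q^ 1) b ⟩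
  half ∙ two ∙ (two ∙ q^ 1 ∙ b)                          ≈⟨ ≋-trans (∙-cong half-two ≋-refl) (∙-identityˡ _) ⟩
  two ∙ q^ 1 ∙ b                                         ∎

-- φ(q)φ(-q) = φ(-q²)² turns the dissection of φ into that of φ(-q)², and then φ(q)ψ(q²) = ψ(q)² into that of φ(q)².
Φ₋² : Φ₋ ∙ Φ₋ ≋ dbl Φ₊ ∙ dbl Φ₊ ⊟ # (+ 4) ∙ q^ 1 ∙ (dbl (dbl Ψ) ∙ dbl (dbl Ψ))
Φ₋² = dbl-injective (≋-sym (begin
  dbl (dbl Φ₊ ∙ dbl Φ₊ ⊟ # (+ 4) ∙ q^ 1 ∙ (dbl (dbl Ψ) ∙ dbl (dbl Ψ)))
    ≈⟨ ≋-trans (dbl-⊞ _ _) (⊞-cong (dbl-∙ _ _) (≋-trans (dbl-~ _) (~-cong (≋-trans (dbl-∙ _ _) (∙-cong (≋-trans (dbl-∙ _ _) (∙-cong (dbl-K _) (≋-trans (dbl-q^ 1) (q^-+ 1 1)))) (dbl-∙ _ _)))))) ⟩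
  a ∙ a ⊟ # (+ 4) ∙ (q^ 1 ∙ q^ 1) ∙ (b ∙ b)
    ≈⟨ solve 3 (λ a x b → a :* a :- ′ 4 :* (x :* x) :* (b :* b) := (a :+ (′ 1 :+ ′ 1) :* x :* b) :* (a :- (′ 1 :+ ′ 1) :* x :* b)) ≋-refl a (q^ 1) b ⟩
  (a ⊞ two ∙ q^ 1 ∙ b) ∙ (a ⊟ two ∙ q^ 1 ∙ b)
    ≈⟨ ∙-cong (≋-sym Φ₊-ab) (≋-sym Φ₋-ab) ⟩
  Φ₊ ∙ Φ₋
    ≈⟨ ≐-unique (Φ₊-η ⊗ Φ₋-η) (≐-dbl (Φ₋-η ⊗ Φ₋-η) ⊗ ≐-η (+ 0 ∷ + 0 ∷ + 0 ∷ [])) ⟩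
  dbl (Φ₋ ∙ Φ₋) ∙ η (+ 0 ∷ + 0 ∷ + 0 ∷ [])
    ≈⟨ ≋-trans (∙-cong ≋-refl (η-zeros 3)) (∙-identityʳ _) ⟩
  dbl (Φ₋ ∙ Φ₋) ∎))

Φ₊² : Φ₊ ∙ Φ₊ ≋ dbl Φ₊ ∙ dbl Φ₊ ⊞ # (+ 4) ∙ q^ 1 ∙ (dbl (dbl Ψ) ∙ dbl (dbl Ψ))
Φ₊² = begin
  Φ₊ ∙ Φ₊
    ≈⟨ ∙-cong Φ₊-ab Φ₊-ab ⟩
  (a ⊞ two ∙ q^ 1 ∙ b) ∙ (a ⊞ two ∙ q^ 1 ∙ b)
    ≈⟨ solve 3 (λ a x b → (a :+ (′ 1 :+ ′ 1) :* x :* b) :* (a :+ (′ 1 :+ ′ 1) :* x :* b) := (a :- (′ 1 :+ ′ 1) :* x :* b) :* (a :- (′ 1 :+ ′ 1) :* x :* b) :+ ′ 8 :* x :* (a :* b)) ≋-refl a (q^ 1) b ⟩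
  (a ⊟ two ∙ q^ 1 ∙ b) ∙ (a ⊟ two ∙ q^ 1 ∙ b) ⊞ # (+ 8) ∙ q^ 1 ∙ (a ∙ b)
    ≈⟨ ⊞-cong (≋-trans (∙-cong (≋-sym Φ₋-ab) (≋-sym Φ₋-ab)) Φ₋²) (∙-cong ≋-refl ab) ⟩
  dbl Φ₊ ∙ dbl Φ₊ ⊟ # (+ 4) ∙ q^ 1 ∙ c² ⊞ # (+ 8) ∙ q^ 1 ∙ c²
    ≈⟨ solve 3 (λ f x c → f :- ′ 4 :* x :* c :+ ′ 8 :* x :* c := f :+ ′ 4 :* x :* c) ≋-refl (dbl Φ₊ ∙ dbl Φ₊) (q^ 1) c² ⟩
  dbl Φ₊ ∙ dbl Φ₊ ⊞ # (+ 4) ∙ q^ 1 ∙ c² ∎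
  where
    c² = dbl (dbl Ψ) ∙ dbl (dbl Ψ)
    ab : a ∙ b ≋ c²
    ab = ≐-unique (≐-dbl (≐-dbl Φ₊-η) ⊗ ≐-dbl (≐-dbl (≐-dbl Ψ-η))) (≐-pad 1 (≐-dbl (≐-dbl Ψ-η) ⊗ ≐-dbl (≐-dbl Ψ-η)))

infix 20 −_
−_ : ℕ → ℤ
− n = ℤ.- (+ n)

-- Since φ(q) = J₂⁵/(J₁² J₄²), the powers are J₁⁻² = φ(q) J₄²/J₂⁵ and J₁⁻⁴ = φ(q)² J₄⁴/J₂¹⁰. The
-- lists are the even and odd parts after dissecting φ(q) and φ(q)², with q² replaced by q.
U₂ V₂ U₄ V₄ : List ℤ
U₂ = − 5 ∷ + 0 ∷ + 5 ∷ − 2 ∷ []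
V₂ = − 5 ∷ + 2 ∷ − 1 ∷ + 2 ∷ + 0 ∷ []
U₄ = − 14 ∷ + 14 ∷ − 4 ∷ []
V₄ = − 10 ∷ + 2 ∷ + 4 ∷ + 0 ∷ []

J₁⁻² : ∀ es → η (− 2 ∷ es) ≋ dbl (η U₂ ∙ η es) ⊞ q^ 1 ∙ (two ∙ dbl (η V₂ ∙ η es))
J₁⁻² es = begin
  zpow (𝐉 1) (− 2) ∙ dbl (η es)
    ≈⟨ ∙-cong split ≋-refl ⟩
  (dbl (η U₂) ⊞ q^ 1 ∙ (two ∙ dbl (η V₂))) ∙ dbl (η es)
    ≈⟨ solve 5 (λ u x t v e → (u :+ x :* (t :* v)) :* e := u :* e :+ x :* (t :* (v :* e))) ≋-refl (dbl (η U₂)) (q^ 1) two (dbl (η V₂)) (dbl (η es)) ⟩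
  dbl (η U₂) ∙ dbl (η es) ⊞ q^ 1 ∙ (two ∙ (dbl (η V₂) ∙ dbl (η es)))
    ≈⟨ ⊞-cong (≋-sym (dbl-∙ _ _)) (∙-cong ≋-refl (∙-cong ≋-refl (≋-sym (dbl-∙ _ _)))) ⟩
  dbl (η U₂ ∙ η es) ⊞ q^ 1 ∙ (two ∙ dbl (η V₂ ∙ η es)) ∎
  where
    r : Series
    r = η (+ 0 ∷ − 5 ∷ + 2 ∷ [])
    r-η : r ≐ + 0 ∷ − 5 ∷ + 2 ∷ []
    r-η = isη ≋-refl
    inverse-square : zpow (𝐉 1) (− 2) ≐ − 2 ∷ []
    inverse-square = isη (≋-trans (≋-sym (∙-identityʳ _)) (∙-cong ≋-refl (≋-sym dbl-𝟙)))
    split : zpow (𝐉 1) (− 2) ≋ dbl (η U₂) ⊞ q^ 1 ∙ (two ∙ dbl (η V₂))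
    split = begin
      zpow (𝐉 1) (− 2)                       ≈⟨ ≐-unique (≐-pad 2 inverse-square) (Φ₊-η ⊗ r-η) ⟩
      Φ₊ ∙ r                                 ≈⟨ ∙-cong Φ₊-ab ≋-refl ⟩
      (a ⊞ two ∙ q^ 1 ∙ b) ∙ r               ≈⟨ solve 5 (λ a t x b r → (a :+ t :* x :* b) :* r := a :* r :+ x :* (t :* (b :* r))) ≋-refl a two (q^ 1) b r ⟩
      a ∙ r ⊞ q^ 1 ∙ (two ∙ (b ∙ r))         ≈⟨ ⊞-cong (≐-unique (≐-dbl (≐-dbl Φ₊-η) ⊗ r-η) (≐-dbl (≐-η U₂)))
                                                       (∙-cong ≋-refl (∙-cong ≋-refl (≐-unique (≐-dbl (≐-dbl (≐-dbl Ψ-η)) ⊗ r-η) (≐-dbl (≐-η V₂))))) ⟩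
      dbl (η U₂) ⊞ q^ 1 ∙ (two ∙ dbl (η V₂))   ∎

J₁⁻⁴ : ∀ es → η (− 4 ∷ es) ≋ dbl (η U₄ ∙ η es) ⊞ q^ 1 ∙ (# (+ 4) ∙ dbl (η V₄ ∙ η es))
J₁⁻⁴ es = begin
  zpow (𝐉 1) (− 4) ∙ dbl (η es)
    ≈⟨ ∙-cong split ≋-refl ⟩
  (dbl (η U₄) ⊞ q^ 1 ∙ (# (+ 4) ∙ dbl (η V₄))) ∙ dbl (η es)
    ≈⟨ solve 4 (λ u x v e → (u :+ x :* (′ 4 :* v)) :* e := u :* e :+ x :* (′ 4 :* (v :* e))) ≋-refl (dbl (η U₄)) (q^ 1) (dbl (η V₄)) (dbl (η es)) ⟩
  dbl (η U₄) ∙ dbl (η es) ⊞ q^ 1 ∙ (# (+ 4) ∙ (dbl (η V₄) ∙ dbl (η es)))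
    ≈⟨ ⊞-cong (≋-sym (dbl-∙ _ _)) (∙-cong ≋-refl (∙-cong ≋-refl (≋-sym (dbl-∙ _ _)))) ⟩
  dbl (η U₄ ∙ η es) ⊞ q^ 1 ∙ (# (+ 4) ∙ dbl (η V₄ ∙ η es)) ∎
  where
    r : Series
    r = η (+ 0 ∷ − 10 ∷ + 4 ∷ [])
    r-η : r ≐ + 0 ∷ − 10 ∷ + 4 ∷ []
    r-η = isη ≋-refl
    inverse-fourth : zpow (𝐉 1) (− 4) ≐ − 4 ∷ []
    inverse-fourth = isη (≋-trans (≋-sym (∙-identityʳ _)) (∙-cong ≋-refl (≋-sym dbl-𝟙)))
    split : zpow (𝐉 1) (− 4) ≋ dbl (η U₄) ⊞ q^ 1 ∙ (# (+ 4) ∙ dbl (η V₄))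
    split = begin
      zpow (𝐉 1) (− 4)                       ≈⟨ ≐-unique (≐-pad 2 inverse-fourth) (Φ₊-η ⊗ Φ₊-η ⊗ r-η) ⟩
      Φ₊ ∙ Φ₊ ∙ r                            ≈⟨ ∙-cong Φ₊² ≋-refl ⟩
      (dbl Φ₊ ∙ dbl Φ₊ ⊞ # (+ 4) ∙ q^ 1 ∙ (dbl (dbl Ψ) ∙ dbl (dbl Ψ))) ∙ r
        ≈⟨ solve 4 (λ a x b r → (a :+ ′ 4 :* x :* b) :* r := a :* r :+ x :* (′ 4 :* (b :* r))) ≋-refl (dbl Φ₊ ∙ dbl Φ₊) (q^ 1) (dbl (dbl Ψ) ∙ dbl (dbl Ψ)) r ⟩
      dbl Φ₊ ∙ dbl Φ₊ ∙ r ⊞ q^ 1 ∙ (# (+ 4) ∙ (dbl (dbl Ψ) ∙ dbl (dbl Ψ) ∙ r))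
        ≈⟨ ⊞-cong (≐-unique (≐-dbl Φ₊-η ⊗ ≐-dbl Φ₊-η ⊗ r-η) (≐-dbl (≐-η U₄)))
                  (∙-cong ≋-refl (∙-cong ≋-refl (≐-unique (≐-dbl (≐-dbl Ψ-η) ⊗ ≐-dbl (≐-dbl Ψ-η) ⊗ r-η) (≐-dbl (≐-η V₄))))) ⟩
      dbl (η U₄) ⊞ q^ 1 ∙ (# (+ 4) ∙ dbl (η V₄)) ∎

dissect₂ : ∀ es → η (− 2 ∷ es) ≋ dbl (η (U₂ ⊹ es)) ⊞ q^ 1 ∙ (two ∙ dbl (η (V₂ ⊹ es)))
dissect₂ es = ≋-trans (J₁⁻² es) (⊞-cong (dbl-cong (η-∙ U₂ es)) (∙-cong ≋-refl (∙-cong ≋-refl (dbl-cong (η-∙ V₂ es)))))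

dissect₄ : ∀ es → η (− 4 ∷ es) ≋ dbl (η (U₄ ⊹ es)) ⊞ q^ 1 ∙ (# (+ 4) ∙ dbl (η (V₄ ⊹ es)))
dissect₄ es = ≋-trans (J₁⁻⁴ es) (⊞-cong (dbl-cong (η-∙ U₄ es)) (∙-cong ≋-refl (∙-cong ≋-refl (dbl-cong (η-∙ V₄ es)))))

opaque
  unfolding _⊞_
  -- Parts of f read off from q f: the formulas for rank 2 carry q⁻¹, and multiplication by q keeps
  -- them among power series.
  even-part′ : ∀ {f} e z → q^ 1 ∙ f ≋ q^ 1 ∙ dbl e ⊞ dbl z → Even f ≋ e
  even-part′ {f} e z p = pw λ n → ≡.trans (≡.sym (q^-at 1 f (2 * n))) (≡.trans (at p (suc (2 * n)))
    (≡.trans (cong₂ ℚ._+_ (≡.trans (q^-at 1 (dbl e) (2 * n)) (dbl-even e n)) (dbl-odd z n)) (ℚₚ.+-identityʳ (e n))))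

  odd-part′ : ∀ {f} e z → q^ 1 ∙ f ≋ q^ 1 ∙ dbl e ⊞ dbl z → q^ 1 ∙ Odd f ≋ z
  odd-part′ {f} e z p = pw λ
    { zero    → ≡.trans (q^-low 1 (Odd f) 0 (s≤s z≤n)) (≡.trans (≡.sym (q^-low 1 f 0 (s≤s z≤n))) (≡.trans (at p 0)
                  (≡.trans (cong (ℚ._+ z 0) (q^-low 1 (dbl e) 0 (s≤s z≤n))) (ℚₚ.+-identityˡ (z 0)))))
    ; (suc n) → ≡.trans (q^-at 1 (Odd f) n) (≡.trans (≡.sym (q^-at 1 f (suc (2 * n)))) (≡.trans (at p (suc (suc (2 * n))))
                  (≡.trans (cong₂ ℚ._+_ (≡.trans (q^-at 1 (dbl e) (suc (2 * n))) (dbl-odd e n)) (dbl-even (tail z) n)) (ℚₚ.+-identityˡ (z (suc n)))))) }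

-- The three generating functions

Ω₊ Ω₋ Λ₊ Λ₋ Λ₃ G₀ G₂ : Series
Ω₊ = Ω two
Ω₋ = Ω (~ two)
Λ₊ = η (− 4 ∷ + 8 ∷ − 5 ∷ + 2 ∷ [])
Λ₋ = η (+ 0 ∷ − 2 ∷ + 3 ∷ [])
Λ₃ = η (− 4 ∷ + 6 ∷ + 1 ∷ − 2 ∷ [])
G₀ = half ∙ (M₊ ⊞ M₋)
G₂ = half ∙ (M₊ ⊟ M₋)

private
  E₀ E₁ B₂ : Series
  E₀  = η (− 4 ∷ + 4 ∷ − 2 ∷ + 5 ∷ − 2 ∷ [])
  E₁ = η (− 4 ∷ + 4 ∷ + 0 ∷ − 1 ∷ + 2 ∷ + 0 ∷ [])
  B₂  = η (− 2 ∷ − 3 ∷ + 6 ∷ + 0 ∷ [])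

move : ∀ {x y z} → x ⊞ y ≋ z → x ≋ z ⊟ y
move {x} {y} {z} p = ≋-trans (solve 2 (λ x y → x := x :+ y :- y) ≋-refl x y) (⊞-cong p ≋-refl)

M₊≋ : M₊ ≋ Λ₊ ⊟ q^ 1 ∙ dbl Ω₋
M₊≋ = move (eta M₊-equation)

M₋≋ : M₋ ≋ Λ₋ ⊟ q^ 1 ∙ dbl Ω₊
M₋≋ = move (eta M₋-equation)

H≋ : H ≋ K quarter ∙ Λ₃ ⊟ dbl (dbl 𝔽)
H≋ = move H-equation

private
  half-4 : half ∙ # (+ 4) ≋ two
  half-4 = ≋-trans (∙-cong ≋-refl (solve 0 (′ 4 := (′ 1 :+ ′ 1) :* (′ 1 :+ ′ 1)) ≋-refl)) (≋-trans (≋-sym (∙-assoc _ _ _)) (≋-trans (∙-cong half-two ≋-refl) (∙-identityˡ two)))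

  quarter-4 : K quarter ∙ # (+ 4) ≋ 𝟙
  quarter-4 = ≋-sym (K-* quarter (ℤtoℚ (+ 4)))

  dbl-two∙ : ∀ f → two ∙ dbl f ≋ dbl (two ∙ f)
  dbl-two∙ f = ≋-sym (≋-trans (dbl-∙ _ _) (∙-cong dbl-two ≋-refl))

  dbl-#∙ : ∀ i f → # i ∙ dbl f ≋ dbl (# i ∙ f)
  dbl-#∙ i f = ≋-sym (≋-trans (dbl-∙ _ _) (∙-cong (dbl-K _) ≋-refl))

  q²-dbl : ∀ f → q^ 1 ∙ (q^ 1 ∙ dbl f) ≋ dbl (q^ 1 ∙ f)
  q²-dbl f = ≋-trans (≋-sym (∙-assoc _ _ _)) (≋-trans (∙-cong (≋-trans (≋-sym (q^-+ 1 1)) (≋-sym (dbl-q^ 1))) ≋-refl) (≋-sym (dbl-∙ _ _)))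

  dbl-⊟ : ∀ f g → dbl (f ⊟ g) ≋ dbl f ⊟ dbl g
  dbl-⊟ f g = ≋-trans (dbl-⊞ _ _) (⊞-cong ≋-refl (dbl-~ g))

  Λ₊-parts : Λ₊ ≋ dbl (η (− 6 ∷ + 9 ∷ − 2 ∷ [])) ⊞ q^ 1 ∙ (# (+ 4) ∙ dbl B₂)
  Λ₊-parts = dissect₄ (+ 8 ∷ − 5 ∷ + 2 ∷ [])

  -- The two quotients share the factor J₂⁴/J₁⁴ and leave φ(q) and φ(-q), so their half sum and half
  -- difference are read off from the dissection of φ.
  Φ-pair : (η (− 6 ∷ + 9 ∷ − 2 ∷ []) ≋ Φ₊ ∙ η (− 4 ∷ + 4 ∷ [])) × (η (− 2 ∷ + 3 ∷ []) ≋ Φ₋ ∙ η (− 4 ∷ + 4 ∷ []))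
  Φ-pair = ≐-unique (≐-η (− 6 ∷ + 9 ∷ − 2 ∷ [])) (Φ₊-η ⊗ ≐-η (− 4 ∷ + 4 ∷ [])) , ≐-unique (≐-η (− 2 ∷ + 3 ∷ [])) (Φ₋-η ⊗ ≐-η (− 4 ∷ + 4 ∷ []))

  E-sum : half ∙ (η (− 6 ∷ + 9 ∷ − 2 ∷ []) ⊞ η (− 2 ∷ + 3 ∷ [])) ≋ E₀
  E-sum = begin
    half ∙ (η (− 6 ∷ + 9 ∷ − 2 ∷ []) ⊞ η (− 2 ∷ + 3 ∷ []))  ≈⟨ ∙-cong ≋-refl (⊞-cong (proj₁ Φ-pair) (proj₂ Φ-pair)) ⟩
    half ∙ (Φ₊ ∙ r ⊞ Φ₋ ∙ r)                                 ≈⟨ solve 4 (λ h x y r → h :* (x :* r :+ y :* r) := h :* (x :+ y) :* r) ≋-refl half Φ₊ Φ₋ r ⟩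
    half ∙ (Φ₊ ⊞ Φ₋) ∙ r                                     ≈⟨ ∙-cong Φ-sum ≋-refl ⟩
    dbl (dbl Φ₊) ∙ r                                         ≈⟨ eta (≐-dbl (≐-dbl Φ₊-η) ⊗ ≐-η (− 4 ∷ + 4 ∷ [])) ⟩
    E₀                                                        ∎
    where r = η (− 4 ∷ + 4 ∷ [])

  E-difference : half ∙ (η (− 6 ∷ + 9 ∷ − 2 ∷ []) ⊟ η (− 2 ∷ + 3 ∷ [])) ≋ two ∙ q^ 1 ∙ E₁
  E-difference = begin
    half ∙ (η (− 6 ∷ + 9 ∷ − 2 ∷ []) ⊟ η (− 2 ∷ + 3 ∷ []))  ≈⟨ ∙-cong ≋-refl (⊞-cong (proj₁ Φ-pair) (~-cong (proj₂ Φ-pair))) ⟩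
    half ∙ (Φ₊ ∙ r ⊟ Φ₋ ∙ r)                                 ≈⟨ solve 4 (λ h x y r → h :* (x :* r :- y :* r) := h :* (x :- y) :* r) ≋-refl half Φ₊ Φ₋ r ⟩
    half ∙ (Φ₊ ⊟ Φ₋) ∙ r                                     ≈⟨ ∙-cong Φ-difference ≋-refl ⟩
    two ∙ q^ 1 ∙ dbl (dbl (dbl Ψ)) ∙ r                       ≈⟨ ≋-trans (∙-assoc _ _ _) (∙-cong ≋-refl (eta (≐-dbl (≐-dbl (≐-dbl Ψ-η)) ⊗ ≐-η (− 4 ∷ + 4 ∷ [])))) ⟩
    two ∙ q^ 1 ∙ E₁                                          ∎
    where r = η (− 4 ∷ + 4 ∷ [])

  Λ-sum : half ∙ (Λ₊ ⊞ Λ₋) ≋ dbl E₀ ⊞ q^ 1 ∙ dbl (two ∙ B₂)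
  Λ-sum = begin
    half ∙ (Λ₊ ⊞ Λ₋)
      ≈⟨ ∙-cong ≋-refl (⊞-cong Λ₊-parts (≋-sym (η-dbl (− 2 ∷ + 3 ∷ [])))) ⟩
    half ∙ (dbl u ⊞ q^ 1 ∙ (# (+ 4) ∙ dbl B₂) ⊞ dbl v)
      ≈⟨ solve 5 (λ h u x b v → h :* (u :+ x :* (′ 4 :* b) :+ v) := h :* (u :+ v) :+ x :* (h :* ′ 4 :* b)) ≋-refl half (dbl u) (q^ 1) (dbl B₂) (dbl v) ⟩
    half ∙ (dbl u ⊞ dbl v) ⊞ q^ 1 ∙ (half ∙ # (+ 4) ∙ dbl B₂)
      ≈⟨ ⊞-cong (≋-sym (≋-trans (dbl-∙ _ _) (∙-cong (dbl-K _) (dbl-⊞ _ _)))) (∙-cong ≋-refl (≋-trans (∙-cong half-4 ≋-refl) (dbl-two∙ B₂))) ⟩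
    dbl (half ∙ (u ⊞ v)) ⊞ q^ 1 ∙ dbl (two ∙ B₂)
      ≈⟨ ⊞-cong (dbl-cong E-sum) ≋-refl ⟩
    dbl E₀ ⊞ q^ 1 ∙ dbl (two ∙ B₂) ∎
    where
      u = η (− 6 ∷ + 9 ∷ − 2 ∷ [])
      v = η (− 2 ∷ + 3 ∷ [])

  Λ-difference : half ∙ (Λ₊ ⊟ Λ₋) ≋ dbl (two ∙ q^ 1 ∙ E₁) ⊞ q^ 1 ∙ dbl (two ∙ B₂)
  Λ-difference = begin
    half ∙ (Λ₊ ⊟ Λ₋)
      ≈⟨ ∙-cong ≋-refl (⊞-cong Λ₊-parts (~-cong (≋-sym (η-dbl (− 2 ∷ + 3 ∷ []))))) ⟩
    half ∙ (dbl u ⊞ q^ 1 ∙ (# (+ 4) ∙ dbl B₂) ⊟ dbl v)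
      ≈⟨ solve 5 (λ h u x b v → h :* (u :+ x :* (′ 4 :* b) :- v) := h :* (u :- v) :+ x :* (h :* ′ 4 :* b)) ≋-refl half (dbl u) (q^ 1) (dbl B₂) (dbl v) ⟩
    half ∙ (dbl u ⊟ dbl v) ⊞ q^ 1 ∙ (half ∙ # (+ 4) ∙ dbl B₂)
      ≈⟨ ⊞-cong (≋-sym (≋-trans (dbl-∙ _ _) (∙-cong (dbl-K _) (dbl-⊟ _ _)))) (∙-cong ≋-refl (≋-trans (∙-cong half-4 ≋-refl) (dbl-two∙ B₂))) ⟩
    dbl (half ∙ (u ⊟ v)) ⊞ q^ 1 ∙ dbl (two ∙ B₂)
      ≈⟨ ⊞-cong (dbl-cong E-difference) ≋-refl ⟩
    dbl (two ∙ q^ 1 ∙ E₁) ⊞ q^ 1 ∙ dbl (two ∙ B₂) ∎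
    where
      u = η (− 6 ∷ + 9 ∷ − 2 ∷ [])
      v = η (− 2 ∷ + 3 ∷ [])

  G₀-M₊ : G₀ ≋ half ∙ (Λ₊ ⊞ Λ₋) ⊟ q^ 1 ∙ dbl (dbl M₊)
  G₀-M₊ = begin
    half ∙ (M₊ ⊞ M₋)
      ≈⟨ ∙-cong ≋-refl (⊞-cong M₊≋ M₋≋) ⟩
    half ∙ (Λ₊ ⊟ q^ 1 ∙ dbl Ω₋ ⊞ (Λ₋ ⊟ q^ 1 ∙ dbl Ω₊))
      ≈⟨ solve 6 (λ h l x o m p → h :* (l :- x :* o :+ (m :- x :* p)) := h :* (l :+ m) :- x :* (h :* (p :+ o))) ≋-refl half Λ₊ (q^ 1) (dbl Ω₋) Λ₋ (dbl Ω₊) ⟩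
    half ∙ (Λ₊ ⊞ Λ₋) ⊟ q^ 1 ∙ (half ∙ (dbl Ω₊ ⊞ dbl Ω₋))
      ≈⟨ ⊞-cong ≋-refl (~-cong (∙-cong ≋-refl (≋-trans (∙-cong ≋-refl (≋-trans (≋-sym (dbl-⊞ _ _)) (≋-trans (dbl-cong (≋-sym dbl-M₊)) (≋-sym (dbl-two∙ _)))))
           (≋-trans (≋-sym (∙-assoc _ _ _)) (≋-trans (∙-cong half-two ≋-refl) (∙-identityˡ _)))))) ⟩
    half ∙ (Λ₊ ⊞ Λ₋) ⊟ q^ 1 ∙ dbl (dbl M₊) ∎

  dbl-M₊≋ : dbl M₊ ≋ dbl Λ₊ ⊟ q^ 2 ∙ dbl (dbl Ω₋)
  dbl-M₊≋ = ≋-trans (dbl-cong M₊≋) (≋-trans (dbl-⊟ _ _) (⊞-cong ≋-refl (~-cong (≋-trans (dbl-∙ _ _) (∙-cong (dbl-q^ 1) ≋-refl)))))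

G₀-2-1 : G₀ ≋ q^ 5 ∙ dbl (dbl (dbl Ω₋)) ⊟ q^ 1 ∙ dbl (dbl Λ₊) ⊞ half ∙ (Λ₊ ⊞ Λ₋)
G₀-2-1 = begin
  G₀
    ≈⟨ ≋-trans G₀-M₊ (⊞-cong ≋-refl (~-cong (∙-cong ≋-refl (≋-trans (dbl-cong dbl-M₊≋) (≋-trans (dbl-⊟ _ _) (⊞-cong ≋-refl (~-cong (≋-trans (dbl-∙ _ _) (∙-cong (dbl-q^ 2) ≋-refl))))))))) ⟩
  half ∙ (Λ₊ ⊞ Λ₋) ⊟ q^ 1 ∙ (dbl (dbl Λ₊) ⊟ q^ 4 ∙ dbl (dbl (dbl Ω₋)))
    ≈⟨ solve 5 (λ s x l y o → s :- x :* (l :- y :* o) := x :* y :* o :- x :* l :+ s) ≋-refl (half ∙ (Λ₊ ⊞ Λ₋)) (q^ 1) (dbl (dbl Λ₊)) (q^ 4) (dbl (dbl (dbl Ω₋))) ⟩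
  q^ 1 ∙ q^ 4 ∙ dbl (dbl (dbl Ω₋)) ⊟ q^ 1 ∙ dbl (dbl Λ₊) ⊞ half ∙ (Λ₊ ⊞ Λ₋)
    ≈⟨ ⊞-cong (⊞-cong (∙-cong (≋-sym (q^-+ 1 4)) ≋-refl) ≋-refl) ≋-refl ⟩
  q^ 5 ∙ dbl (dbl (dbl Ω₋)) ⊟ q^ 1 ∙ dbl (dbl Λ₊) ⊞ half ∙ (Λ₊ ⊞ Λ₋) ∎

private
  G₀-parts : G₀ ≋ dbl E₀ ⊞ q^ 1 ∙ dbl (two ∙ B₂ ⊟ dbl M₊)
  G₀-parts = begin
    G₀                                                           ≈⟨ ≋-trans G₀-M₊ (⊞-cong Λ-sum ≋-refl) ⟩
    dbl E₀ ⊞ q^ 1 ∙ dbl (two ∙ B₂) ⊟ q^ 1 ∙ dbl (dbl M₊)           ≈⟨ solve 4 (λ e x b m → e :+ x :* b :- x :* m := e :+ x :* (b :- m)) ≋-refl (dbl E₀) (q^ 1) (dbl (two ∙ B₂)) (dbl (dbl M₊)) ⟩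
    dbl E₀ ⊞ q^ 1 ∙ (dbl (two ∙ B₂) ⊟ dbl (dbl M₊))                ≈⟨ ⊞-cong ≋-refl (∙-cong ≋-refl (≋-sym (dbl-⊟ _ _))) ⟩
    dbl E₀ ⊞ q^ 1 ∙ dbl (two ∙ B₂ ⊟ dbl M₊)                        ∎

G₀-4-1 : Even G₀ ≋ E₀
G₀-4-1 = even-part E₀ (two ∙ B₂ ⊟ dbl M₊) G₀-parts

private
  G₀-odd : Odd G₀ ≋ two ∙ B₂ ⊟ dbl M₊
  G₀-odd = odd-part E₀ (two ∙ B₂ ⊟ dbl M₊) G₀-parts

G₀-4-3 : Odd G₀ ≋ q^ 2 ∙ dbl (dbl Ω₋) ⊟ dbl Λ₊ ⊞ two ∙ B₂
G₀-4-3 = ≋-trans G₀-odd (≋-trans (⊞-cong ≋-refl (~-cong dbl-M₊≋))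
  (solve 4 (λ b l x o → b :- (l :- x :* o) := x :* o :- l :+ b) ≋-refl (two ∙ B₂) (dbl Λ₊) (q^ 2) (dbl (dbl Ω₋))))

private
  E-parts : Even G₀ ≋ dbl (η (− 10 ∷ + 12 ∷ + 1 ∷ − 2 ∷ [])) ⊞ q^ 1 ∙ dbl (# (+ 4) ∙ η (− 6 ∷ + 0 ∷ + 9 ∷ − 2 ∷ []))
  E-parts = ≋-trans G₀-4-1 (≋-trans (dissect₄ (+ 4 ∷ − 2 ∷ + 5 ∷ − 2 ∷ [])) (⊞-cong ≋-refl (∙-cong ≋-refl (dbl-#∙ (+ 4) _))))

G₀-8-1 : Even (Even G₀) ≋ η (− 10 ∷ + 12 ∷ + 1 ∷ − 2 ∷ [])
G₀-8-1 = even-part _ (# (+ 4) ∙ η (− 6 ∷ + 0 ∷ + 9 ∷ − 2 ∷ [])) E-parts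

G₀-8-5 : Odd (Even G₀) ≋ # (+ 4) ∙ η (− 6 ∷ + 0 ∷ + 9 ∷ − 2 ∷ [])
G₀-8-5 = odd-part (η (− 10 ∷ + 12 ∷ + 1 ∷ − 2 ∷ [])) _ E-parts

private
  B₀ B₁ : Series
  B₀ = η (− 8 ∷ + 6 ∷ + 5 ∷ − 2 ∷ [])
  B₁ = η (− 8 ∷ + 8 ∷ − 1 ∷ + 2 ∷ + 0 ∷ [])

  B-parts : two ∙ B₂ ≋ dbl (two ∙ B₀) ⊞ q^ 1 ∙ dbl (# (+ 4) ∙ B₁)
  B-parts = begin
    two ∙ B₂                                                        ≈⟨ ∙-cong ≋-refl (dissect₂ (− 3 ∷ + 6 ∷ + 0 ∷ [])) ⟩
    two ∙ (dbl B₀ ⊞ q^ 1 ∙ (two ∙ dbl B₁))                         ≈⟨ solve 3 (λ u x v → (′ 1 :+ ′ 1) :* (u :+ x :* ((′ 1 :+ ′ 1) :* v)) := (′ 1 :+ ′ 1) :* u :+ x :* (′ 4 :* v)) ≋-refl (dbl B₀) (q^ 1) (dbl B₁) ⟩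
    two ∙ dbl B₀ ⊞ q^ 1 ∙ (# (+ 4) ∙ dbl B₁)                       ≈⟨ ⊞-cong (dbl-two∙ B₀) (∙-cong ≋-refl (dbl-#∙ (+ 4) B₁)) ⟩
    dbl (two ∙ B₀) ⊞ q^ 1 ∙ dbl (# (+ 4) ∙ B₁)                     ∎

  G₀-odd-parts : Odd G₀ ≋ dbl (two ∙ B₀ ⊟ M₊) ⊞ q^ 1 ∙ dbl (# (+ 4) ∙ B₁)
  G₀-odd-parts = begin
    Odd G₀                                                         ≈⟨ ≋-trans G₀-odd (⊞-cong B-parts ≋-refl) ⟩
    dbl (two ∙ B₀) ⊞ q^ 1 ∙ dbl (# (+ 4) ∙ B₁) ⊟ dbl M₊            ≈⟨ solve 3 (λ u v m → u :+ v :- m := u :- m :+ v) ≋-refl (dbl (two ∙ B₀)) (q^ 1 ∙ dbl (# (+ 4) ∙ B₁)) (dbl M₊) ⟩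
    dbl (two ∙ B₀) ⊟ dbl M₊ ⊞ q^ 1 ∙ dbl (# (+ 4) ∙ B₁)            ≈⟨ ⊞-cong (≋-sym (dbl-⊟ _ _)) ≋-refl ⟩
    dbl (two ∙ B₀ ⊟ M₊) ⊞ q^ 1 ∙ dbl (# (+ 4) ∙ B₁)                ∎

G₀-8-3 : Even (Odd G₀) ≋ q^ 1 ∙ dbl Ω₋ ⊞ two ∙ B₀ ⊟ Λ₊
G₀-8-3 = ≋-trans (even-part (two ∙ B₀ ⊟ M₊) (# (+ 4) ∙ B₁) G₀-odd-parts) (≋-trans (⊞-cong ≋-refl (~-cong M₊≋))
  (solve 4 (λ b l x o → b :- (l :- x :* o) := x :* o :+ b :- l) ≋-refl (two ∙ B₀) Λ₊ (q^ 1) (dbl Ω₋)))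

G₀-8-7 : Odd (Odd G₀) ≋ # (+ 4) ∙ B₁
G₀-8-7 = odd-part (two ∙ B₀ ⊟ M₊) (# (+ 4) ∙ B₁) G₀-odd-parts

private
  H₁ : Series
  H₁ = η (− 4 ∷ + 3 ∷ + 2 ∷ + 0 ∷ [])

  H-parts : H ≋ dbl (K quarter ∙ η (− 8 ∷ + 15 ∷ − 6 ∷ []) ⊟ dbl 𝔽) ⊞ q^ 1 ∙ dbl H₁
  H-parts = begin
    H
      ≈⟨ ≋-trans H≋ (⊞-cong (∙-cong ≋-refl (dissect₄ (+ 6 ∷ + 1 ∷ − 2 ∷ []))) ≋-refl) ⟩
    K quarter ∙ (dbl u ⊞ q^ 1 ∙ (# (+ 4) ∙ dbl H₁)) ⊟ dbl (dbl 𝔽)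
      ≈⟨ solve 5 (λ k u x v f → k :* (u :+ x :* (′ 4 :* v)) :- f := k :* u :- f :+ x :* (k :* ′ 4 :* v)) ≋-refl (K quarter) (dbl u) (q^ 1) (dbl H₁) (dbl (dbl 𝔽)) ⟩
    K quarter ∙ dbl u ⊟ dbl (dbl 𝔽) ⊞ q^ 1 ∙ (K quarter ∙ # (+ 4) ∙ dbl H₁)
      ≈⟨ ⊞-cong (≋-sym (≋-trans (dbl-⊟ _ _) (⊞-cong (≋-trans (dbl-∙ _ _) (∙-cong (dbl-K _) ≋-refl)) ≋-refl))) (∙-cong ≋-refl (≋-trans (∙-cong quarter-4 ≋-refl) (∙-identityˡ _))) ⟩
    dbl (K quarter ∙ u ⊟ dbl 𝔽) ⊞ q^ 1 ∙ dbl H₁ ∎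
    where u = η (− 8 ∷ + 15 ∷ − 6 ∷ [])

G₁-4-0 : Even H ≋ K quarter ∙ η (− 8 ∷ + 15 ∷ − 6 ∷ []) ⊟ dbl 𝔽
G₁-4-0 = even-part _ H₁ H-parts

G₁-4-2 : Odd H ≋ H₁
G₁-4-2 = odd-part (K quarter ∙ η (− 8 ∷ + 15 ∷ − 6 ∷ []) ⊟ dbl 𝔽) _ H-parts

private
  H₁-parts : Odd H ≋ dbl (η (− 11 ∷ + 16 ∷ − 4 ∷ [])) ⊞ q^ 1 ∙ dbl (# (+ 4) ∙ η (− 7 ∷ + 4 ∷ + 4 ∷ + 0 ∷ []))
  H₁-parts = ≋-trans G₁-4-2 (≋-trans (dissect₄ (+ 3 ∷ + 2 ∷ + 0 ∷ [])) (⊞-cong ≋-refl (∙-cong ≋-refl (dbl-#∙ (+ 4) _))))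

G₁-8-2 : Even (Odd H) ≋ η (− 11 ∷ + 16 ∷ − 4 ∷ [])
G₁-8-2 = even-part _ (# (+ 4) ∙ η (− 7 ∷ + 4 ∷ + 4 ∷ + 0 ∷ [])) H₁-parts

G₁-8-6 : Odd (Odd H) ≋ # (+ 4) ∙ η (− 7 ∷ + 4 ∷ + 4 ∷ + 0 ∷ [])
G₁-8-6 = odd-part (η (− 11 ∷ + 16 ∷ − 4 ∷ [])) _ H₁-parts

private
  C₀ C₁ C₂ : Series
  C₀ = η (− 13 ∷ + 22 ∷ − 8 ∷ [])
  C₁ = η (− 5 ∷ − 2 ∷ + 8 ∷ + 0 ∷ [])
  C₂ = η (− 9 ∷ + 10 ∷ + 0 ∷ + 0 ∷ [])

  -- J₁⁻⁸ is taken as a product of two dissected copies of J₁⁻⁴. The mixed terms coincide, giving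
  -- the coefficient 8, and the product of the odd parts returns to the even part with coefficient
  -- 16.
  J₁⁻⁸ : η (− 8 ∷ + 15 ∷ − 6 ∷ []) ≋ dbl (C₀ ⊞ # (+ 16) ∙ q^ 1 ∙ C₁) ⊞ q^ 1 ∙ dbl (# (+ 8) ∙ C₂)
  J₁⁻⁸ = begin
    η (− 8 ∷ + 15 ∷ − 6 ∷ [])
      ≈⟨ ≐-unique (≐-η (− 8 ∷ + 15 ∷ − 6 ∷ [])) (≐-η (− 4 ∷ []) ⊗ ≐-η (− 4 ∷ + 15 ∷ − 6 ∷ [])) ⟩
    η (− 4 ∷ []) ∙ η (− 4 ∷ + 15 ∷ − 6 ∷ [])
      ≈⟨ ∙-cong (dissect₄ []) (dissect₄ (+ 15 ∷ − 6 ∷ [])) ⟩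
    (dbl x ⊞ q^ 1 ∙ (# (+ 4) ∙ dbl y)) ∙ (dbl x′ ⊞ q^ 1 ∙ (# (+ 4) ∙ dbl y′))
      ≈⟨ solve 5 (λ x y z w q → (x :+ q :* (′ 4 :* y)) :* (z :+ q :* (′ 4 :* w)) := x :* z :+ ′ 16 :* (q :* q) :* (y :* w) :+ q :* (′ 4 :* (x :* w) :+ ′ 4 :* (y :* z))) ≋-refl (dbl x) (dbl y) (dbl x′) (dbl y′) (q^ 1) ⟩
    dbl x ∙ dbl x′ ⊞ # (+ 16) ∙ (q^ 1 ∙ q^ 1) ∙ (dbl y ∙ dbl y′) ⊞ q^ 1 ∙ (# (+ 4) ∙ (dbl x ∙ dbl y′) ⊞ # (+ 4) ∙ (dbl y ∙ dbl x′))
      ≈⟨ ⊞-cong (⊞-cong (mul U₄ (+ 1 ∷ + 8 ∷ − 4 ∷ [])) (∙-cong (∙-cong ≋-refl (≋-trans (≋-sym (q^-+ 1 1)) (≋-sym (dbl-q^ 1)))) (mul V₄ (+ 5 ∷ − 4 ∷ + 4 ∷ + 0 ∷ []))))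
                (∙-cong ≋-refl (⊞-cong (∙-cong ≋-refl (mul U₄ (+ 5 ∷ − 4 ∷ + 4 ∷ + 0 ∷ []))) (∙-cong ≋-refl (mul V₄ (+ 1 ∷ + 8 ∷ − 4 ∷ []))))) ⟩
    dbl C₀ ⊞ # (+ 16) ∙ dbl (q^ 1) ∙ dbl C₁ ⊞ q^ 1 ∙ (# (+ 4) ∙ dbl C₂ ⊞ # (+ 4) ∙ dbl C₂)
      ≈⟨ ⊞-cong (≋-sym (≋-trans (dbl-⊞ _ _) (⊞-cong ≋-refl (≋-trans (dbl-∙ _ _) (∙-cong (≋-trans (dbl-∙ _ _) (∙-cong (dbl-K _) ≋-refl)) ≋-refl)))))
                (∙-cong ≋-refl (≋-trans (solve 1 (λ c → ′ 4 :* c :+ ′ 4 :* c := ′ 8 :* c) ≋-refl (dbl C₂)) (dbl-#∙ (+ 8) C₂))) ⟩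
    dbl (C₀ ⊞ # (+ 16) ∙ q^ 1 ∙ C₁) ⊞ q^ 1 ∙ dbl (# (+ 8) ∙ C₂) ∎
    where
      x = η U₄
      y = η V₄
      x′ = η (+ 1 ∷ + 8 ∷ − 4 ∷ [])
      y′ = η (+ 5 ∷ − 4 ∷ + 4 ∷ + 0 ∷ [])
      mul : ∀ es fs → dbl (η es) ∙ dbl (η fs) ≋ dbl (η (es ⊹ fs))
      mul es fs = ≋-trans (≋-sym (dbl-∙ _ _)) (dbl-cong (η-∙ es fs))

  H₀-parts : Even H ≋ dbl (K quarter ∙ C₀ ⊞ # (+ 4) ∙ (q^ 1 ∙ C₁) ⊟ 𝔽) ⊞ q^ 1 ∙ dbl (# (+ 2) ∙ C₂)
  H₀-parts = begin
    Even H
      ≈⟨ ≋-trans G₁-4-0 (⊞-cong (∙-cong ≋-refl J₁⁻⁸) ≋-refl) ⟩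
    K quarter ∙ (dbl (C₀ ⊞ # (+ 16) ∙ q^ 1 ∙ C₁) ⊞ q^ 1 ∙ dbl (# (+ 8) ∙ C₂)) ⊟ dbl 𝔽
      ≈⟨ solve 5 (λ k u x v f → k :* (u :+ x :* v) :- f := k :* u :- f :+ x :* (k :* v)) ≋-refl (K quarter) (dbl (C₀ ⊞ # (+ 16) ∙ q^ 1 ∙ C₁)) (q^ 1) (dbl (# (+ 8) ∙ C₂)) (dbl 𝔽) ⟩
    K quarter ∙ dbl (C₀ ⊞ # (+ 16) ∙ q^ 1 ∙ C₁) ⊟ dbl 𝔽 ⊞ q^ 1 ∙ (K quarter ∙ dbl (# (+ 8) ∙ C₂))
      ≈⟨ ⊞-cong (≋-sym (≋-trans (dbl-⊟ _ _) (⊞-cong (≋-trans (dbl-∙ _ _) (∙-cong (dbl-K _) ≋-refl)) ≋-refl))) (∙-cong ≋-refl (≋-sym (≋-trans (dbl-∙ _ _) (∙-cong (dbl-K _) ≋-refl)))) ⟩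
    dbl (K quarter ∙ (C₀ ⊞ # (+ 16) ∙ q^ 1 ∙ C₁) ⊟ 𝔽) ⊞ q^ 1 ∙ dbl (K quarter ∙ (# (+ 8) ∙ C₂))
      ≈⟨ ⊞-cong (dbl-cong (⊞-cong (≋-trans (solve 4 (λ k c x d → k :* (c :+ ′ 16 :* x :* d) := k :* c :+ k :* ′ 4 :* (′ 4 :* (x :* d))) ≋-refl (K quarter) C₀ (q^ 1) C₁)
                   (⊞-cong ≋-refl (≋-trans (∙-cong quarter-4 ≋-refl) (∙-identityˡ _)))) ≋-refl))
                (∙-cong ≋-refl (dbl-cong (≋-trans (solve 2 (λ k c → k :* (′ 8 :* c) := k :* ′ 4 :* (′ 2 :* c)) ≋-refl (K quarter) C₂) (≋-trans (∙-cong quarter-4 ≋-refl) (∙-identityˡ _))))) ⟩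
    dbl (K quarter ∙ C₀ ⊞ # (+ 4) ∙ (q^ 1 ∙ C₁) ⊟ 𝔽) ⊞ q^ 1 ∙ dbl (# (+ 2) ∙ C₂) ∎

G₁-8-0 : Even (Even H) ≋ K quarter ∙ C₀ ⊞ # (+ 4) ∙ (q^ 1 ∙ C₁) ⊟ 𝔽
G₁-8-0 = even-part _ (# (+ 2) ∙ C₂) H₀-parts

G₁-8-4 : Odd (Even H) ≋ # (+ 2) ∙ C₂
G₁-8-4 = odd-part (K quarter ∙ C₀ ⊞ # (+ 4) ∙ (q^ 1 ∙ C₁) ⊟ 𝔽) _ H₀-parts

private
  G₂-H : q^ 1 ∙ G₂ ≋ q^ 1 ∙ (half ∙ (Λ₊ ⊟ Λ₋)) ⊞ two ∙ dbl (dbl H)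
  G₂-H = begin
    q^ 1 ∙ (half ∙ (M₊ ⊟ M₋))
      ≈⟨ ∙-cong ≋-refl (∙-cong ≋-refl (⊞-cong M₊≋ (~-cong M₋≋))) ⟩
    q^ 1 ∙ (half ∙ (Λ₊ ⊟ q^ 1 ∙ dbl Ω₋ ⊟ (Λ₋ ⊟ q^ 1 ∙ dbl Ω₊)))
      ≈⟨ solve 6 (λ h l x o m p → x :* (h :* (l :- x :* o :- (m :- x :* p))) := x :* (h :* (l :- m)) :+ h :* (x :* (x :* (p :- o)))) ≋-refl half Λ₊ (q^ 1) (dbl Ω₋) Λ₋ (dbl Ω₊) ⟩
    q^ 1 ∙ (half ∙ (Λ₊ ⊟ Λ₋)) ⊞ half ∙ (q^ 1 ∙ (q^ 1 ∙ (dbl Ω₊ ⊟ dbl Ω₋)))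
      ≈⟨ ⊞-cong ≋-refl (≋-trans (∙-cong ≋-refl (≋-trans (∙-cong ≋-refl (∙-cong ≋-refl (≋-sym (dbl-⊟ _ _)))) (≋-trans (q²-dbl _) (≋-trans (dbl-cong (≋-sym dbl-H)) (≋-sym (dbl-#∙ (+ 4) _))))))
           (≋-trans (≋-sym (∙-assoc _ _ _)) (∙-cong half-4 ≋-refl))) ⟩
    q^ 1 ∙ (half ∙ (Λ₊ ⊟ Λ₋)) ⊞ two ∙ dbl (dbl H) ∎

G₂-2-1 : q^ 1 ∙ G₂ ≋ q^ 1 ∙ (half ∙ (Λ₊ ⊟ Λ₋)) ⊞ two ∙ dbl (dbl (K quarter ∙ Λ₃ ⊟ dbl (dbl 𝔽)))
G₂-2-1 = ≋-trans G₂-H (⊞-cong ≋-refl (∙-cong ≋-refl (dbl-cong (dbl-cong H≋))))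

private
  G₂-parts : q^ 1 ∙ G₂ ≋ q^ 1 ∙ dbl (two ∙ q^ 1 ∙ E₁) ⊞ dbl (q^ 1 ∙ (two ∙ B₂) ⊞ two ∙ dbl H)
  G₂-parts = begin
    q^ 1 ∙ G₂
      ≈⟨ ≋-trans G₂-H (⊞-cong (∙-cong ≋-refl Λ-difference) (dbl-two∙ (dbl H))) ⟩
    q^ 1 ∙ (dbl (two ∙ q^ 1 ∙ E₁) ⊞ q^ 1 ∙ dbl (two ∙ B₂)) ⊞ dbl (two ∙ dbl H)
      ≈⟨ solve 4 (λ x e b h → x :* (e :+ x :* b) :+ h := x :* e :+ (x :* (x :* b) :+ h)) ≋-refl (q^ 1) (dbl (two ∙ q^ 1 ∙ E₁)) (dbl (two ∙ B₂)) (dbl (two ∙ dbl H)) ⟩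
    q^ 1 ∙ dbl (two ∙ q^ 1 ∙ E₁) ⊞ (q^ 1 ∙ (q^ 1 ∙ dbl (two ∙ B₂)) ⊞ dbl (two ∙ dbl H))
      ≈⟨ ⊞-cong ≋-refl (≋-trans (⊞-cong (q²-dbl _) ≋-refl) (≋-sym (dbl-⊞ _ _))) ⟩
    q^ 1 ∙ dbl (two ∙ q^ 1 ∙ E₁) ⊞ dbl (q^ 1 ∙ (two ∙ B₂) ⊞ two ∙ dbl H) ∎

G₂-4-1 : Even G₂ ≋ two ∙ q^ 1 ∙ E₁
G₂-4-1 = even-part′ (two ∙ q^ 1 ∙ E₁) (q^ 1 ∙ (two ∙ B₂) ⊞ two ∙ dbl H) G₂-parts

private
  G₂-odd : q^ 1 ∙ Odd G₂ ≋ q^ 1 ∙ (two ∙ B₂) ⊞ two ∙ dbl H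
  G₂-odd = odd-part′ (two ∙ q^ 1 ∙ E₁) (q^ 1 ∙ (two ∙ B₂) ⊞ two ∙ dbl H) G₂-parts

G₂-4-3 : q^ 1 ∙ Odd G₂ ≋ q^ 1 ∙ (two ∙ B₂) ⊞ two ∙ dbl (K quarter ∙ Λ₃ ⊟ dbl (dbl 𝔽))
G₂-4-3 = ≋-trans G₂-odd (⊞-cong ≋-refl (∙-cong ≋-refl (dbl-cong H≋)))

private
  E′-parts : Even G₂ ≋ dbl (# (+ 8) ∙ (q^ 1 ∙ η (− 6 ∷ + 2 ∷ + 3 ∷ + 2 ∷ + 0 ∷ []))) ⊞ q^ 1 ∙ dbl (two ∙ η (− 10 ∷ + 14 ∷ − 5 ∷ + 2 ∷ + 0 ∷ []))
  E′-parts = begin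
    Even G₂
      ≈⟨ ≋-trans G₂-4-1 (∙-cong ≋-refl (dissect₄ (+ 4 ∷ + 0 ∷ − 1 ∷ + 2 ∷ + 0 ∷ []))) ⟩
    two ∙ q^ 1 ∙ (dbl u ⊞ q^ 1 ∙ (# (+ 4) ∙ dbl v))
      ≈⟨ solve 3 (λ x u v → (′ 1 :+ ′ 1) :* x :* (u :+ x :* (′ 4 :* v)) := ′ 8 :* (x :* (x :* v)) :+ x :* ((′ 1 :+ ′ 1) :* u)) ≋-refl (q^ 1) (dbl u) (dbl v) ⟩
    # (+ 8) ∙ (q^ 1 ∙ (q^ 1 ∙ dbl v)) ⊞ q^ 1 ∙ (two ∙ dbl u)
      ≈⟨ ⊞-cong (≋-trans (∙-cong ≋-refl (q²-dbl v)) (dbl-#∙ (+ 8) _)) (∙-cong ≋-refl (dbl-two∙ u)) ⟩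
    dbl (# (+ 8) ∙ (q^ 1 ∙ v)) ⊞ q^ 1 ∙ dbl (two ∙ u) ∎
    where
      u = η (− 10 ∷ + 14 ∷ − 5 ∷ + 2 ∷ + 0 ∷ [])
      v = η (− 6 ∷ + 2 ∷ + 3 ∷ + 2 ∷ + 0 ∷ [])

G₂-8-1 : Even (Even G₂) ≋ # (+ 8) ∙ (q^ 1 ∙ η (− 6 ∷ + 2 ∷ + 3 ∷ + 2 ∷ + 0 ∷ []))
G₂-8-1 = even-part _ (two ∙ η (− 10 ∷ + 14 ∷ − 5 ∷ + 2 ∷ + 0 ∷ [])) E′-parts

G₂-8-5 : Odd (Even G₂) ≋ two ∙ η (− 10 ∷ + 14 ∷ − 5 ∷ + 2 ∷ + 0 ∷ [])
G₂-8-5 = odd-part (# (+ 8) ∙ (q^ 1 ∙ η (− 6 ∷ + 2 ∷ + 3 ∷ + 2 ∷ + 0 ∷ []))) _ E′-parts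

private
  G₂-odd-parts : q^ 1 ∙ Odd G₂ ≋ q^ 1 ∙ dbl (two ∙ B₀) ⊞ dbl (q^ 1 ∙ (# (+ 4) ∙ B₁) ⊞ two ∙ H)
  G₂-odd-parts = begin
    q^ 1 ∙ Odd G₂
      ≈⟨ ≋-trans G₂-odd (⊞-cong (∙-cong ≋-refl B-parts) (dbl-two∙ H)) ⟩
    q^ 1 ∙ (dbl (two ∙ B₀) ⊞ q^ 1 ∙ dbl (# (+ 4) ∙ B₁)) ⊞ dbl (two ∙ H)
      ≈⟨ solve 4 (λ x e b h → x :* (e :+ x :* b) :+ h := x :* e :+ (x :* (x :* b) :+ h)) ≋-refl (q^ 1) (dbl (two ∙ B₀)) (dbl (# (+ 4) ∙ B₁)) (dbl (two ∙ H)) ⟩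
    q^ 1 ∙ dbl (two ∙ B₀) ⊞ (q^ 1 ∙ (q^ 1 ∙ dbl (# (+ 4) ∙ B₁)) ⊞ dbl (two ∙ H))
      ≈⟨ ⊞-cong ≋-refl (≋-trans (⊞-cong (q²-dbl _) ≋-refl) (≋-sym (dbl-⊞ _ _))) ⟩
    q^ 1 ∙ dbl (two ∙ B₀) ⊞ dbl (q^ 1 ∙ (# (+ 4) ∙ B₁) ⊞ two ∙ H) ∎

G₂-8-3 : Even (Odd G₂) ≋ two ∙ B₀
G₂-8-3 = even-part′ (two ∙ B₀) (q^ 1 ∙ (# (+ 4) ∙ B₁) ⊞ two ∙ H) G₂-odd-parts

G₂-8-7 : q^ 1 ∙ Odd (Odd G₂) ≋ q^ 1 ∙ (# (+ 4) ∙ B₁) ⊞ two ∙ (K quarter ∙ Λ₃ ⊟ dbl (dbl 𝔽))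
G₂-8-7 = ≋-trans (odd-part′ (two ∙ B₀) (q^ 1 ∙ (# (+ 4) ∙ B₁) ⊞ two ∙ H) G₂-odd-parts) (⊞-cong ≋-refl (∙-cong ≋-refl H≋))

-- Laurent series

opaque
  unfolding _⊞_
  mono-q^ : ∀ c j → mono c j ≋ K c ∙ q^ j
  mono-q^ c j = pw λ n → ≡.sym (≡.trans (cst-⊛ c (mono 1ℚ j) n) (aux n j))
    where
      aux : ∀ n j → c ℚ.* mono 1ℚ j n ≡ mono c j n
      aux zero    zero    = ℚₚ.*-identityʳ c
      aux zero    (suc j) = ℚₚ.*-zeroʳ c
      aux (suc n) zero    = ℚₚ.*-zeroʳ c
      aux (suc n) (suc j) = aux n j

  ·-K : ∀ c f → c · f ≋ K c ∙ f
  ·-K c f = pw λ n → ≡.sym (cst-⊛ c f n)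

  ⊕-⊞ : ∀ f g → f ⊕ g ≋ f ⊞ g
  ⊕-⊞ f g = ≋-refl

  ⊖-⊟ : ∀ f g → f ⊖ g ≋ f ⊟ g
  ⊖-⊟ f g = ≋-refl

  ⊛-∙ : ∀ f g → f ⊛ g ≋ f ∙ g
  ⊛-∙ f g = ≋-refl

  cst-K : ∀ c → cst c ≋ K c
  cst-K c = ≋-refl

  inv-⁻¹ : ∀ f → inv f ≋ f ⁻¹
  inv-⁻¹ f = ≋-refl

  mono-one : ∀ j → mono 1ℚ j ≋ q^ j
  mono-one j = ≋-refl

  -- Multiply both sides by the two poles. When an index lies below the order of one side only, the
  -- other side is compared with a coefficient below a power of q, which is zero.
  coeff-unique : ∀ F G → mono 1ℚ (shift G) ⊛ ser F ≋ mono 1ℚ (shift F) ⊛ ser G → F ≈ G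
  coeff-unique (laurent d f) (laurent e g) p k = cases (k ℤ.+ + d) (k ℤ.+ + e) ≡.refl ≡.refl
    where
      at-nat : ∀ h n i → h ℤ.+ + n ≡ + i → coeff (laurent n f) h ≡ f i
      at-nat h n i r with h ℤ.+ + n | r
      ... | _ | ≡.refl = ≡.refl
      at-nat′ : ∀ h n i → h ℤ.+ + n ≡ + i → coeff (laurent n g) h ≡ g i
      at-nat′ h n i r with h ℤ.+ + n | r
      ... | _ | ≡.refl = ≡.refl
      at-neg : ∀ h n i (u : Series) → h ℤ.+ + n ≡ -[1+ i ] → coeff (laurent n u) h ≡ 0ℚ
      at-neg h n i u r with h ℤ.+ + n | r
      ... | _ | ≡.refl = ≡.refl
      swap : k ℤ.+ + d ℤ.+ + e ≡ k ℤ.+ + e ℤ.+ + d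
      swap = ≡.trans (ℤₚ.+-assoc k (+ d) (+ e)) (≡.trans (cong (λ x → k ℤ.+ x) (ℤₚ.+-comm (+ d) (+ e))) (≡.sym (ℤₚ.+-assoc k (+ e) (+ d))))
      below : ∀ x i y z → -[1+ i ] ℤ.+ + x ≡ + (z + y) → z + y < x
      below x i y z r = ℤₚ.drop‿+<+ (ℤₚ.<-≤-trans (subst (ℤ._< + x) r (ℤₚ.m⊖1+n<m x (suc i))) (ℤₚ.≤-refl))
      cases : ∀ u v → k ℤ.+ + d ≡ u → k ℤ.+ + e ≡ v → coeff (laurent d f) k ≡ coeff (laurent e g) k
      cases (+ i) (+ j) r s = ≡.trans (at-nat k d i r) (≡.trans (≡.sym (q^-at e f i)) (≡.trans (at p (e + i))
        (≡.trans (cong (mono 1ℚ d ⊛ g) same) (≡.trans (q^-at d g j) (≡.sym (at-nat′ k e j s))))))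
        where
          same : e + i ≡ d + j
          same = ℤₚ.+-injective (≡.trans (cong +_ (ℕₚ.+-comm e i)) (≡.trans (≡.trans (cong (ℤ._+ + e) (≡.sym r)) (≡.trans swap (cong (ℤ._+ + d) s))) (cong +_ (ℕₚ.+-comm j d))))
      cases (+ i) -[1+ j ] r s = ≡.trans (at-nat k d i r) (≡.trans (≡.sym (q^-at e f i)) (≡.trans (at p (e + i))
        (≡.trans (q^-low d g (e + i) (below d j i e (≡.trans (≡.trans (cong (ℤ._+ + d) (≡.sym s)) (≡.trans (≡.sym swap) (cong (ℤ._+ + e) r))) (cong +_ (ℕₚ.+-comm i e))))) (≡.sym (at-neg k e j g s)))))
      cases -[1+ i ] (+ j) r s = ≡.trans (at-neg k d i f r) (≡.trans (≡.sym (q^-low e f (d + j) (below e i j d (≡.trans (≡.trans (cong (ℤ._+ + e) (≡.sym r)) (≡.trans swap (cong (ℤ._+ + d) s))) (cong +_ (ℕₚ.+-comm j d))))))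
        (≡.trans (at p (d + j)) (≡.trans (q^-at d g j) (≡.sym (at-nat′ k e j s)))))
      cases -[1+ i ] -[1+ j ] r s = ≡.trans (at-neg k d i f r) (≡.sym (at-neg k e j g s))

-- L is the Laurent series q^(-a) f.
record Rep (a : ℕ) (L : Laurent) (f : Series) : Set where
  constructor rep
  field represents : q^ a ∙ ser L ≋ q^ (shift L) ∙ f
open Rep public

Rep-≈ : ∀ {a G L f} → Rep a L f → q^ a ∙ G ≋ f → ⟦ G ⟧ ≈ L
Rep-≈ {a} {G} {L} {f} (rep r) p = coeff-unique ⟦ G ⟧ L (≋-trans (≋-trans (⊛-∙ _ _) (∙-cong (mono-one (shift L)) ≋-refl)) (≋-trans (q^-regular a (begin
  q^ a ∙ (q^ (shift L) ∙ G)     ≈⟨ solve 3 (λ x y z → x :* (y :* z) := y :* (x :* z)) ≋-refl (q^ a) (q^ (shift L)) G ⟩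
  q^ (shift L) ∙ (q^ a ∙ G)     ≈⟨ ∙-cong ≋-refl p ⟩
  q^ (shift L) ∙ f              ≈⟨ r ⟨
  q^ a ∙ ser L                  ≈⟨ solve 2 (λ x y → x :* y := x :* (′ 1 :* y)) ≋-refl (q^ a) (ser L) ⟩
  q^ a ∙ (𝟙 ∙ ser L)            ≈⟨ ∙-cong ≋-refl (∙-cong (≋-sym q^-zero) ≋-refl) ⟩
  q^ a ∙ (q^ 0 ∙ ser L)         ∎))
  (≋-sym (≋-trans (⊛-∙ _ _) (∙-cong (mono-one 0) ≋-refl)))))

Rep-≋ : ∀ {a L f g} → f ≋ g → Rep a L f → Rep a L g
Rep-≋ p (rep r) = rep (≋-trans r (∙-cong ≋-refl p))

Rep-+ : ∀ {a F G f g} → Rep a F f → Rep a G g → Rep a (F +ᴸ G) (f ⊞ g)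
Rep-+ {a} {F} {G} {f} {g} (rep r) (rep s) = rep (begin
  q^ a ∙ (mono 1ℚ e ⊛ ser F ⊕ mono 1ℚ d ⊛ ser G)
    ≈⟨ ∙-cong ≋-refl (≋-trans (⊕-⊞ _ _) (⊞-cong (≋-trans (⊛-∙ _ _) (∙-cong (mono-one e) ≋-refl)) (≋-trans (⊛-∙ _ _) (∙-cong (mono-one d) ≋-refl)))) ⟩
  q^ a ∙ (q^ e ∙ ser F ⊞ q^ d ∙ ser G)
    ≈⟨ solve 5 (λ a e d f g → a :* (e :* f :+ d :* g) := e :* (a :* f) :+ d :* (a :* g)) ≋-refl (q^ a) (q^ e) (q^ d) (ser F) (ser G) ⟩
  q^ e ∙ (q^ a ∙ ser F) ⊞ q^ d ∙ (q^ a ∙ ser G)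
    ≈⟨ ⊞-cong (∙-cong ≋-refl r) (∙-cong ≋-refl s) ⟩
  q^ e ∙ (q^ d ∙ f) ⊞ q^ d ∙ (q^ e ∙ g)
    ≈⟨ solve 4 (λ e d f g → e :* (d :* f) :+ d :* (e :* g) := d :* e :* (f :+ g)) ≋-refl (q^ e) (q^ d) f g ⟩
  q^ d ∙ q^ e ∙ (f ⊞ g)
    ≈⟨ ∙-cong (≋-sym (q^-+ d e)) ≋-refl ⟩
  q^ (d + e) ∙ (f ⊞ g) ∎)
  where
    d = shift F
    e = shift G

Rep-- : ∀ {a F G f g} → Rep a F f → Rep a G g → Rep a (F -ᴸ G) (f ⊟ g)
Rep-- {a} {F} {G} {f} {g} (rep r) (rep s) = rep (begin
  q^ a ∙ (mono 1ℚ e ⊛ ser F ⊖ mono 1ℚ d ⊛ ser G)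
    ≈⟨ ∙-cong ≋-refl (≋-trans (⊖-⊟ _ _) (⊞-cong (≋-trans (⊛-∙ _ _) (∙-cong (mono-one e) ≋-refl)) (~-cong (≋-trans (⊛-∙ _ _) (∙-cong (mono-one d) ≋-refl))))) ⟩
  q^ a ∙ (q^ e ∙ ser F ⊟ q^ d ∙ ser G)
    ≈⟨ solve 5 (λ a e d f g → a :* (e :* f :- d :* g) := e :* (a :* f) :- d :* (a :* g)) ≋-refl (q^ a) (q^ e) (q^ d) (ser F) (ser G) ⟩
  q^ e ∙ (q^ a ∙ ser F) ⊟ q^ d ∙ (q^ a ∙ ser G)
    ≈⟨ ⊞-cong (∙-cong ≋-refl r) (~-cong (∙-cong ≋-refl s)) ⟩
  q^ e ∙ (q^ d ∙ f) ⊟ q^ d ∙ (q^ e ∙ g)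
    ≈⟨ solve 4 (λ e d f g → e :* (d :* f) :- d :* (e :* g) := d :* e :* (f :- g)) ≋-refl (q^ e) (q^ d) f g ⟩
  q^ d ∙ q^ e ∙ (f ⊟ g)
    ≈⟨ ∙-cong (≋-sym (q^-+ d e)) ≋-refl ⟩
  q^ (d + e) ∙ (f ⊟ g) ∎)
  where
    d = shift F
    e = shift G

Rep-* : ∀ {a b F G f g} → Rep a F f → Rep b G g → Rep (a + b) (F *ᴸ G) (f ∙ g)
Rep-* {a} {b} {F} {G} {f} {g} (rep r) (rep s) = rep (begin
  q^ (a + b) ∙ (ser F ⊛ ser G)             ≈⟨ ∙-cong (q^-+ a b) (⊛-∙ _ _) ⟩
  q^ a ∙ q^ b ∙ (ser F ∙ ser G)            ≈⟨ solve 4 (λ a b f g → a :* b :* (f :* g) := a :* f :* (b :* g)) ≋-refl (q^ a) (q^ b) (ser F) (ser G) ⟩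
  q^ a ∙ ser F ∙ (q^ b ∙ ser G)            ≈⟨ ∙-cong r s ⟩
  q^ d ∙ f ∙ (q^ e ∙ g)                    ≈⟨ solve 4 (λ a b f g → a :* f :* (b :* g) := a :* b :* (f :* g)) ≋-refl (q^ d) (q^ e) f g ⟩
  q^ d ∙ q^ e ∙ (f ∙ g)                    ≈⟨ ∙-cong (≋-sym (q^-+ d e)) ≋-refl ⟩
  q^ (d + e) ∙ (f ∙ g)                     ∎)
  where
    d = shift F
    e = shift G

Rep-• : ∀ {a F f} c → Rep a F f → Rep a (c • F) (K c ∙ f)
Rep-• {a} {F} {f} c (rep r) = rep (≋-trans (∙-cong ≋-refl (·-K c (ser F))) (≋-trans
  (solve 3 (λ a k f → a :* (k :* f) := k :* (a :* f)) ≋-refl (q^ a) (K c) (ser F)) (≋-trans (∙-cong ≋-refl r)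
  (solve 3 (λ a k f → k :* (a :* f) := a :* (k :* f)) ≋-refl (q^ (shift F)) (K c) f))))

Rep-qpow : ∀ n → Rep 0 (qpow (+ n)) (q^ n)
Rep-qpow n = rep (∙-cong ≋-refl (mono-one n))

Rep-q⁻¹ : Rep 1 (qpow -[1+ 0 ]) 𝟙
Rep-q⁻¹ = rep (∙-cong ≋-refl (cst-K 1ℚ))

Rep-raise : ∀ {F f} → Rep 0 F f → Rep 1 F (q^ 1 ∙ f)
Rep-raise {F} {f} (rep r) = rep (≋-trans (∙-cong ≋-refl (≋-trans (≋-trans (≋-sym (∙-identityˡ _)) (∙-cong (≋-sym q^-zero) ≋-refl)) r))
  (solve 3 (λ a b c → a :* (b :* c) := b :* (a :* c)) ≋-refl (q^ 1) (q^ (shift F)) f))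

-- Defining products, eta quotients and g in terms of `P` and `∑`

^^-q^ : ∀ m k → mono 1ℚ m ^^ k ≋ q^ (m * k)
^^-q^ m zero    = ≋-trans (cst-K 1ℚ) (≋-sym (≋-trans (q^-cong (ℕₚ.*-zeroʳ m)) q^-zero))
^^-q^ m (suc k) = ≋-trans (⊛-∙ _ _) (≋-trans (∙-cong (mono-one m) (^^-q^ m k)) (≋-trans (≋-sym (q^-+ m (m * k))) (q^-cong (≡.sym (ℕₚ.*-suc m k)))))

factor : ∀ c j m k → cst 1ℚ ⊖ mono c j ⊛ mono 1ℚ m ^^ k ≋ fac (K c) (j + m * k)
factor c j m k = ≋-trans (⊖-⊟ _ _) (⊞-cong (cst-K 1ℚ) (~-cong (≋-trans (⊛-∙ _ _) (≋-trans (∙-cong (mono-q^ c j) (^^-q^ m k)) (≋-trans (∙-assoc _ _ _) (∙-cong ≋-refl (≋-sym (q^-+ j (m * k)))))))))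

prodFin-Π : ∀ n {F G : ℕ → Series} → (∀ k → F k ≋ G k) → prodFin F n ≋ Π< n G
prodFin-Π zero    p = cst-K 1ℚ
prodFin-Π (suc n) p = ≋-trans (⊛-∙ _ _) (∙-cong (prodFin-Π n p) (p n))

poch-P : ∀ c j m n → poch (mono c j) (mono 1ℚ m) n ≋ P (K c) j m n
poch-P c j m n = prodFin-Π n (factor c j m)

J-𝐉 : ∀ m → J m ≋ 𝐉 m
J-𝐉 m = pw λ N → at (prodFin-Π (suc N) (factor 1ℚ m m)) N

^^-pow : ∀ {f g} → f ≋ g → ∀ e → f ^^ e ≋ pow g e
^^-pow p zero    = cst-K 1ℚ
^^-pow p (suc e) = ≋-trans (⊛-∙ _ _) (≋-trans (∙-cong p (^^-pow p e)) (∙-comm _ _))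

unit-vector : ℕ → ℤ → List ℤ
unit-vector zero    e = e ∷ []
unit-vector (suc k) e = + 0 ∷ unit-vector k e

𝐉-power : ∀ k e → pow (𝐉 (2 ℕ.^ k)) e ≐ unit-vector k (+ e)
𝐉-power zero    e = isη (≋-trans (≋-sym (∙-identityʳ _)) (∙-cong ≋-refl (≋-sym dbl-𝟙)))
𝐉-power (suc k) e = ≐-trans (≋-trans (Π-cong e λ _ _ → ≋-sym (dbl-P∞ (2 ℕ.^ k) (2 ℕ.^ k) (ℕₚ.m^n>0 2 k) dbl-𝟙)) (≋-sym (dbl-Π e _))) (≐-dbl (𝐉-power k e))

-- The entry (k , e) stands for the factor J_(2^k)^e.
J-product : List (ℕ × ℕ) → Series
J-product []             = cst 1ℚ
J-product ((k , e) ∷ ps) = J (2 ℕ.^ k) ^^ e ⊛ J-product ps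

exponents : List (ℕ × ℕ) → List ℤ
exponents []             = []
exponents ((k , e) ∷ ps) = unit-vector k (+ e) ⊹ exponents ps

J-product-η : ∀ ps → J-product ps ≐ exponents ps
J-product-η []             = isη (cst-K 1ℚ)
J-product-η ((k , e) ∷ ps) = ≐-trans (≋-trans (⊛-∙ _ _) (∙-cong (^^-pow (J-𝐉 (2 ℕ.^ k)) e) ≋-refl)) (𝐉-power k e ⊗ J-product-η ps)

J-quotient : ∀ num den → J-product num ⊛ inv (J-product den) ≐ exponents num ⊹ negate (exponents den)
J-quotient num den = ≐-trans (≋-trans (⊛-∙ _ _) (∙-cong ≋-refl (inv-⁻¹ _))) (J-product-η num ⊗ ≐-⁻¹ (J-product-η den))

K-minus : K -1ℚ ≋ ~ 𝟙
K-minus = K-neg 1ℚ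

fac-minus-K : ∀ d → fac (K -1ℚ) d ≋ fac (~ 𝟙) d
fac-minus-K d = ⊞-cong ≋-refl (~-cong (∙-cong K-minus ≋-refl))

-- At coefficient N, `∑` reads one term more than `sumInf`, that of index N + 1. Its order is at
-- least N + 1, so it contributes nothing.
sumInf-∑ : ∀ {F G : ℕ → Series} (e : ℕ → ℕ) → (∀ n → F n ≋ q^ (e n) ∙ G n) → (∀ n → n ≤ e n) → sumInf F ≋ ∑ (λ n → q^ (e n) ∙ G n)
sumInf-∑ {F} {G} e p le = pw λ N → ≡.trans (sum N N) (≡.trans (at (Σ-cong (suc N) λ n _ → p n) N) (≡.sym (last N)))
  where
    opaque
      unfolding _⊞_
      sum : ∀ M N → sumTo M (λ n → F n N) ≡ Σ< (suc M) F N
      sum zero    N = ≡.sym (≡.trans (cong (ℚ._+ F 0 N) (cst-0 N)) (ℚₚ.+-identityˡ (F 0 N)))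
      sum (suc M) N = cong (ℚ._+ F (suc M) N) (sum M N)
      last : ∀ N → ∑ (λ n → q^ (e n) ∙ G n) N ≡ Σ< (suc N) (λ n → q^ (e n) ∙ G n) N
      last N = ≡.trans (cong (Σ< (suc N) (λ n → q^ (e n) ∙ G n) N ℚ.+_) (q^-low (e (suc N)) (G (suc N)) N (le (suc N)))) (ℚₚ.+-identityʳ (Σ< (suc N) (λ n → q^ (e n) ∙ G n) N))

-- Terms of g(c q^j ; q^m), with l = m - j
g-term : ℚ → ℕ → ℕ → ℕ → ℕ → Series
g-term c j m l n = mono 1ℚ m ^^ (n * n) ⊛ inv (poch (mono c j) (mono 1ℚ m) (suc n) ⊛ poch (mono c l) (mono 1ℚ m) n)

g-term-P : ∀ j m l n → Unit (P⁺ j m (suc n) ∙ P⁺ l m n) → g-term -1ℚ j m l n ≋ q^ (m * (n * n)) ∙ (P⁺ j m (suc n) ∙ P⁺ l m n) ⁻¹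
g-term-P j m l n u = ≋-trans (⊛-∙ _ _) (∙-cong (^^-q^ m (n * n)) (≋-trans (inv-⁻¹ _) (≋-sym (⁻¹-cong u (≋-sym (≋-trans (⊛-∙ _ _) (∙-cong (conv j (suc n)) (conv l n))))))))
  where
    conv : ∀ x n → poch (mono -1ℚ x) (mono 1ℚ m) n ≋ P⁺ x m n
    conv x n = ≋-trans (poch-P -1ℚ x m n) (Π-cong n λ k _ → fac-minus-K (x + m * k))

-- For x = - q^j the factor x⁻¹ splits into the sign -1 and the Laurent shift by j; only the sign
-- acts on the series part.
g-series : ∀ {S} j m l → sumInf (g-term -1ℚ j m l) ≋ S → (-1ℚ · (-1ℚ · cst 1ℚ ⊕ sumInf (g-term -1ℚ j m l))) ≋ 𝟙 ⊟ S
g-series {S} j m l p = ≋-trans (·-K -1ℚ _) (≋-trans (∙-cong K-minus (≋-trans (⊕-⊞ _ _) (⊞-cong (≋-trans (·-K -1ℚ _) (∙-cong K-minus (cst-K 1ℚ))) p)))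
  (solve 1 (λ s → (⊝ ′ 1) :* ((⊝ ′ 1) :* ′ 1 :+ s) := ′ 1 :- s) ≋-refl S))

module _ (m : ℕ) (0<m : 0 < m) where
  private
    U₀ : ∀ n → Unit (P⁺ 0 m n)
    U₀ n = Π-Unit n λ { zero → Unit-≋ (fac-cong (≡.sym (ℕₚ.*-zeroʳ m))) Unit-fac-minus-zero ; (suc k) → Unit-fac (≤-trans 0<m (ℕₚ.m≤m*n m (suc k))) }

    P⁺-zero : ∀ n → P⁺ 0 m (suc n) ≋ two ∙ P⁺ m m n
    P⁺-zero n = ≋-trans (Π-head n _) (∙-cong (≋-trans (fac-cong (ℕₚ.*-zeroʳ m)) (≋-trans (fac-minus 0) (⊞-cong ≋-refl q^-zero))) (Π-cong n λ k _ → fac-cong (ℕₚ.*-suc m k)))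

  third : ℕ → Series
  third n = q^ (m * (n * n)) ∙ (P⁺ 0 m (suc n) ∙ P⁺ 0 m (suc n)) ⁻¹

  third-small : Small third
  third-small = Small-q^ (λ n → m * (n * n)) _ λ k → ≤-trans (ℕₚ.n≤1+n k) (≤-trans (ℕₚ.m≤m*n (suc k) (suc k)) (ℕₚ.m≤n*m _ m {{ℕ.>-nonZero 0<m}}))

  third-unit : ∀ n → Unit (P⁺ 0 m (suc n) ∙ P⁺ 0 m (suc n))
  third-unit n = Unit-∙ (U₀ (suc n)) (U₀ (suc n))

  -- (-1 ; Q)_(n+1) = 2 (-Q ; Q)_n, so a summand of g(-1 ; Q) is twice the one with (-1 ; Q)_(n+1)
  -- squared, which is the shape of `𝔽`.
  g-zero : sumInf (g-term -1ℚ 0 m m) ≋ two ∙ ∑ third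
  g-zero = ≋-trans (sumInf-∑ (λ n → m * (n * n)) (λ n → g-term-P 0 m m n (U n)) bound)
    (≋-trans (∑-cong λ n → ≋-trans (∙-cong ≋-refl (doubled n)) (solve 3 (λ q t i → q :* (t :* i) := t :* (q :* i)) ≋-refl (q^ (m * (n * n))) two _)) (≋-sym (∑-∙ two third-small)))
    where
      bound : ∀ n → n ≤ m * (n * n)
      bound zero    = z≤n
      bound (suc n) = ≤-trans (ℕₚ.m≤m*n (suc n) (suc n)) (ℕₚ.m≤n*m _ m {{ℕ.>-nonZero 0<m}})
      U : ∀ n → Unit (P⁺ 0 m (suc n) ∙ P⁺ m m n)
      U n = Unit-∙ (U₀ (suc n)) (Unit-P (~ 𝟙) m m n 0<m)
      doubled : ∀ n → (P⁺ 0 m (suc n) ∙ P⁺ m m n) ⁻¹ ≋ two ∙ (P⁺ 0 m (suc n) ∙ P⁺ 0 m (suc n)) ⁻¹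
      doubled n = ⁻¹-unique (begin
        P⁺ 0 m (suc n) ∙ P⁺ m m n ∙ (two ∙ i)      ≈⟨ solve 4 (λ p r t i → p :* r :* (t :* i) := p :* (t :* r) :* i) ≋-refl (P⁺ 0 m (suc n)) (P⁺ m m n) two i ⟩
        P⁺ 0 m (suc n) ∙ (two ∙ P⁺ m m n) ∙ i      ≈⟨ ∙-cong (∙-cong ≋-refl (≋-sym (P⁺-zero n))) ≋-refl ⟩
        P⁺ 0 m (suc n) ∙ P⁺ 0 m (suc n) ∙ i        ≈⟨ ∙-inverse (third-unit n) ⟩
        𝟙                                          ∎)
        where i = (P⁺ 0 m (suc n) ∙ P⁺ 0 m (suc n)) ⁻¹

dbl-P⁺ : ∀ x m n → dbl (P⁺ x m n) ≋ P⁺ (2 * x) (2 * m) n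
dbl-P⁺ x m n = ≋-trans (dbl-Π n _) (Π-cong n λ k _ → ≋-trans (dbl-fac (x + m * k) dbl-minus) (fac-cong (shuffle x m k)))
  where
    shuffle : ∀ x m k → 2 * (x + m * k) ≡ 2 * x + 2 * m * k
    shuffle = solve-∀

third-dbl : ∀ m 0<m 0<2m → dbl (∑ (third m 0<m)) ≋ ∑ (third (2 * m) 0<2m)
third-dbl m 0<m 0<2m = ≋-trans (dbl-∑ (third-small m 0<m)) (∑-cong λ n → ≋-trans (dbl-∙ _ _) (∙-cong (≋-trans (dbl-q^ _) (q^-cong (≡.sym (ℕₚ.*-assoc 2 m (n * n)))))
  (≋-trans (dbl-⁻¹ (third-unit m 0<m n)) (⁻¹-cong (dbl-Unit (third-unit m 0<m n)) (≋-trans (dbl-∙ _ _) (∙-cong (dbl-P⁺ 0 m (suc n)) (dbl-P⁺ 0 m (suc n))))))))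

denom-minus : ∀ e → denom (~ two) 𝟙 e ≋ fac (~ 𝟙) e ∙ fac (~ 𝟙) e
denom-minus e = ≋-trans (≋-sym (denom-cong (~ 𝟙) e minus-two)) (denom-two e minus²)

𝔽-third : 𝔽 ≋ ∑ (third 1 (s≤s z≤n))
𝔽-third = ∑-cong λ n → ∙-cong (q^-cong (cong (1 *_) (cong (n *_) (ℕₚ.+-identityʳ n)))) (≋-trans (Π-⁻¹ (suc n) Unit-denom-minus)
  (⁻¹-cong (Π-Unit (suc n) Unit-denom-minus) (≋-trans (Π-cong (suc n) λ i _ → denom-minus (0 + 1 * i)) (Π-∙ (suc n) _ _))))

module _ (j : ℕ) (0<j : 0 < j) where
  private
    m : ℕ
    m = 2 * j

    0<m : 0 < m
    0<m = ≤-trans 0<j (m≤m+n j _)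

    p i : ℕ → Series
    p n = P⁺ j m n
    i n = p n ⁻¹

    Up : ∀ n → Unit (p n)
    Up n = Unit-P (~ 𝟙) j m n 0<j

  -- The summand of `Ω₋` with q replaced by q^j.
  omega : ℕ → Series
  omega n = q^ (m * (n * (n + 1))) ∙ (p (suc n) ∙ p (suc n)) ⁻¹

  omega-small : Small omega
  omega-small = Small-q^ (λ n → m * (n * (n + 1))) _ λ k → ≤-trans (ℕₚ.n≤1+n k) (≤-trans (ℕₚ.m≤m*n (suc k) (suc k + 1)) (ℕₚ.m≤n*m _ m {{ℕ.>-nonZero 0<m}}))

  omega-unit : ∀ n → Unit (p (suc n) ∙ p (suc n))
  omega-unit n = Unit-∙ (Up (suc n)) (Up (suc n))

  private
    telescope : ℕ → Series
    telescope n = q^ (m * (n * n)) ∙ (i n ∙ i n)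

    square-bound : ∀ n → n ≤ m * (n * n)
    square-bound zero    = z≤n
    square-bound (suc n) = ≤-trans (ℕₚ.m≤m*n (suc n) (suc n)) (ℕₚ.m≤n*m _ m {{ℕ.>-nonZero 0<m}})

    telescope-small : Small telescope
    telescope-small = Small-q^ (λ n → m * (n * n)) _ λ k → ≤-trans (ℕₚ.n≤1+n k) (square-bound (suc k))

    g-summand : ℕ → Series
    g-summand n = q^ (m * (n * n)) ∙ (p (suc n) ∙ p n) ⁻¹

    -- With t = q^(j + m n), the numerator is split by 1 + t = (1 + t)² - t² - t. Since m = 2j, the
    -- factor t² moves q^(m n²) to q^(m (n+1)²), so the first two parts telescope.
    step : ∀ n → g-summand n ≋ telescope n ⊟ telescope (suc n) ⊟ q^ j ∙ omega n
    step n = begin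
      Q ∙ (p n ∙ y ∙ p n) ⁻¹
        ≈⟨ ∙-cong ≋-refl (≋-trans (⁻¹-∙ (Up (suc n)) (Up n)) (∙-cong (⁻¹-∙ (Up n) Uy) ≋-refl)) ⟩
      Q ∙ (i n ∙ z ∙ i n)
        ≈⟨ solve 3 (λ q i z → q :* (i :* z :* i) := q :* (i :* i) :* (z :* ′ 1)) ≋-refl Q (i n) z ⟩
      Q ∙ (i n ∙ i n) ∙ (z ∙ 𝟙)
        ≈⟨ ∙-cong ≋-refl (∙-cong ≋-refl (≋-sym yz)) ⟩
      Q ∙ (i n ∙ i n) ∙ (z ∙ ((𝟙 ⊟ ~ 𝟙 ∙ t) ∙ z))
        ≈⟨ solve 4 (λ q i z t → q :* (i :* i) :* (z :* ((′ 1 :- (⊝ ′ 1) :* t) :* z)) :=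
             q :* (i :* i) :* ((′ 1 :- (⊝ ′ 1) :* t) :* z :* ((′ 1 :- (⊝ ′ 1) :* t) :* z)) :- q :* t :* t :* (i :* z :* (i :* z)) :- q :* t :* (i :* z :* (i :* z))) ≋-refl Q (i n) z t ⟩
      Q ∙ (i n ∙ i n) ∙ ((𝟙 ⊟ ~ 𝟙 ∙ t) ∙ z ∙ ((𝟙 ⊟ ~ 𝟙 ∙ t) ∙ z)) ⊟ Q ∙ t ∙ t ∙ (i n ∙ z ∙ (i n ∙ z)) ⊟ Q ∙ t ∙ (i n ∙ z ∙ (i n ∙ z))
        ≈⟨ ⊞-cong (⊞-cong (≋-trans (∙-cong ≋-refl (∙-cong yz yz)) (solve 1 (λ x → x :* (′ 1 :* ′ 1) := x) ≋-refl _))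
                          (~-cong (∙-cong (≋-trans (∙-cong (≋-sym (q^-+ _ _)) ≋-refl) (≋-trans (≋-sym (q^-+ _ _)) (q^-cong (e₁ j n)))) (∙-cong (≋-sym iz) (≋-sym iz)))))
                  (~-cong (≋-trans (∙-cong (≋-trans (≋-sym (q^-+ _ _)) (≋-trans (q^-cong (e₂ j n)) (q^-+ j _))) (≋-sym (≋-trans (⁻¹-∙ (Up (suc n)) (Up (suc n))) (∙-cong iz iz)))) (∙-assoc _ _ _))) ⟩
      telescope n ⊟ telescope (suc n) ⊟ q^ j ∙ omega n ∎
      where
        Q = q^ (m * (n * n))
        t = q^ (j + m * n)
        y = fac (~ 𝟙) (j + m * n)
        z = y ⁻¹
        Uy : Unit y
        Uy = Unit-fac (≤-trans 0<j (m≤m+n j _))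
        yz : (𝟙 ⊟ ~ 𝟙 ∙ t) ∙ z ≋ 𝟙
        yz = ∙-inverse Uy
        iz : i (suc n) ≋ i n ∙ z
        iz = ⁻¹-∙ (Up n) Uy
        e₁ : ∀ j n → 2 * j * (n * n) + (j + 2 * j * n) + (j + 2 * j * n) ≡ 2 * j * (suc n * suc n)
        e₁ = solve-∀
        e₂ : ∀ j n → 2 * j * (n * n) + (j + 2 * j * n) ≡ j + 2 * j * (n * (n + 1))
        e₂ = solve-∀

  -- The telescoping part collapses to its first term 1. The -1 in the definition of g cancels it,
  -- and division by q^j leaves Ω₋ at q^j.
  g-odd : sumInf (g-term -1ℚ j m j) ≋ 𝟙 ⊟ q^ j ∙ ∑ omega
  g-odd = begin
    sumInf (g-term -1ℚ j m j)
      ≈⟨ sumInf-∑ (λ n → m * (n * n)) (λ n → g-term-P j m j n (Unit-∙ (Up (suc n)) (Up n))) square-bound ⟩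
    ∑ g-summand
      ≈⟨ ∑-cong step ⟩
    ∑ (λ n → telescope n ⊟ telescope (suc n) ⊟ q^ j ∙ omega n)
      ≈⟨ ≋-trans (∑-⊟ _ _) (⊞-cong (∑-⊟ telescope (λ n → telescope (suc n))) (~-cong (≋-sym (∑-∙ (q^ j) omega-small)))) ⟩
    ∑ telescope ⊟ ∑ (λ n → telescope (suc n)) ⊟ q^ j ∙ ∑ omega
      ≈⟨ ⊞-cong (≋-trans (⊞-cong (∑-head telescope-small) ≋-refl) (solve 2 (λ a b → a :+ b :- b := a) ≋-refl (telescope 0) (∑ (λ n → telescope (suc n))))) ≋-refl ⟩
    telescope 0 ⊟ q^ j ∙ ∑ omega
      ≈⟨ ⊞-cong (≋-trans (∙-cong (≋-trans (q^-cong (ℕₚ.*-zeroʳ m)) q^-zero) (≋-trans (∙-cong one one) (∙-identityˡ 𝟙))) (∙-identityˡ 𝟙)) ≋-refl ⟩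
    𝟙 ⊟ q^ j ∙ ∑ omega ∎
    where
      one : i 0 ≋ 𝟙
      one = ⁻¹-unique (∙-identityˡ 𝟙)

omega-dbl : ∀ j 0<j 0<2j → dbl (∑ (omega j 0<j)) ≋ ∑ (omega (2 * j) 0<2j)
omega-dbl j 0<j 0<2j = ≋-trans (dbl-∑ (omega-small j 0<j)) (∑-cong λ n → ≋-trans (dbl-∙ _ _) (∙-cong (≋-trans (dbl-q^ _) (q^-cong (≡.sym (ℕₚ.*-assoc 2 (2 * j) (n * (n + 1))))))
  (≋-trans (dbl-⁻¹ (omega-unit j 0<j n)) (⁻¹-cong (dbl-Unit (omega-unit j 0<j n)) (≋-trans (dbl-∙ _ _) (∙-cong (dbl-P⁺ j (2 * j) (suc n)) (dbl-P⁺ j (2 * j) (suc n))))))))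

Ω₋-omega : Ω₋ ≋ ∑ (omega 1 (s≤s z≤n))
Ω₋-omega = ∑-cong λ n → ∙-cong ≋-refl (≋-trans (Π-⁻¹ (suc n) U) (⁻¹-cong (Π-Unit (suc n) U) (≋-trans (Π-cong (suc n) λ i _ → denom-minus (1 + 2 * i)) (Π-∙ (suc n) _ _))))
  where
    U : ∀ i → Unit (denom (~ two) 𝟙 (1 + 2 * i))
    U i = Unit-denom (~ two) 𝟙 (s≤s z≤n)

Rep-g-zero : ∀ m 0<m {f} → f ≋ ∑ (third (suc m) 0<m) → Rep 0 (g -1ℚ 0 (suc m)) (𝟙 ⊟ two ∙ f)
Rep-g-zero m 0<m p = rep (∙-cong ≋-refl (≋-trans (g-series 0 (suc m) (suc m) (g-zero (suc m) 0<m)) (⊞-cong ≋-refl (~-cong (∙-cong ≋-refl (≋-sym p))))))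

g-odd-series : ∀ j 0<j {f} → f ≋ ∑ (omega j 0<j) → (-1ℚ · (-1ℚ · cst 1ℚ ⊕ sumInf (g-term -1ℚ j (2 * j) j))) ≋ q^ j ∙ f
g-odd-series j 0<j {f} p = ≋-trans (g-series j (2 * j) j (g-odd j 0<j)) (≋-trans (solve 1 (λ x → ′ 1 :- (′ 1 :- x) := x) ≋-refl (q^ j ∙ ∑ (omega j 0<j))) (∙-cong ≋-refl (≋-sym p)))

-- Counting odd Durfee symbols

module _ {X : Set} where
  wsum : (X → ℚ) → List X → ℚ
  wsum w []       = 0ℚ
  wsum w (x ∷ xs) = w x ℚ.+ wsum w xs

  wsum-cong : ∀ {v w : X → ℚ} → (∀ x → v x ≡ w x) → ∀ xs → wsum v xs ≡ wsum w xs
  wsum-cong p []       = ≡.refl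
  wsum-cong p (x ∷ xs) = cong₂ ℚ._+_ (p x) (wsum-cong p xs)

  wsum-++ : ∀ w xs ys → wsum w (xs ++ ys) ≡ wsum w xs ℚ.+ wsum w ys
  wsum-++ w []       ys = ≡.sym (ℚₚ.+-identityˡ _)
  wsum-++ w (x ∷ xs) ys = ≡.trans (cong (w x ℚ.+_) (wsum-++ w xs ys)) (≡.sym (ℚₚ.+-assoc (w x) _ _))

  wsum-*ˡ : ∀ c w xs → wsum (λ x → c ℚ.* w x) xs ≡ c ℚ.* wsum w xs
  wsum-*ˡ c w []       = ≡.sym (ℚₚ.*-zeroʳ c)
  wsum-*ˡ c w (x ∷ xs) = ≡.trans (cong (c ℚ.* w x ℚ.+_) (wsum-*ˡ c w xs)) (≡.sym (ℚₚ.*-distribˡ-+ c (w x) (wsum w xs)))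

  wsum-*ʳ : ∀ c w xs → wsum (λ x → w x ℚ.* c) xs ≡ wsum w xs ℚ.* c
  wsum-*ʳ c w xs = ≡.trans (wsum-cong (λ x → ℚₚ.*-comm (w x) c) xs) (≡.trans (wsum-*ˡ c w xs) (ℚₚ.*-comm c _))

  wsum-+ : ∀ v w xs → wsum (λ x → v x ℚ.+ w x) xs ≡ wsum v xs ℚ.+ wsum w xs
  wsum-+ v w []       = ≡.refl
  wsum-+ v w (x ∷ xs) = ≡.trans (cong (v x ℚ.+ w x ℚ.+_) (wsum-+ v w xs))
    (+-*-Solver.solve 4 (λ a b c d → (a :+′ b) :+′ (c :+′ d) :=′ (a :+′ c) :+′ (b :+′ d)) ≡.refl (v x) (w x) (wsum v xs) (wsum w xs))
    where open +-*-Solver using () renaming (_:=_ to _:=′_; _:+_ to _:+′_)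

  wsum-applyUpTo : ∀ w (f : ℕ → X) n → wsum w (List.applyUpTo f (suc n)) ≡ sumTo n (λ i → w (f i))
  wsum-applyUpTo w f zero    = ℚₚ.+-identityʳ (w (f 0))
  wsum-applyUpTo w f (suc n) = ≡.trans (cong (w (f 0) ℚ.+_) (wsum-applyUpTo w (λ i → f (suc i)) n)) (≡.sym (sumTo-head n λ i → w (f i)))

  module _ {Q : X → Set} (Q? : ∀ x → Dec (Q x)) where
    indicator : X → ℚ
    indicator x = if ⌊ Q? x ⌋ then 1ℚ else 0ℚ

    wsum-filter : ∀ w xs → wsum w (List.filter Q? xs) ≡ wsum (λ x → if ⌊ Q? x ⌋ then w x else 0ℚ) xs
    wsum-filter w []       = ≡.refl
    wsum-filter w (x ∷ xs) with Q? x
    ... | yes _ = cong (w x ℚ.+_) (wsum-filter w xs)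
    ... | no _  = ≡.trans (wsum-filter w xs) (≡.sym (ℚₚ.+-identityˡ _))

    length-filter : ∀ xs → + List.length (List.filter Q? xs) / 1 ≡ wsum indicator xs
    length-filter []       = ≡.refl
    length-filter (x ∷ xs) with Q? x
    ... | no _  = ≡.trans (length-filter xs) (≡.sym (ℚₚ.+-identityˡ _))
    ... | yes _ = ≡.trans (ℤtoℚ-/ (+ suc n)) (≡.trans (ℤtoℚ-+ (+ 1) (+ n)) (cong (1ℚ ℚ.+_) (≡.trans (≡.sym (ℤtoℚ-/ (+ n))) (length-filter xs))))
      where n = List.length (List.filter Q? xs)

module _ {X Y : Set} where
  wsum-map : ∀ (w : Y → ℚ) (f : X → Y) xs → wsum w (List.map f xs) ≡ wsum (λ x → w (f x)) xs
  wsum-map w f []       = ≡.refl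
  wsum-map w f (x ∷ xs) = cong (w (f x) ℚ.+_) (wsum-map w f xs)

  wsum-concatMap : ∀ (w : Y → ℚ) (f : X → List Y) xs → wsum w (List.concatMap f xs) ≡ wsum (λ x → wsum w (f x)) xs
  wsum-concatMap w f []       = ≡.refl
  wsum-concatMap w f (x ∷ xs) = ≡.trans (wsum-++ w (f x) (List.concatMap f xs)) (cong (wsum w (f x) ℚ.+_) (wsum-concatMap w f xs))

sumTo-extend : ∀ d t f → (∀ i → t < i → f i ≡ 0ℚ) → sumTo (d + t) f ≡ sumTo t f
sumTo-extend zero    t f z = ≡.refl
sumTo-extend (suc d) t f z = ≡.trans (cong₂ ℚ._+_ (sumTo-extend d t f z) (z (suc (d + t)) (s≤s (m≤n+m t d)))) (ℚₚ.+-identityʳ _)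

-- The generating function of the odd partitions with parts at most 2D + 1, weighted by
-- a function of the number of parts
A : ℕ → (ℕ → ℚ) → Series
A D w s = wsum (λ r → w (List.length r)) (oddPartitions D s)

A-zero : ∀ w → A 0 w ≋ K (w 0) ⊞ q^ 1 ∙ A 0 (λ k → w (suc k))
A-zero w = by-cases 1 (λ { zero _ → low ; (suc _) (s≤s ()) }) (λ n → high n)
  where
    value : ∀ w s → A 0 w s ≡ w s
    value w s = ≡.trans (ℚₚ.+-identityʳ _) (cong w (Listₚ.length-replicate s))
    opaque
      unfolding _⊞_
      low : A 0 w 0 ≡ (K (w 0) ⊞ q^ 1 ∙ A 0 (λ k → w (suc k))) 0
      low = ≡.trans (value w 0) (≡.sym (≡.trans (cong (w 0 ℚ.+_) (q^-low 1 (A 0 (λ k → w (suc k))) 0 (s≤s z≤n))) (ℚₚ.+-identityʳ (w 0))))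
      high : ∀ n → A 0 w (suc n) ≡ (K (w 0) ⊞ q^ 1 ∙ A 0 (λ k → w (suc k))) (suc n)
      high n = ≡.trans (value w (suc n)) (≡.sym (≡.trans (ℚₚ.+-identityˡ _) (≡.trans (q^-at 1 (A 0 (λ k → w (suc k))) n) (value (λ k → w (suc k)) n))))

module _ (D : ℕ) where
  private
    p : ℕ
    p = suc (2 * suc D)

    h : (ℕ → ℚ) → ℕ → ℕ → ℚ
    h w s m = if ⌊ m * p ℕ.≤? s ⌋ then A D (λ k → w (m + k)) (s ∸ m * p) else 0ℚ

    h-yes : ∀ w s m → m * p ≤ s → h w s m ≡ A D (λ k → w (m + k)) (s ∸ m * p)
    h-yes w s m le with m * p ℕ.≤? s
    ... | yes _ = ≡.refl
    ... | no n  = ⊥-elim (n le)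

    h-no : ∀ w s m → ¬ (m * p ≤ s) → h w s m ≡ 0ℚ
    h-no w s m n with m * p ℕ.≤? s
    ... | yes le = ⊥-elim (n le)
    ... | no _   = ≡.refl

    A-sum : ∀ w s → A (suc D) w s ≡ sumTo s (h w s)
    A-sum w s = ≡.trans (wsum-concatMap (λ r → w (List.length r)) blockList (List.filter (λ m → m * p ℕ.≤? s) (List.upTo (suc s))))
      (≡.trans (wsum-filter (λ m → m * p ℕ.≤? s) block (List.upTo (suc s)))
      (≡.trans (wsum-applyUpTo (λ m → if ⌊ m * p ℕ.≤? s ⌋ then block m else 0ℚ) (λ m → m) s) (sumTo-cong s λ m _ → inner m)))
      where
        blockList : ℕ → List (List ℕ)
        blockList m = List.map (λ r → List.replicate m p ++ r) (oddPartitions D (s ∸ m * p))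
        block : ℕ → ℚ
        block m = wsum (λ r → w (List.length r)) (blockList m)
        parts : ∀ m → block m ≡ A D (λ k → w (m + k)) (s ∸ m * p)
        parts m = ≡.trans (wsum-map _ _ (oddPartitions D (s ∸ m * p))) (wsum-cong (λ r → cong w (≡.trans (Listₚ.length-++ (List.replicate m p)) (cong (_+ List.length r) (Listₚ.length-replicate m)))) (oddPartitions D (s ∸ m * p)))
        inner : ∀ m → (if ⌊ m * p ℕ.≤? s ⌋ then block m else 0ℚ) ≡ h w s m
        inner m = cong (λ x → if ⌊ m * p ℕ.≤? s ⌋ then x else 0ℚ) (parts m)

    too-big : ∀ s m → s < p → ¬ (suc m * p ≤ s)
    too-big s m s<p le = ℕₚ.<⇒≱ s<p (≤-trans (m≤m+n p (m * p)) le)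

    head-term : ∀ w s → h w s 0 ≡ A D w s
    head-term w s = h-yes w s 0 z≤n

    shift-term : ∀ w t m → h w (p + t) (suc m) ≡ h (λ k → w (suc k)) t m
    shift-term w t m with m * p ℕ.≤? t
    ... | yes le = ≡.trans (h-yes w (p + t) (suc m) (ℕₚ.+-monoʳ-≤ p le)) (cong (A D (λ k → w (suc (m + k)))) (ℕₚ.[m+n]∸[m+o]≡n∸o p t (m * p)))
    ... | no n   = h-no w (p + t) (suc m) λ le → n (ℕₚ.+-cancelˡ-≤ p (m * p) t le)

  -- In the sum over the multiplicity of the part 2D + 3, multiplicity 0 leaves `A D w`; removing
  -- one copy from a positive multiplicity lowers the sum by 2D + 3 and shifts the weight by one
  -- part.
  A-suc : ∀ w → A (suc D) w ≋ A D w ⊞ q^ (1 + 2 * suc D) ∙ A (suc D) (λ k → w (suc k))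
  A-suc w = by-cases p low high
    where
      w′ : ℕ → ℚ
      w′ k = w (suc k)
      small-sum : ∀ s → s < p → sumTo s (h w s) ≡ A D w s
      small-sum zero    s<p = head-term w 0
      small-sum (suc s) s<p = ≡.trans (sumTo-head s (h w (suc s))) (≡.trans (cong₂ ℚ._+_ (head-term w (suc s)) (sumTo-0 s λ m _ → h-no w (suc s) (suc m) (too-big (suc s) m s<p))) (ℚₚ.+-identityʳ _))
      large-sum : ∀ t → sumTo (p + t) (h w (p + t)) ≡ A D w (p + t) ℚ.+ sumTo t (h w′ t)
      large-sum t = ≡.trans (sumTo-head (2 * suc D + t) (h w (p + t))) (cong₂ ℚ._+_ (head-term w (p + t))
        (≡.trans (sumTo-cong (2 * suc D + t) λ m _ → shift-term w t m)
          (sumTo-extend (2 * suc D) t (h w′ t) λ m t<m → h-no w′ t m λ le → ℕₚ.<⇒≱ t<m (≤-trans (ℕₚ.m≤m*n m p) le))))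
      opaque
        unfolding _⊞_
        low : ∀ s → s < p → A (suc D) w s ≡ (A D w ⊞ q^ p ∙ A (suc D) w′) s
        low s s<p = ≡.trans (A-sum w s) (≡.trans (small-sum s s<p) (≡.sym (≡.trans (cong (A D w s ℚ.+_) (q^-low p (A (suc D) w′) s s<p)) (ℚₚ.+-identityʳ _))))
        high : ∀ t → A (suc D) w (p + t) ≡ (A D w ⊞ q^ p ∙ A (suc D) w′) (p + t)
        high t = ≡.trans (A-sum w (p + t)) (≡.trans (large-sum t) (cong (A D w (p + t) ℚ.+_) (≡.sym (≡.trans (q^-at p (A (suc D) w′) t) (A-sum w′ t)))))

-- Indicators of the residues modulo 4, defined through each other so that `δ₀ (suc n)` computes to
-- `δ₃ n`. The shifted weights in `A-zero` and `A-suc` are then again members of the list.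
δ₀ δ₁ δ₂ δ₃ : ℕ → ℚ
δ₀ zero    = 1ℚ
δ₀ (suc n) = δ₃ n
δ₁ zero    = 0ℚ
δ₁ (suc n) = δ₀ n
δ₂ zero    = 0ℚ
δ₂ (suc n) = δ₁ n
δ₃ zero    = 0ℚ
δ₃ (suc n) = δ₂ n

-- With a(ζ) = a₀ + a₁ ζ + a₂ ζ² + a₃ ζ³ these are a(1)², a(-1)² and a(i) a(-i).
γ₊ γ₋ γ₀ : Series → Series → Series → Series → Series
γ₊ a₀ a₁ a₂ a₃ = (a₀ ⊞ a₂ ⊞ (a₁ ⊞ a₃)) ∙ (a₀ ⊞ a₂ ⊞ (a₁ ⊞ a₃))
γ₋ a₀ a₁ a₂ a₃ = (a₀ ⊞ a₂ ⊟ (a₁ ⊞ a₃)) ∙ (a₀ ⊞ a₂ ⊟ (a₁ ⊞ a₃))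
γ₀ a₀ a₁ a₂ a₃ = (a₀ ⊟ a₂) ∙ (a₀ ⊟ a₂) ⊞ (a₁ ⊟ a₃) ∙ (a₁ ⊟ a₃)

-- The hypotheses say a(ζ) = (1 - y ζ) b(ζ) modulo ζ⁴ - 1. Evaluation at 1, at -1 and at the pair ±i
-- gives the factors (1 - y)², (1 + y)² and 1 + y², the denominators for X = 2, -2 and 0, written in
-- the form to which `denom` unfolds.
module _ {y a₀ a₁ a₂ a₃ b₀ b₁ b₂ b₃ : Series}
  (p₀ : b₀ ≋ a₀ ⊞ y ∙ b₃) (p₁ : b₁ ≋ a₁ ⊞ y ∙ b₀) (p₂ : b₂ ≋ a₂ ⊞ y ∙ b₁) (p₃ : b₃ ≋ a₃ ⊞ y ∙ b₂) where
  private
    back : ∀ {b a c} → b ≋ a ⊞ y ∙ c → a ≋ b ⊟ y ∙ c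
    back {b} {a} {c} p = ≋-sym (≋-trans (⊞-cong p ≋-refl) (solve 2 (λ a x → a :+ x :- x := a) ≋-refl a (y ∙ c)))

    four : ∀ (F : Series → Series → Series → Series → Series) → (∀ {a a′ b b′ c c′ d d′} → a ≋ a′ → b ≋ b′ → c ≋ c′ → d ≋ d′ → F a b c d ≋ F a′ b′ c′ d′) →
      F a₀ a₁ a₂ a₃ ≋ F (b₀ ⊟ y ∙ b₃) (b₁ ⊟ y ∙ b₀) (b₂ ⊟ y ∙ b₁) (b₃ ⊟ y ∙ b₂)
    four F c = c (back p₀) (back p₁) (back p₂) (back p₃)

  γ₊-step : γ₊ b₀ b₁ b₂ b₃ ∙ (𝟙 ∙ (𝟙 ⊞ y ∙ y) ⊟ 𝟙 ∙ y ∙ two) ≋ γ₊ a₀ a₁ a₂ a₃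
  γ₊-step = ≋-sym (≋-trans (four γ₊ λ p r s t → ∙-cong (⊞-cong (⊞-cong p s) (⊞-cong r t)) (⊞-cong (⊞-cong p s) (⊞-cong r t)))
    (solve 5 (λ y a b c d → let s = a :- y :* d :+ (c :- y :* b) :+ (b :- y :* a :+ (d :- y :* c)); t = a :+ c :+ (b :+ d) in
      s :* s := t :* t :* (′ 1 :* (′ 1 :+ y :* y) :- ′ 1 :* y :* (′ 1 :+ ′ 1))) ≋-refl y b₀ b₁ b₂ b₃))

  γ₋-step : γ₋ b₀ b₁ b₂ b₃ ∙ (𝟙 ∙ (𝟙 ⊞ y ∙ y) ⊟ 𝟙 ∙ y ∙ ~ two) ≋ γ₋ a₀ a₁ a₂ a₃
  γ₋-step = ≋-sym (≋-trans (four γ₋ λ p r s t → ∙-cong (⊞-cong (⊞-cong p s) (~-cong (⊞-cong r t))) (⊞-cong (⊞-cong p s) (~-cong (⊞-cong r t))))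
    (solve 5 (λ y a b c d → let s = a :- y :* d :+ (c :- y :* b) :- (b :- y :* a :+ (d :- y :* c)); t = a :+ c :- (b :+ d) in
      s :* s := t :* t :* (′ 1 :* (′ 1 :+ y :* y) :- ′ 1 :* y :* (⊝ (′ 1 :+ ′ 1)))) ≋-refl y b₀ b₁ b₂ b₃))

  γ₀-step : γ₀ b₀ b₁ b₂ b₃ ∙ (𝟙 ∙ (𝟙 ⊞ y ∙ y) ⊟ 𝟙 ∙ y ∙ 𝟘) ≋ γ₀ a₀ a₁ a₂ a₃
  γ₀-step = ≋-sym (≋-trans (four γ₀ λ p r s t → ⊞-cong (∙-cong (⊞-cong p (~-cong s)) (⊞-cong p (~-cong s))) (∙-cong (⊞-cong r (~-cong t)) (⊞-cong r (~-cong t))))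
    (solve 5 (λ y a b c d → let s = a :- y :* d :- (c :- y :* b); s′ = b :- y :* a :- (d :- y :* c); t = a :- c; t′ = b :- d in
      s :* s :+ s′ :* s′ := (t :* t :+ t′ :* t′) :* (′ 1 :* (′ 1 :+ y :* y) :- ′ 1 :* y :* ′ 0)) ≋-refl y b₀ b₁ b₂ b₃))

rows : (Series → Series → Series → Series → Series) → ℕ → Series
rows γ D = γ (A D δ₀) (A D δ₁) (A D δ₂) (A D δ₃)

rows-product : ∀ γ X → γ 𝟙 𝟘 𝟘 𝟘 ≋ 𝟙 →
  (∀ {y a₀ a₁ a₂ a₃ b₀ b₁ b₂ b₃} → b₀ ≋ a₀ ⊞ y ∙ b₃ → b₁ ≋ a₁ ⊞ y ∙ b₀ → b₂ ≋ a₂ ⊞ y ∙ b₁ → b₃ ≋ a₃ ⊞ y ∙ b₂ →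
    γ b₀ b₁ b₂ b₃ ∙ (𝟙 ∙ (𝟙 ⊞ y ∙ y) ⊟ 𝟙 ∙ y ∙ X) ≋ γ a₀ a₁ a₂ a₃) →
  ∀ D → rows γ D ≋ Π< (suc D) (λ i → denom X 𝟙 (1 + 2 * i) ⁻¹)
rows-product γ X start step D = ≋-trans (solved D) (product D)
  where
    E : ℕ → Series
    E i = denom X 𝟙 (1 + 2 * i)
    unitE : ∀ i → Unit (E i)
    unitE i = Unit-denom X 𝟙 (s≤s z≤n)
    before : ℕ → Series
    before zero    = 𝟙
    before (suc D) = rows γ D
    solved : ∀ D → rows γ D ≋ before D ∙ E D ⁻¹
    solved zero    = divide (unitE 0) (≋-trans (step (A-zero δ₀) (A-zero δ₁) (A-zero δ₂) (A-zero δ₃)) start)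
    solved (suc D) = divide (unitE (suc D)) (step (A-suc D δ₀) (A-suc D δ₁) (A-suc D δ₂) (A-suc D δ₃))
    product : ∀ D → before D ∙ E D ⁻¹ ≋ Π< (suc D) (λ i → E i ⁻¹)
    product zero    = ≋-refl
    product (suc D) = ∙-cong (≋-trans (solved D) (product D)) ≋-refl

-- The bottom length selects a residue r, for which w_r tests the top length. As a sum of products,
-- this form of the rank condition separates the two rows.
χ : (w₀ w₁ w₂ w₃ : ℕ → ℚ) → ℕ → ℕ → ℚ
χ w₀ w₁ w₂ w₃ s t = w₀ s ℚ.* δ₀ t ℚ.+ w₁ s ℚ.* δ₁ t ℚ.+ w₂ s ℚ.* δ₂ t ℚ.+ w₃ s ℚ.* δ₃ t

private
  rankIndicator : ℤ → ℕ → ℕ → ℚ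
  rankIndicator a s t = if ⌊ ((+ s ℤ.- + t) %ℕ 4) ℕ.≟ (a %ℕ 4) ⌋ then 1ℚ else 0ℚ

  rank-suc : ∀ a s t → rankIndicator a (suc s) (suc t) ≡ rankIndicator a s t
  rank-suc a s t = cong (λ r → if ⌊ (r %ℕ 4) ℕ.≟ (a %ℕ 4) ⌋ then 1ℚ else 0ℚ)
    (≡.trans (ℤₚ.m-n≡m⊖n (suc s) (suc t)) (≡.trans (ℤₚ.[1+m]⊖[1+n]≡m⊖n s t) (≡.sym (ℤₚ.m-n≡m⊖n s t))))

  rotate : ∀ a b c d → d ℚ.+ a ℚ.+ b ℚ.+ c ≡ a ℚ.+ b ℚ.+ c ℚ.+ d
  rotate = +-*-Solver.solve 4 (λ a b c d → d :+′ a :+′ b :+′ c :=′ a :+′ b :+′ c :+′ d) ≡.refl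
    where open +-*-Solver using () renaming (_:=_ to _:=′_; _:+_ to _:+′_)

-- Shortening both rows by one entry keeps the rank and rotates the four products, so one row may be
-- taken empty; then both sides have period 4.
rank-0 : ∀ s t → rankIndicator (+ 0) s t ≡ χ δ₀ δ₁ δ₂ δ₃ s t
rank-0 (suc s) (suc t) = ≡.trans (rank-suc (+ 0) s t) (≡.trans (rank-0 s t) (≡.sym (rotate (δ₀ s ℚ.* δ₀ t) (δ₁ s ℚ.* δ₁ t) (δ₂ s ℚ.* δ₂ t) (δ₃ s ℚ.* δ₃ t))))
rank-0 0 0 = ≡.refl
rank-0 1 0 = ≡.refl
rank-0 2 0 = ≡.refl
rank-0 3 0 = ≡.refl
rank-0 (suc (suc (suc (suc s)))) 0 = rank-0 s 0
rank-0 0 1 = ≡.refl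
rank-0 0 2 = ≡.refl
rank-0 0 3 = ≡.refl
rank-0 0 4 = ≡.refl
-- The period starts at t = 1: for t = 0 the rank is not negative, and its remainder is computed by
-- another clause.
rank-0 0 (suc (suc (suc (suc (suc t))))) = rank-0 0 (suc t)

rank-1 : ∀ s t → rankIndicator (+ 1) s t ≡ χ δ₁ δ₂ δ₃ δ₀ s t
rank-1 (suc s) (suc t) = ≡.trans (rank-suc (+ 1) s t) (≡.trans (rank-1 s t) (≡.sym (rotate (δ₁ s ℚ.* δ₀ t) (δ₂ s ℚ.* δ₁ t) (δ₃ s ℚ.* δ₂ t) (δ₀ s ℚ.* δ₃ t))))
rank-1 0 0 = ≡.refl
rank-1 1 0 = ≡.refl
rank-1 2 0 = ≡.refl
rank-1 3 0 = ≡.refl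
rank-1 (suc (suc (suc (suc s)))) 0 = rank-1 s 0
rank-1 0 1 = ≡.refl
rank-1 0 2 = ≡.refl
rank-1 0 3 = ≡.refl
rank-1 0 4 = ≡.refl
rank-1 0 (suc (suc (suc (suc (suc t))))) = rank-1 0 (suc t)

rank-2 : ∀ s t → rankIndicator (+ 2) s t ≡ χ δ₂ δ₃ δ₀ δ₁ s t
rank-2 (suc s) (suc t) = ≡.trans (rank-suc (+ 2) s t) (≡.trans (rank-2 s t) (≡.sym (rotate (δ₂ s ℚ.* δ₀ t) (δ₃ s ℚ.* δ₁ t) (δ₀ s ℚ.* δ₂ t) (δ₁ s ℚ.* δ₃ t))))
rank-2 0 0 = ≡.refl
rank-2 1 0 = ≡.refl
rank-2 2 0 = ≡.refl
rank-2 3 0 = ≡.refl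
rank-2 (suc (suc (suc (suc s)))) 0 = rank-2 s 0
rank-2 0 1 = ≡.refl
rank-2 0 2 = ≡.refl
rank-2 0 3 = ≡.refl
rank-2 0 4 = ≡.refl
rank-2 0 (suc (suc (suc (suc (suc t))))) = rank-2 0 (suc t)

𝒩 : ℤ → Series
𝒩 a n = + N⁰ a 4 n / 1

module _ (a : ℤ) (w₀ w₁ w₂ w₃ : ℕ → ℚ) (rank : ∀ s t → rankIndicator a s t ≡ χ w₀ w₁ w₂ w₃ s t) where
  private
    pairs : ℕ → Series
    pairs D = A D w₀ ∙ A D δ₀ ⊞ A D w₁ ∙ A D δ₁ ⊞ A D w₂ ∙ A D δ₂ ⊞ A D w₃ ∙ A D δ₃

    len : List ℕ → ℕ
    len = List.length

    two-rows : ∀ D M (f : ℕ → ℕ → ℚ) → ℚ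
    two-rows D M f = sumTo M (λ r → wsum (λ top → wsum (λ bot → f (len top) (len bot)) (oddPartitions D (M ∸ r))) (oddPartitions D r))

    two-rows-product : ∀ D M w u → two-rows D M (λ s t → w s ℚ.* u t) ≡ (A D w ⊛ A D u) M
    two-rows-product D M w u = sumTo-cong M λ r _ → ≡.trans (wsum-cong (λ top → wsum-*ˡ (w (len top)) (λ bot → u (len bot)) (oddPartitions D (M ∸ r))) (oddPartitions D r))
      (wsum-*ʳ (A D u (M ∸ r)) (λ top → w (len top)) (oddPartitions D r))

    two-rows-+ : ∀ D M f g → two-rows D M (λ s t → f s t ℚ.+ g s t) ≡ two-rows D M f ℚ.+ two-rows D M g
    two-rows-+ D M f g = ≡.trans (sumTo-cong M λ r _ → ≡.trans (wsum-cong (λ top → wsum-+ (λ bot → f (len top) (len bot)) (λ bot → g (len top) (len bot)) (oddPartitions D (M ∸ r))) (oddPartitions D r))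
        (wsum-+ (λ top → wsum (λ bot → f (len top) (len bot)) (oddPartitions D (M ∸ r))) (λ top → wsum (λ bot → g (len top) (len bot)) (oddPartitions D (M ∸ r))) (oddPartitions D r)))
      (sumTo-+ M _ _)

    opaque
      unfolding _⊞_
      two-rows-χ : ∀ D M → two-rows D M (χ w₀ w₁ w₂ w₃) ≡ pairs D M
      two-rows-χ D M = ≡.trans (two-rows-+ D M (λ s t → w₀ s ℚ.* δ₀ t ℚ.+ w₁ s ℚ.* δ₁ t ℚ.+ w₂ s ℚ.* δ₂ t) (λ s t → w₃ s ℚ.* δ₃ t)) (cong₂ ℚ._+_
        (≡.trans (two-rows-+ D M (λ s t → w₀ s ℚ.* δ₀ t ℚ.+ w₁ s ℚ.* δ₁ t) (λ s t → w₂ s ℚ.* δ₂ t)) (cong₂ ℚ._+_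
          (≡.trans (two-rows-+ D M (λ s t → w₀ s ℚ.* δ₀ t) (λ s t → w₁ s ℚ.* δ₁ t)) (cong₂ ℚ._+_ (two-rows-product D M w₀ δ₀) (two-rows-product D M w₁ δ₁)))
          (two-rows-product D M w₂ δ₂)))
        (two-rows-product D M w₃ δ₃))

    q^-if : ∀ c f n → (if ⌊ c ℕ.≤? n ⌋ then f (n ∸ c) else 0ℚ) ≡ (q^ c ∙ f) n
    q^-if c f n with c ℕ.≤? n
    ... | yes le = ≡.trans (≡.sym (q^-at c f (n ∸ c))) (cong (q^ c ∙ f) (ℕₚ.m+[n∸m]≡n le))
    ... | no gt  = ≡.sym (q^-low c f n (ℕₚ.≰⇒> gt))

    ind : OddDurfee → ℚ
    ind = indicator (λ σ → (oddRank σ %ℕ 4) ℕ.≟ (a %ℕ 4))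

    withTop : ℕ → ℕ → List ℕ → List OddDurfee
    withTop D M top = List.map (λ bot → D , top , bot) (oddPartitions D M)

    withSplit : ℕ → ℕ → ℕ → List OddDurfee
    withSplit D M r = List.concatMap (withTop D (M ∸ r)) (oddPartitions D r)

    withD : ℕ → ℕ → List OddDurfee
    withD M D = List.concatMap (withSplit D M) (List.upTo (suc M))

    withD-sum : ∀ D M → wsum ind (withD M D) ≡ pairs D M
    withD-sum D M = ≡.trans (wsum-concatMap ind (withSplit D M) (List.upTo (suc M))) (≡.trans (wsum-applyUpTo (λ r → wsum ind (withSplit D M r)) (λ r → r) M)
      (≡.trans (sumTo-cong M λ r _ → ≡.trans (wsum-concatMap ind (withTop D (M ∸ r)) (oddPartitions D r)) (wsum-cong (λ top →
        ≡.trans (wsum-map ind (λ bot → D , top , bot) (oddPartitions D (M ∸ r))) (wsum-cong (λ bot → rank (len top) (len bot)) (oddPartitions D (M ∸ r)))) (oddPartitions D r)))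
      (two-rows-χ D M)))

    symbols : ∀ n → 𝒩 a n ≡ sumInf (λ D → q^ (core D) ∙ pairs D) n
    symbols n = ≡.trans (length-filter (λ σ → (oddRank σ %ℕ 4) ℕ.≟ (a %ℕ 4)) (oddDurfeeSymbols n))
      (≡.trans (wsum-concatMap ind (λ D → withD (n ∸ core D) D) (List.filter (λ D → core D ℕ.≤? n) (List.upTo (suc n))))
      (≡.trans (wsum-filter (λ D → core D ℕ.≤? n) (λ D → wsum ind (withD (n ∸ core D) D)) (List.upTo (suc n)))
      (≡.trans (wsum-applyUpTo (λ D → if ⌊ core D ℕ.≤? n ⌋ then wsum ind (withD (n ∸ core D) D) else 0ℚ) (λ D → D) n)
      (sumTo-cong n λ D _ → ≡.trans (cong (λ x → if ⌊ core D ℕ.≤? n ⌋ then x else 0ℚ) (withD-sum D (n ∸ core D))) (q^-if (core D) (pairs D) n)))))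

  𝒩-sum : 𝒩 a ≋ ∑ (λ D → q^ (core D) ∙ pairs D)
  𝒩-sum = ≋-trans (pw symbols) (sumInf-∑ core (λ D → ≋-refl) λ D → ≤-trans (≤-trans (m≤m+n D (1 * D)) (m≤n+m (2 * D) (2 * D * D))) (m≤m+n _ 1))

private
  core≡ : ∀ D → core D ≡ 1 + 2 * (D * (D + 1))
  core≡ = shuffle
    where
      shuffle : ∀ D → 2 * D * D + 2 * D + 1 ≡ 1 + 2 * (D * (D + 1))
      shuffle = solve-∀

  core-small : ∀ F → Small (λ D → q^ (core D) ∙ F D)
  core-small F = Small-q^ core F λ k → ≤-trans (ℕₚ.n≤1+n k) (≤-trans (≤-trans (m≤m+n (suc k) (1 * suc k)) (m≤n+m (2 * suc k) (2 * suc k * suc k))) (m≤m+n _ 1))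

  rows-sum : ∀ γ X → (∀ D → rows γ D ≋ Π< (suc D) (λ i → denom X 𝟙 (1 + 2 * i) ⁻¹)) → ∑ (λ D → q^ (core D) ∙ rows γ D) ≋ q^ 1 ∙ Ω X
  rows-sum γ X p = ≋-trans (∑-cong λ D → ≋-trans (∙-cong (≋-trans (q^-cong (core≡ D)) (q^-+ 1 _)) (p D)) (∙-assoc _ _ _)) (≋-sym (∑-∙ (q^ 1) (OmegaT.eulerian-small X)))

  total₊ : ∑ (λ D → q^ (core D) ∙ rows γ₊ D) ≋ q^ 1 ∙ Ω₊
  total₊ = rows-sum γ₊ two (rows-product γ₊ two (solve 0 ((′ 1 :+ ′ 0 :+ (′ 0 :+ ′ 0)) :* (′ 1 :+ ′ 0 :+ (′ 0 :+ ′ 0)) := ′ 1) ≋-refl) γ₊-step)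

  total₋ : ∑ (λ D → q^ (core D) ∙ rows γ₋ D) ≋ q^ 1 ∙ Ω₋
  total₋ = rows-sum γ₋ (~ two) (rows-product γ₋ (~ two) (solve 0 ((′ 1 :+ ′ 0 :- (′ 0 :+ ′ 0)) :* (′ 1 :+ ′ 0 :- (′ 0 :+ ′ 0)) := ′ 1) ≋-refl) γ₋-step)

  total₀ : ∑ (λ D → q^ (core D) ∙ rows γ₀ D) ≋ q^ 1 ∙ Ω 𝟘
  total₀ = rows-sum γ₀ 𝟘 (rows-product γ₀ 𝟘 (solve 0 ((′ 1 :- ′ 0) :* (′ 1 :- ′ 0) :+ (′ 0 :- ′ 0) :* (′ 0 :- ′ 0) := ′ 1) ≋-refl) γ₀-step)

  𝒩₀ : 𝒩 (+ 0) ≋ ∑ _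
  𝒩₀ = 𝒩-sum (+ 0) δ₀ δ₁ δ₂ δ₃ rank-0

  𝒩₁ : 𝒩 (+ 1) ≋ ∑ _
  𝒩₁ = 𝒩-sum (+ 1) δ₁ δ₂ δ₃ δ₀ rank-1

  𝒩₂ : 𝒩 (+ 2) ≋ ∑ _
  𝒩₂ = 𝒩-sum (+ 2) δ₂ δ₃ δ₀ δ₁ rank-2

  -- Orthogonality modulo 4, for each D separately: the classes of the rank are recovered from
  -- a(1)², a(-1)² and a(i) a(-i), which are the `γ₊`, `γ₋` and `γ₀` of the rows.
  𝒩-plus : two ∙ (𝒩 (+ 0) ⊞ 𝒩 (+ 2)) ≋ q^ 1 ∙ Ω₊ ⊞ q^ 1 ∙ Ω₋
  𝒩-plus = ≋-trans (∙-cong ≋-refl (≋-trans (⊞-cong 𝒩₀ 𝒩₂) (≋-sym (∑-⊞ _ _)))) (≋-trans (∑-∙ two (Small-⊞ (core-small _) (core-small _)))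
    (≋-trans (∑-cong λ D → solve 5 (λ q a b c d → (′ 1 :+ ′ 1) :* (q :* (a :* a :+ b :* b :+ c :* c :+ d :* d) :+ q :* (c :* a :+ d :* b :+ a :* c :+ b :* d)) :=
        q :* ((a :+ c :+ (b :+ d)) :* (a :+ c :+ (b :+ d))) :+ q :* ((a :+ c :- (b :+ d)) :* (a :+ c :- (b :+ d)))) ≋-refl (q^ (core D)) (A D δ₀) (A D δ₁) (A D δ₂) (A D δ₃))
    (≋-trans (∑-⊞ _ _) (⊞-cong total₊ total₋))))

  𝒩-minus : 𝒩 (+ 0) ⊟ 𝒩 (+ 2) ≋ q^ 1 ∙ Ω 𝟘
  𝒩-minus = ≋-trans (⊞-cong 𝒩₀ (~-cong 𝒩₂)) (≋-trans (≋-sym (∑-⊟ _ _)) (≋-trans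
    (∑-cong λ D → solve 5 (λ q a b c d → q :* (a :* a :+ b :* b :+ c :* c :+ d :* d) :- q :* (c :* a :+ d :* b :+ a :* c :+ b :* d) :=
        q :* ((a :- c) :* (a :- c) :+ (b :- d) :* (b :- d))) ≋-refl (q^ (core D)) (A D δ₀) (A D δ₁) (A D δ₂) (A D δ₃)) total₀))

  𝒩-odd : # (+ 4) ∙ 𝒩 (+ 1) ≋ q^ 1 ∙ Ω₊ ⊟ q^ 1 ∙ Ω₋
  𝒩-odd = ≋-trans (∙-cong ≋-refl 𝒩₁) (≋-trans (∑-∙ (# (+ 4)) (core-small _))
    (≋-trans (∑-cong λ D → solve 5 (λ q a b c d → ′ 4 :* (q :* (b :* a :+ c :* b :+ d :* c :+ a :* d)) :=
        q :* ((a :+ c :+ (b :+ d)) :* (a :+ c :+ (b :+ d))) :- q :* ((a :+ c :- (b :+ d)) :* (a :+ c :- (b :+ d)))) ≋-refl (q^ (core D)) (A D δ₀) (A D δ₁) (A D δ₂) (A D δ₃))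
    (≋-trans (∑-⊟ _ _) (⊞-cong total₊ (~-cong total₋)))))

  𝒩-plus′ : 𝒩 (+ 0) ⊞ 𝒩 (+ 2) ≋ q^ 1 ∙ dbl M₊
  𝒩-plus′ = unit-regular (unit-factor (≋-trans (∙-comm two half) half-two)) (≋-trans 𝒩-plus (≋-trans
    (solve 3 (λ x a b → x :* a :+ x :* b := x :* (a :+ b)) ≋-refl (q^ 1) Ω₊ Ω₋) (≋-trans (∙-cong ≋-refl (≋-sym dbl-M₊))
    (solve 3 (λ x t m → x :* (t :* m) := t :* (x :* m)) ≋-refl (q^ 1) two (dbl M₊)))))

  𝒩-minus′ : 𝒩 (+ 0) ⊟ 𝒩 (+ 2) ≋ q^ 1 ∙ dbl M₋
  𝒩-minus′ = ≋-trans 𝒩-minus (∙-cong ≋-refl (≋-sym dbl-M₋))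

-- Rows consist of odd numbers and 2D² + 2D + 1 is odd, so n and the rank have opposite parity: even
-- ranks occur only for odd n, and odd ranks, as in `𝒩-1`, only for even n.
𝒩-0 : 𝒩 (+ 0) ≋ dbl 𝟘 ⊞ q^ 1 ∙ dbl G₀
𝒩-0 = begin
  𝒩 (+ 0)
    ≈⟨ ≋-trans (≋-sym (∙-identityˡ _)) (∙-cong (≋-sym half-two) ≋-refl) ⟩
  half ∙ two ∙ 𝒩 (+ 0)
    ≈⟨ solve 3 (λ h a b → h :* (′ 1 :+ ′ 1) :* a := h :* (a :+ b :+ (a :- b))) ≋-refl half (𝒩 (+ 0)) (𝒩 (+ 2)) ⟩
  half ∙ (𝒩 (+ 0) ⊞ 𝒩 (+ 2) ⊞ (𝒩 (+ 0) ⊟ 𝒩 (+ 2)))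
    ≈⟨ ∙-cong ≋-refl (⊞-cong 𝒩-plus′ 𝒩-minus′) ⟩
  half ∙ (q^ 1 ∙ dbl M₊ ⊞ q^ 1 ∙ dbl M₋)
    ≈⟨ solve 4 (λ h x a b → h :* (x :* a :+ x :* b) := ′ 0 :+ x :* (h :* (a :+ b))) ≋-refl half (q^ 1) (dbl M₊) (dbl M₋) ⟩
  𝟘 ⊞ q^ 1 ∙ (half ∙ (dbl M₊ ⊞ dbl M₋))
    ≈⟨ ⊞-cong (≋-sym (dbl-K 0ℚ)) (∙-cong ≋-refl (≋-sym (≋-trans (dbl-∙ _ _) (∙-cong (dbl-K _) (dbl-⊞ _ _))))) ⟩
  dbl 𝟘 ⊞ q^ 1 ∙ dbl G₀ ∎

𝒩-2 : 𝒩 (+ 2) ≋ dbl 𝟘 ⊞ q^ 1 ∙ dbl G₂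
𝒩-2 = begin
  𝒩 (+ 2)
    ≈⟨ ≋-trans (≋-sym (∙-identityˡ _)) (∙-cong (≋-sym half-two) ≋-refl) ⟩
  half ∙ two ∙ 𝒩 (+ 2)
    ≈⟨ solve 3 (λ h a b → h :* (′ 1 :+ ′ 1) :* b := h :* (a :+ b :- (a :- b))) ≋-refl half (𝒩 (+ 0)) (𝒩 (+ 2)) ⟩
  half ∙ (𝒩 (+ 0) ⊞ 𝒩 (+ 2) ⊟ (𝒩 (+ 0) ⊟ 𝒩 (+ 2)))
    ≈⟨ ∙-cong ≋-refl (⊞-cong 𝒩-plus′ (~-cong 𝒩-minus′)) ⟩
  half ∙ (q^ 1 ∙ dbl M₊ ⊟ q^ 1 ∙ dbl M₋)
    ≈⟨ solve 4 (λ h x a b → h :* (x :* a :- x :* b) := ′ 0 :+ x :* (h :* (a :- b))) ≋-refl half (q^ 1) (dbl M₊) (dbl M₋) ⟩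
  𝟘 ⊞ q^ 1 ∙ (half ∙ (dbl M₊ ⊟ dbl M₋))
    ≈⟨ ⊞-cong (≋-sym (dbl-K 0ℚ)) (∙-cong ≋-refl (≋-sym (≋-trans (dbl-∙ _ _) (∙-cong (dbl-K _) (≋-trans (dbl-⊞ _ _) (⊞-cong ≋-refl (dbl-~ _))))))) ⟩
  dbl 𝟘 ⊞ q^ 1 ∙ dbl G₂ ∎

𝒩-1 : 𝒩 (+ 1) ≋ dbl H ⊞ q^ 1 ∙ dbl 𝟘
𝒩-1 = ≋-trans (unit-regular (Unit-K λ ()) (≋-trans 𝒩-odd (≋-trans (solve 3 (λ x a b → x :* a :- x :* b := x :* (a :- b)) ≋-refl (q^ 1) Ω₊ Ω₋) (≋-sym dbl-H))))
  (≋-trans (solve 2 (λ h x → h := h :+ x :* ′ 0) ≋-refl (dbl H) (q^ 1)) (⊞-cong ≋-refl (∙-cong ≋-refl (≋-sym (dbl-K 0ℚ)))))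

-- The generating functions as Laurent series

private
  Even-cong : ∀ {f g} → f ≋ g → Even f ≋ Even g
  Even-cong p = pw λ n → at p (2 * n)

  Odd-cong : ∀ {f g} → f ≋ g → Odd f ≋ Odd g
  Odd-cong p = pw λ n → at p (suc (2 * n))

  reindex : ∀ a {i j : ℕ → ℕ} → (∀ n → i n ≡ j n) → (λ n → 𝒩 a (i n)) ≋ (λ n → 𝒩 a (j n))
  reindex a p = pw λ n → cong (𝒩 a) (p n)

  unshifted : ∀ a r s {L f} → Rep 0 L f → (λ n → 𝒩 a (r * n + s)) ≋ f → GF a r s ≈ L
  unshifted a r s R p = Rep-≈ R (≋-trans (∙-cong q^-zero p) (∙-identityˡ _))

  polar : ∀ a r s {L f} → Rep 1 L f → q^ 1 ∙ (λ n → 𝒩 a (r * n + s)) ≋ f → GF a r s ≈ L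
  polar a r s R p = Rep-≈ R p

  2n+1 : ∀ n → 2 * n + 1 ≡ suc (2 * n)
  2n+1 = solve-∀
  2n+0 : ∀ n → 2 * n + 0 ≡ 2 * n
  2n+0 = solve-∀
  4n+0 : ∀ n → 4 * n + 0 ≡ 2 * (2 * n)
  4n+0 = solve-∀
  4n+1 : ∀ n → 4 * n + 1 ≡ suc (2 * (2 * n))
  4n+1 = solve-∀
  4n+2 : ∀ n → 4 * n + 2 ≡ 2 * suc (2 * n)
  4n+2 = solve-∀
  4n+3 : ∀ n → 4 * n + 3 ≡ suc (2 * suc (2 * n))
  4n+3 = solve-∀
  8n+0 : ∀ n → 8 * n + 0 ≡ 2 * (2 * (2 * n))
  8n+0 = solve-∀
  8n+1 : ∀ n → 8 * n + 1 ≡ suc (2 * (2 * (2 * n)))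
  8n+1 = solve-∀
  8n+2 : ∀ n → 8 * n + 2 ≡ 2 * suc (2 * (2 * n))
  8n+2 = solve-∀
  8n+3 : ∀ n → 8 * n + 3 ≡ suc (2 * suc (2 * (2 * n)))
  8n+3 = solve-∀
  8n+4 : ∀ n → 8 * n + 4 ≡ 2 * (2 * suc (2 * n))
  8n+4 = solve-∀
  8n+5 : ∀ n → 8 * n + 5 ≡ suc (2 * (2 * suc (2 * n)))
  8n+5 = solve-∀
  8n+6 : ∀ n → 8 * n + 6 ≡ 2 * suc (2 * suc (2 * n))
  8n+6 = solve-∀
  8n+7 : ∀ n → 8 * n + 7 ≡ suc (2 * suc (2 * suc (2 * n)))
  8n+7 = solve-∀

  odd-0 : Odd (𝒩 (+ 0)) ≋ G₀
  odd-0 = odd-part 𝟘 G₀ 𝒩-0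

  odd-2 : Odd (𝒩 (+ 2)) ≋ G₂
  odd-2 = odd-part 𝟘 G₂ 𝒩-2

  even-1 : Even (𝒩 (+ 1)) ≋ H
  even-1 = even-part H 𝟘 𝒩-1

  power : ℕ × ℕ → ℕ × ℕ
  power a = 2 ℕ.^ proj₁ a , proj₂ a

  -- The product inside `ηq` is local to its definition and cannot be the subject of an induction.
  -- On lists of known length it computes to `J-product`, so each shape of quotient has its own
  -- reflexivity proof.
  Quotient : List (ℕ × ℕ) → List (ℕ × ℕ) → Set
  Quotient num den = ser (ηq (List.map power num) (List.map power den)) ≋ J-product num ⊛ inv (J-product den)

  Rep-η : ∀ N D num den n → Quotient num den → List.map power num ≡ N → List.map power den ≡ D →
    Rep 0 (ηq N D) (η ((exponents num ⊹ negate (exponents den)) ++ List.replicate n (+ 0)))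
  Rep-η _ _ num den n p ≡.refl ≡.refl = rep (∙-cong ≋-refl (≋-trans p (eta (≐-pad n (J-quotient num den)))))

  quotient₁₁ : ∀ a b → Quotient (a ∷ []) (b ∷ [])
  quotient₁₁ a b = ≋-refl

  quotient₁₂ : ∀ a b c → Quotient (a ∷ []) (b ∷ c ∷ [])
  quotient₁₂ a b c = ≋-refl

  quotient₂₁ : ∀ a b c → Quotient (a ∷ b ∷ []) (c ∷ [])
  quotient₂₁ a b c = ≋-refl

  quotient₂₂ : ∀ a b c d → Quotient (a ∷ b ∷ []) (c ∷ d ∷ [])
  quotient₂₂ a b c d = ≋-refl

  quotient₂₃ : ∀ a b c d e → Quotient (a ∷ b ∷ []) (c ∷ d ∷ e ∷ [])
  quotient₂₃ a b c d e = ≋-refl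

  quotient₃₁ : ∀ a b c d → Quotient (a ∷ b ∷ c ∷ []) (d ∷ [])
  quotient₃₁ a b c d = ≋-refl

  0<₃ : ∀ {n} → 0 < suc n
  0<₃ = s≤s z≤n

  𝔽₂ : dbl 𝔽 ≋ ∑ (third 2 0<₃)
  𝔽₂ = ≋-trans (dbl-cong 𝔽-third) (third-dbl 1 0<₃ 0<₃)

  𝔽₄ : dbl (dbl 𝔽) ≋ ∑ (third 4 0<₃)
  𝔽₄ = ≋-trans (dbl-cong 𝔽₂) (third-dbl 2 0<₃ 0<₃)

  𝔽₈ : dbl (dbl (dbl 𝔽)) ≋ ∑ (third 8 0<₃)
  𝔽₈ = ≋-trans (dbl-cong 𝔽₄) (third-dbl 4 0<₃ 0<₃)

  𝔽₁₆ : dbl (dbl (dbl (dbl 𝔽))) ≋ ∑ (third 16 0<₃)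
  𝔽₁₆ = ≋-trans (dbl-cong 𝔽₈) (third-dbl 8 0<₃ 0<₃)

  Ω₂ : dbl Ω₋ ≋ ∑ (omega 2 0<₃)
  Ω₂ = ≋-trans (dbl-cong Ω₋-omega) (omega-dbl 1 0<₃ 0<₃)

  Ω₄ : dbl (dbl Ω₋) ≋ ∑ (omega 4 0<₃)
  Ω₄ = ≋-trans (dbl-cong Ω₂) (omega-dbl 2 0<₃ 0<₃)

  Ω₈ : dbl (dbl (dbl Ω₋)) ≋ ∑ (omega 8 0<₃)
  Ω₈ = ≋-trans (dbl-cong Ω₄) (omega-dbl 4 0<₃ 0<₃)

  from-zero : ∀ {s f} → s ≋ f → q^ 0 ∙ s ≋ f
  from-zero p = ≋-trans (∙-cong q^-zero p) (∙-identityˡ _)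

  Rep-g₂ : Rep 0 (g -1ℚ 2 4) (dbl Ω₋)
  Rep-g₂ = rep (from-zero (g-odd-series 2 0<₃ Ω₂))

  Rep-g₄ : Rep 0 (g -1ℚ 4 8) (dbl (dbl Ω₋))
  Rep-g₄ = rep (from-zero (g-odd-series 4 0<₃ Ω₄))

  Rep-g₈ : Rep 0 (g -1ℚ 8 16) (dbl (dbl (dbl Ω₋)))
  Rep-g₈ = rep (from-zero (g-odd-series 8 0<₃ Ω₈))

  two-# : two ≋ # (+ 2)
  two-# = solve 0 (′ 1 :+ ′ 1 := ′ 2) ≋-refl

  eta-Λ₊ : Rep 0 (ηq ((2 , 8) ∷ (8 , 2) ∷ []) ((1 , 4) ∷ (4 , 5) ∷ [])) Λ₊
  eta-Λ₊ = Rep-η ((2 , 8) ∷ (8 , 2) ∷ []) ((1 , 4) ∷ (4 , 5) ∷ []) ((1 , 8) ∷ (3 , 2) ∷ []) ((0 , 4) ∷ (2 , 5) ∷ []) 0 (quotient₂₂ (1 , 8) (3 , 2) (0 , 4) (2 , 5)) ≡.refl ≡.refl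

  eta-Λ₋ : Rep 0 (ηq ((4 , 3) ∷ []) ((2 , 2) ∷ [])) Λ₋
  eta-Λ₋ = Rep-η ((4 , 3) ∷ []) ((2 , 2) ∷ []) ((2 , 3) ∷ []) ((1 , 2) ∷ []) 0 (quotient₁₁ (2 , 3) (1 , 2)) ≡.refl ≡.refl

  eta-Λ₃ : Rep 0 (ηq ((2 , 6) ∷ (4 , 1) ∷ []) ((1 , 4) ∷ (8 , 2) ∷ [])) Λ₃
  eta-Λ₃ = Rep-η ((2 , 6) ∷ (4 , 1) ∷ []) ((1 , 4) ∷ (8 , 2) ∷ []) ((1 , 6) ∷ (2 , 1) ∷ []) ((0 , 4) ∷ (3 , 2) ∷ []) 0 (quotient₂₂ (1 , 6) (2 , 1) (0 , 4) (3 , 2)) ≡.refl ≡.refl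

  eta-B : Rep 0 (ηq ((4 , 6) ∷ []) ((1 , 2) ∷ (2 , 3) ∷ [])) (η (− 2 ∷ − 3 ∷ + 6 ∷ + 0 ∷ []))
  eta-B = Rep-η ((4 , 6) ∷ []) ((1 , 2) ∷ (2 , 3) ∷ []) ((2 , 6) ∷ []) ((0 , 2) ∷ (1 , 3) ∷ []) 1 (quotient₁₂ (2 , 6) (0 , 2) (1 , 3)) ≡.refl ≡.refl

  eta-B₀ : Rep 0 (ηq ((2 , 6) ∷ (4 , 5) ∷ []) ((1 , 8) ∷ (8 , 2) ∷ [])) (η (− 8 ∷ + 6 ∷ + 5 ∷ − 2 ∷ []))
  eta-B₀ = Rep-η ((2 , 6) ∷ (4 , 5) ∷ []) ((1 , 8) ∷ (8 , 2) ∷ []) ((1 , 6) ∷ (2 , 5) ∷ []) ((0 , 8) ∷ (3 , 2) ∷ []) 0 (quotient₂₂ (1 , 6) (2 , 5) (0 , 8) (3 , 2)) ≡.refl ≡.refl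

  eta-B₁ : Rep 0 (ηq ((2 , 8) ∷ (8 , 2) ∷ []) ((1 , 8) ∷ (4 , 1) ∷ [])) (η (− 8 ∷ + 8 ∷ − 1 ∷ + 2 ∷ + 0 ∷ []))
  eta-B₁ = Rep-η ((2 , 8) ∷ (8 , 2) ∷ []) ((1 , 8) ∷ (4 , 1) ∷ []) ((1 , 8) ∷ (3 , 2) ∷ []) ((0 , 8) ∷ (2 , 1) ∷ []) 1 (quotient₂₂ (1 , 8) (3 , 2) (0 , 8) (2 , 1)) ≡.refl ≡.refl

  K-minus-half : K (- (+ 1 / 2)) ≋ ~ half
  K-minus-half = K-neg (+ 1 / 2)

  -- `𝟙 ⊟ two ∙ x` is g(-1) when x is `𝔽` in the matching power of q; the constant -1/2 of the
  -- statement removes half of its leading 1.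
  mock-part : ∀ x → K (- (+ 1 / 2)) ∙ q^ 0 ⊞ half ∙ (𝟙 ⊟ two ∙ x) ≋ ~ x
  mock-part x = begin
    K (- (+ 1 / 2)) ∙ q^ 0 ⊞ half ∙ (𝟙 ⊟ two ∙ x)   ≈⟨ ⊞-cong (∙-cong K-minus-half q^-zero) ≋-refl ⟩
    ~ half ∙ 𝟙 ⊞ half ∙ (𝟙 ⊟ two ∙ x)               ≈⟨ solve 2 (λ h x → ⊝ h :* ′ 1 :+ h :* (′ 1 :- (′ 1 :+ ′ 1) :* x) := ⊝ (h :* (′ 1 :+ ′ 1) :* x)) ≋-refl half x ⟩
    ~ (half ∙ two ∙ x)                              ≈⟨ ~-cong (≋-trans (∙-cong half-two ≋-refl) (∙-identityˡ x)) ⟩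
    ~ x                                             ∎

  two-quarter : two ∙ K quarter ≋ half
  two-quarter = ≋-trans (∙-cong two-# ≋-refl) (≋-sym (K-* (ℤtoℚ (+ 2)) quarter))

  -- The counterpart of `mock-part` for right-hand sides with q⁻¹: these are represented after
  -- multiplication by q, which turns q⁻¹ into 1.
  polar-part : ∀ l x → two ∙ (K quarter ∙ l ⊟ x) ≋ K (- 1ℚ) ∙ 𝟙 ⊞ 𝟙 ∙ (𝟙 ⊟ two ∙ x) ⊞ half ∙ (𝟙 ∙ l)
  polar-part l x = begin
    two ∙ (K quarter ∙ l ⊟ x)                                     ≈⟨ solve 3 (λ k l x → (′ 1 :+ ′ 1) :* (k :* l :- x) := (⊝ ′ 1) :* ′ 1 :+ ′ 1 :* (′ 1 :- (′ 1 :+ ′ 1) :* x) :+ (′ 1 :+ ′ 1) :* k :* (′ 1 :* l)) ≋-refl (K quarter) l x ⟩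
    ~ 𝟙 ∙ 𝟙 ⊞ 𝟙 ∙ (𝟙 ⊟ two ∙ x) ⊞ two ∙ K quarter ∙ (𝟙 ∙ l)       ≈⟨ ⊞-cong (⊞-cong (∙-cong (≋-sym (K-neg 1ℚ)) ≋-refl) ≋-refl) (∙-cong two-quarter ≋-refl) ⟩
    K (- 1ℚ) ∙ 𝟙 ⊞ 𝟙 ∙ (𝟙 ⊟ two ∙ x) ⊞ half ∙ (𝟙 ∙ l)             ∎

  dbl-mixed : ∀ l x → dbl (K quarter ∙ l ⊟ x) ≋ K quarter ∙ dbl l ⊟ dbl x
  dbl-mixed l x = ≋-trans (dbl-⊞ _ _) (⊞-cong (≋-trans (dbl-∙ _ _) (∙-cong (dbl-K _) ≋-refl)) (dbl-~ x))

private
  dbl-Λ₊ : η (+ 0 ∷ − 4 ∷ + 8 ∷ − 5 ∷ + 2 ∷ []) ≋ dbl Λ₊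
  dbl-Λ₊ = ≋-sym (η-dbl (− 4 ∷ + 8 ∷ − 5 ∷ + 2 ∷ []))

  dbl²-Λ₊ : η (+ 0 ∷ + 0 ∷ − 4 ∷ + 8 ∷ − 5 ∷ + 2 ∷ []) ≋ dbl (dbl Λ₊)
  dbl²-Λ₊ = ≋-trans (≋-sym (η-dbl (+ 0 ∷ − 4 ∷ + 8 ∷ − 5 ∷ + 2 ∷ []))) (dbl-cong dbl-Λ₊)

  dbl-Λ₃ : η (+ 0 ∷ − 4 ∷ + 6 ∷ + 1 ∷ − 2 ∷ []) ≋ dbl Λ₃
  dbl-Λ₃ = ≋-sym (η-dbl (− 4 ∷ + 6 ∷ + 1 ∷ − 2 ∷ []))

  dbl²-Λ₃ : η (+ 0 ∷ + 0 ∷ − 4 ∷ + 6 ∷ + 1 ∷ − 2 ∷ []) ≋ dbl (dbl Λ₃)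
  dbl²-Λ₃ = ≋-trans (≋-sym (η-dbl (+ 0 ∷ − 4 ∷ + 6 ∷ + 1 ∷ − 2 ∷ []))) (dbl-cong dbl-Λ₃)

-- Odd rank congruent to 0 modulo 4

part-0-2-1 : GF (+ 0) 2 1 ≈ qpow (+ 5) *ᴸ g -1ℚ 8 16 -ᴸ qpow (+ 1) *ᴸ ηq ((8 , 8) ∷ (32 , 2) ∷ []) ((4 , 4) ∷ (16 , 5) ∷ [])
  +ᴸ (+ 1 / 2) • (ηq ((2 , 8) ∷ (8 , 2) ∷ []) ((1 , 4) ∷ (4 , 5) ∷ []) +ᴸ ηq ((4 , 3) ∷ []) ((2 , 2) ∷ []))
part-0-2-1 = unshifted (+ 0) 2 1 (Rep-+ (Rep-- (Rep-* (Rep-qpow 5) Rep-g₈)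
    (Rep-* (Rep-qpow 1) (Rep-≋ dbl²-Λ₊ (Rep-η ((8 , 8) ∷ (32 , 2) ∷ []) ((4 , 4) ∷ (16 , 5) ∷ []) ((3 , 8) ∷ (5 , 2) ∷ []) ((2 , 4) ∷ (4 , 5) ∷ []) 0 (quotient₂₂ (3 , 8) (5 , 2) (2 , 4) (4 , 5)) ≡.refl ≡.refl))))
    (Rep-• (+ 1 / 2) (Rep-+ eta-Λ₊ eta-Λ₋)))
  (≋-trans (reindex (+ 0) 2n+1) (≋-trans odd-0 G₀-2-1))

part-0-4-1 : GF (+ 0) 4 1 ≈ ηq ((2 , 4) ∷ (8 , 5) ∷ []) ((1 , 4) ∷ (4 , 2) ∷ (16 , 2) ∷ [])
part-0-4-1 = unshifted (+ 0) 4 1 (Rep-η ((2 , 4) ∷ (8 , 5) ∷ []) ((1 , 4) ∷ (4 , 2) ∷ (16 , 2) ∷ []) ((1 , 4) ∷ (3 , 5) ∷ []) ((0 , 4) ∷ (2 , 2) ∷ (4 , 2) ∷ []) 0 (quotient₂₃ (1 , 4) (3 , 5) (0 , 4) (2 , 2) (4 , 2)) ≡.refl ≡.refl)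
  (≋-trans (reindex (+ 0) 4n+1) (≋-trans (Even-cong odd-0) G₀-4-1))

part-0-4-3 : GF (+ 0) 4 3 ≈ qpow (+ 2) *ᴸ g -1ℚ 4 8 -ᴸ ηq ((4 , 8) ∷ (16 , 2) ∷ []) ((2 , 4) ∷ (8 , 5) ∷ [])
  +ᴸ (+ 2 / 1) • ηq ((4 , 6) ∷ []) ((1 , 2) ∷ (2 , 3) ∷ [])
part-0-4-3 = unshifted (+ 0) 4 3 (Rep-+ (Rep-- (Rep-* (Rep-qpow 2) Rep-g₄) (Rep-≋ dbl-Λ₊ (Rep-η ((4 , 8) ∷ (16 , 2) ∷ []) ((2 , 4) ∷ (8 , 5) ∷ []) ((2 , 8) ∷ (4 , 2) ∷ []) ((1 , 4) ∷ (3 , 5) ∷ []) 0 (quotient₂₂ (2 , 8) (4 , 2) (1 , 4) (3 , 5)) ≡.refl ≡.refl))) (Rep-• (+ 2 / 1) eta-B))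
  (≋-trans (reindex (+ 0) 4n+3) (≋-trans (Odd-cong odd-0) (≋-trans G₀-4-3 (⊞-cong ≋-refl (∙-cong two-# ≋-refl)))))

part-0-8-1 : GF (+ 0) 8 1 ≈ ηq ((2 , 12) ∷ (4 , 1) ∷ []) ((1 , 10) ∷ (8 , 2) ∷ [])
part-0-8-1 = unshifted (+ 0) 8 1 (Rep-η ((2 , 12) ∷ (4 , 1) ∷ []) ((1 , 10) ∷ (8 , 2) ∷ []) ((1 , 12) ∷ (2 , 1) ∷ []) ((0 , 10) ∷ (3 , 2) ∷ []) 0 (quotient₂₂ (1 , 12) (2 , 1) (0 , 10) (3 , 2)) ≡.refl ≡.refl)
  (≋-trans (reindex (+ 0) 8n+1) (≋-trans (Even-cong (Even-cong odd-0)) G₀-8-1))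

part-0-8-3 : GF (+ 0) 8 3 ≈ qpow (+ 1) *ᴸ g -1ℚ 2 4 +ᴸ (+ 2 / 1) • ηq ((2 , 6) ∷ (4 , 5) ∷ []) ((1 , 8) ∷ (8 , 2) ∷ [])
  -ᴸ ηq ((2 , 8) ∷ (8 , 2) ∷ []) ((1 , 4) ∷ (4 , 5) ∷ [])
part-0-8-3 = unshifted (+ 0) 8 3 (Rep-- (Rep-+ (Rep-* (Rep-qpow 1) Rep-g₂) (Rep-• (+ 2 / 1) eta-B₀)) eta-Λ₊)
  (≋-trans (reindex (+ 0) 8n+3) (≋-trans (Even-cong (Odd-cong odd-0)) (≋-trans G₀-8-3 (⊞-cong (⊞-cong ≋-refl (∙-cong two-# ≋-refl)) ≋-refl))))

part-0-8-5 : GF (+ 0) 8 5 ≈ (+ 4 / 1) • ηq ((4 , 9) ∷ []) ((1 , 6) ∷ (8 , 2) ∷ [])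
part-0-8-5 = unshifted (+ 0) 8 5 (Rep-• (+ 4 / 1) (Rep-η ((4 , 9) ∷ []) ((1 , 6) ∷ (8 , 2) ∷ []) ((2 , 9) ∷ []) ((0 , 6) ∷ (3 , 2) ∷ []) 0 (quotient₁₂ (2 , 9) (0 , 6) (3 , 2)) ≡.refl ≡.refl))
  (≋-trans (reindex (+ 0) 8n+5) (≋-trans (Odd-cong (Even-cong odd-0)) G₀-8-5))

part-0-8-7 : GF (+ 0) 8 7 ≈ (+ 4 / 1) • ηq ((2 , 8) ∷ (8 , 2) ∷ []) ((1 , 8) ∷ (4 , 1) ∷ [])
part-0-8-7 = unshifted (+ 0) 8 7 (Rep-• (+ 4 / 1) eta-B₁)
  (≋-trans (reindex (+ 0) 8n+7) (≋-trans (Odd-cong (Odd-cong odd-0)) G₀-8-7))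

-- Odd rank congruent to 1 modulo 4

part-1-2-0 : GF (+ 1) 2 0 ≈ (- (+ 1 / 2)) • qpow (+ 0) +ᴸ (+ 1 / 2) • g -1ℚ 0 4
  +ᴸ (+ 1 / 4) • ηq ((2 , 6) ∷ (4 , 1) ∷ []) ((1 , 4) ∷ (8 , 2) ∷ [])
part-1-2-0 = unshifted (+ 1) 2 0 (Rep-+ (Rep-+ (Rep-• (- (+ 1 / 2)) (Rep-qpow 0)) (Rep-• (+ 1 / 2) (Rep-g-zero 3 0<₃ 𝔽₄))) (Rep-• (+ 1 / 4) eta-Λ₃))
  (≋-trans (reindex (+ 1) 2n+0) (≋-trans even-1 (≋-trans H≋ (≋-trans (⊞-comm _ _) (⊞-cong (≋-sym (mock-part _)) ≋-refl)))))

part-1-4-0 : GF (+ 1) 4 0 ≈ (- (+ 1 / 2)) • qpow (+ 0) +ᴸ (+ 1 / 2) • g -1ℚ 0 2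
  +ᴸ (+ 1 / 4) • ηq ((2 , 15) ∷ []) ((1 , 8) ∷ (4 , 6) ∷ [])
part-1-4-0 = unshifted (+ 1) 4 0 (Rep-+ (Rep-+ (Rep-• (- (+ 1 / 2)) (Rep-qpow 0)) (Rep-• (+ 1 / 2) (Rep-g-zero 1 0<₃ 𝔽₂)))
    (Rep-• (+ 1 / 4) (Rep-η ((2 , 15) ∷ []) ((1 , 8) ∷ (4 , 6) ∷ []) ((1 , 15) ∷ []) ((0 , 8) ∷ (2 , 6) ∷ []) 0 (quotient₁₂ (1 , 15) (0 , 8) (2 , 6)) ≡.refl ≡.refl)))
  (≋-trans (reindex (+ 1) 4n+0) (≋-trans (Even-cong even-1) (≋-trans G₁-4-0 (≋-trans (⊞-comm _ _) (⊞-cong (≋-sym (mock-part _)) ≋-refl)))))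

part-1-4-2 : GF (+ 1) 4 2 ≈ ηq ((2 , 3) ∷ (4 , 2) ∷ []) ((1 , 4) ∷ [])
part-1-4-2 = unshifted (+ 1) 4 2 (Rep-η ((2 , 3) ∷ (4 , 2) ∷ []) ((1 , 4) ∷ []) ((1 , 3) ∷ (2 , 2) ∷ []) ((0 , 4) ∷ []) 1 (quotient₂₁ (1 , 3) (2 , 2) (0 , 4)) ≡.refl ≡.refl)
  (≋-trans (reindex (+ 1) 4n+2) (≋-trans (Odd-cong even-1) G₁-4-2))

part-1-8-0 : GF (+ 1) 8 0 ≈ (- (+ 1 / 2)) • qpow (+ 0) +ᴸ (+ 1 / 2) • g -1ℚ 0 1
  +ᴸ (+ 1 / 4) • ηq ((2 , 22) ∷ []) ((1 , 13) ∷ (4 , 8) ∷ [])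
  +ᴸ (+ 4 / 1) • (qpow (+ 1) *ᴸ ηq ((4 , 8) ∷ []) ((1 , 5) ∷ (2 , 2) ∷ []))
part-1-8-0 = unshifted (+ 1) 8 0 (Rep-+ (Rep-+ (Rep-+ (Rep-• (- (+ 1 / 2)) (Rep-qpow 0)) (Rep-• (+ 1 / 2) (Rep-g-zero 0 0<₃ 𝔽-third)))
    (Rep-• (+ 1 / 4) (Rep-η ((2 , 22) ∷ []) ((1 , 13) ∷ (4 , 8) ∷ []) ((1 , 22) ∷ []) ((0 , 13) ∷ (2 , 8) ∷ []) 0 (quotient₁₂ (1 , 22) (0 , 13) (2 , 8)) ≡.refl ≡.refl)))
    (Rep-• (+ 4 / 1) (Rep-* (Rep-qpow 1) (Rep-η ((4 , 8) ∷ []) ((1 , 5) ∷ (2 , 2) ∷ []) ((2 , 8) ∷ []) ((0 , 5) ∷ (1 , 2) ∷ []) 1 (quotient₁₂ (2 , 8) (0 , 5) (1 , 2)) ≡.refl ≡.refl))))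
  (≋-trans (reindex (+ 1) 8n+0) (≋-trans (Even-cong (Even-cong even-1)) (≋-trans G₁-8-0
    (≋-trans (solve 3 (λ a b x → a :+ b :- x := ⊝ x :+ a :+ b) ≋-refl _ _ _) (⊞-cong (⊞-cong (≋-sym (mock-part _)) ≋-refl) ≋-refl)))))

part-1-8-2 : GF (+ 1) 8 2 ≈ ηq ((2 , 16) ∷ []) ((1 , 11) ∷ (4 , 4) ∷ [])
part-1-8-2 = unshifted (+ 1) 8 2 (Rep-η ((2 , 16) ∷ []) ((1 , 11) ∷ (4 , 4) ∷ []) ((1 , 16) ∷ []) ((0 , 11) ∷ (2 , 4) ∷ []) 0 (quotient₁₂ (1 , 16) (0 , 11) (2 , 4)) ≡.refl ≡.refl)
  (≋-trans (reindex (+ 1) 8n+2) (≋-trans (Even-cong (Odd-cong even-1)) G₁-8-2))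

part-1-8-4 : GF (+ 1) 8 4 ≈ (+ 2 / 1) • ηq ((2 , 10) ∷ []) ((1 , 9) ∷ [])
part-1-8-4 = unshifted (+ 1) 8 4 (Rep-• (+ 2 / 1) (Rep-η ((2 , 10) ∷ []) ((1 , 9) ∷ []) ((1 , 10) ∷ []) ((0 , 9) ∷ []) 2 (quotient₁₁ (1 , 10) (0 , 9)) ≡.refl ≡.refl))
  (≋-trans (reindex (+ 1) 8n+4) (≋-trans (Odd-cong (Even-cong even-1)) G₁-8-4))

part-1-8-6 : GF (+ 1) 8 6 ≈ (+ 4 / 1) • ηq ((2 , 4) ∷ (4 , 4) ∷ []) ((1 , 7) ∷ [])
part-1-8-6 = unshifted (+ 1) 8 6 (Rep-• (+ 4 / 1) (Rep-η ((2 , 4) ∷ (4 , 4) ∷ []) ((1 , 7) ∷ []) ((1 , 4) ∷ (2 , 4) ∷ []) ((0 , 7) ∷ []) 1 (quotient₂₁ (1 , 4) (2 , 4) (0 , 7)) ≡.refl ≡.refl))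
  (≋-trans (reindex (+ 1) 8n+6) (≋-trans (Odd-cong (Odd-cong even-1)) G₁-8-6))

-- Odd rank congruent to 2 modulo 4

part-2-2-1 : GF (+ 2) 2 1 ≈ (- 1ℚ) • qpow -[1+ 0 ] +ᴸ qpow -[1+ 0 ] *ᴸ g -1ℚ 0 16
  +ᴸ (+ 1 / 2) • (qpow -[1+ 0 ] *ᴸ ηq ((8 , 6) ∷ (16 , 1) ∷ []) ((4 , 4) ∷ (32 , 2) ∷ []))
  -ᴸ (+ 1 / 2) • ηq ((4 , 3) ∷ []) ((2 , 2) ∷ [])
  +ᴸ (+ 1 / 2) • ηq ((2 , 8) ∷ (8 , 2) ∷ []) ((1 , 4) ∷ (4 , 5) ∷ [])
part-2-2-1 = polar (+ 2) 2 1 (Rep-+ (Rep-- (Rep-+ (Rep-+ (Rep-• (- 1ℚ) Rep-q⁻¹) (Rep-* Rep-q⁻¹ (Rep-g-zero 15 0<₃ 𝔽₁₆)))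
    (Rep-• (+ 1 / 2) (Rep-* Rep-q⁻¹ (Rep-≋ dbl²-Λ₃ (Rep-η ((8 , 6) ∷ (16 , 1) ∷ []) ((4 , 4) ∷ (32 , 2) ∷ []) ((3 , 6) ∷ (4 , 1) ∷ []) ((2 , 4) ∷ (5 , 2) ∷ []) 0 (quotient₂₂ (3 , 6) (4 , 1) (2 , 4) (5 , 2)) ≡.refl ≡.refl)))))
    (Rep-raise (Rep-• (+ 1 / 2) eta-Λ₋))) (Rep-raise (Rep-• (+ 1 / 2) eta-Λ₊)))
  (≋-trans (∙-cong ≋-refl (≋-trans (reindex (+ 2) 2n+1) odd-2)) (≋-trans G₂-2-1 (≋-trans
    (⊞-cong (solve 4 (λ x h a b → x :* (h :* (a :- b)) := ⊝ (x :* (h :* b)) :+ x :* (h :* a)) ≋-refl (q^ 1) half Λ₊ Λ₋)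
            (≋-trans (∙-cong ≋-refl (≋-trans (dbl-cong (dbl-mixed Λ₃ (dbl (dbl 𝔽)))) (dbl-mixed (dbl Λ₃) (dbl (dbl (dbl 𝔽)))))) (polar-part (dbl (dbl Λ₃)) (dbl (dbl (dbl (dbl 𝔽)))))))
    (solve 3 (λ a b c → a :+ b :+ c := c :+ a :+ b) ≋-refl _ _ _))))

part-2-4-1 : GF (+ 2) 4 1 ≈ (+ 2 / 1) • (qpow (+ 1) *ᴸ ηq ((2 , 4) ∷ (16 , 2) ∷ []) ((1 , 4) ∷ (8 , 1) ∷ []))
part-2-4-1 = unshifted (+ 2) 4 1 (Rep-• (+ 2 / 1) (Rep-* (Rep-qpow 1) (Rep-η ((2 , 4) ∷ (16 , 2) ∷ []) ((1 , 4) ∷ (8 , 1) ∷ []) ((1 , 4) ∷ (4 , 2) ∷ []) ((0 , 4) ∷ (3 , 1) ∷ []) 1 (quotient₂₂ (1 , 4) (4 , 2) (0 , 4) (3 , 1)) ≡.refl ≡.refl)))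
  (≋-trans (reindex (+ 2) 4n+1) (≋-trans (Even-cong odd-2) (≋-trans G₂-4-1 (≋-trans (∙-assoc _ _ _) (∙-cong two-# ≋-refl)))))

part-2-4-3 : GF (+ 2) 4 3 ≈ (- 1ℚ) • qpow -[1+ 0 ] +ᴸ qpow -[1+ 0 ] *ᴸ g -1ℚ 0 8
  +ᴸ (+ 1 / 2) • (qpow -[1+ 0 ] *ᴸ ηq ((4 , 6) ∷ (8 , 1) ∷ []) ((2 , 4) ∷ (16 , 2) ∷ []))
  +ᴸ (+ 2 / 1) • ηq ((4 , 6) ∷ []) ((1 , 2) ∷ (2 , 3) ∷ [])
part-2-4-3 = polar (+ 2) 4 3 (Rep-+ (Rep-+ (Rep-+ (Rep-• (- 1ℚ) Rep-q⁻¹) (Rep-* Rep-q⁻¹ (Rep-g-zero 7 0<₃ 𝔽₈)))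
    (Rep-• (+ 1 / 2) (Rep-* Rep-q⁻¹ (Rep-≋ dbl-Λ₃ (Rep-η ((4 , 6) ∷ (8 , 1) ∷ []) ((2 , 4) ∷ (16 , 2) ∷ []) ((2 , 6) ∷ (3 , 1) ∷ []) ((1 , 4) ∷ (4 , 2) ∷ []) 0 (quotient₂₂ (2 , 6) (3 , 1) (1 , 4) (4 , 2)) ≡.refl ≡.refl)))))
    (Rep-raise (Rep-• (+ 2 / 1) eta-B)))
  (≋-trans (∙-cong ≋-refl (≋-trans (reindex (+ 2) 4n+3) (Odd-cong odd-2))) (≋-trans G₂-4-3 (≋-trans (⊞-comm _ _)
    (⊞-cong (≋-trans (∙-cong ≋-refl (dbl-mixed Λ₃ (dbl (dbl 𝔽)))) (polar-part (dbl Λ₃) (dbl (dbl (dbl 𝔽))))) (∙-cong ≋-refl (∙-cong two-# ≋-refl))))))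

part-2-8-1 : GF (+ 2) 8 1 ≈ (+ 8 / 1) • (qpow (+ 1) *ᴸ ηq ((2 , 2) ∷ (4 , 3) ∷ (8 , 2) ∷ []) ((1 , 6) ∷ []))
part-2-8-1 = unshifted (+ 2) 8 1 (Rep-• (+ 8 / 1) (Rep-* (Rep-qpow 1) (Rep-η ((2 , 2) ∷ (4 , 3) ∷ (8 , 2) ∷ []) ((1 , 6) ∷ []) ((1 , 2) ∷ (2 , 3) ∷ (3 , 2) ∷ []) ((0 , 6) ∷ []) 1 (quotient₃₁ (1 , 2) (2 , 3) (3 , 2) (0 , 6)) ≡.refl ≡.refl)))
  (≋-trans (reindex (+ 2) 8n+1) (≋-trans (Even-cong (Even-cong odd-2)) G₂-8-1))

part-2-8-3 : GF (+ 2) 8 3 ≈ (+ 2 / 1) • ηq ((2 , 6) ∷ (4 , 5) ∷ []) ((1 , 8) ∷ (8 , 2) ∷ [])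
part-2-8-3 = unshifted (+ 2) 8 3 (Rep-• (+ 2 / 1) eta-B₀)
  (≋-trans (reindex (+ 2) 8n+3) (≋-trans (Even-cong (Odd-cong odd-2)) (≋-trans G₂-8-3 (∙-cong two-# ≋-refl))))

part-2-8-5 : GF (+ 2) 8 5 ≈ (+ 2 / 1) • ηq ((2 , 14) ∷ (8 , 2) ∷ []) ((1 , 10) ∷ (4 , 5) ∷ [])
part-2-8-5 = unshifted (+ 2) 8 5 (Rep-• (+ 2 / 1) (Rep-η ((2 , 14) ∷ (8 , 2) ∷ []) ((1 , 10) ∷ (4 , 5) ∷ []) ((1 , 14) ∷ (3 , 2) ∷ []) ((0 , 10) ∷ (2 , 5) ∷ []) 1 (quotient₂₂ (1 , 14) (3 , 2) (0 , 10) (2 , 5)) ≡.refl ≡.refl))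
  (≋-trans (reindex (+ 2) 8n+5) (≋-trans (Odd-cong (Even-cong odd-2)) (≋-trans G₂-8-5 (∙-cong two-# ≋-refl))))

part-2-8-7 : GF (+ 2) 8 7 ≈ (- 1ℚ) • qpow -[1+ 0 ] +ᴸ qpow -[1+ 0 ] *ᴸ g -1ℚ 0 4
  +ᴸ (+ 1 / 2) • (qpow -[1+ 0 ] *ᴸ ηq ((2 , 6) ∷ (4 , 1) ∷ []) ((1 , 4) ∷ (8 , 2) ∷ []))
  +ᴸ (+ 4 / 1) • ηq ((2 , 8) ∷ (8 , 2) ∷ []) ((1 , 8) ∷ (4 , 1) ∷ [])
part-2-8-7 = polar (+ 2) 8 7 (Rep-+ (Rep-+ (Rep-+ (Rep-• (- 1ℚ) Rep-q⁻¹) (Rep-* Rep-q⁻¹ (Rep-g-zero 3 0<₃ 𝔽₄)))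
    (Rep-• (+ 1 / 2) (Rep-* Rep-q⁻¹ eta-Λ₃))) (Rep-raise (Rep-• (+ 4 / 1) eta-B₁)))
  (≋-trans (∙-cong ≋-refl (≋-trans (reindex (+ 2) 8n+7) (Odd-cong (Odd-cong odd-2)))) (≋-trans G₂-8-7 (≋-trans (⊞-comm _ _)
    (⊞-cong (polar-part Λ₃ (dbl (dbl 𝔽))) ≋-refl))))

theorem3p2 : (GF (+ 0) 2 1 ≈ qpow (+ 5) *ᴸ g -1ℚ 8 16 -ᴸ qpow (+ 1) *ᴸ ηq ((8 , 8) ∷ (32 , 2) ∷ []) ((4 , 4) ∷ (16 , 5) ∷ [])
    +ᴸ (+ 1 / 2) • (ηq ((2 , 8) ∷ (8 , 2) ∷ []) ((1 , 4) ∷ (4 , 5) ∷ []) +ᴸ ηq ((4 , 3) ∷ []) ((2 , 2) ∷ [])))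
    × (GF (+ 0) 4 1 ≈ ηq ((2 , 4) ∷ (8 , 5) ∷ []) ((1 , 4) ∷ (4 , 2) ∷ (16 , 2) ∷ []))
    × (GF (+ 0) 4 3 ≈ qpow (+ 2) *ᴸ g -1ℚ 4 8 -ᴸ ηq ((4 , 8) ∷ (16 , 2) ∷ []) ((2 , 4) ∷ (8 , 5) ∷ [])
    +ᴸ (+ 2 / 1) • ηq ((4 , 6) ∷ []) ((1 , 2) ∷ (2 , 3) ∷ []))
    × (GF (+ 0) 8 1 ≈ ηq ((2 , 12) ∷ (4 , 1) ∷ []) ((1 , 10) ∷ (8 , 2) ∷ []))
    × (GF (+ 0) 8 3 ≈ qpow (+ 1) *ᴸ g -1ℚ 2 4 +ᴸ (+ 2 / 1) • ηq ((2 , 6) ∷ (4 , 5) ∷ []) ((1 , 8) ∷ (8 , 2) ∷ [])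
    -ᴸ ηq ((2 , 8) ∷ (8 , 2) ∷ []) ((1 , 4) ∷ (4 , 5) ∷ []))
    × (GF (+ 0) 8 5 ≈ (+ 4 / 1) • ηq ((4 , 9) ∷ []) ((1 , 6) ∷ (8 , 2) ∷ []))
    × (GF (+ 0) 8 7 ≈ (+ 4 / 1) • ηq ((2 , 8) ∷ (8 , 2) ∷ []) ((1 , 8) ∷ (4 , 1) ∷ []))
    × (GF (+ 1) 2 0 ≈ (- (+ 1 / 2)) • qpow (+ 0) +ᴸ (+ 1 / 2) • g -1ℚ 0 4
    +ᴸ (+ 1 / 4) • ηq ((2 , 6) ∷ (4 , 1) ∷ []) ((1 , 4) ∷ (8 , 2) ∷ []))
    × (GF (+ 1) 4 0 ≈ (- (+ 1 / 2)) • qpow (+ 0) +ᴸ (+ 1 / 2) • g -1ℚ 0 2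
    +ᴸ (+ 1 / 4) • ηq ((2 , 15) ∷ []) ((1 , 8) ∷ (4 , 6) ∷ []))
    × (GF (+ 1) 4 2 ≈ ηq ((2 , 3) ∷ (4 , 2) ∷ []) ((1 , 4) ∷ []))
    × (GF (+ 1) 8 0 ≈ (- (+ 1 / 2)) • qpow (+ 0) +ᴸ (+ 1 / 2) • g -1ℚ 0 1
    +ᴸ (+ 1 / 4) • ηq ((2 , 22) ∷ []) ((1 , 13) ∷ (4 , 8) ∷ [])
    +ᴸ (+ 4 / 1) • (qpow (+ 1) *ᴸ ηq ((4 , 8) ∷ []) ((1 , 5) ∷ (2 , 2) ∷ [])))
    × (GF (+ 1) 8 2 ≈ ηq ((2 , 16) ∷ []) ((1 , 11) ∷ (4 , 4) ∷ []))
    × (GF (+ 1) 8 4 ≈ (+ 2 / 1) • ηq ((2 , 10) ∷ []) ((1 , 9) ∷ []))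
    × (GF (+ 1) 8 6 ≈ (+ 4 / 1) • ηq ((2 , 4) ∷ (4 , 4) ∷ []) ((1 , 7) ∷ []))
    × (GF (+ 2) 2 1 ≈ (- 1ℚ) • qpow -[1+ 0 ] +ᴸ qpow -[1+ 0 ] *ᴸ g -1ℚ 0 16
    +ᴸ (+ 1 / 2) • (qpow -[1+ 0 ] *ᴸ ηq ((8 , 6) ∷ (16 , 1) ∷ []) ((4 , 4) ∷ (32 , 2) ∷ []))
    -ᴸ (+ 1 / 2) • ηq ((4 , 3) ∷ []) ((2 , 2) ∷ [])
    +ᴸ (+ 1 / 2) • ηq ((2 , 8) ∷ (8 , 2) ∷ []) ((1 , 4) ∷ (4 , 5) ∷ []))
    × (GF (+ 2) 4 1 ≈ (+ 2 / 1) • (qpow (+ 1) *ᴸ ηq ((2 , 4) ∷ (16 , 2) ∷ []) ((1 , 4) ∷ (8 , 1) ∷ [])))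
    × (GF (+ 2) 4 3 ≈ (- 1ℚ) • qpow -[1+ 0 ] +ᴸ qpow -[1+ 0 ] *ᴸ g -1ℚ 0 8
    +ᴸ (+ 1 / 2) • (qpow -[1+ 0 ] *ᴸ ηq ((4 , 6) ∷ (8 , 1) ∷ []) ((2 , 4) ∷ (16 , 2) ∷ []))
    +ᴸ (+ 2 / 1) • ηq ((4 , 6) ∷ []) ((1 , 2) ∷ (2 , 3) ∷ []))
    × (GF (+ 2) 8 1 ≈ (+ 8 / 1) • (qpow (+ 1) *ᴸ ηq ((2 , 2) ∷ (4 , 3) ∷ (8 , 2) ∷ []) ((1 , 6) ∷ [])))
    × (GF (+ 2) 8 3 ≈ (+ 2 / 1) • ηq ((2 , 6) ∷ (4 , 5) ∷ []) ((1 , 8) ∷ (8 , 2) ∷ []))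
    × (GF (+ 2) 8 5 ≈ (+ 2 / 1) • ηq ((2 , 14) ∷ (8 , 2) ∷ []) ((1 , 10) ∷ (4 , 5) ∷ []))
    × (GF (+ 2) 8 7 ≈ (- 1ℚ) • qpow -[1+ 0 ] +ᴸ qpow -[1+ 0 ] *ᴸ g -1ℚ 0 4
    +ᴸ (+ 1 / 2) • (qpow -[1+ 0 ] *ᴸ ηq ((2 , 6) ∷ (4 , 1) ∷ []) ((1 , 4) ∷ (8 , 2) ∷ []))
    +ᴸ (+ 4 / 1) • ηq ((2 , 8) ∷ (8 , 2) ∷ []) ((1 , 8) ∷ (4 , 1) ∷ []))
theorem3p2 =
    part-0-2-1 , part-0-4-1 , part-0-4-3 , part-0-8-1 , part-0-8-3 , part-0-8-5 , part-0-8-7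
  , part-1-2-0 , part-1-4-0 , part-1-4-2 , part-1-8-0 , part-1-8-2 , part-1-8-4 , part-1-8-6
  , part-2-2-1 , part-2-4-1 , part-2-4-3 , part-2-8-1 , part-2-8-3 , part-2-8-5 , part-2-8-7
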